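{- Let $q$ be a prime power with $q > q_0(\ell) := \dfrac{2^{\frac{1}{\ell-1}}}{2^{\frac{1}{\ell-1}}-1}$, and let $\ell, m$ be integers with $2 \le \ell < m$. Let $V_m$ be an $m$-dimensional vector space over $\mathbb{F}_q$ with ordered basis $\mathcal{B}=\{v_1,\dots,v_m\}$, and let $\alpha=(\alpha_1,\dots,\alpha_\ell)\in I(\ell,m)$ with $\alpha_\ell = m$. Then for every hyperplane $\Pi_\alpha$ of $\mathbb{P}^{k_\alpha-1}$, $$|\Pi_\alpha \cap \Omega_\alpha(\ell,V_m,\mathcal{B})| \le |\Omega_\alpha(\ell,V_m,\mathcal{B})| - q^{\delta(\alpha)}.$$ Moreover, equality holds if and only if $\Pi_\alpha$ is Schubert decomposable.
   Context: $V_i=\mathrm{span}\{v_1,\dots,v_i\}$. $I(\ell,m)=\{(\beta_1,\dots,\beta_\ell)\in\mathbb{Z}^\ell: 1\le\beta_1<\dots<\beta_\ell\le m\}$, partially ordered by $\beta\le\alpha$ iff $\beta_i\le\alpha_i$ for all $i$; $\nabla(\alpha)=\{\beta\in I(\ell,m):\beta\le\alpha\}$, $k_\alpha=|\nabla(\alpha)|$, and $\delta(\alpha)=\alpha_1+\dots+\alpha_\ell-\ell(\ell+1)/2$. The Schubert variety is $\Omega_\alpha(\ell,V_m,\mathcal{B})=\{L\subseteq V_m \text{ subspace}: \dim L=\ell,\ \dim(L\cap V_{\alpha_j})\ge j \text{ for } j=1,\dots,\ell\}$. Via the Plücker embedding, $L$ maps to the point of $\mathbb{P}(\bigwedge^\ell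 V_m)$ with homogeneous coordinates $X_\beta(L)$, $\beta\in I(\ell,m)$, where $X_\beta(L)$ is the $\ell\times\ell$ minor on columns $\beta_1,\dots,\beta_\ell$ of any $\ell\times m$ matrix whose rows are the coordinates (w.r.t. $\mathcal{B}$) of a basis of $L$. $\mathbb{P}^{k_\alpha-1}$ is the linear subspace $\{X_\beta=0 \text{ for all } \beta\notin\nabla(\alpha)\}$, which contains the image of $\Omega_\alpha(\ell,V_m,\mathcal{B})$; a hyperplane of $\mathbb{P}^{k_\alpha-1}$ is the zero set of a nonzero linear form $F_\alpha=\sum_{\beta\in\nabla(\alpha)}c_\beta X_\beta$, and $\Pi_\alpha\cap\Omega_\alpha(\ell,V_m,\mathcal{B})$ denotes the set of $L\in\Omega_\alpha(\ell,V_m,\mathcal{B})$ whose Plücker point lies on $\Pi_\alpha$. Schubert decomposability: for $\beta\in I(\ell,m)$ let $\beta^{\mathsf{c}}=(\beta'_1<\dots<\beta'_{m-\ell})$ be the complement of $\{\beta_1,\dots,\beta_\ell\}$ in $\{1,\dots,m\}$ and $v_{\beta^{\mathsf c}}=v_{\beta'_1}\wedge\dots\wedge v_{\beta'_{m-\ell}}$; a linear form $\sum_{\beta\in I(\ell,m)}c_\beta X_\beta$ is identified with $\sum_\beta c_\beta v_{\beta^{\mathsf c}}\in\bigwedge^{m-\ell}V_m$. A nonzero $z\in\bigwedge^{m-\ell}V_m$ is decomposable if $z=w_1\wedge\dots\wedge w_{m-\ell}$ for some $w_i\in V_m$; put $\mathcal{V}(z)=\{x\in V_m: z\wedge x=0\}$.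 Split $\alpha$ into maximal blocks of consecutive integers: integers $0=p_0<p_1<\dots<p_u<p_{u+1}=\ell$ with $\alpha_{p_i+1}-\alpha_{p_i}\ge2$ for $1\le i\le u$ and $\alpha_{p_i-j}=\alpha_{p_i}-j$ for $1\le i\le u+1$, $1\le j<p_i-p_{i-1}$. An element $z$ is Schubert decomposable with respect to $\Omega_\alpha(\ell,V_m,\mathcal{B})$ if $z$ is decomposable and $\dim(\mathcal{V}(z)\cap V_{\alpha_{p_i}})=\alpha_{p_i}-p_i$ for $i=1,\dots,u$. A hyperplane of $\mathbb{P}^{k_\alpha-1}$ given by $F_\alpha=\sum_{\beta\in\nabla(\alpha)}c_\beta X_\beta$ is Schubert decomposable if there is a linear form $F=\sum_{\beta\in I(\ell,m)}c'_\beta X_\beta$ with $c'_\beta=c_\beta$ for all $\beta\in\nabla(\alpha)$ whose associated element of $\bigwedge^{m-\ell}V_m$ is Schubert decomposable. -}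

module Defs where

open import Level using (0ℓ)
open import Algebra.Core using (Op₁; Op₂)
open import Algebra.Structures using (IsCommutativeRing)
open import Data.Nat as ℕ using (ℕ; zero; suc; _∸_; _^_)
open import Data.Nat.DivMod using (_/_)
open import Data.Nat.Primality using (Prime)
open import Data.Fin using (Fin; zero; suc; toℕ; punchIn)
open import Data.Vec as Vec using (Vec; []; _∷_; lookup)
open import Data.List as List using (List; concatMap; allFin)
open import Data.Product using (Σ; ∃; ∃₂; _×_; _,_)
open import Relation.Binary.PropositionalEquality using (_≡_; _≢_)
open import Relation.Nullary using (¬_)

IsPrimePower : ℕ → Set
IsPrimePower q = ∃₂ λ p k → Prime p × q ≡ p ^ suc k

-- q > q₀(ℓ) = 2^(1/(ℓ-1)) / (2^(1/(ℓ-1)) - 1), rewritten without reals: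
-- for ℓ ≥ 2 and q ≥ 2 it is equivalent to  q^(ℓ-1) < 2 (q-1)^(ℓ-1).
AboveQ₀ : ℕ → ℕ → Set
AboveQ₀ ℓ q = q ^ (ℓ ∸ 1) ℕ.< 2 ℕ.* ((q ∸ 1) ^ (ℓ ∸ 1))

record Field : Set₁ where
  infixl 7 _*_
  infixl 6 _+_
  field
    Carrier : Set
    _+_ _*_ : Op₂ Carrier
    -_      : Op₁ Carrier
    0# 1#   : Carrier
    isCommutativeRing : IsCommutativeRing _≡_ _+_ _*_ -_ 0# 1#
    0≢1     : 0# ≢ 1#
    inverse : ∀ x → x ≢ 0# → ∃ λ y → x * y ≡ 1#

-- Index sequences (0-based: an entry a : Fin m stands for the integer toℕ a + 1)

allVecs : (m r : ℕ) → List (Vec (Fin m) r)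
allVecs m zero    = [] List.∷ List.[]
allVecs m (suc r) = concatMap (λ i → List.map (i ∷_) (allVecs m r)) (allFin m)

Inc : ∀ {m r} → Vec (Fin m) r → Set
Inc {r = r} β = ∀ (i j : Fin r) → toℕ i ℕ.< toℕ j → toℕ (lookup β i) ℕ.< toℕ (lookup β j)

_≼_ : ∀ {m r} → Vec (Fin m) r → Vec (Fin m) r → Set
_≼_ {r = r} β α = ∀ (i : Fin r) → toℕ (lookup β i) ℕ.≤ toℕ (lookup α i)

_∈∇_ : ∀ {m r} → Vec (Fin m) r → Vec (Fin m) r → Set
β ∈∇ α = Inc β × β ≼ α

-- disjoint entries (for increasing β, γ of lengths ℓ, m-ℓ: γ = β^c)
Disjoint : ∀ {m r s} → Vec (Fin m) r → Vec (Fin m) s → Set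
Disjoint {r = r} {s} β γ = ∀ (i : Fin r) (k : Fin s) → lookup β i ≢ lookup γ k

δ : ∀ {m ℓ} → Vec (Fin m) ℓ → ℕ
δ {ℓ = ℓ} α = Vec.sum (Vec.map (λ a → suc (toℕ a)) α) ∸ ((ℓ ℕ.* suc ℓ) / 2)

CountClasses : {A : Set} → (A → Set) → (A → A → Set) → ℕ → Set
CountClasses {A} P _~_ N =
  Σ (Fin N → A) λ reps →
    (∀ i → P (reps i)) ×
    (∀ i j → reps i ~ reps j → i ≡ j) ×
    (∀ x → P x → ∃ λ i → x ~ reps i)

-- Linear algebra over a field K, V_m = K^m with standard basis v₁,…,v_m

module Over (K : Field) where
  open Field K public

  Vector : ℕ → Set
  Vector m = Fin m → Carrier

  Matrix : ℕ → ℕ → Set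
  Matrix r m = Fin r → Fin m → Carrier

  Subset : ℕ → Set₁
  Subset m = Vector m → Set

  sumF : ∀ {n} → (Fin n → Carrier) → Carrier
  sumF {zero}  f = 0#
  sumF {suc n} f = f zero + sumF (λ i → f (suc i))

  sumL : {A : Set} → List A → (A → Carrier) → Carrier
  sumL xs f = List.foldr (λ x s → f x + s) 0# xs

  signed : ℕ → Carrier → Carrier
  signed zero    x = x
  signed (suc k) x = - signed k x

  det : ∀ n → Matrix n n → Carrier
  det zero    M = 1#
  det (suc n) M = sumF λ j → signed (toℕ j) (M zero j * det n (λ i k → M (suc i) (punchIn j k)))

  minor : ∀ {r m} → Matrix r m → Vec (Fin m) r → Carrier
  minor {r} M β = det r (λ i k → M i (lookup β k))

  lincomb : ∀ {n m} → (Fin n → Carrier) → (Fin n → Vector m) → Vector m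
  lincomb c v k = sumF λ i → c i * v i k

  LinIndep : ∀ {n m} → (Fin n → Vector m) → Set
  LinIndep v = ∀ c → (∀ k → lincomb c v k ≡ 0#) → ∀ i → c i ≡ 0#

  HasIndep : ∀ {m} → Subset m → ℕ → Set
  HasIndep {m} S n = Σ (Fin n → Vector m) λ v → (∀ i → S (v i)) × LinIndep v

  Dim : ∀ {m} → Subset m → ℕ → Set
  Dim S d = HasIndep S d × ¬ HasIndep S (suc d)

  InSpan : ∀ {r m} → Matrix r m → Subset m
  InSpan M x = ∃ λ c → ∀ k → lincomb c M k ≡ x k

  InV : ∀ {m} → ℕ → Subset m
  InV i x = ∀ k → i ℕ.≤ toℕ k → x k ≡ 0#

  -- a subspace L of dimension ℓ is represented by a matrix whose rows form a basis;
  -- two matrices represent the same L iff their row spans agree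
  SameSpace : ∀ {ℓ m} → Matrix ℓ m → Matrix ℓ m → Set
  SameSpace M M' = (∀ i → InSpan M (M' i)) × (∀ i → InSpan M' (M i))

  InΩ : ∀ {ℓ m} → Vec (Fin m) ℓ → Matrix ℓ m → Set
  InΩ {ℓ} α M = LinIndep M ×
    (∀ (j : Fin ℓ) → HasIndep (λ x → InSpan M x × InV (suc (toℕ (lookup α j))) x) (suc (toℕ j)))

  -- value of the linear form Σ_β c_β X_β at the Plücker coordinates of M
  formVal : ∀ {ℓ m} → (Vec (Fin m) ℓ → Carrier) → Matrix ℓ m → Carrier
  formVal {ℓ} {m} c M = sumL (allVecs m ℓ) λ β → c β * minor M β

  OnΠ : ∀ {ℓ m} → (Vec (Fin m) ℓ → Carrier) → Matrix ℓ m → Set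
  OnΠ c M = formVal c M ≡ 0#

  appendRow : ∀ {k m} → Matrix k m → Vector m → Matrix (suc k) m
  appendRow {zero}  W x zero    = x
  appendRow {zero}  W x (suc ())
  appendRow {suc k} W x zero    = W zero
  appendRow {suc k} W x (suc i) = appendRow (λ i' → W (suc i')) x i

  -- z = Σ_β c'_β v_{β^c} equals w₁ ∧ … ∧ w_{m-ℓ} (rows of W), in coordinates
  Represents : ∀ {ℓ m} → (Vec (Fin m) ℓ → Carrier) → Matrix (m ∸ ℓ) m → Set
  Represents {ℓ} {m} c' W = ∀ (β : Vec (Fin m) ℓ) (γ : Vec (Fin m) (m ∸ ℓ)) →
    Inc β → Inc γ → Disjoint β γ → c' β ≡ minor W γ

  -- 𝒱(z) for z = w₁ ∧ … ∧ w_k : x with w₁ ∧ … ∧ w_k ∧ x = 0, in coordinates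
  Inᵥ : ∀ {k m} → Matrix k m → Subset m
  Inᵥ {k} {m} W x = ∀ (γ : Vec (Fin m) (suc k)) → Inc γ → minor (appendRow W x) γ ≡ 0#

  SchubertDecomposable : ∀ {ℓ m} → Vec (Fin m) ℓ → (Vec (Fin m) ℓ → Carrier) → Set
  SchubertDecomposable {ℓ} {m} α c' =
    (∃ λ β → Inc β × c' β ≢ 0#) ×
    Σ (Matrix (m ∸ ℓ) m) λ W → Represents c' W ×
      (∀ (j j' : Fin ℓ) → toℕ j' ≡ suc (toℕ j) →
        2 ℕ.+ toℕ (lookup α j) ℕ.≤ toℕ (lookup α j') →
        Dim (λ x → Inᵥ W x × InV (suc (toℕ (lookup α j))) x)
            (suc (toℕ (lookup α j)) ∸ suc (toℕ j)))

  HyperplaneSchubertDecomposable : ∀ {ℓ m} → Vec (Fin m) ℓ → (Vec (Fin m) ℓ → Carrier) → Set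
  HyperplaneSchubertDecomposable {ℓ} {m} α c =
    Σ (Vec (Fin m) ℓ → Carrier) λ c' → (∀ β → β ∈∇ α → c' β ≡ c β) × SchubertDecomposable α c'

{-# OPTIONS --safe #-}
module Submission where

open import Defs
open import Data.Nat using (ℕ; _+_; _*_; _^_; _≤_; _<_; _∸_; _⊓_; suc; zero; z≤n; s≤s)
import Data.Nat as ℕ
open import Data.Nat.DivMod using (_/_; m*n/n≡m)
open import Data.Nat.Properties hiding (eq?) renaming (_≟_ to _≟ⁿ_)
open import Data.Nat.Tactic.RingSolver using () renaming (solve-∀ to ℕ-solve)
open import Data.Fin using (Fin; toℕ; punchIn; punchOut)
import Data.Fin as Fin
import Data.Fin.Properties as Finₚ
open import Data.Vec using (Vec; []; _∷_; lookup; insertAt; removeAt; map; zipWith; replicate; tabulate; _++_)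
import Data.Vec as Vec
import Data.Vec.Properties as Vecₚ
open import Data.List using (List; []; _∷_)
import Data.List as List
open import Data.Maybe using (nothing)
open import Data.Product using (∃; ∃₂; _×_; _,_; proj₁; proj₂)
open import Data.Product.Properties using () renaming (≡-dec to ×-≡-dec)
open import Data.Sum using (_⊎_; inj₁; inj₂)
open import Data.Empty using (⊥)
open import Data.Unit using (⊤; tt)
open import Relation.Binary.PropositionalEquality
  using (_≡_; _≢_; refl; sym; trans; cong; cong₂; subst; subst₂; module ≡-Reasoning)
open import Relation.Binary.Definitions using (DecidableEquality; tri<; tri≈; tri>)
open import Relation.Nullary using (¬_; Dec; yes; no; contradiction)
open import Relation.Nullary.Decidable using (_×-dec_; _→-dec_; ¬?; map′; decidable-stable)
open import Function using (id; _∘_)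
open import Function.Bundles using (_↔_; _⇔_; Inverse; mk⇔; module Equivalence)
open import Algebra.Bundles using (CommutativeRing)
import Algebra.Properties.Group
import Algebra.Properties.Ring
import Tactic.RingSolver.NonReflective
open import Tactic.RingSolver.Core.AlmostCommutativeRing using (fromCommutativeRing)

{-
Let T(F) be the number of ordered bases M of members of Ω_α with F(M) ≠ 0; it is |GL_ℓ| times the
number of points of Ω_α off the hyperplane F = 0. The bound T(F) ≥ |GL_ℓ| q^δ is proved by induction
on m. Let V_a, a = α_t, be the last step of the flag before the final block of α, put s = ℓ - t, and let
H = ker h be a hyperplane containing V_a.

If F vanishes on the members of Ω_α inside H, then F(L) only depends on L ∩ H, and T(F) is an explicit
multiple of T(F(v, ·)|_H) for any v with h(v) = 1. Otherwise compare the bases M with prescribed values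
λ = h(M) to those inside H: for each λ the former are at least as many, and a basis M inside H with
F(M) ≠ 0 is compatible with at least q^s columns λ, so T(F) ≥ q^s T(F|_H). More than q^s columns are
possible when dim (L ∩ V_a) > t. So if T(F) attains the bound and F vanishes inside no such H, all L
with F(L) ≠ 0 satisfy dim (L ∩ V_a) = t, and summing T(F) = q^s T(F|_H) over all H is contradictory.
Hence an extremal F is, step by step, the contraction of a top form by vectors adapted to the flag.

Conversely, if F comes from W = 𝒱(z), the L with F(L) ≠ 0 are complements of W. Such an L is determined
by its vectors in e_{β_r} + (W ∩ V_{α_c}), where α_c ends the block of α_r, which leaves q^δ choices.
-}

-- The comparison over a column λ ≠ 0 rests on row reduction: pivoting on a nonzero entry of λ
-- rewrites the bases with h-values λ as pairs (y, X) with y and X inside H. On such pairs F is an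
-- affine function of y, whose linear part is the corresponding function for bases inside H, and
-- over a finite field an affine function is nonzero at least as often as its linear part. One
-- sequence `e`, the excesses α_j - j, serves all dimensions of the induction. In dimension ℓ + k
-- only the conditions with `e j < k` are imposed, the others being automatic, so passing to a
-- hyperplane lowers k or ℓ and leaves `e` alone; the exponent δ becomes the sum of min(e j, k).
-- That H contains V_a is what makes every imposed condition read the same in H as in the whole
-- space. Dimensions enter only as cardinalities q^d, so that duality, rank and direct sums all
-- become double counts. For the converse, the coefficients of z are prescribed on ∇(α) only. That
-- they determine F on Ω_α is a separate induction along coordinate hyperplanes.

-- Counting by sums of indicators over finite sets

module Sums where
  private variable
    A B : Set
    P Q : Set

  𝟙 : Dec P → ℕ
  𝟙 (yes _) = 1
  𝟙 (no _)  = 0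

  𝟙-yes : (d : Dec P) → P → 𝟙 d ≡ 1
  𝟙-yes (yes _) p = refl
  𝟙-yes (no ¬p) p = contradiction p ¬p

  𝟙-no : (d : Dec P) → ¬ P → 𝟙 d ≡ 0
  𝟙-no (yes p) ¬p = contradiction p ¬p
  𝟙-no (no _)  ¬p = refl

  𝟙-mono : (d : Dec P) (e : Dec Q) → (P → Q) → 𝟙 d ≤ 𝟙 e
  𝟙-mono (yes p) e f = ≤-reflexive (sym (𝟙-yes e (f p)))
  𝟙-mono (no _)  e f = z≤n

  𝟙-cong : (d : Dec P) (e : Dec Q) → (P → Q) → (Q → P) → 𝟙 d ≡ 𝟙 e
  𝟙-cong d e f g = ≤-antisym (𝟙-mono d e f) (𝟙-mono e d g)

  𝟙-× : (d : Dec P) (e : Dec Q) → 𝟙 (d ×-dec e) ≡ 𝟙 d * 𝟙 e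
  𝟙-× (yes p) (yes q) = refl
  𝟙-× (yes p) (no _)  = refl
  𝟙-× (no _)  e       = refl

  𝟙-¬ : (d : Dec P) → 𝟙 d + 𝟙 (¬? d) ≡ 1
  𝟙-¬ (yes _) = refl
  𝟙-¬ (no _)  = refl

  𝟙-pos : (d : Dec P) → 𝟙 d ≢ 0 → P
  𝟙-pos (yes p) _ = p
  𝟙-pos (no _) h = contradiction refl h

  ∑ˡ : List A → (A → ℕ) → ℕ
  ∑ˡ []       f = 0
  ∑ˡ (x ∷ xs) f = f x + ∑ˡ xs f

  ∑ˡ-cong : (xs : List A) {f g : A → ℕ} → (∀ x → f x ≡ g x) → ∑ˡ xs f ≡ ∑ˡ xs g
  ∑ˡ-cong []       h = refl
  ∑ˡ-cong (x ∷ xs) h = cong₂ _+_ (h x) (∑ˡ-cong xs h)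

  ∑ˡ-mono : (xs : List A) {f g : A → ℕ} → (∀ x → f x ≤ g x) → ∑ˡ xs f ≤ ∑ˡ xs g
  ∑ˡ-mono []       h = z≤n
  ∑ˡ-mono (x ∷ xs) h = +-mono-≤ (h x) (∑ˡ-mono xs h)

  ∑ˡ-+ : (xs : List A) (f g : A → ℕ) → ∑ˡ xs (λ x → f x + g x) ≡ ∑ˡ xs f + ∑ˡ xs g
  ∑ˡ-+ []       f g = refl
  ∑ˡ-+ (x ∷ xs) f g rewrite ∑ˡ-+ xs f g = interchange (f x) (g x) (∑ˡ xs f) (∑ˡ xs g)
    where
    interchange : ∀ a b c d → a + b + (c + d) ≡ a + c + (b + d)
    interchange = ℕ-solve

  ∑ˡ-* : (xs : List A) (c : ℕ) (f : A → ℕ) → ∑ˡ xs (λ x → c * f x) ≡ c * ∑ˡ xs f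
  ∑ˡ-* []       c f = sym (*-zeroʳ c)
  ∑ˡ-* (x ∷ xs) c f rewrite ∑ˡ-* xs c f = sym (*-distribˡ-+ c (f x) _)

  ∑ˡ-0 : (xs : List A) → ∑ˡ xs (λ _ → 0) ≡ 0
  ∑ˡ-0 []       = refl
  ∑ˡ-0 (x ∷ xs) = ∑ˡ-0 xs

  ∑ˡ-swap : (xs : List A) (ys : List B) (f : A → B → ℕ) →
            ∑ˡ xs (λ x → ∑ˡ ys (f x)) ≡ ∑ˡ ys (λ y → ∑ˡ xs (λ x → f x y))
  ∑ˡ-swap []       ys f = sym (∑ˡ-0 ys)
  ∑ˡ-swap (x ∷ xs) ys f rewrite ∑ˡ-swap xs ys f = sym (∑ˡ-+ ys (f x) _)

  ∑ˡ-++ : (xs ys : List A) (f : A → ℕ) → ∑ˡ (xs List.++ ys) f ≡ ∑ˡ xs f + ∑ˡ ys f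
  ∑ˡ-++ []       ys f = refl
  ∑ˡ-++ (x ∷ xs) ys f rewrite ∑ˡ-++ xs ys f = sym (+-assoc (f x) _ _)

  ∑ˡ-map : (g : A → B) (xs : List A) (f : B → ℕ) → ∑ˡ (List.map g xs) f ≡ ∑ˡ xs (f ∘ g)
  ∑ˡ-map g []       f = refl
  ∑ˡ-map g (x ∷ xs) f = cong (f (g x) +_) (∑ˡ-map g xs f)

  ∑ˡ-concatMap : (g : A → List B) (xs : List A) (f : B → ℕ) →
                 ∑ˡ (List.concatMap g xs) f ≡ ∑ˡ xs (λ x → ∑ˡ (g x) f)
  ∑ˡ-concatMap g []       f = refl
  ∑ˡ-concatMap g (x ∷ xs) f rewrite sym (∑ˡ-concatMap g xs f) = ∑ˡ-++ (g x) _ f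

  ∑ˡ-pos : (xs : List A) (f : A → ℕ) → ∑ˡ xs f ≢ 0 → ∃ λ x → f x ≢ 0
  ∑ˡ-pos []       f h = contradiction refl h
  ∑ˡ-pos (x ∷ xs) f h with f x in eq
  ... | suc n = x , λ e → contradiction (trans (sym eq) e) λ ()
  ... | zero  = ∑ˡ-pos xs f h

  -- `once` states multiplicity one as a sum of indicators, the shape in which it is substituted
  -- into double counts.
  record Finite (A : Set) : Set where
    field
      elems : List A
      _≟_   : DecidableEquality A
      once  : ∀ a → ∑ˡ elems (λ x → 𝟙 (x ≟ a)) ≡ 1

  module _ (FA : Finite A) where
    open Finite FA

    ∑ : (A → ℕ) → ℕ
    ∑ = ∑ˡ elems

    # : {P : A → Set} → (∀ x → Dec (P x)) → ℕ
    # P? = ∑ (λ x → 𝟙 (P? x))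

    size : ℕ
    size = ∑ (λ _ → 1)

    ∑-cong : {f g : A → ℕ} → (∀ x → f x ≡ g x) → ∑ f ≡ ∑ g
    ∑-cong = ∑ˡ-cong elems

    ∑-mono : {f g : A → ℕ} → (∀ x → f x ≤ g x) → ∑ f ≤ ∑ g
    ∑-mono = ∑ˡ-mono elems

    ∑-+ : (f g : A → ℕ) → ∑ (λ x → f x + g x) ≡ ∑ f + ∑ g
    ∑-+ = ∑ˡ-+ elems

    ∑-*ˡ : (c : ℕ) (f : A → ℕ) → ∑ (λ x → c * f x) ≡ c * ∑ f
    ∑-*ˡ = ∑ˡ-* elems

    ∑-*ʳ : (c : ℕ) (f : A → ℕ) → ∑ (λ x → f x * c) ≡ ∑ f * c
    ∑-*ʳ c f = trans (∑-cong (λ x → *-comm (f x) c)) (trans (∑-*ˡ c f) (*-comm c _))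

    ∑-const : (c : ℕ) → ∑ (λ _ → c) ≡ size * c
    ∑-const c = trans (∑-cong (λ _ → sym (*-identityˡ c))) (∑-*ʳ c (λ _ → 1))

    ∑-0 : ∑ (λ _ → 0) ≡ 0
    ∑-0 = ∑ˡ-0 elems

    ∑-δ : (a : A) (f : A → ℕ) → ∑ (λ x → 𝟙 (x ≟ a) * f x) ≡ f a
    ∑-δ a f = begin
      ∑ (λ x → 𝟙 (x ≟ a) * f x) ≡⟨ ∑-cong (λ x → at x (x ≟ a)) ⟩
      ∑ (λ x → 𝟙 (x ≟ a) * f a) ≡⟨ ∑-*ʳ (f a) _ ⟩
      # (_≟ a) * f a            ≡⟨ cong (_* f a) (once a) ⟩
      1 * f a                   ≡⟨ *-identityˡ (f a) ⟩
      f a                       ∎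
      where
      open ≡-Reasoning
      at : ∀ x (d : Dec (x ≡ a)) → 𝟙 d * f x ≡ 𝟙 d * f a
      at x (yes refl) = refl
      at x (no _)     = refl

    ∑-≥ : (a : A) (f : A → ℕ) → f a ≤ ∑ f
    ∑-≥ a f = begin
      f a                       ≡⟨ sym (∑-δ a f) ⟩
      ∑ (λ x → 𝟙 (x ≟ a) * f x) ≤⟨ ∑-mono (λ x → at x (x ≟ a)) ⟩
      ∑ f                       ∎
      where
      open ≤-Reasoning
      at : ∀ x (d : Dec (x ≡ a)) → 𝟙 d * f x ≤ f x
      at x (yes _) = ≤-reflexive (*-identityˡ (f x))
      at x (no _)  = z≤n

    ∑-strict : {f g : A → ℕ} → (∀ x → f x ≤ g x) → ∀ a → f a < g a → ∑ f < ∑ g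
    ∑-strict {f} {g} h a lt = begin-strict
      ∑ f                                          <⟨ n<1+n _ ⟩
      -- The extra unit is written as the indicator of `a`, the one place where there is room for
      -- it.
      1 + ∑ f                                      ≡⟨ cong (_+ ∑ f) (sym (once a)) ⟩
      # (_≟ a) + ∑ f                               ≡⟨ sym (∑-+ _ f) ⟩
      ∑ (λ x → 𝟙 (x ≟ a) + f x)                    ≤⟨ ∑-mono (λ x → at x (x ≟ a)) ⟩
      ∑ g                                          ∎
      where
      open ≤-Reasoning
      at : ∀ x (d : Dec (x ≡ a)) → 𝟙 d + f x ≤ g x
      at x (yes refl) = lt
      at x (no _)     = h x

    ∑-≡0 : (f : A → ℕ) → ∑ f ≡ 0 → ∀ x → f x ≡ 0
    ∑-≡0 f h x = n≤0⇒n≡0 (≤-trans (∑-≥ x f) (≤-reflexive h))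

    ∑-zero : (f : A → ℕ) → (∀ x → f x ≡ 0) → ∑ f ≡ 0
    ∑-zero f h = trans (∑-cong h) ∑-0

    ∑-pos : (f : A → ℕ) → ∑ f ≢ 0 → ∃ λ x → f x ≢ 0
    ∑-pos = ∑ˡ-pos elems

    module _ {P : A → Set} (P? : ∀ x → Dec (P x)) where

      #-pos : # P? ≢ 0 → ∃ P
      #-pos h = let x , hx = ∑-pos _ h in x , 𝟙-pos (P? x) hx

      #-≢0 : ∀ {x} → P x → # P? ≢ 0
      #-≢0 {x} p e = contradiction (trans (sym (𝟙-yes (P? x) p)) (∑-≡0 _ e x)) λ ()

      ∃? : Dec (∃ P)
      ∃? with # P? in eq
      ... | zero  = no λ (x , p) → #-≢0 p eq
      ... | suc n = yes (#-pos λ e → contradiction (trans (sym eq) e) λ ())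

    ∀? : {P : A → Set} → (∀ x → Dec (P x)) → Dec (∀ x → P x)
    ∀? P? = map′ (λ h x → decidable-stable (P? x) λ ¬p → h (x , ¬p))
                 (λ h (x , ¬p) → ¬p (h x)) (¬? (∃? (λ x → ¬? (P? x))))

    #-cong : {P Q : A → Set} (P? : ∀ x → Dec (P x)) (Q? : ∀ x → Dec (Q x)) →
             (∀ x → P x → Q x) → (∀ x → Q x → P x) → # P? ≡ # Q?
    #-cong P? Q? f g = ∑-cong λ x → 𝟙-cong (P? x) (Q? x) (f x) (g x)

    #-mono : {P Q : A → Set} (P? : ∀ x → Dec (P x)) (Q? : ∀ x → Dec (Q x)) →
             (∀ x → P x → Q x) → # P? ≤ # Q?
    #-mono P? Q? f = ∑-mono λ x → 𝟙-mono (P? x) (Q? x) (f x)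

    #-all : {P : A → Set} (P? : ∀ x → Dec (P x)) → (∀ x → P x) → # P? ≡ size
    #-all P? h = ∑-cong λ x → 𝟙-yes (P? x) (h x)

    #-single : {P : A → Set} (P? : ∀ x → Dec (P x)) (a : A) → P a → (∀ x → P x → x ≡ a) → # P? ≡ 1
    #-single P? a pa h =
      trans (#-cong P? (_≟ a) h (λ { x refl → pa })) (once a)

  ∑-swap : (FA : Finite A) (FB : Finite B) (f : A → B → ℕ) →
           ∑ FA (λ x → ∑ FB (f x)) ≡ ∑ FB (λ y → ∑ FA (λ x → f x y))
  ∑-swap FA FB = ∑ˡ-swap (Finite.elems FA) (Finite.elems FB)

  ∑-bij : (FA : Finite A) (FB : Finite B) (to : A → B) (from : B → A) →
          (∀ b → to (from b) ≡ b) → (∀ a → from (to a) ≡ a) →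
          (f : B → ℕ) → ∑ FA (λ a → f (to a)) ≡ ∑ FB f
  ∑-bij FA FB to from tf ft f = begin
    ∑ FA (λ a → f (to a))
      ≡⟨ ∑-cong FA (λ a → sym (∑-δ FB (to a) f)) ⟩
    ∑ FA (λ a → ∑ FB (λ b → 𝟙 (b ≟ᴮ to a) * f b))
      ≡⟨ ∑-swap FA FB _ ⟩
    ∑ FB (λ b → ∑ FA (λ a → 𝟙 (b ≟ᴮ to a) * f b))
      ≡⟨ ∑-cong FB (λ b → ∑-cong FA (λ a → cong (_* f b)
           (𝟙-cong (b ≟ᴮ to a) (a ≟ᴬ from b) (λ { refl → sym (ft a) }) (λ { refl → sym (tf b) })))) ⟩
    ∑ FB (λ b → ∑ FA (λ a → 𝟙 (a ≟ᴬ from b) * f b))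
      ≡⟨ ∑-cong FB (λ b → ∑-δ FA (from b) (λ _ → f b)) ⟩
    ∑ FB f ∎
    where
    open ≡-Reasoning
    open Finite FA renaming (_≟_ to _≟ᴬ_)
    open Finite FB renaming (_≟_ to _≟ᴮ_)

  #-injection : (FA : Finite A) (FB : Finite B) {P : A → Set} {Q : B → Set} (P? : ∀ a → Dec (P a)) (Q? : ∀ b → Dec (Q b))
                (to : A → B) → (∀ a → P a → Q (to a)) → (∀ a a′ → P a → P a′ → to a ≡ to a′ → a ≡ a′) → # FA P? ≤ # FB Q?
  #-injection FA FB P? Q? to hq inj = begin
    # FA P?
      ≡⟨ ∑-cong FA (λ a → sym (∑-δ FB (to a) (λ _ → 𝟙 (P? a)))) ⟩
    ∑ FA (λ a → ∑ FB (λ b → 𝟙 (b ≟ᴮ to a) * 𝟙 (P? a)))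
      ≡⟨ ∑-swap FA FB _ ⟩
    ∑ FB (λ b → ∑ FA (λ a → 𝟙 (b ≟ᴮ to a) * 𝟙 (P? a)))
      ≤⟨ ∑-mono FB atMostOne ⟩
    # FB Q? ∎
    where
    open ≤-Reasoning
    open Finite FA renaming (_≟_ to _≟ᴬ_)
    open Finite FB renaming (_≟_ to _≟ᴮ_)
    -- The left side is the size of the fibre over `b`: at most one by injectivity, and zero unless
    -- `Q b`.
    atMostOne : ∀ b → ∑ FA (λ a → 𝟙 (b ≟ᴮ to a) * 𝟙 (P? a)) ≤ 𝟙 (Q? b)
    atMostOne b with ∃? FA (λ a → (b ≟ᴮ to a) ×-dec P? a)
    ... | no none = ≤-trans (≤-reflexive (∑-zero FA _ λ a →
      trans (sym (𝟙-× (b ≟ᴮ to a) (P? a))) (𝟙-no ((b ≟ᴮ to a) ×-dec P? a) λ e → none (a , e)))) z≤n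
    ... | yes (a , refl , pa) = begin
      ∑ FA (λ a′ → 𝟙 (to a ≟ᴮ to a′) * 𝟙 (P? a′))   ≡⟨ ∑-cong FA (λ a′ → sym (𝟙-× (to a ≟ᴮ to a′) (P? a′))) ⟩
      # FA (λ a′ → (to a ≟ᴮ to a′) ×-dec P? a′)    ≡⟨ #-single FA _ a (refl , pa) (λ a′ (e , pa′) → inj a′ a pa′ pa (sym e)) ⟩
      1                                            ≡⟨ sym (𝟙-yes (Q? (to a)) (hq a pa)) ⟩
      𝟙 (Q? (to a))                                ∎

  #-surjection : (FA : Finite A) (FB : Finite B) {P : A → Set} {Q : B → Set} (P? : ∀ a → Dec (P a)) (Q? : ∀ b → Dec (Q b))
                 (to : A → B) → (∀ a → P a → Q (to a)) → (∀ a a′ → P a → P a′ → to a ≡ to a′ → a ≡ a′) →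
                 # FB Q? ≤ # FA P? → ∀ b → Q b → ∃ λ a → P a × to a ≡ b
  #-surjection FA FB {P} {Q} P? Q? to hq inj le b qb with ∃? FA (λ a → P? a ×-dec (Finite._≟_ FB (to a) b))
  ... | yes found = found
  -- If `b` were missed, `to` would inject `P` into `Q` without `b`, which is strictly smaller.
  ... | no none = contradiction le (<⇒≱ (begin-strict
    # FA P?
      ≤⟨ #-injection FA FB P? (λ b′ → Q? b′ ×-dec ¬? (b′ ≟ᴮ b)) to (λ a pa → hq a pa , λ e → none (a , pa , e)) inj ⟩
    # FB (λ b′ → Q? b′ ×-dec ¬? (b′ ≟ᴮ b))
      <⟨ ∑-strict FB (λ b′ → 𝟙-mono (Q? b′ ×-dec ¬? (b′ ≟ᴮ b)) (Q? b′) proj₁) b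
           (subst₂ _<_ (sym (𝟙-no (Q? b ×-dec ¬? (b ≟ᴮ b)) (λ (_ , ne) → ne refl))) (sym (𝟙-yes (Q? b) qb)) ≤-refl) ⟩
    # FB Q? ∎))
    where
    open ≤-Reasoning
    open Finite FB renaming (_≟_ to _≟ᴮ_)

  #-image : (FA : Finite A) (FB : Finite B) (to : A → B) → (∀ a a′ → to a ≡ to a′ → a ≡ a′) → {Q : B → Set} (Q? : ∀ b → Dec (Q b)) →
            # FB (λ b → ∃? FA (λ a → Finite._≟_ FB (to a) b) ×-dec Q? b) ≡ # FA (λ a → Q? (to a))
  #-image FA FB to inj Q? = ≤-antisym
    (begin
      # FB (λ b → ∃? FA (λ a → to a ≟ᴮ b) ×-dec Q? b)
        ≤⟨ ∑-mono FB at ⟩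
      ∑ FB (λ b → ∑ FA (λ a → 𝟙 (b ≟ᴮ to a) * 𝟙 (Q? b)))
        ≡⟨ ∑-swap FB FA _ ⟩
      ∑ FA (λ a → ∑ FB (λ b → 𝟙 (b ≟ᴮ to a) * 𝟙 (Q? b)))
        ≡⟨ ∑-cong FA (λ a → ∑-δ FB (to a) (λ b → 𝟙 (Q? b))) ⟩
      # FA (λ a → Q? (to a)) ∎)
    (#-injection FA FB (λ a → Q? (to a)) _ to (λ a qa → (a , refl) , qa) (λ a a′ _ _ → inj a a′))
    where
    open ≤-Reasoning
    open Finite FB renaming (_≟_ to _≟ᴮ_)
    at : ∀ b → 𝟙 (∃? FA (λ a → to a ≟ᴮ b) ×-dec Q? b) ≤ ∑ FA (λ a → 𝟙 (b ≟ᴮ to a) * 𝟙 (Q? b))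
    at b with ∃? FA (λ a → to a ≟ᴮ b) | Q? b
    ... | no _         | _     = z≤n
    ... | yes _        | no _  = z≤n
    ... | yes (a , e)  | yes _ = ≤-trans (≤-reflexive (sym (trans (*-identityʳ _) (𝟙-yes (b ≟ᴮ to a) (sym e)))))
      (∑-≥ FA a (λ a → 𝟙 (b ≟ᴮ to a) * 1))

  finPair : Finite A → Finite B → Finite (A × B)
  finPair {A} {B} FA FB = record { elems = pairs ; _≟_ = ×-≡-dec _≟ᴬ_ _≟ᴮ_ ; once = once-pair }
    where
    open Finite FA renaming (_≟_ to _≟ᴬ_; elems to as; once to onceᴬ)
    open Finite FB renaming (_≟_ to _≟ᴮ_; elems to bs; once to onceᴮ)
    pairs : List (A × B)
    pairs = List.concatMap (λ a → List.map (a ,_) bs) as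
    once-pair : ∀ p → ∑ˡ pairs (λ x → 𝟙 (×-≡-dec _≟ᴬ_ _≟ᴮ_ x p)) ≡ 1
    once-pair (a , b) = trans (trans (∑ˡ-concatMap _ as _) (∑ˡ-cong as (λ x → trans (∑ˡ-map (x ,_) bs _)
      (trans (∑ˡ-cong bs (λ y → trans (𝟙-cong _ ((x ≟ᴬ a) ×-dec (y ≟ᴮ b)) (λ { refl → refl , refl }) (λ { (refl , refl) → refl })) (𝟙-× (x ≟ᴬ a) (y ≟ᴮ b))))
             (trans (∑ˡ-* bs (𝟙 (x ≟ᴬ a)) _) (trans (cong (𝟙 (x ≟ᴬ a) *_) (onceᴮ b)) (*-identityʳ _))))))) (onceᴬ a)

  #-pair : (FA : Finite A) (FB : Finite B) {P : A → Set} {Q : B → Set} (P? : ∀ a → Dec (P a)) (Q? : ∀ b → Dec (Q b)) →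
           # (finPair FA FB) (λ (a , b) → P? a ×-dec Q? b) ≡ # FA P? * # FB Q?
  #-pair FA FB P? Q? = trans (∑ˡ-concatMap _ (Finite.elems FA) _) (trans (∑ˡ-cong (Finite.elems FA) (λ a →
    trans (∑ˡ-map (a ,_) (Finite.elems FB) _) (trans (∑ˡ-cong (Finite.elems FB) (λ b → 𝟙-× (P? a) (Q? b))) (∑ˡ-* (Finite.elems FB) (𝟙 (P? a)) _))))
    (∑-*ʳ FA (# FB Q?) _))

  ∑-vec-list : (FA : List A) (n : ℕ) → List (Vec A n)
  ∑-vec-list FA zero    = [] ∷ []
  ∑-vec-list FA (suc n) = List.concatMap (λ a → List.map (a ∷_) (∑-vec-list FA n)) FA

  ∑ˡ-vec : (xs : List A) (n : ℕ) (f : Vec A (suc n) → ℕ) →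
           ∑ˡ (∑-vec-list xs (suc n)) f ≡ ∑ˡ xs (λ a → ∑ˡ (∑-vec-list xs n) (λ v → f (a ∷ v)))
  ∑ˡ-vec xs n f = trans (∑ˡ-concatMap _ xs f) (∑ˡ-cong xs (λ a → ∑ˡ-map (a ∷_) (∑-vec-list xs n) f))

  finVec : Finite A → ∀ n → Finite (Vec A n)
  finVec FA n = record
    { elems = ∑-vec-list elems n
    ; _≟_   = Vecₚ.≡-dec _≟_
    ; once  = once-vec n }
    where
    open Finite FA
    once-vec : ∀ n (v : Vec _ n) → ∑ˡ (∑-vec-list elems n) (λ w → 𝟙 (Vecₚ.≡-dec _≟_ w v)) ≡ 1
    once-vec zero    [] = refl
    once-vec (suc n) (a ∷ v) = begin
      ∑ˡ (∑-vec-list elems (suc n)) (λ w → 𝟙 (Vecₚ.≡-dec _≟_ w (a ∷ v)))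
        ≡⟨ ∑ˡ-vec elems n _ ⟩
      ∑ˡ elems (λ b → ∑ˡ (∑-vec-list elems n) (λ w → 𝟙 (Vecₚ.≡-dec _≟_ (b ∷ w) (a ∷ v))))
        ≡⟨ ∑ˡ-cong elems (λ b → ∑ˡ-cong (∑-vec-list elems n) λ w → trans
             (𝟙-cong _ ((b ≟ a) ×-dec Vecₚ.≡-dec _≟_ w v) (λ { refl → refl , refl }) (λ { (refl , refl) → refl }))
             (𝟙-× (b ≟ a) _)) ⟩
      ∑ˡ elems (λ b → ∑ˡ (∑-vec-list elems n) (λ w → 𝟙 (b ≟ a) * 𝟙 (Vecₚ.≡-dec _≟_ w v)))
        ≡⟨ ∑ˡ-cong elems (λ b → trans (∑ˡ-* (∑-vec-list elems n) (𝟙 (b ≟ a)) _)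
             (trans (cong (𝟙 (b ≟ a) *_) (once-vec n v)) (*-identityʳ _))) ⟩
      ∑ˡ elems (λ b → 𝟙 (b ≟ a))
        ≡⟨ once a ⟩
      1 ∎
      where open ≡-Reasoning

  ∑-∷ : (FA : Finite A) (n : ℕ) (f : Vec A (suc n) → ℕ) →
        ∑ (finVec FA (suc n)) f ≡ ∑ FA (λ a → ∑ (finVec FA n) (λ v → f (a ∷ v)))
  ∑-∷ FA = ∑ˡ-vec (Finite.elems FA)

  -- Lets the entry at any position be summed out first, since a pivot may sit anywhere.
  ∑-insertAt : (FA : Finite A) (n : ℕ) (i : Fin (suc n)) (f : Vec A (suc n) → ℕ) →
               ∑ (finVec FA (suc n)) f ≡ ∑ FA (λ a → ∑ (finVec FA n) (λ v → f (insertAt v i a)))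
  ∑-insertAt FA n Fin.zero f = ∑-∷ FA n f
  ∑-insertAt FA (suc n) (Fin.suc i) f = begin
    ∑ (finVec FA (suc (suc n))) f
      ≡⟨ ∑-∷ FA (suc n) f ⟩
    ∑ FA (λ b → ∑ (finVec FA (suc n)) (λ v → f (b ∷ v)))
      ≡⟨ ∑-cong FA (λ b → ∑-insertAt FA n i (λ v → f (b ∷ v))) ⟩
    ∑ FA (λ b → ∑ FA (λ a → ∑ (finVec FA n) (λ v → f (b ∷ insertAt v i a))))
      ≡⟨ ∑-swap FA FA _ ⟩
    ∑ FA (λ a → ∑ FA (λ b → ∑ (finVec FA n) (λ v → f (b ∷ insertAt v i a))))
      ≡⟨ ∑-cong FA (λ a → sym (∑-∷ FA n (λ v → f (insertAt v (Fin.suc i) a)))) ⟩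
    ∑ FA (λ a → ∑ (finVec FA (suc n)) (λ v → f (insertAt v (Fin.suc i) a))) ∎
    where open ≡-Reasoning

  size-vec : (FA : Finite A) (n : ℕ) → size (finVec FA n) ≡ size FA ^ n
  size-vec FA zero    = refl
  size-vec FA (suc n) = begin
    size (finVec FA (suc n))           ≡⟨ ∑-∷ FA n _ ⟩
    ∑ FA (λ _ → size (finVec FA n))    ≡⟨ ∑-const FA _ ⟩
    size FA * size (finVec FA n)       ≡⟨ cong (size FA *_) (size-vec FA n) ⟩
    size FA * size FA ^ n              ∎
    where open ≡-Reasoning

  ∑ˡ-allFin-suc : ∀ n (f : Fin (suc n) → ℕ) →
                  ∑ˡ (List.tabulate {n = suc n} id) f ≡ f Fin.zero + ∑ˡ (List.tabulate {n = n} id) (λ i → f (Fin.suc i))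
  ∑ˡ-allFin-suc n f = cong (f Fin.zero +_) (go n id Fin.suc)
    where
    go : ∀ m (g : Fin m → Fin n) (h : Fin n → Fin (suc n)) →
         ∑ˡ (List.tabulate (λ i → h (g i))) f ≡ ∑ˡ (List.tabulate g) (λ i → f (h i))
    go zero    g h = refl
    go (suc m) g h = cong (f (h (g Fin.zero)) +_) (go m (λ i → g (Fin.suc i)) h)

  finFin : ∀ n → Finite (Fin n)
  finFin n = record { elems = List.tabulate id ; _≟_ = Finₚ._≟_ ; once = once-fin n }
    where
    once-fin : ∀ n (a : Fin n) → ∑ˡ (List.tabulate id) (λ x → 𝟙 (x Finₚ.≟ a)) ≡ 1
    once-fin (suc n) Fin.zero = trans (∑ˡ-allFin-suc n (λ x → 𝟙 (x Finₚ.≟ Fin.zero)))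
      (cong suc (trans (∑ˡ-cong (List.tabulate {n = n} id) (λ i → 𝟙-no (Fin.suc i Finₚ.≟ Fin.zero) λ ()))
                       (∑ˡ-0 (List.tabulate {n = n} id))))
    once-fin (suc n) (Fin.suc a) = trans (∑ˡ-allFin-suc n (λ x → 𝟙 (x Finₚ.≟ Fin.suc a)))
      (trans (∑ˡ-cong (List.tabulate {n = n} id) (λ i → 𝟙-cong (Fin.suc i Finₚ.≟ Fin.suc a) (i Finₚ.≟ a) Finₚ.suc-injective (cong Fin.suc)))
             (once-fin n a))

  size-fin : ∀ n → size (finFin n) ≡ n
  size-fin zero    = refl
  size-fin (suc n) = trans (∑ˡ-allFin-suc n (λ _ → 1)) (cong suc (size-fin n))

  fin↔ : Finite A → (to : A → B) (from : B → A) →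
         (∀ b → to (from b) ≡ b) → (∀ a → from (to a) ≡ a) → Finite B
  fin↔ FA to from tf ft = record
    { elems = List.map to elems
    ; _≟_   = eq?
    ; once  = λ b → trans (∑ˡ-map to elems _)
        (trans (∑ˡ-cong elems (λ a → 𝟙-cong (eq? (to a) b) (a ≟ from b)
                 (λ { refl → sym (ft a) }) (λ { refl → tf b })))
               (once (from b))) }
    where
    open Finite FA
    eq? : DecidableEquality _
    eq? x y = map′ (λ e → trans (sym (tf x)) (trans (cong to e) (tf y))) (cong from) (from x ≟ from y)

open Sums

-- Vector spaces, linear maps and alternating forms

module Forms (K : Field) where
  open Field K public
    renaming (_+_ to infixl 6 _+ᶠ_; _*_ to infixl 7 _*ᶠ_; -_ to infix 8 -ᶠ_)
    using (Carrier; 0#; 1#; 0≢1; inverse; isCommutativeRing)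
  open Over K public using (signed)

  commutativeRing : CommutativeRing _ _
  commutativeRing = record { isCommutativeRing = isCommutativeRing }

  module R where
    open CommutativeRing commutativeRing public
    open Algebra.Properties.Group +-group public using (inverseˡ-unique; ⁻¹-involutive; ε⁻¹≈ε)
    open Algebra.Properties.Ring ring public using (-‿distribˡ-*; -‿distribʳ-*; -1*x≈-x)

  module Solver = Tactic.RingSolver.NonReflective (fromCommutativeRing commutativeRing (λ _ → nothing))

  -- Additive inverses are not among the operations: `⊙-zeroˡ` makes `(-ᶠ 1#) ⊙ x` an inverse of
  -- `x`, and every instance has fewer laws to supply.
  record Space (A : Set) : Set where
    infixl 6 _⊕_
    infixr 7 _⊙_
    field
      _⊕_         : A → A → A
      _⊙_         : Carrier → A → A
      𝟘           : A
      ⊕-assoc     : ∀ x y z → (x ⊕ y) ⊕ z ≡ x ⊕ (y ⊕ z)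
      ⊕-comm      : ∀ x y → x ⊕ y ≡ y ⊕ x
      ⊕-identityˡ : ∀ x → 𝟘 ⊕ x ≡ x
      ⊙-distribˡ  : ∀ c x y → c ⊙ (x ⊕ y) ≡ c ⊙ x ⊕ c ⊙ y
      ⊙-distribʳ  : ∀ c d x → (c +ᶠ d) ⊙ x ≡ c ⊙ x ⊕ d ⊙ x
      ⊙-assoc     : ∀ c d x → (c *ᶠ d) ⊙ x ≡ c ⊙ d ⊙ x
      ⊙-identity  : ∀ x → 1# ⊙ x ≡ x
      ⊙-zeroˡ     : ∀ x → 0# ⊙ x ≡ 𝟘
  open Space {{...}} public

  instance
    scalarSpace : Space Carrier
    scalarSpace = record
      { _⊕_ = _+ᶠ_ ; _⊙_ = _*ᶠ_ ; 𝟘 = 0#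
      ; ⊕-assoc = R.+-assoc ; ⊕-comm = R.+-comm ; ⊕-identityˡ = R.+-identityˡ
      ; ⊙-distribˡ = R.distribˡ ; ⊙-distribʳ = λ c d x → R.distribʳ x c d
      ; ⊙-assoc = R.*-assoc ; ⊙-identity = R.*-identityˡ ; ⊙-zeroˡ = R.zeroˡ }

  module _ {A : Set} {{_ : Space A}} where

    ⊕-identityʳ : ∀ (x : A) → x ⊕ 𝟘 ≡ x
    ⊕-identityʳ x = trans (⊕-comm x 𝟘) (⊕-identityˡ x)

    ⊙-zeroʳ : ∀ c → c ⊙ 𝟘 {A} ≡ 𝟘
    ⊙-zeroʳ c = begin
      c ⊙ 𝟘           ≡⟨ cong (c ⊙_) (sym (⊙-zeroˡ 𝟘)) ⟩
      c ⊙ 0# ⊙ 𝟘      ≡⟨ sym (⊙-assoc c 0# 𝟘) ⟩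
      (c *ᶠ 0#) ⊙ 𝟘   ≡⟨ cong (_⊙ 𝟘) (R.zeroʳ c) ⟩
      0# ⊙ 𝟘          ≡⟨ ⊙-zeroˡ 𝟘 ⟩
      𝟘               ∎
      where open ≡-Reasoning

    ⊙-cancel : ∀ c (x : A) → c ⊙ x ⊕ (-ᶠ c) ⊙ x ≡ 𝟘
    ⊙-cancel c x = trans (sym (⊙-distribʳ c (-ᶠ c) x)) (trans (cong (_⊙ x) (R.-‿inverseʳ c)) (⊙-zeroˡ x))

    ⊕-interchange : ∀ (a b c d : A) → (a ⊕ b) ⊕ (c ⊕ d) ≡ (a ⊕ c) ⊕ (b ⊕ d)
    ⊕-interchange a b c d = begin
      (a ⊕ b) ⊕ (c ⊕ d)   ≡⟨ ⊕-assoc a b _ ⟩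
      a ⊕ (b ⊕ (c ⊕ d))   ≡⟨ cong (a ⊕_) (sym (⊕-assoc b c d)) ⟩
      a ⊕ ((b ⊕ c) ⊕ d)   ≡⟨ cong (λ z → a ⊕ (z ⊕ d)) (⊕-comm b c) ⟩
      a ⊕ ((c ⊕ b) ⊕ d)   ≡⟨ cong (a ⊕_) (⊕-assoc c b d) ⟩
      a ⊕ (c ⊕ (b ⊕ d))   ≡⟨ sym (⊕-assoc a c _) ⟩
      (a ⊕ c) ⊕ (b ⊕ d)   ∎
      where open ≡-Reasoning

    infix 8 ⊖_
    ⊖_ : A → A
    ⊖ x = (-ᶠ 1#) ⊙ x

    ⊖-inverse : ∀ (x : A) → x ⊕ ⊖ x ≡ 𝟘
    ⊖-inverse x = trans (cong (_⊕ ⊖ x) (sym (⊙-identity x))) (⊙-cancel 1# x)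

    ⊕-⊖ : ∀ (x y : A) → (x ⊕ y) ⊕ ⊖ y ≡ x
    ⊕-⊖ x y = trans (⊕-assoc x y _) (trans (cong (x ⊕_) (⊖-inverse y)) (⊕-identityʳ x))

    ⊖-⊕ : ∀ (x y : A) → (x ⊕ ⊖ y) ⊕ y ≡ x
    ⊖-⊕ x y = trans (⊕-assoc x _ y) (trans (cong (x ⊕_) (trans (⊕-comm _ y) (⊖-inverse y))) (⊕-identityʳ x))

    ⊕-cancelʳ : ∀ (x y z : A) → x ⊕ z ≡ y ⊕ z → x ≡ y
    ⊕-cancelʳ x y z e = trans (sym (⊕-⊖ x z)) (trans (cong (_⊕ ⊖ z) e) (⊕-⊖ y z))

    ⊖-≡ : ∀ (x y : A) → x ⊕ ⊖ y ≡ 𝟘 → x ≡ y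
    ⊖-≡ x y e = trans (sym (⊖-⊕ x y)) (trans (cong (_⊕ y) e) (⊕-identityˡ y))

    ⊙-inverse : ∀ {c d} (x : A) → c *ᶠ d ≡ 1# → c ⊙ d ⊙ x ≡ x
    ⊙-inverse {c} {d} x e = trans (sym (⊙-assoc c d x)) (trans (cong (_⊙ x) e) (⊙-identity x))

  instance
    vecSpace : ∀ {A n} {{_ : Space A}} → Space (Vec A n)
    vecSpace {n = n} = record
      { _⊕_ = zipWith _⊕_ ; _⊙_ = λ c → map (c ⊙_) ; 𝟘 = replicate n 𝟘
      ; ⊕-assoc = Vecₚ.zipWith-assoc ⊕-assoc ; ⊕-comm = Vecₚ.zipWith-comm ⊕-comm
      ; ⊕-identityˡ = Vecₚ.zipWith-identityˡ ⊕-identityˡ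
      ; ⊙-distribˡ = distribˡ ; ⊙-distribʳ = distribʳ ; ⊙-assoc = assoc
      ; ⊙-identity = λ xs → trans (Vecₚ.map-cong ⊙-identity xs) (Vecₚ.map-id xs) ; ⊙-zeroˡ = zeroˡ }
      where
      distribˡ : ∀ {n} c (xs ys : Vec _ n) → map (c ⊙_) (zipWith _⊕_ xs ys) ≡ zipWith _⊕_ (map (c ⊙_) xs) (map (c ⊙_) ys)
      distribˡ c []       []       = refl
      distribˡ c (x ∷ xs) (y ∷ ys) = cong₂ _∷_ (⊙-distribˡ c x y) (distribˡ c xs ys)
      distribʳ : ∀ {n} c d (xs : Vec _ n) → map ((c +ᶠ d) ⊙_) xs ≡ zipWith _⊕_ (map (c ⊙_) xs) (map (d ⊙_) xs)
      distribʳ c d []       = refl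
      distribʳ c d (x ∷ xs) = cong₂ _∷_ (⊙-distribʳ c d x) (distribʳ c d xs)
      assoc : ∀ {n} c d (xs : Vec _ n) → map ((c *ᶠ d) ⊙_) xs ≡ map (c ⊙_) (map (d ⊙_) xs)
      assoc c d []       = refl
      assoc c d (x ∷ xs) = cong₂ _∷_ (⊙-assoc c d x) (assoc c d xs)
      zeroˡ : ∀ {n} (xs : Vec _ n) → map (0# ⊙_) xs ≡ replicate n 𝟘
      zeroˡ []       = refl
      zeroˡ (x ∷ xs) = cong₂ _∷_ (⊙-zeroˡ x) (zeroˡ xs)

  V : ℕ → Set
  V n = Vec Carrier n

  record Lin {A B : Set} {{_ : Space A}} {{_ : Space B}} (f : A → B) : Set where
    field
      add   : ∀ x y → f (x ⊕ y) ≡ f x ⊕ f y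
      scale : ∀ c x → f (c ⊙ x) ≡ c ⊙ f x
    zero-map : f 𝟘 ≡ 𝟘
    zero-map = trans (cong f (sym (⊙-zeroˡ 𝟘))) (trans (scale 0# 𝟘) (⊙-zeroˡ (f 𝟘)))
    axpy : ∀ x c y → f (x ⊕ c ⊙ y) ≡ f x ⊕ c ⊙ f y
    axpy x c y = trans (add x _) (cong (f x ⊕_) (scale c y))
  open Lin public

  module _ {A B C : Set} {{_ : Space A}} {{_ : Space B}} {{_ : Space C}} where
    lin-∘ : {f : B → C} {g : A → B} → Lin f → Lin g → Lin (λ x → f (g x))
    lin-∘ {f} lf lg = record
      { add   = λ x y → trans (cong f (add lg x y)) (add lf _ _)
      ; scale = λ c x → trans (cong f (scale lg c x)) (scale lf c _) }

  module _ {A B : Set} {{_ : Space A}} {{_ : Space B}} where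
    lin-⊕ : {f g : A → B} → Lin f → Lin g → Lin (λ x → f x ⊕ g x)
    lin-⊕ {f} {g} lf lg = record
      { add   = λ x y → trans (cong₂ _⊕_ (add lf x y) (add lg x y)) (⊕-interchange (f x) (f y) (g x) (g y))
      ; scale = λ c x → trans (cong₂ _⊕_ (scale lf c x) (scale lg c x)) (sym (⊙-distribˡ c (f x) (g x))) }

    lin-⊙ : (c : Carrier) {f : A → B} → Lin f → Lin (λ x → c ⊙ f x)
    lin-⊙ c {f} lf = record
      { add   = λ x y → trans (cong (c ⊙_) (add lf x y)) (⊙-distribˡ c _ _)
      ; scale = λ d x → trans (cong (c ⊙_) (scale lf d x)) (trans (sym (⊙-assoc c d _))
                  (trans (cong (_⊙ f x) (R.*-comm c d)) (⊙-assoc d c _))) }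

    lin-𝟘 : Lin {A} {B} (λ _ → 𝟘)
    lin-𝟘 = record { add = λ _ _ → sym (⊕-identityˡ 𝟘) ; scale = λ c _ → sym (⊙-zeroʳ c) }

    lin-*ʳ : {f : A → Carrier} (b : B) → Lin f → Lin (λ x → f x ⊙ b)
    lin-*ʳ {f} b lf = record
      { add   = λ x y → trans (cong (_⊙ b) (add lf x y)) (⊙-distribʳ (f x) (f y) b)
      ; scale = λ c x → trans (cong (_⊙ b) (scale lf c x)) (⊙-assoc c (f x) b) }

    lin-ext : {f g : A → B} → (∀ x → f x ≡ g x) → Lin g → Lin f
    lin-ext h lg = record
      { add   = λ x y → trans (h _) (trans (add lg x y) (sym (cong₂ _⊕_ (h x) (h y))))
      ; scale = λ c x → trans (h _) (trans (scale lg c x) (sym (cong (c ⊙_) (h x)))) }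

  module _ {A : Set} {{_ : Space A}} where

    infixr 7 _∙_
    -- With scalar entries this is the dot product; with vectors as entries it is the product of a
    -- row vector with a matrix, so that `c ∙ M` runs through the row span of `M`.
    _∙_ : ∀ {n} → Vec Carrier n → Vec A n → A
    []       ∙ []       = 𝟘
    (c ∷ cs) ∙ (x ∷ xs) = c ⊙ x ⊕ cs ∙ xs

    lin-lookup : ∀ {n} (i : Fin n) → Lin (λ (xs : Vec A n) → lookup xs i)
    lin-lookup i = record { add = Vecₚ.lookup-zipWith _⊕_ i ; scale = λ c → Vecₚ.lookup-map i (c ⊙_) }

    lin-∙ˡ : ∀ {n} (M : Vec A n) → Lin (_∙ M)
    lin-∙ˡ M = record { add = ad M ; scale = sc M }
      where
      ad : ∀ {n} (M : Vec A n) c d → (c ⊕ d) ∙ M ≡ c ∙ M ⊕ d ∙ M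
      ad []      []      []      = sym (⊕-identityˡ 𝟘)
      ad (x ∷ M) (c ∷ cs) (d ∷ ds) = trans (cong₂ _⊕_ (⊙-distribʳ c d x) (ad M cs ds)) (⊕-interchange _ _ _ _)
      sc : ∀ {n} (M : Vec A n) s c → (s ⊙ c) ∙ M ≡ s ⊙ c ∙ M
      sc []      s []      = sym (⊙-zeroʳ s)
      sc (x ∷ M) s (c ∷ cs) = trans (cong₂ _⊕_ (⊙-assoc s c x) (sc M s cs)) (sym (⊙-distribˡ s _ _))

    lin-∙ʳ : ∀ {n} (c : Vec Carrier n) → Lin (λ (M : Vec A n) → c ∙ M)
    lin-∙ʳ []      = record { add = λ { [] [] → sym (⊕-identityˡ 𝟘) } ; scale = λ { s [] → sym (⊙-zeroʳ s) } }
    lin-∙ʳ (c ∷ cs) = record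
      { add   = λ { (x ∷ xs) (y ∷ ys) → trans (cong₂ _⊕_ (⊙-distribˡ c x y) (add (lin-∙ʳ cs) xs ys)) (⊕-interchange _ _ _ _) }
      ; scale = λ { s (x ∷ xs) → trans (cong₂ _⊕_ (trans (sym (⊙-assoc c s x)) (trans (cong (_⊙ x) (R.*-comm c s)) (⊙-assoc s c x)))
                                                  (scale (lin-∙ʳ cs) s xs))
                                       (sym (⊙-distribˡ s _ _)) } }

    ∙-insertAt : ∀ {n} (c : Vec Carrier n) (M : Vec A n) i u y → insertAt c i u ∙ insertAt M i y ≡ u ⊙ y ⊕ c ∙ M
    ∙-insertAt c        M       Fin.zero    u y = refl
    ∙-insertAt (c ∷ cs) (x ∷ M) (Fin.suc i) u y = begin
      c ⊙ x ⊕ insertAt cs i u ∙ insertAt M i y ≡⟨ cong (c ⊙ x ⊕_) (∙-insertAt cs M i u y) ⟩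
      c ⊙ x ⊕ (u ⊙ y ⊕ cs ∙ M)                 ≡⟨ sym (⊕-assoc _ _ _) ⟩
      (c ⊙ x ⊕ u ⊙ y) ⊕ cs ∙ M                 ≡⟨ cong (_⊕ cs ∙ M) (⊕-comm _ _) ⟩
      (u ⊙ y ⊕ c ⊙ x) ⊕ cs ∙ M                 ≡⟨ ⊕-assoc _ _ _ ⟩
      u ⊙ y ⊕ (c ⊙ x ⊕ cs ∙ M)                 ∎
      where open ≡-Reasoning

    ∙-zero : ∀ {n} (c : Vec Carrier n) (M : Vec A n) → (∀ i → lookup M i ≡ 𝟘) → c ∙ M ≡ 𝟘
    ∙-zero []       []      h = refl
    ∙-zero (c ∷ cs) (x ∷ M) h = trans (cong₂ _⊕_ (trans (cong (c ⊙_) (h Fin.zero)) (⊙-zeroʳ c)) (∙-zero cs M (λ i → h (Fin.suc i))))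
                                      (⊕-identityˡ 𝟘)

  ∙-map : ∀ {A B : Set} {{_ : Space A}} {{_ : Space B}} {f : A → B} → Lin f →
          ∀ {n} (c : Vec Carrier n) (M : Vec A n) → f (c ∙ M) ≡ c ∙ map f M
  ∙-map lf []       []      = zero-map lf
  ∙-map lf (c ∷ cs) (x ∷ M) = trans (add lf _ _) (cong₂ _⊕_ (scale lf c x) (∙-map lf cs M))

  ∙-comm : ∀ {n} (c d : V n) → c ∙ d ≡ d ∙ c
  ∙-comm []       []       = refl
  ∙-comm (c ∷ cs) (d ∷ ds) = cong₂ _⊕_ (R.*-comm c d) (∙-comm cs ds)

  insertAt-view : ∀ {A : Set} {n} (xs : Vec A (suc n)) (i : Fin (suc n)) →
                  ∃₂ λ ys y → xs ≡ insertAt ys i y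
  insertAt-view xs i = removeAt xs i , lookup xs i , sym (Vecₚ.insertAt-removeAt xs i)

  x*y≡0 : ∀ {x y} → x ≢ 0# → x *ᶠ y ≡ 0# → y ≡ 0#
  x*y≡0 {x} {y} x≢0 e = let x⁻¹ , inv = inverse x x≢0 in begin
    y                ≡⟨ sym (⊙-inverse y (trans (R.*-comm x⁻¹ x) inv)) ⟩
    x⁻¹ *ᶠ (x *ᶠ y)  ≡⟨ cong (x⁻¹ *ᶠ_) e ⟩
    x⁻¹ *ᶠ 0#        ≡⟨ R.zeroʳ x⁻¹ ⟩
    0#               ∎
    where open ≡-Reasoning

  signed-0 : ∀ k → signed k 0# ≡ 0#
  signed-0 zero    = refl
  signed-0 (suc k) = trans (cong -ᶠ_ (signed-0 k)) R.ε⁻¹≈ε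

  signed-neg : ∀ k x → signed k (-ᶠ x) ≡ -ᶠ signed k x
  signed-neg zero    x = refl
  signed-neg (suc k) x = cong -ᶠ_ (signed-neg k x)

  signed-involutive : ∀ k x → signed k (signed k x) ≡ x
  signed-involutive zero    x = refl
  signed-involutive (suc k) x = begin
    -ᶠ signed k (-ᶠ signed k x)   ≡⟨ cong -ᶠ_ (signed-neg k _) ⟩
    -ᶠ (-ᶠ signed k (signed k x)) ≡⟨ R.⁻¹-involutive _ ⟩
    signed k (signed k x)         ≡⟨ signed-involutive k x ⟩
    x                             ∎
    where open ≡-Reasoning

  signed-≡0 : ∀ k {x} → signed k x ≡ 0# → x ≡ 0#
  signed-≡0 k {x} e = trans (sym (signed-involutive k x)) (trans (cong (signed k) e) (signed-0 k))

  -- Alternating multilinear forms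

  module _ {A : Set} {{_ : Space A}} where

    Adj : ∀ ℓ → (Vec A (suc ℓ) → Carrier) → Set
    Adj zero    F = ⊤
    Adj (suc ℓ) F = ∀ x xs → F (x ∷ x ∷ xs) ≡ 0#

    -- Vanishing on equal arguments is asked only for the first two places, but also of every
    -- partial form, which covers all adjacent places; `swap-neg` and `alt-repeat` reach places
    -- further apart. `Adj` is separate because a form in one argument has no second place.
    data Alt : ∀ ℓ → (Vec A ℓ → Carrier) → Set where
      altZ : ∀ {F} → Alt 0 F
      altS : ∀ {ℓ F} → (∀ x → Alt ℓ (λ xs → F (x ∷ xs))) → (∀ xs → Lin (λ x → F (x ∷ xs))) →
             Adj ℓ F → Alt (suc ℓ) F

    alt-tail : ∀ {ℓ F} → Alt (suc ℓ) F → ∀ x → Alt ℓ (λ xs → F (x ∷ xs))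
    alt-tail (altS t _ _) = t

    alt-lin : ∀ {ℓ F} → Alt (suc ℓ) F → ∀ xs → Lin (λ x → F (x ∷ xs))
    alt-lin (altS _ l _) = l

    alt-adj : ∀ {ℓ F} → Alt (suc (suc ℓ)) F → ∀ x xs → F (x ∷ x ∷ xs) ≡ 0#
    alt-adj (altS _ _ a) = a

    alt-ext : ∀ {ℓ F G} → (∀ xs → F xs ≡ G xs) → Alt ℓ G → Alt ℓ F
    alt-ext {zero}  h altZ = altZ
    alt-ext {suc ℓ} h (altS t l a) =
      altS (λ x → alt-ext (λ xs → h (x ∷ xs)) (t x)) (λ xs → lin-ext (λ x → h (x ∷ xs)) (l xs)) (adj ℓ h a)
      where
      adj : ∀ ℓ {F G} → (∀ xs → F xs ≡ G xs) → Adj ℓ G → Adj ℓ F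
      adj zero    h a = tt
      adj (suc ℓ) h a x xs = trans (h _) (a x xs)

    alt-⊕ : ∀ {ℓ F G} → Alt ℓ F → Alt ℓ G → Alt ℓ (λ xs → F xs +ᶠ G xs)
    alt-⊕ altZ altZ = altZ
    alt-⊕ {suc ℓ} (altS t l a) (altS t′ l′ a′) =
      altS (λ x → alt-⊕ (t x) (t′ x)) (λ xs → lin-⊕ (l xs) (l′ xs)) (adj ℓ a a′)
      where
      adj : ∀ ℓ {F G} → Adj ℓ F → Adj ℓ G → Adj ℓ (λ xs → F xs +ᶠ G xs)
      adj zero    a a′ = tt
      adj (suc ℓ) a a′ x xs = trans (cong₂ _+ᶠ_ (a x xs) (a′ x xs)) (R.+-identityˡ 0#)

    alt-⊙ : ∀ c {ℓ F} → Alt ℓ F → Alt ℓ (λ xs → c *ᶠ F xs)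
    alt-⊙ c altZ = altZ
    alt-⊙ c {suc ℓ} (altS t l a) = altS (λ x → alt-⊙ c (t x)) (λ xs → lin-⊙ c (l xs)) (adj ℓ a)
      where
      adj : ∀ ℓ {F} → Adj ℓ F → Adj ℓ (λ xs → c *ᶠ F xs)
      adj zero    a = tt
      adj (suc ℓ) a x xs = trans (cong (c *ᶠ_) (a x xs)) (R.zeroʳ c)

    alt-0 : ∀ ℓ → Alt ℓ (λ _ → 0#)
    alt-0 zero    = altZ
    alt-0 (suc ℓ) = altS (λ _ → alt-0 ℓ) (λ _ → lin-𝟘) (adj ℓ)
      where
      adj : ∀ ℓ → Adj ℓ (λ _ → 0#)
      adj zero    = tt
      adj (suc ℓ) = λ _ _ → refl

    alt-++ : ∀ ℓ {k F} (W : Vec A k) → Alt (ℓ + k) F → Alt ℓ (λ xs → F (xs ++ W))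
    alt-++ zero    W _ = altZ
    alt-++ (suc ℓ) W (altS t l a) = altS (λ x → alt-++ ℓ W (t x)) (λ xs → l (xs ++ W)) (adj ℓ a)
      where
      adj : ∀ ℓ {F} → Adj (ℓ + _) F → Adj ℓ (λ xs → F (xs ++ W))
      adj zero    a = tt
      adj (suc ℓ) a x xs = a x (xs ++ W)

    swap-neg : ∀ {ℓ F} → Alt (suc (suc ℓ)) F → ∀ x y xs → F (x ∷ y ∷ xs) ≡ -ᶠ F (y ∷ x ∷ xs)
    swap-neg {ℓ} {F} af x y xs = R.inverseˡ-unique _ _ (begin
      F (x ∷ y ∷ xs) +ᶠ F (y ∷ x ∷ xs)
        ≡⟨ cong₂ _+ᶠ_ (sym (trans (cong (_+ᶠ F (x ∷ y ∷ xs)) (alt-adj af x xs)) (R.+-identityˡ _)))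
                      (sym (trans (cong (F (y ∷ x ∷ xs) +ᶠ_) (alt-adj af y xs)) (R.+-identityʳ _))) ⟩
      (F (x ∷ x ∷ xs) +ᶠ F (x ∷ y ∷ xs)) +ᶠ (F (y ∷ x ∷ xs) +ᶠ F (y ∷ y ∷ xs))
        ≡⟨ cong₂ _+ᶠ_ (sym (add (alt-lin (alt-tail af x) xs) x y)) (sym (add (alt-lin (alt-tail af y) xs) x y)) ⟩
      F (x ∷ (x ⊕ y) ∷ xs) +ᶠ F (y ∷ (x ⊕ y) ∷ xs)
        ≡⟨ sym (add (alt-lin af _) x y) ⟩
      F ((x ⊕ y) ∷ (x ⊕ y) ∷ xs)
        ≡⟨ alt-adj af (x ⊕ y) xs ⟩
      0# ∎)
      where open ≡-Reasoning

    alt-insertAt : ∀ {ℓ F} → Alt (suc ℓ) F → ∀ xs i v → F (insertAt xs i v) ≡ signed (toℕ i) (F (v ∷ xs))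
    alt-insertAt af xs       Fin.zero    v = refl
    alt-insertAt {F = F} af (x ∷ xs) (Fin.suc i) v = begin
      F (x ∷ insertAt xs i v)              ≡⟨ alt-insertAt (alt-tail af x) xs i v ⟩
      signed (toℕ i) (F (x ∷ v ∷ xs))      ≡⟨ cong (signed (toℕ i)) (swap-neg af x v xs) ⟩
      signed (toℕ i) (-ᶠ F (v ∷ x ∷ xs))   ≡⟨ signed-neg (toℕ i) _ ⟩
      -ᶠ signed (toℕ i) (F (v ∷ x ∷ xs))   ∎
      where open ≡-Reasoning

    alt-repeat : ∀ {ℓ F} → Alt (suc ℓ) F → ∀ xs i → F (lookup xs i ∷ xs) ≡ 0#
    alt-repeat {suc ℓ} {F} af xs i with insertAt-view xs i
    ... | ys , y , refl = begin
      F (lookup (insertAt ys i y) i ∷ insertAt ys i y)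
        ≡⟨ cong (λ z → F (z ∷ insertAt ys i y)) (Vecₚ.insertAt-lookup ys i y) ⟩
      F (y ∷ insertAt ys i y)                ≡⟨ alt-insertAt (alt-tail af y) ys i y ⟩
      signed (toℕ i) (F (y ∷ y ∷ ys))        ≡⟨ cong (signed (toℕ i)) (alt-adj af y ys) ⟩
      signed (toℕ i) 0#                      ≡⟨ signed-0 (toℕ i) ⟩
      0#                                     ∎
      where open ≡-Reasoning

    -- One operation with two uses: clearing a pivot row out of the other rows, and lifting a tuple
    -- off a hyperplane to prescribed values of the functional, `y` being the complementary vector.
    shear : ∀ {n} → A → Vec Carrier n → Vec A n → Vec A n
    shear y = zipWith (λ c x → x ⊕ c ⊙ y)

    -- Every added term repeats `y`, which already occupies a slot of `F`.
    alt-shear : ∀ {ℓ F} → Alt (suc ℓ) F → ∀ y cs xs → F (y ∷ shear y cs xs) ≡ F (y ∷ xs)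
    alt-shear af y [] [] = refl
    alt-shear {suc ℓ} {F} af y (c ∷ cs) (x ∷ xs) = begin
      F (y ∷ (x ⊕ c ⊙ y) ∷ shear y cs xs)
        ≡⟨ axpy (alt-lin (alt-tail af y) _) x c y ⟩
      F (y ∷ x ∷ shear y cs xs) +ᶠ c *ᶠ F (y ∷ y ∷ shear y cs xs)
        ≡⟨ cong₂ _+ᶠ_ (swap-neg af y x _) (trans (cong (c *ᶠ_) (alt-adj af y _)) (R.zeroʳ c)) ⟩
      -ᶠ F (x ∷ y ∷ shear y cs xs) +ᶠ 0#   ≡⟨ R.+-identityʳ _ ⟩
      -ᶠ F (x ∷ y ∷ shear y cs xs)         ≡⟨ cong -ᶠ_ (alt-shear (alt-tail af x) y cs xs) ⟩
      -ᶠ F (x ∷ y ∷ xs)                    ≡⟨ sym (swap-neg af y x xs) ⟩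
      F (y ∷ x ∷ xs)                       ∎
      where open ≡-Reasoning

    lin-vanish : ∀ {φ : A → Carrier} → Lin φ → ∀ {n} (c : V n) (M : Vec A n) →
                 (∀ i → φ (lookup M i) ≡ 0#) → φ (c ∙ M) ≡ 0#
    lin-vanish {φ} lφ c M h = trans (∙-map lφ c M)
      (∙-zero c (map φ M) (λ i → trans (Vecₚ.lookup-map i φ M) (h i)))

    -- An alternating form vanishing at a tuple vanishes on its whole span: expand in the
    -- first slot, and shear the chosen basis vector out of the remaining arguments.
    alt-span : ∀ {ℓ F} → Alt ℓ F → (M : Vec A ℓ) → F M ≡ 0# → (P : Vec (V ℓ) ℓ) → F (map (_∙ M) P) ≡ 0#
    alt-span {zero}  {F} af [] e [] = e
    alt-span {suc ℓ} {F} af M e (p ∷ P) = lin-vanish (alt-lin af _) p M at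
      where
      open ≡-Reasoning
      rows : ∀ {k} (i : Fin (suc ℓ)) M′ y (Q : Vec (V (suc ℓ)) k) →
             map (_∙ insertAt M′ i y) Q ≡ shear y (map (λ q → lookup q i) Q) (map (_∙ M′) (map (λ q → removeAt q i) Q))
      rows i M′ y []      = refl
      rows i M′ y (q ∷ Q) = cong₂ _∷_
        (trans (cong (_∙ insertAt M′ i y) (sym (Vecₚ.insertAt-removeAt q i)))
               (trans (∙-insertAt (removeAt q i) M′ i (lookup q i) y) (⊕-comm _ _)))
        (rows i M′ y Q)
      at : ∀ i → F (lookup M i ∷ map (_∙ M) P) ≡ 0#
      at i with insertAt-view M i
      ... | M′ , y , refl = begin
        F (lookup (insertAt M′ i y) i ∷ map (_∙ insertAt M′ i y) P)
          ≡⟨ cong₂ (λ z Z → F (z ∷ Z)) (Vecₚ.insertAt-lookup M′ i y) (rows i M′ y P) ⟩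
        F (y ∷ shear y (map (λ q → lookup q i) P) (map (_∙ M′) (map (λ q → removeAt q i) P)))
          ≡⟨ alt-shear af y _ _ ⟩
        F (y ∷ map (_∙ M′) (map (λ q → removeAt q i) P))
          ≡⟨ alt-span (alt-tail af y) M′
               (signed-≡0 (toℕ i) (trans (sym (alt-insertAt af M′ i y)) e)) _ ⟩
        0# ∎

    -- If c ∙ M = 0 with c i ≠ 0, replacing the i-th entry of M by c ∙ M multiplies F by ± c i.
    alt-indep : ∀ {ℓ F} → Alt ℓ F → (M : Vec A ℓ) → F M ≢ 0# → ∀ c → c ∙ M ≡ 𝟘 → DecidableEquality Carrier → c ≡ 𝟘
    alt-indep {ℓ} {F} af M nz c e _≟_ = ext c (λ i → at i)
      where
      ext : ∀ {n} (c : V n) → (∀ i → lookup c i ≡ 0#) → c ≡ 𝟘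
      ext []       h = refl
      ext (c ∷ cs) h = cong₂ _∷_ (h Fin.zero) (ext cs (λ i → h (Fin.suc i)))
      insertion : ∀ {ℓ F} → Alt (suc ℓ) F → ∀ M′ (i : Fin (suc ℓ)) y c′ u →
                  insertAt c′ i u ∙ insertAt M′ i y ≡ 𝟘 → F (insertAt M′ i y) ≢ 0# → u ≡ 0#
      insertion {F = F} af M′ i y c′ u e nz with u ≟ 0#
      ... | yes u≡0 = u≡0
      ... | no u≢0 = contradiction (trans (alt-insertAt af M′ i y) (trans (cong (signed (toℕ i)) (x*y≡0 u≢0 (begin
        u *ᶠ F (y ∷ M′)                            ≡⟨ sym (R.+-identityʳ _) ⟩
        u *ᶠ F (y ∷ M′) +ᶠ 0#                      ≡⟨ cong (u *ᶠ F (y ∷ M′) +ᶠ_)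
                                                        (sym (lin-vanish (alt-lin af M′) c′ M′ (alt-repeat af M′))) ⟩
        u *ᶠ F (y ∷ M′) +ᶠ F (c′ ∙ M′ ∷ M′)        ≡⟨ cong (_+ᶠ F (c′ ∙ M′ ∷ M′)) (sym (scale (alt-lin af M′) u y)) ⟩
        F (u ⊙ y ∷ M′) +ᶠ F (c′ ∙ M′ ∷ M′)         ≡⟨ sym (add (alt-lin af M′) _ _) ⟩
        F ((u ⊙ y ⊕ c′ ∙ M′) ∷ M′)                 ≡⟨ cong (λ z → F (z ∷ M′)) (trans (sym (∙-insertAt c′ M′ i u y)) e) ⟩
        F (𝟘 ∷ M′)                                 ≡⟨ zero-map (alt-lin af M′) ⟩
        0#                                         ∎))) (signed-0 (toℕ i)))) nz
        where open ≡-Reasoning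
      at : ∀ i → lookup c i ≡ 0#
      at i = go c M af e nz i
        where
        go : ∀ {ℓ F} (c : V ℓ) (M : Vec A ℓ) → Alt ℓ F → c ∙ M ≡ 𝟘 → F M ≢ 0# → ∀ i → lookup c i ≡ 0#
        go {suc ℓ} c M af e nz i with insertAt-view M i | insertAt-view c i
        ... | M′ , y , refl | c′ , u , refl = trans (Vecₚ.insertAt-lookup c′ i u) (insertion af M′ i y c′ u e nz)

  alt-map : ∀ {A B : Set} {{_ : Space A}} {{_ : Space B}} {g : A → B} → Lin g →
            ∀ {ℓ F} → Alt ℓ F → Alt ℓ (λ xs → F (map g xs))
  alt-map lg altZ = altZ
  alt-map {g = g} lg {suc ℓ} (altS t l a) =
    altS (λ x → alt-map lg (t (g x))) (λ xs → lin-∘ (l (map g xs)) lg) (adj ℓ a)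
    where
    adj : ∀ ℓ {F} → Adj ℓ F → Adj ℓ (λ xs → F (map g xs))
    adj zero    a = tt
    adj (suc ℓ) a x xs = a (g x) (map g xs)

  -- The product of a linear functional h with an alternating form pulled back along ρ,
  -- expanded along the entries h x.
  module _ {A B : Set} {{_ : Space A}} {{_ : Space B}} {h : A → Carrier} {ρ : A → B} (lh : Lin h) (lρ : Lin ρ) where

    wedge : ∀ {n} → (Vec B n → Carrier) → Vec A (suc n) → Carrier
    wedge {zero}  τ (x ∷ [])     = h x *ᶠ τ []
    wedge {suc n} τ (x ∷ y ∷ xs) = h x *ᶠ τ (map ρ (y ∷ xs)) +ᶠ (-ᶠ 1#) *ᶠ wedge (λ zs → τ (ρ x ∷ zs)) (y ∷ xs)

    wedge-cong : ∀ {n} {τ τ′ : Vec B n → Carrier} → (∀ zs → τ zs ≡ τ′ zs) → ∀ xs → wedge τ xs ≡ wedge τ′ xs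
    wedge-cong {zero}  e (x ∷ [])     = cong (h x *ᶠ_) (e [])
    wedge-cong {suc n} e (x ∷ y ∷ xs) = cong₂ _+ᶠ_ (cong (h x *ᶠ_) (e _)) (cong ((-ᶠ 1#) *ᶠ_) (wedge-cong (λ zs → e (ρ x ∷ zs)) (y ∷ xs)))

    wedge-linear : ∀ {n} (τ₁ τ₂ : Vec B n → Carrier) c xs →
                   wedge (λ zs → τ₁ zs +ᶠ c *ᶠ τ₂ zs) xs ≡ wedge τ₁ xs +ᶠ c *ᶠ wedge τ₂ xs
    wedge-linear {zero} τ₁ τ₂ c (x ∷ []) = lem (h x) (τ₁ []) c (τ₂ [])
      where
      open Solver
      lem : ∀ a b c d → a *ᶠ (b +ᶠ c *ᶠ d) ≡ a *ᶠ b +ᶠ c *ᶠ (a *ᶠ d)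
      lem = solve 4 (λ a b c d → (a ⊗ (b Solver.⊕ c ⊗ d)) ⊜ (a ⊗ b Solver.⊕ c ⊗ (a ⊗ d))) refl
    wedge-linear {suc n} τ₁ τ₂ c (x ∷ y ∷ xs) =
      trans (cong (λ w → h x *ᶠ (τ₁ (map ρ (y ∷ xs)) +ᶠ c *ᶠ τ₂ (map ρ (y ∷ xs))) +ᶠ (-ᶠ 1#) *ᶠ w)
                  (wedge-linear (λ zs → τ₁ (ρ x ∷ zs)) (λ zs → τ₂ (ρ x ∷ zs)) c (y ∷ xs)))
            (lem (h x) _ c _ (-ᶠ 1#) _ _)
      where
      open Solver
      lem : ∀ a b c d n u v → a *ᶠ (b +ᶠ c *ᶠ d) +ᶠ n *ᶠ (u +ᶠ c *ᶠ v) ≡ (a *ᶠ b +ᶠ n *ᶠ u) +ᶠ c *ᶠ (a *ᶠ d +ᶠ n *ᶠ v)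
      lem = solve 7 (λ a b c d n u v → (a ⊗ (b Solver.⊕ c ⊗ d) Solver.⊕ n ⊗ (u Solver.⊕ c ⊗ v))
                                     ⊜ ((a ⊗ b Solver.⊕ n ⊗ u) Solver.⊕ c ⊗ (a ⊗ d Solver.⊕ n ⊗ v))) refl

    wedge-0 : ∀ {n} (τ : Vec B n → Carrier) → (∀ zs → τ zs ≡ 0#) → ∀ xs → wedge τ xs ≡ 0#
    wedge-0 {zero}  τ e (x ∷ [])     = trans (cong (h x *ᶠ_) (e [])) (R.zeroʳ _)
    wedge-0 {suc n} τ e (x ∷ y ∷ xs) = trans
      (cong₂ _+ᶠ_ (trans (cong (h x *ᶠ_) (e _)) (R.zeroʳ _))
                  (trans (cong ((-ᶠ 1#) *ᶠ_) (wedge-0 (λ zs → τ (ρ x ∷ zs)) (λ zs → e _) (y ∷ xs))) (R.zeroʳ _))) (R.+-identityˡ 0#)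

    wedge-kernel : ∀ {n} (τ : Vec B n → Carrier) xs → (∀ i → h (lookup xs i) ≡ 0#) → wedge τ xs ≡ 0#
    wedge-kernel {zero}  τ (x ∷ [])     e = trans (cong (_*ᶠ τ []) (e Fin.zero)) (R.zeroˡ _)
    wedge-kernel {suc n} τ (x ∷ y ∷ xs) e = trans
      (cong₂ _+ᶠ_ (trans (cong (_*ᶠ τ (map ρ (y ∷ xs))) (e Fin.zero)) (R.zeroˡ _))
                  (trans (cong ((-ᶠ 1#) *ᶠ_) (wedge-kernel (λ zs → τ (ρ x ∷ zs)) (y ∷ xs) (λ i → e (Fin.suc i)))) (R.zeroʳ _))) (R.+-identityˡ 0#)

    -- Only the term applying `h` to `x` survives. For `x` with `h x` equal to one, contraction by
    -- `x` thus gives `τ` back on the kernel of `h`; this is how the decompositions below are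
    -- verified.
    wedge-head : ∀ {n} (τ : Vec B n → Carrier) x xs → (∀ i → h (lookup xs i) ≡ 0#) →
                 wedge τ (x ∷ xs) ≡ h x *ᶠ τ (map ρ xs)
    wedge-head {zero}  τ x []       e = refl
    wedge-head {suc n} τ x (y ∷ xs) e = trans
      (cong (_ +ᶠ_) (trans (cong ((-ᶠ 1#) *ᶠ_) (wedge-kernel _ (y ∷ xs) e)) (R.zeroʳ _))) (R.+-identityʳ _)

    alt-wedge : ∀ {n τ} → Alt n τ → Alt (suc n) (wedge τ)
    alt-wedge {zero} {τ} altZ = altS (λ _ → altZ) (λ { [] → lin-*ʳ (τ []) lh }) tt
    alt-wedge {suc n} {τ} aτ@(altS t l a) = altS tail linear adjacent
      where
      open ≡-Reasoning
      tail : ∀ x → Alt (suc n) (λ xs → wedge τ (x ∷ xs))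
      tail x = alt-ext (λ { (y ∷ xs) → refl })
        (alt-⊕ (alt-⊙ (h x) (alt-map lρ aτ)) (alt-⊙ (-ᶠ 1#) (alt-wedge (t (ρ x)))))
      linear : ∀ xs → Lin (λ x → wedge τ (x ∷ xs))
      linear (y ∷ xs) =
        (lin-⊕ (lin-*ʳ (τ (map ρ (y ∷ xs))) lh) (lin-⊙ (-ᶠ 1#) record
          { add   = λ x z → begin
              wedge (λ zs → τ (ρ (x ⊕ z) ∷ zs)) (y ∷ xs)
                ≡⟨ wedge-cong (λ zs → trans (cong (λ w → τ (w ∷ zs)) (add lρ x z))
                     (trans (add (l zs) _ _) (cong (τ (ρ x ∷ zs) +ᶠ_) (sym (R.*-identityˡ _))))) (y ∷ xs) ⟩
              wedge (λ zs → τ (ρ x ∷ zs) +ᶠ 1# *ᶠ τ (ρ z ∷ zs)) (y ∷ xs)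
                ≡⟨ wedge-linear _ _ 1# (y ∷ xs) ⟩
              _ +ᶠ 1# *ᶠ wedge (λ zs → τ (ρ z ∷ zs)) (y ∷ xs)
                ≡⟨ cong (_ +ᶠ_) (R.*-identityˡ _) ⟩
              wedge (λ zs → τ (ρ x ∷ zs)) (y ∷ xs) +ᶠ wedge (λ zs → τ (ρ z ∷ zs)) (y ∷ xs) ∎
          ; scale = λ c x → begin
              wedge (λ zs → τ (ρ (c ⊙ x) ∷ zs)) (y ∷ xs)
                ≡⟨ wedge-cong (λ zs → trans (cong (λ w → τ (w ∷ zs)) (scale lρ c x))
                     (trans (scale (l zs) c _) (sym (R.+-identityˡ _)))) (y ∷ xs) ⟩
              wedge (λ zs → 0# +ᶠ c *ᶠ τ (ρ x ∷ zs)) (y ∷ xs)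
                ≡⟨ wedge-linear (λ _ → 0#) _ c (y ∷ xs) ⟩
              wedge (λ _ → 0#) (y ∷ xs) +ᶠ c *ᶠ wedge (λ zs → τ (ρ x ∷ zs)) (y ∷ xs)
                ≡⟨ trans (cong (_+ᶠ c *ᶠ wedge (λ zs → τ (ρ x ∷ zs)) (y ∷ xs)) (wedge-0 _ (λ _ → refl) (y ∷ xs))) (R.+-identityˡ _) ⟩
              c *ᶠ wedge (λ zs → τ (ρ x ∷ zs)) (y ∷ xs) ∎ }))
      -- the two terms in which h is applied to one of the repeated vectors cancel
      adjacent : ∀ x xs → wedge τ (x ∷ x ∷ xs) ≡ 0#
      adjacent x []       = ⊖-inverse _
      adjacent x (y ∷ xs) = begin
        u +ᶠ (-ᶠ 1#) *ᶠ (u +ᶠ (-ᶠ 1#) *ᶠ w)   ≡⟨ cong (λ z → u +ᶠ (-ᶠ 1#) *ᶠ (u +ᶠ (-ᶠ 1#) *ᶠ z)) (wedge-0 _ (a (ρ x)) (y ∷ xs)) ⟩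
        u +ᶠ (-ᶠ 1#) *ᶠ (u +ᶠ (-ᶠ 1#) *ᶠ 0#)  ≡⟨ cong (λ z → u +ᶠ (-ᶠ 1#) *ᶠ z) (trans (cong (u +ᶠ_) (R.zeroʳ _)) (R.+-identityʳ u)) ⟩
        u +ᶠ (-ᶠ 1#) *ᶠ u                    ≡⟨ ⊖-inverse u ⟩
        0#                                   ∎
        where
        u = h x *ᶠ τ (map ρ (x ∷ y ∷ xs))
        w = wedge (λ zs → τ (ρ x ∷ ρ x ∷ zs)) (y ∷ xs)

-- The excess of an increasing sequence

module Profile where

  -- The excess α_j - j (for 1-based j and α_j) as a function of the position, continued by k.
  excess : ∀ {n r} → ℕ → Vec (Fin n) r → ℕ → ℕ → ℕ
  excess k []      o j       = k
  excess k (a ∷ α) o zero    = toℕ a ∸ o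
  excess k (a ∷ α) o (suc j) = excess k α (suc o) j

  excess-lookup : ∀ {n r} k (α : Vec (Fin n) r) o i → excess k α o (toℕ i) ≡ toℕ (lookup α i) ∸ (o + toℕ i)
  excess-lookup k (a ∷ α) o Fin.zero    = cong (toℕ a ∸_) (sym (+-identityʳ o))
  excess-lookup k (a ∷ α) o (Fin.suc i) = trans (excess-lookup k α (suc o) i) (cong (toℕ (lookup α i) ∸_) (sym (+-suc o (toℕ i))))

  excess-≤ : ∀ {n r} k (α : Vec (Fin n) r) o → (∀ i → toℕ (lookup α i) ≤ (o + toℕ i) + k) → ∀ j → excess k α o j ≤ k
  excess-≤ k []      o h j       = ≤-refl
  excess-≤ k (a ∷ α) o h zero    = ≤-trans (∸-monoˡ-≤ o (h Fin.zero)) (≤-reflexive (trans (cong (λ z → z + k ∸ o) (+-identityʳ o)) (m+n∸m≡n o k)))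
  excess-≤ k (a ∷ α) o h (suc j) = excess-≤ k α (suc o) (λ i → subst (λ z → toℕ (lookup α i) ≤ z + k) (+-suc o (toℕ i)) (h (Fin.suc i))) j

  -- Consecutive entries of an increasing sequence differ by at least one, which pays for the growth
  -- of the position. The step from the last entry to the continuation uses the upper bound `k`.
  excess-step : ∀ {n r} k (α : Vec (Fin n) r) o → (∀ i → toℕ (lookup α i) ≤ (o + toℕ i) + k) →
                (∀ i j → toℕ i < toℕ j → toℕ (lookup α i) < toℕ (lookup α j)) → ∀ j → excess k α o j ≤ excess k α o (suc j)
  excess-step k []           o h inc j       = ≤-refl
  excess-step k (a ∷ [])     o h inc zero    = excess-≤ k (a ∷ []) o h zero
  excess-step k (a ∷ b ∷ α)  o h inc zero    = ∸-monoˡ-≤ (suc o) (inc Fin.zero (Fin.suc Fin.zero) (s≤s z≤n))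
  excess-step k (a ∷ α)      o h inc (suc j) = excess-step k α (suc o)
    (λ i → subst (λ z → toℕ (lookup α i) ≤ z + k) (+-suc o (toℕ i)) (h (Fin.suc i))) (λ i j p → inc (Fin.suc i) (Fin.suc j) (s≤s p)) j

  monotone : (f : ℕ → ℕ) → (∀ j → f j ≤ f (suc j)) → ∀ {i j} → i ≤ j → f i ≤ f j
  monotone f step {i} {j} h with ≤⇒≤′ h
  ... | ℕ.≤′-refl = ≤-refl
  ... | ℕ.≤′-step {n} h′ = ≤-trans (monotone f step (≤′⇒≤ h′)) (step n)

  sumTo : ℕ → (ℕ → ℕ) → ℕ
  sumTo zero    f = 0
  sumTo (suc r) f = sumTo r f + f r

  sumTo-front : ∀ r f → sumTo (suc r) f ≡ f 0 + sumTo r (λ j → f (suc j))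
  sumTo-front zero    f = +-comm 0 (f 0)
  sumTo-front (suc r) f = trans (cong (_+ f (suc r)) (sumTo-front r f)) (+-assoc (f 0) _ _)

  sumTo-cong : ∀ r {f g : ℕ → ℕ} → (∀ j → j < r → f j ≡ g j) → sumTo r f ≡ sumTo r g
  sumTo-cong zero    h = refl
  sumTo-cong (suc r) h = cong₂ _+_ (sumTo-cong r (λ j p → h j (m≤n⇒m≤1+n p))) (h r ≤-refl)

  sumTo-+ : ∀ r f g → sumTo r (λ j → f j + g j) ≡ sumTo r f + sumTo r g
  sumTo-+ zero    f g = refl
  sumTo-+ (suc r) f g = trans (cong (_+ (f r + g r)) (sumTo-+ r f g)) (lem (sumTo r f) (sumTo r g) (f r) (g r))
    where
    lem : ∀ a b c d → a + b + (c + d) ≡ a + c + (b + d)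
    lem = ℕ-solve

  sum-excess : ∀ {n r} k (α : Vec (Fin n) r) o → (∀ i → o + toℕ i ≤ toℕ (lookup α i)) →
               Vec.sum (map (λ a → suc (toℕ a)) α) ≡ sumTo r (λ j → excess k α o j + suc (o + j))
  sum-excess k []      o h = refl
  sum-excess {r = suc r} k (a ∷ α) o h = begin
    suc (toℕ a) + Vec.sum (map (λ a → suc (toℕ a)) α)
      ≡⟨ cong₂ _+_ (sym (trans (+-suc (toℕ a ∸ o) (o + 0)) (cong suc (trans (cong (toℕ a ∸ o +_) (+-identityʳ o)) (m∸n+n≡m (≤-trans (≤-reflexive (sym (+-identityʳ o))) (h Fin.zero)))))))
           (sum-excess k α (suc o) (λ i → ≤-trans (≤-reflexive (sym (+-suc o (toℕ i)))) (h (Fin.suc i)))) ⟩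
    (toℕ a ∸ o + suc (o + 0)) + sumTo r (λ j → excess k α (suc o) j + suc (suc o + j))
      ≡⟨ cong ((toℕ a ∸ o + suc (o + 0)) +_) (sumTo-cong r (λ j _ → cong (λ z → excess k α (suc o) j + suc z) (sym (+-suc o j)))) ⟩
    (toℕ a ∸ o + suc (o + 0)) + sumTo r (λ j → excess k (a ∷ α) o (suc j) + suc (o + suc j))
      ≡⟨ sym (sumTo-front r (λ j → excess k (a ∷ α) o j + suc (o + j))) ⟩
    sumTo (suc r) (λ j → excess k (a ∷ α) o j + suc (o + j)) ∎
    where open ≡-Reasoning

  triangle : ∀ r → 2 * sumTo r suc ≡ r * suc r
  triangle zero    = refl
  triangle (suc r) = trans (*-distribˡ-+ 2 (sumTo r suc) (suc r)) (trans (cong (_+ 2 * suc r) (triangle r)) (lem r))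
    where
    lem : ∀ r → r * suc r + 2 * suc r ≡ suc r * suc (suc r)
    lem = ℕ-solve

  half-triangle : ∀ r → (r * suc r) / 2 ≡ sumTo r suc
  half-triangle r = trans (cong (_/ 2) (trans (sym (triangle r)) (*-comm 2 (sumTo r suc)))) (m*n/n≡m (sumTo r suc) 2)

-- Linear algebra by counting over a finite field

module FiniteField (K : Field) (finK : Finite (Field.Carrier K)) where
  open Forms K

  q : ℕ
  q = size finK

  infix 4 _≟_ _≟ᵛ_
  _≟_ : DecidableEquality Carrier
  _≟_ = Finite._≟_ finK

  finV : ∀ n → Finite (V n)
  finV = finVec finK

  _≟ᵛ_ : ∀ {n} → DecidableEquality (V n)
  _≟ᵛ_ {n} = Finite._≟_ (finV n)

  2≤q : 2 ≤ q
  2≤q = begin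
    2                                         ≡⟨ sym (cong₂ _+_ (Finite.once finK 0#) (Finite.once finK 1#)) ⟩
    # finK (_≟ 0#) + # finK (_≟ 1#)           ≡⟨ sym (∑-+ finK _ _) ⟩
    ∑ finK (λ x → 𝟙 (x ≟ 0#) + 𝟙 (x ≟ 1#))    ≤⟨ ∑-mono finK (λ x → at (x ≟ 0#) (x ≟ 1#)) ⟩
    q                                         ∎
    where
    open ≤-Reasoning
    at : ∀ {x} (d : Dec (x ≡ 0#)) (e : Dec (x ≡ 1#)) → 𝟙 d + 𝟙 e ≤ 1
    at (yes refl) (yes e) = contradiction e 0≢1
    at (yes _)    (no _)  = ≤-refl
    at (no _)     (yes _) = ≤-refl
    at (no _)     (no _)  = z≤n

  1≤q^ : ∀ n → 1 ≤ q ^ n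
  1≤q^ zero    = ≤-refl
  1≤q^ (suc n) = *-mono-≤ (≤-trans (n≤1+n 1) 2≤q) (1≤q^ n)

  q^≢0 : ∀ n → q ^ n ≢ 0
  q^≢0 n = >⇒≢ (1≤q^ n)

  private instance
    q-nonZero : ℕ.NonZero q
    q-nonZero = ℕ.>-nonZero (≤-trans (n≤1+n 1) 2≤q)

  q^-nonZero : ∀ n → ℕ.NonZero (q ^ n)
  q^-nonZero n = ℕ.>-nonZero (1≤q^ n)

  q^-mono : ∀ {a b} → a ≤ b → q ^ a ≤ q ^ b
  q^-mono = ^-monoʳ-≤ q

  q^-strict : ∀ {a b} → a < b → q ^ a < q ^ b
  q^-strict = ^-monoʳ-< q 2≤q

  q^-cancel-≤ : ∀ {a b} → q ^ a ≤ q ^ b → a ≤ b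
  q^-cancel-≤ {a} {b} h with a ≤? b
  ... | yes p = p
  ... | no ¬p = contradiction h (<⇒≱ (q^-strict (≰⇒> ¬p)))

  -- Subspaces and their cardinalities

  record Subspace {A : Set} {{_ : Space A}} (S : A → Set) : Set where
    field
      has-0 : S 𝟘
      has-⊕ : ∀ {x y} → S x → S y → S (x ⊕ y)
      has-⊙ : ∀ c {x} → S x → S (c ⊙ x)
  open Subspace public

  module _ {A : Set} {{_ : Space A}} where

    whole : Subspace {A} (λ _ → ⊤)
    whole = record { has-0 = tt ; has-⊕ = λ _ _ → tt ; has-⊙ = λ _ _ → tt }

    sub-× : {S T : A → Set} → Subspace S → Subspace T → Subspace (λ x → S x × T x)
    sub-× s t = record
      { has-0 = has-0 s , has-0 t
      ; has-⊕ = λ (a , b) (c , d) → has-⊕ s a c , has-⊕ t b d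
      ; has-⊙ = λ c (a , b) → has-⊙ s c a , has-⊙ t c b }

    sub-∙ : {S : A → Set} → Subspace S → ∀ {n} (c : V n) (M : Vec A n) → (∀ i → S (lookup M i)) → S (c ∙ M)
    sub-∙ s []      []      h = has-0 s
    sub-∙ s (c ∷ cs) (x ∷ M) h = has-⊕ s (has-⊙ s c (h Fin.zero)) (sub-∙ s cs M (λ i → h (Fin.suc i)))

    module _ (FA : Finite A) {S : A → Set} (S? : ∀ x → Dec (S x)) (sub : Subspace S) where

      #-translate : ∀ {φ : A → Carrier} → Lin φ → ∀ {y} → S y → ∀ {a b} → φ y +ᶠ a ≡ b →
                    # FA (λ x → S? x ×-dec (φ x ≟ a)) ≡ # FA (λ x → S? x ×-dec (φ x ≟ b))
      #-translate {φ} lφ {y} sy {a} {b} e = begin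
        # FA (λ x → S? x ×-dec (φ x ≟ a))
          ≡⟨ #-cong FA _ (λ x → S? (x ⊕ y) ×-dec (φ (x ⊕ y) ≟ b))
               (λ x (sx , p) → has-⊕ sub sx sy , trans (add lφ x y) (trans (R.+-comm _ _) (trans (cong (φ y +ᶠ_) p) e)))
               (λ x (sx , p) → subst S (⊕-⊖ x y) (has-⊕ sub sx (has-⊙ sub _ sy)) ,
                  ⊕-cancelʳ _ _ (φ y) (trans (sym (add lφ x y)) (trans p (trans (sym e) (R.+-comm _ _))))) ⟩
        # FA (λ x → S? (x ⊕ y) ×-dec (φ (x ⊕ y) ≟ b))
          ≡⟨ ∑-bij FA FA (_⊕ y) (_⊕ ⊖ y) (λ x → ⊖-⊕ x y) (λ x → ⊕-⊖ x y) (λ x → 𝟙 (S? x ×-dec (φ x ≟ b))) ⟩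
        # FA (λ x → S? x ×-dec (φ x ≟ b)) ∎
        where open ≡-Reasoning

      -- If `φ` is nonzero at some `y` of `S`, multiples of `y` translate the kernel onto every
      -- other fibre, so all `q` fibres have the same size.
      kernel-dichotomy : ∀ {φ : A → Carrier} → Lin φ →
        (∀ x → S x → φ x ≡ 0#) ⊎ q * # FA (λ x → S? x ×-dec (φ x ≟ 0#)) ≡ # FA S?
      kernel-dichotomy {φ} lφ with ∃? FA (λ x → S? x ×-dec ¬? (φ x ≟ 0#))
      ... | no none = inj₁ at
        where
        at : ∀ x → S x → φ x ≡ 0#
        at x sx with φ x ≟ 0#
        ... | yes e = e
        ... | no ne = contradiction (x , sx , ne) none
      ... | yes (y , sy , ne) = inj₂ (begin
        q * # FA (λ x → S? x ×-dec (φ x ≟ 0#))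
          ≡⟨ sym (∑-const finK _) ⟩
        ∑ finK (λ c → # FA (λ x → S? x ×-dec (φ x ≟ 0#)))
          ≡⟨ ∑-cong finK (λ c → #-translate lφ (has-⊙ sub (c *ᶠ y⁻¹) sy) (hits c)) ⟩
        ∑ finK (λ c → # FA (λ x → S? x ×-dec (φ x ≟ c)))
          ≡⟨ ∑-swap finK FA _ ⟩
        ∑ FA (λ x → ∑ finK (λ c → 𝟙 (S? x ×-dec (φ x ≟ c))))
          ≡⟨ ∑-cong FA (λ x → trans (∑-cong finK (λ c → trans (𝟙-× (S? x) (φ x ≟ c)) (*-comm (𝟙 (S? x)) _)))
               (trans (∑-cong finK (λ c → cong (_* 𝟙 (S? x)) (𝟙-cong (φ x ≟ c) (c ≟ φ x) sym sym)))
                      (∑-δ finK (φ x) (λ _ → 𝟙 (S? x))))) ⟩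
        # FA S? ∎)
        where
        open ≡-Reasoning
        y⁻¹ = proj₁ (inverse (φ y) ne)
        hits : ∀ c → φ ((c *ᶠ y⁻¹) ⊙ y) +ᶠ 0# ≡ c
        hits c = begin
          φ ((c *ᶠ y⁻¹) ⊙ y) +ᶠ 0#   ≡⟨ R.+-identityʳ _ ⟩
          φ ((c *ᶠ y⁻¹) ⊙ y)         ≡⟨ scale lφ _ y ⟩
          (c *ᶠ y⁻¹) *ᶠ φ y          ≡⟨ R.*-assoc c y⁻¹ (φ y) ⟩
          c *ᶠ (y⁻¹ *ᶠ φ y)          ≡⟨ cong (c *ᶠ_) (trans (R.*-comm _ _) (proj₂ (inverse (φ y) ne))) ⟩
          c *ᶠ 1#                    ≡⟨ R.*-identityʳ c ⟩
          c                          ∎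

      #-drop : ∀ {φ : A → Carrier} → Lin φ → # FA S? ≤ q * # FA (λ x → S? x ×-dec (φ x ≟ 0#))
      #-drop {φ} lφ with kernel-dichotomy lφ
      ... | inj₂ e = ≤-reflexive (sym e)
      ... | inj₁ h = begin
        # FA S?                                  ≤⟨ #-mono FA S? _ (λ x sx → sx , h x sx) ⟩
        # FA (λ x → S? x ×-dec (φ x ≟ 0#))       ≤⟨ m≤n*m _ q ⟩
        q * # FA (λ x → S? x ×-dec (φ x ≟ 0#))   ∎
        where open ≤-Reasoning

      -- Both cases of the dichotomy in one equation without subtraction. It is linear in the
      -- indicator of "φ vanishes on S" and can therefore be summed over a family of functionals.
      kernel-count : ∀ {φ : A → Carrier} → Lin φ → (d : Dec (∀ x → S x → φ x ≡ 0#)) →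
        q * # FA (λ x → S? x ×-dec (φ x ≟ 0#)) + # FA S? * 𝟙 d ≡ # FA S? + q * (# FA S? * 𝟙 d)
      kernel-count {φ} lφ (yes h) = trans
        (cong (λ z → q * z + # FA S? * 1) (#-cong FA _ S? (λ x → proj₁) (λ x sx → sx , h x sx)))
        (lem q (# FA S?))
        where
        lem : ∀ a b → a * b + b * 1 ≡ b + a * (b * 1)
        lem = ℕ-solve
      kernel-count {φ} lφ (no ¬h) with kernel-dichotomy lφ
      ... | inj₁ h = contradiction h ¬h
      ... | inj₂ e = cong₂ _+_ e (trans (*-zeroʳ (# FA S?)) (sym (trans (cong (q *_) (*-zeroʳ (# FA S?))) (*-zeroʳ q))))

    #-≢0-shift : (FA : Finite A) {f : A → Carrier} → Lin f → ∀ k →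
                 # FA (λ x → ¬? (f x ≟ 0#)) ≤ # FA (λ x → ¬? ((f x +ᶠ k) ≟ 0#))
    #-≢0-shift FA {f} lf k with ∃? FA (λ y → (f y +ᶠ k) ≟ 0#)
    ... | no none = begin
      # FA (λ x → ¬? (f x ≟ 0#))            ≤⟨ #-mono FA _ _ (λ x _ e → none (x , e)) ⟩
      # FA (λ x → ¬? ((f x +ᶠ k) ≟ 0#))     ∎
      where open ≤-Reasoning
    -- A zero `y` of `f + k` exhibits `f + k` as a translate of `f`, so the counts agree; without a
    -- zero every point is counted on the right.
    ... | yes (y , e) = ≤-reflexive (begin
      # FA (λ x → ¬? (f x ≟ 0#))
        ≡⟨ ∑-cong FA (λ x → 𝟙-cong (¬? (f x ≟ 0#)) (¬? ((f (x ⊕ y) +ᶠ k) ≟ 0#))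
             (λ ne z → ne (trans (sym (shift x)) z)) (λ ne z → ne (trans (shift x) z))) ⟩
      ∑ FA (λ x → 𝟙 (¬? ((f (x ⊕ y) +ᶠ k) ≟ 0#)))
        ≡⟨ ∑-bij FA FA (_⊕ y) (_⊕ ⊖ y) (λ x → ⊖-⊕ x y) (λ x → ⊕-⊖ x y) (λ x → 𝟙 (¬? ((f x +ᶠ k) ≟ 0#))) ⟩
      # FA (λ x → ¬? ((f x +ᶠ k) ≟ 0#)) ∎)
      where
      open ≡-Reasoning
      shift : ∀ x → f (x ⊕ y) +ᶠ k ≡ f x
      shift x = begin
        f (x ⊕ y) +ᶠ k       ≡⟨ cong (_+ᶠ k) (add lf x y) ⟩
        (f x +ᶠ f y) +ᶠ k    ≡⟨ R.+-assoc _ _ _ ⟩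
        f x +ᶠ (f y +ᶠ k)    ≡⟨ cong (f x +ᶠ_) e ⟩
        f x +ᶠ 0#            ≡⟨ R.+-identityʳ _ ⟩
        f x                  ∎

  -- Counting the zeros of B on S × T by rows and by columns.
  bilinear-count : {A B : Set} {{_ : Space A}} {{_ : Space B}} (FA : Finite A) (FB : Finite B)
    {S : A → Set} {T : B → Set} (S? : ∀ x → Dec (S x)) (T? : ∀ y → Dec (T y)) → Subspace S → Subspace T →
    (β : A → B → Carrier) → (∀ x → Lin (β x)) → (∀ y → Lin (λ x → β x y)) →
    # FA (λ x → S? x ×-dec ∀? FB (λ y → T? y →-dec (β x y ≟ 0#))) * # FB T? ≡
    # FB (λ y → T? y ×-dec ∀? FA (λ x → S? x →-dec (β x y ≟ 0#))) * # FA S?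
  bilinear-count FA FB {S} {T} S? T? sub-S sub-T β lβ lβ′ =
    cancel {q} 2≤q (# FA rad-S) (# FB T?) (# FB rad-T) (# FA S?) (side FA FB S? T? sub-T β lβ)
      (trans (cong (λ z → q * z + # FA S? * # FB rad-T) zeros) (side FB FA T? S? sub-S (λ y x → β x y) lβ′))
    where
    rad-S : ∀ x → Dec (S x × (∀ y → T y → β x y ≡ 0#))
    rad-S x = S? x ×-dec ∀? FB (λ y → T? y →-dec (β x y ≟ 0#))
    rad-T : ∀ y → Dec (T y × (∀ x → S x → β x y ≡ 0#))
    rad-T y = T? y ×-dec ∀? FA (λ x → S? x →-dec (β x y ≟ 0#))
    side : {A B : Set} {{_ : Space A}} {{_ : Space B}} (FA : Finite A) (FB : Finite B)
      {S : A → Set} {T : B → Set} (S? : ∀ x → Dec (S x)) (T? : ∀ y → Dec (T y)) → Subspace T →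
      (β : A → B → Carrier) → (∀ x → Lin (β x)) →
      q * ∑ FA (λ x → 𝟙 (S? x) * # FB (λ y → T? y ×-dec (β x y ≟ 0#)))
        + # FB T? * # FA (λ x → S? x ×-dec ∀? FB (λ y → T? y →-dec (β x y ≟ 0#)))
      ≡ # FA S? * # FB T? + q * (# FB T? * # FA (λ x → S? x ×-dec ∀? FB (λ y → T? y →-dec (β x y ≟ 0#))))
    side FA FB S? T? sub-T β lβ = begin
      q * ∑ FA (λ x → s x * z x) + N * # FA (λ x → S? x ×-dec D x)
        ≡⟨ cong (λ w → q * ∑ FA (λ x → s x * z x) + N * w) (∑-cong FA (λ x → 𝟙-× (S? x) (D x))) ⟩
      q * ∑ FA (λ x → s x * z x) + N * ∑ FA (λ x → s x * 𝟙 (D x))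
        ≡⟨ sym (cong₂ _+_ (∑-*ˡ FA q _) (∑-*ˡ FA N _)) ⟩
      ∑ FA (λ x → q * (s x * z x)) + ∑ FA (λ x → N * (s x * 𝟙 (D x)))
        ≡⟨ sym (∑-+ FA _ _) ⟩
      ∑ FA (λ x → q * (s x * z x) + N * (s x * 𝟙 (D x)))
        ≡⟨ ∑-cong FA (λ x → trans (lem₁ q (s x) (z x) N (𝟙 (D x)))
             (trans (cong (s x *_) (kernel-count FB T? sub-T (lβ x) (D x))) (lem₂ q (s x) N (𝟙 (D x))))) ⟩
      ∑ FA (λ x → s x * N + q * (N * (s x * 𝟙 (D x))))
        ≡⟨ ∑-+ FA _ _ ⟩
      ∑ FA (λ x → s x * N) + ∑ FA (λ x → q * (N * (s x * 𝟙 (D x))))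
        ≡⟨ cong₂ _+_ (∑-*ʳ FA N s) (trans (∑-*ˡ FA q _) (cong (q *_) (∑-*ˡ FA N _))) ⟩
      # FA S? * N + q * (N * ∑ FA (λ x → s x * 𝟙 (D x)))
        ≡⟨ cong (λ w → # FA S? * N + q * (N * w)) (∑-cong FA (λ x → sym (𝟙-× (S? x) (D x)))) ⟩
      # FA S? * N + q * (N * # FA (λ x → S? x ×-dec D x)) ∎
      where
      open ≡-Reasoning
      N = # FB T?
      s : _ → ℕ
      s x = 𝟙 (S? x)
      z : _ → ℕ
      z x = # FB (λ y → T? y ×-dec (β x y ≟ 0#))
      D : ∀ x → Dec (∀ y → _ → β x y ≡ 0#)
      D x = ∀? FB (λ y → T? y →-dec (β x y ≟ 0#))
      lem₁ : ∀ q s z N d → q * (s * z) + N * (s * d) ≡ s * (q * z + N * d)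
      lem₁ = ℕ-solve
      lem₂ : ∀ q s N d → s * (N + q * (N * d)) ≡ s * N + q * (N * (s * d))
      lem₂ = ℕ-solve
    zeros : ∑ FA (λ x → 𝟙 (S? x) * # FB (λ y → T? y ×-dec (β x y ≟ 0#))) ≡
            ∑ FB (λ y → 𝟙 (T? y) * # FA (λ x → S? x ×-dec (β x y ≟ 0#)))
    zeros = begin
      ∑ FA (λ x → 𝟙 (S? x) * # FB (λ y → T? y ×-dec (β x y ≟ 0#)))
        ≡⟨ ∑-cong FA (λ x → sym (∑-*ˡ FB (𝟙 (S? x)) _)) ⟩
      ∑ FA (λ x → ∑ FB (λ y → 𝟙 (S? x) * 𝟙 (T? y ×-dec (β x y ≟ 0#))))
        ≡⟨ ∑-swap FA FB _ ⟩
      ∑ FB (λ y → ∑ FA (λ x → 𝟙 (S? x) * 𝟙 (T? y ×-dec (β x y ≟ 0#))))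
        ≡⟨ ∑-cong FB (λ y → ∑-cong FA (λ x → trans (cong (𝟙 (S? x) *_) (𝟙-× (T? y) (β x y ≟ 0#)))
             (trans (lem (𝟙 (S? x)) (𝟙 (T? y)) _) (cong (𝟙 (T? y) *_) (sym (𝟙-× (S? x) (β x y ≟ 0#))))))) ⟩
      ∑ FB (λ y → ∑ FA (λ x → 𝟙 (T? y) * 𝟙 (S? x ×-dec (β x y ≟ 0#))))
        ≡⟨ ∑-cong FB (λ y → ∑-*ˡ FA (𝟙 (T? y)) _) ⟩
      ∑ FB (λ y → 𝟙 (T? y) * # FA (λ x → S? x ×-dec (β x y ≟ 0#))) ∎
      where
      open ≡-Reasoning
      lem : ∀ a b c → a * (b * c) ≡ b * (a * c)
      lem = ℕ-solve
    -- Both counts contain the same number `E` of zeros. Eliminating `q * E` leaves q - 1 times the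
    -- claim, and q - 1 is positive.
    cancel : ∀ {q} → 2 ≤ q → ∀ A N A′ N′ {E} → q * E + N * A ≡ N′ * N + q * (N * A) →
             q * E + N′ * A′ ≡ N * N′ + q * (N′ * A′) → A * N ≡ A′ * N′
    cancel {suc zero} (s≤s ())
    cancel {suc (suc p)} _ A N A′ N′ {E} e₁ e₂ = *-cancelˡ-≡ (A * N) (A′ * N′) (suc p) (+-cancelˡ-≡ (X + Y + Q * E + N * N′) _ _ (begin
      X + Y + Q * E + N * N′ + suc p * (A * N)
        ≡⟨ lem₁ p A N A′ N′ E ⟩
      (Q * E + N′ * A′) + (N′ * N + Q * (N * A))
        ≡⟨ cong₂ _+_ e₂ (sym e₁) ⟩
      (N * N′ + Q * (N′ * A′)) + (Q * E + N * A)
        ≡⟨ lem₂ p A N A′ N′ E ⟩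
      X + Y + Q * E + N * N′ + suc p * (A′ * N′) ∎))
      where
      open ≡-Reasoning
      X = N * A
      Y = N′ * A′
      Q = suc (suc p)
      lem₁ : ∀ p A N A′ N′ E → N * A + N′ * A′ + (2 + p) * E + N * N′ + (1 + p) * (A * N) ≡
             ((2 + p) * E + N′ * A′) + (N′ * N + (2 + p) * (N * A))
      lem₁ = ℕ-solve
      lem₂ : ∀ p A N A′ N′ E → (N * N′ + (2 + p) * (N′ * A′)) + ((2 + p) * E + N * A) ≡
             N * A + N′ * A′ + (2 + p) * E + N * N′ + (1 + p) * (A′ * N′)
      lem₂ = ℕ-solve

  -- Induction on the number of coordinates: the vectors of `S` with first coordinate zero form a
  -- subspace one dimension lower, of index 1 or q by `kernel-dichotomy`.
  card-power : ∀ {n} {S : V n → Set} (S? : ∀ x → Dec (S x)) → Subspace S → ∃ λ d → # (finV n) S? ≡ q ^ d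
  card-power {zero} S? sub = 0 , cong (_+ 0) (𝟙-yes (S? []) (has-0 sub))
  card-power {suc n} {S} S? sub with card-power {n} (λ v → S? (0# ∷ v)) record
    { has-0 = has-0 sub
    ; has-⊕ = λ {x} {y} a b → subst (λ z → S (z ∷ (x ⊕ y))) (R.+-identityˡ 0#) (has-⊕ sub a b)
    ; has-⊙ = λ c {x} a → subst (λ z → S (z ∷ (c ⊙ x))) (R.zeroʳ c) (has-⊙ sub c a) }
    | kernel-dichotomy (finV (suc n)) S? sub {λ x → lookup x Fin.zero} (lin-lookup Fin.zero)
  ... | d , e | r = finish r
    where
    open ≡-Reasoning
    kernel : # (finV (suc n)) (λ x → S? x ×-dec (lookup x Fin.zero ≟ 0#)) ≡ q ^ d
    kernel = begin
      # (finV (suc n)) (λ x → S? x ×-dec (lookup x Fin.zero ≟ 0#))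
        ≡⟨ ∑-∷ finK n _ ⟩
      ∑ finK (λ a → ∑ (finV n) (λ v → 𝟙 (S? (a ∷ v) ×-dec (a ≟ 0#))))
        ≡⟨ ∑-cong finK (λ a → trans (∑-cong (finV n) (λ v → trans (𝟙-× (S? (a ∷ v)) (a ≟ 0#)) (*-comm _ (𝟙 (a ≟ 0#)))))
             (∑-*ˡ (finV n) (𝟙 (a ≟ 0#)) _)) ⟩
      ∑ finK (λ a → 𝟙 (a ≟ 0#) * # (finV n) (λ v → S? (a ∷ v)))
        ≡⟨ ∑-δ finK 0# _ ⟩
      # (finV n) (λ v → S? (0# ∷ v))
        ≡⟨ e ⟩
      q ^ d ∎
    finish : _ ⊎ _ → ∃ λ d → # (finV (suc n)) S? ≡ q ^ d
    finish (inj₁ h) = d , trans (#-cong (finV (suc n)) S? (λ x → S? x ×-dec (lookup x Fin.zero ≟ 0#)) (λ x s → s , h x s) (λ x → proj₁)) kernel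
    finish (inj₂ h) = suc d , trans (sym h) (cong (q *_) kernel)

  nondegenerate : ∀ {n} (v : V n) → (∀ c → c ∙ v ≡ 0#) → v ≡ 𝟘
  nondegenerate []      h = refl
  nondegenerate (x ∷ v) h = cong₂ _∷_
    (begin
      x                      ≡⟨ sym (R.*-identityˡ x) ⟩
      1# *ᶠ x                ≡⟨ sym (R.+-identityʳ _) ⟩
      1# *ᶠ x +ᶠ 0#          ≡⟨ cong (1# *ᶠ x +ᶠ_) (sym (zero-map (lin-∙ˡ v))) ⟩
      1# *ᶠ x +ᶠ 𝟘 ∙ v       ≡⟨ h (1# ∷ 𝟘) ⟩
      0#                     ∎)
    (nondegenerate v (λ c → trans (sym (trans (cong (_+ᶠ c ∙ v) (R.zeroˡ x)) (R.+-identityˡ _))) (h (0# ∷ c))))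
    where open ≡-Reasoning

  size-V : ∀ n → size (finV n) ≡ q ^ n
  size-V = size-vec finK

  #⊤ : ∀ n → # (finV n) (λ _ → yes tt) ≡ q ^ n
  #⊤ n = size-V n

  -- This is `bilinear-count` for the dot product between the whole space and `C`: one of the two
  -- radicals is trivial because only zero is orthogonal to everything.
  annihilator-count : ∀ {n} {C : V n → Set} (C? : ∀ x → Dec (C x)) → Subspace C →
    # (finV n) (λ l → ∀? (finV n) (λ c → C? c →-dec (c ∙ l ≟ 0#))) * # (finV n) C? ≡ q ^ n
  annihilator-count {n} {C} C? sub = begin
    # (finV n) ann * # (finV n) C?
      ≡⟨ cong (_* # (finV n) C?) (#-cong (finV n) ann (λ l → yes tt ×-dec ann l) (λ _ h → tt , h) (λ _ → proj₂)) ⟩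
    # (finV n) (λ l → yes tt ×-dec ann l) * # (finV n) C?
      ≡⟨ bilinear-count (finV n) (finV n) (λ _ → yes tt) C? whole sub (λ l c → c ∙ l) lin-∙ˡ lin-∙ʳ ⟩
    # (finV n) rad * # (finV n) (λ _ → yes tt)
      ≡⟨ cong₂ _*_ (#-single (finV n) rad 𝟘 (has-0 sub , λ l _ → zero-map (lin-∙ˡ l))
           (λ c (_ , h) → nondegenerate c (λ l → trans (∙-comm l c) (h l tt)))) (#⊤ n) ⟩
    1 * q ^ n
      ≡⟨ *-identityˡ _ ⟩
    q ^ n ∎
    where
    open ≡-Reasoning
    ann : ∀ l → Dec (∀ c → C c → c ∙ l ≡ 0#)
    ann l = ∀? (finV n) (λ c → C? c →-dec (c ∙ l ≟ 0#))
    rad : ∀ c → Dec (C c × (∀ l → ⊤ → c ∙ l ≡ 0#))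
    rad c = C? c ×-dec ∀? (finV n) (λ l → yes tt →-dec (c ∙ l ≟ 0#))

  -- The coordinate flag: Low b is spanned by the first b basis vectors, High b is its annihilator.

  Low : ∀ {n} → ℕ → V n → Set
  Low b       []       = ⊤
  Low zero    (x ∷ xs) = x ≡ 0# × Low zero xs
  Low (suc b) (x ∷ xs) = Low b xs

  High : ∀ {n} → ℕ → V n → Set
  High b       []       = ⊤
  High zero    (x ∷ xs) = ⊤
  High (suc b) (x ∷ xs) = x ≡ 0# × High b xs

  low? : ∀ {n} b (x : V n) → Dec (Low b x)
  low? b       []       = yes tt
  low? zero    (x ∷ xs) = (x ≟ 0#) ×-dec low? zero xs
  low? (suc b) (x ∷ xs) = low? b xs

  high? : ∀ {n} b (x : V n) → Dec (High b x)
  high? b       []       = yes tt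
  high? zero    (x ∷ xs) = yes tt
  high? (suc b) (x ∷ xs) = (x ≟ 0#) ×-dec high? b xs

  low-sub : ∀ {n} b → Subspace {V n} (Low b)
  low-sub {n} b = record { has-0 = z {n} b ; has-⊕ = λ {x} {y} → a b x y ; has-⊙ = λ c {x} → s b c x }
    where
    z : ∀ {n} b → Low b (𝟘 {V n})
    z {zero}  b       = tt
    z {suc n} zero    = refl , z {n} zero
    z {suc n} (suc b) = z {n} b
    a : ∀ {n} b (x y : V n) → Low b x → Low b y → Low b (x ⊕ y)
    a b       []       []       p q = tt
    a zero    (x ∷ xs) (y ∷ ys) (p , ps) (q , qs) = trans (cong₂ _+ᶠ_ p q) (R.+-identityˡ 0#) , a zero xs ys ps qs
    a (suc b) (x ∷ xs) (y ∷ ys) p q = a b xs ys p q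
    s : ∀ {n} b c (x : V n) → Low b x → Low b (c ⊙ x)
    s b       c []       p = tt
    s zero    c (x ∷ xs) (p , ps) = trans (cong (c *ᶠ_) p) (R.zeroʳ c) , s zero c xs ps
    s (suc b) c (x ∷ xs) p = s b c xs p

  high-sub : ∀ {n} b → Subspace {V n} (High b)
  high-sub {n} b = record { has-0 = z {n} b ; has-⊕ = λ {x} {y} → a b x y ; has-⊙ = λ c {x} → s b c x }
    where
    z : ∀ {n} b → High b (𝟘 {V n})
    z {zero}  b       = tt
    z {suc n} zero    = tt
    z {suc n} (suc b) = refl , z {n} b
    a : ∀ {n} b (x y : V n) → High b x → High b y → High b (x ⊕ y)
    a b       []       []       p q = tt
    a zero    (x ∷ xs) (y ∷ ys) p q = tt
    a (suc b) (x ∷ xs) (y ∷ ys) (p , ps) (q , qs) = trans (cong₂ _+ᶠ_ p q) (R.+-identityˡ 0#) , a b xs ys ps qs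
    s : ∀ {n} b c (x : V n) → High b x → High b (c ⊙ x)
    s b       c []       p = tt
    s zero    c (x ∷ xs) p = tt
    s (suc b) c (x ∷ xs) (p , ps) = trans (cong (c *ᶠ_) p) (R.zeroʳ c) , s b c xs ps

  low-0 : ∀ {n} (x : V n) → Low 0 x → x ≡ 𝟘
  low-0 []       _        = refl
  low-0 (x ∷ xs) (p , ps) = cong₂ _∷_ p (low-0 xs ps)

  low-mono : ∀ {n a b} → a ≤ b → (x : V n) → Low a x → Low b x
  low-mono h       []       p = tt
  low-mono {b = zero} z≤n  (x ∷ xs) p = p
  low-mono {b = suc b} z≤n (x ∷ xs) (_ , p) = low-mono {b = b} z≤n xs p
  low-mono (s≤s h) (x ∷ xs) p = low-mono h xs p

  low-full : ∀ {n b} → n ≤ b → (x : V n) → Low b x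
  low-full h       []       = tt
  low-full (s≤s h) (x ∷ xs) = low-full h xs

  high-low : ∀ {n} a (h x : V n) → High a h → Low a x → h ∙ x ≡ 0#
  high-low a       []       []       p q = refl
  high-low zero    (h ∷ hs) (x ∷ xs) p (q , qs) =
    trans (cong₂ _+ᶠ_ (trans (cong (h *ᶠ_) q) (R.zeroʳ h)) (high-low zero hs xs (high-0 hs) qs)) (R.+-identityˡ 0#)
    where
    high-0 : ∀ {n} (h : V n) → High 0 h
    high-0 []      = tt
    high-0 (_ ∷ _) = tt
  high-low (suc a) (h ∷ hs) (x ∷ xs) (p , ps) q =
    trans (cong₂ _+ᶠ_ (trans (cong (_*ᶠ x) p) (R.zeroˡ x)) (high-low a hs xs ps q)) (R.+-identityˡ 0#)

  high-annihilator : ∀ {n} a (x : V n) → (∀ h → High a h → h ∙ x ≡ 0#) → Low a x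
  high-annihilator a       []       p = tt
  high-annihilator {suc n} zero (x ∷ xs) p with nondegenerate (x ∷ xs) (λ { (c ∷ cs) → p (c ∷ cs) tt })
  ... | refl = refl , has-0 (low-sub {n} 0)
  high-annihilator (suc a) (x ∷ xs) p = high-annihilator a xs (λ h hh →
    trans (sym (trans (cong (_+ᶠ h ∙ xs) (R.zeroˡ x)) (R.+-identityˡ _))) (p (0# ∷ h) (refl , hh)))

  #High : ∀ {n} a → # (finV n) (high? a) ≡ q ^ (n ∸ a)
  #High {zero}  zero    = refl
  #High {zero}  (suc a) = refl
  #High {suc n} zero    = trans (∑-cong (finV (suc n)) (λ { (_ ∷ _) → refl })) (size-V (suc n))
  #High {suc n} (suc a) = begin
    # (finV (suc n)) (high? (suc a))
      ≡⟨ ∑-∷ finK n _ ⟩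
    ∑ finK (λ x → ∑ (finV n) (λ v → 𝟙 ((x ≟ 0#) ×-dec high? a v)))
      ≡⟨ ∑-cong finK (λ x → trans (∑-cong (finV n) (λ v → 𝟙-× (x ≟ 0#) (high? a v))) (∑-*ˡ (finV n) (𝟙 (x ≟ 0#)) _)) ⟩
    ∑ finK (λ x → 𝟙 (x ≟ 0#) * # (finV n) (high? a))
      ≡⟨ ∑-δ finK 0# _ ⟩
    # (finV n) (high? a)
      ≡⟨ #High a ⟩
    q ^ (n ∸ a) ∎
    where open ≡-Reasoning

  #Low : ∀ {n b} → b ≤ n → # (finV n) (low? b) ≡ q ^ b
  #Low {zero}  z≤n = refl
  #Low {suc n} z≤n = #-single (finV (suc n)) (low? 0) 𝟘 (has-0 (low-sub {suc n} 0)) (λ x → low-0 x)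
  #Low {suc n} {suc b} (s≤s h) = begin
    # (finV (suc n)) (low? (suc b))                  ≡⟨ ∑-∷ finK n _ ⟩
    ∑ finK (λ x → ∑ (finV n) (λ v → 𝟙 (low? b v)))   ≡⟨ ∑-const finK _ ⟩
    q * # (finV n) (low? b)                          ≡⟨ cong (q *_) (#Low h) ⟩
    q * q ^ b                                        ∎
    where open ≡-Reasoning

  perp? : ∀ {n ℓ} (M : Vec (V n) ℓ) h → Dec (map (h ∙_) M ≡ 𝟘)
  perp? M h = map (h ∙_) M ≟ᵛ 𝟘

  -- Row rank equals column rank, for the columns of M with index ≥ a.
  rank-count : ∀ {n ℓ} a (M : Vec (V n) ℓ) →
    # (finV ℓ) (λ c → low? a (c ∙ M)) * q ^ (n ∸ a) ≡ # (finV n) (λ h → high? a h ×-dec perp? M h) * q ^ ℓ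
  rank-count {n} {ℓ} a M = begin
    # (finV ℓ) (λ c → low? a (c ∙ M)) * q ^ (n ∸ a)
      ≡⟨ cong₂ _*_ (#-cong (finV ℓ) (λ c → low? a (c ∙ M)) rad₁
           (λ c p → tt , λ h hh → high-low a h (c ∙ M) hh p) (λ c (_ , p) → high-annihilator a (c ∙ M) p)) (sym (#High {n} a)) ⟩
    # (finV ℓ) rad₁ * # (finV n) (high? a)
      ≡⟨ bilinear-count (finV ℓ) (finV n) (λ _ → yes tt) (high? a) whole (high-sub a) (λ c h → h ∙ c ∙ M)
           (λ c → lin-∙ˡ (c ∙ M)) (λ h → lin-∘ (lin-∙ʳ h) (lin-∙ˡ M)) ⟩
    # (finV n) rad₂ * # (finV ℓ) (λ _ → yes tt)
      ≡⟨ cong₂ _*_ (#-cong (finV n) rad₂ (λ h → high? a h ×-dec perp? M h)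
           (λ h (hh , p) → hh , nondegenerate _ (λ c → trans (sym (∙-map (lin-∙ʳ h) c M)) (p c tt)))
           (λ h (hh , p) → hh , λ c _ → trans (∙-map (lin-∙ʳ h) c M) (trans (cong (c ∙_) p) (zero-map (lin-∙ʳ c))))) (#⊤ ℓ) ⟩
    # (finV n) (λ h → high? a h ×-dec perp? M h) * q ^ ℓ ∎
    where
    open ≡-Reasoning
    rad₁ : ∀ c → Dec (⊤ × (∀ h → High a h → h ∙ c ∙ M ≡ 0#))
    rad₁ c = yes tt ×-dec ∀? (finV n) (λ h → high? a h →-dec (h ∙ c ∙ M ≟ 0#))
    rad₂ : ∀ h → Dec (High a h × (∀ c → ⊤ → h ∙ c ∙ M ≡ 0#))
    rad₂ h = high? a h ×-dec ∀? (finV ℓ) (λ c → yes tt →-dec (h ∙ c ∙ M ≟ 0#))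

  -- Tuples of vectors, hyperplanes and row reduction

  finM : ∀ n ℓ → Finite (Vec (V n) ℓ)
  finM n ℓ = finVec (finV n) ℓ

  module _ {A : Set} {{_ : Space A}} where

    ∙-shear : ∀ {n} (c : V n) (y : A) l X → c ∙ shear y l X ≡ c ∙ X ⊕ (c ∙ l) ⊙ y
    ∙-shear []       y []       []      = sym (trans (⊕-identityˡ _) (⊙-zeroˡ y))
    ∙-shear (c ∷ cs) y (l ∷ ls) (x ∷ X) = begin
      c ⊙ (x ⊕ l ⊙ y) ⊕ cs ∙ shear y ls X
        ≡⟨ cong₂ _⊕_ (trans (⊙-distribˡ c x _) (cong (c ⊙ x ⊕_) (sym (⊙-assoc c l y)))) (∙-shear cs y ls X) ⟩
      (c ⊙ x ⊕ (c *ᶠ l) ⊙ y) ⊕ (cs ∙ X ⊕ (cs ∙ ls) ⊙ y)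
        ≡⟨ ⊕-interchange _ _ _ _ ⟩
      (c ⊙ x ⊕ cs ∙ X) ⊕ ((c *ᶠ l) ⊙ y ⊕ (cs ∙ ls) ⊙ y)
        ≡⟨ cong ((c ⊙ x ⊕ cs ∙ X) ⊕_) (sym (⊙-distribʳ _ _ y)) ⟩
      (c ⊙ x ⊕ cs ∙ X) ⊕ (c *ᶠ l +ᶠ cs ∙ ls) ⊙ y ∎
      where open ≡-Reasoning

    shear-𝟘ˡ : ∀ {n} l (X : Vec A n) → shear 𝟘 l X ≡ X
    shear-𝟘ˡ []       []      = refl
    shear-𝟘ˡ (l ∷ ls) (x ∷ X) = cong₂ _∷_ (trans (cong (x ⊕_) (⊙-zeroʳ l)) (⊕-identityʳ x)) (shear-𝟘ˡ ls X)

    shear-𝟘ʳ : ∀ {n} y (X : Vec A n) → shear y 𝟘 X ≡ X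
    shear-𝟘ʳ y []      = refl
    shear-𝟘ʳ y (x ∷ X) = cong₂ _∷_ (trans (cong (x ⊕_) (⊙-zeroˡ y)) (⊕-identityʳ x)) (shear-𝟘ʳ y X)

    shear-⊕ : ∀ {n} y l l′ (X : Vec A n) → shear y l (shear y l′ X) ≡ shear y (l ⊕ l′) X
    shear-⊕ y []       []         []      = refl
    shear-⊕ y (l ∷ ls) (l′ ∷ ls′) (x ∷ X) = cong₂ _∷_
      (trans (⊕-assoc x _ _) (cong (x ⊕_) (trans (⊕-comm _ _) (sym (⊙-distribʳ l l′ y))))) (shear-⊕ y ls ls′ X)

    shear-shear : ∀ {n} u (w y : A) (cs : V n) X → shear w (u ⊙ cs) (shear y cs X) ≡ shear (y ⊕ u ⊙ w) cs X
    shear-shear u w y []       []      = refl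
    shear-shear u w y (c ∷ cs) (x ∷ X) = cong₂ _∷_
      (trans (⊕-assoc x _ _) (cong (x ⊕_) (sym (trans (⊙-distribˡ c y _) (cong (c ⊙ y ⊕_)
        (trans (sym (⊙-assoc c u w)) (cong (_⊙ w) (R.*-comm c u))))))))
      (shear-shear u w y cs X)

    shear-insertAt : ∀ {n} (w : A) (l : V n) i u X y → shear w (insertAt l i u) (insertAt X i y) ≡ insertAt (shear w l X) i (y ⊕ u ⊙ w)
    shear-insertAt w l       Fin.zero    u X       y = refl
    shear-insertAt w (l ∷ ls) (Fin.suc i) u (x ∷ X) y = cong (_ ∷_) (shear-insertAt w ls i u X y)

  map-shear : ∀ {A B : Set} {{_ : Space A}} {{_ : Space B}} {f : A → B} → Lin f →
              ∀ {n} y (l : V n) X → map f (shear y l X) ≡ shear (f y) l (map f X)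
  map-shear lf y []       []      = refl
  map-shear lf y (l ∷ ls) (x ∷ X) = cong₂ _∷_ (axpy lf x l y) (map-shear lf y ls X)

  -- For independent rows this is the cardinality of the intersection of their span with V_b.
  card : ∀ {n ℓ} → ℕ → Vec (V n) ℓ → ℕ
  card {ℓ = ℓ} b M = # (finV ℓ) (λ c → low? b (c ∙ M))

  cards : ∀ {n ℓ} → Vec (V n) ℓ → ℕ → ℕ
  cards M b = card b M

  -- For a tuple lifted off a hyperplane with h-values `l` this is the `card` of the lifted tuple
  -- (`card-lift`): a combination lands in a flag step inside the hyperplane only if its
  -- coefficients are orthogonal to `l`.
  cardPerp : ∀ {n ℓ} → V ℓ → Vec (V n) ℓ → ℕ → ℕ
  cardPerp {ℓ = ℓ} l M b = # (finV ℓ) (λ c → (c ∙ l ≟ 0#) ×-dec low? b (c ∙ M))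

  -- A hyperplane g (K^n) = ker h of K^(n+1) containing Low a, with a complementary vector v.
  record Split (n a : ℕ) : Set where
    field
      g         : V n → V (suc n)
      v         : V (suc n)
      h         : V (suc n) → Carrier
      ρ         : V (suc n) → V n
      lin-g     : Lin g
      lin-h     : Lin h
      lin-ρ     : Lin ρ
      h-g       : ∀ x → h (g x) ≡ 0#
      h-v       : h v ≡ 1#
      ρ-g       : ∀ x → ρ (g x) ≡ x
      ρ-v       : ρ v ≡ 𝟘
      decompose : ∀ x → g (ρ x) ⊕ h x ⊙ v ≡ x
      low-g     : ∀ {b} → b ≤ a → ∀ x → Low b x → Low b (g x)
      low-h     : ∀ {b} → b ≤ a → ∀ x → Low b x → h x ≡ 0#
      low-ρ     : ∀ {b} → b ≤ a → ∀ x → Low b x → Low b (ρ x)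

    h-point : ∀ x l → h (g x ⊕ l ⊙ v) ≡ l
    h-point x l = begin
      h (g x ⊕ l ⊙ v)       ≡⟨ axpy lin-h (g x) l v ⟩
      h (g x) +ᶠ l *ᶠ h v   ≡⟨ cong₂ (λ s t → s +ᶠ l *ᶠ t) (h-g x) h-v ⟩
      0# +ᶠ l *ᶠ 1#         ≡⟨ trans (R.+-identityˡ _) (R.*-identityʳ l) ⟩
      l                     ∎
      where open ≡-Reasoning

    ρ-point : ∀ x l → ρ (g x ⊕ l ⊙ v) ≡ x
    ρ-point x l = begin
      ρ (g x ⊕ l ⊙ v)       ≡⟨ axpy lin-ρ (g x) l v ⟩
      ρ (g x) ⊕ l ⊙ ρ v     ≡⟨ cong₂ (λ s t → s ⊕ l ⊙ t) (ρ-g x) ρ-v ⟩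
      x ⊕ l ⊙ 𝟘             ≡⟨ trans (cong (x ⊕_) (⊙-zeroʳ l)) (⊕-identityʳ x) ⟩
      x                     ∎
      where open ≡-Reasoning

    lift : ∀ {ℓ} → V ℓ → Vec (V n) ℓ → Vec (V (suc n)) ℓ
    lift l M = shear v l (map g M)

    lift-𝟘 : ∀ {ℓ} (M : Vec (V n) ℓ) → lift 𝟘 M ≡ map g M
    lift-𝟘 M = shear-𝟘ʳ v (map g M)

    map-h-lift : ∀ {ℓ} (l : V ℓ) M → map h (lift l M) ≡ l
    map-h-lift []       []      = refl
    map-h-lift (l ∷ ls) (x ∷ M) = cong₂ _∷_ (h-point x l) (map-h-lift ls M)

    ∑-point : ∀ f → ∑ (finV (suc n)) f ≡ ∑ finK (λ l → ∑ (finV n) (λ x → f (g x ⊕ l ⊙ v)))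
    ∑-point f = trans
      (sym (∑-bij (finV (suc n)) (finV (suc n)) (λ { (l ∷ x) → g x ⊕ l ⊙ v }) (λ x → h x ∷ ρ x)
        decompose (λ { (l ∷ x) → cong₂ _∷_ (h-point x l) (ρ-point x l) }) f))
      (∑-∷ finK n _)

    ∑-lift : ∀ ℓ f → ∑ (finM (suc n) ℓ) f ≡ ∑ (finV ℓ) (λ l → ∑ (finM n ℓ) (λ M → f (lift l M)))
    ∑-lift zero    f = sym (+-identityʳ _)
    ∑-lift (suc ℓ) f = begin
      ∑ (finM (suc n) (suc ℓ)) f
        ≡⟨ ∑-∷ (finV (suc n)) ℓ f ⟩
      ∑ (finV (suc n)) (λ x → ∑ (finM (suc n) ℓ) (λ X → f (x ∷ X)))
        ≡⟨ ∑-point _ ⟩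
      ∑ finK (λ l → ∑ (finV n) (λ x → ∑ (finM (suc n) ℓ) (λ X → f ((g x ⊕ l ⊙ v) ∷ X))))
        ≡⟨ ∑-cong finK (λ l → trans (∑-cong (finV n) (λ x → ∑-lift ℓ _)) (∑-swap (finV n) (finV ℓ) _)) ⟩
      ∑ finK (λ l → ∑ (finV ℓ) (λ ls → ∑ (finV n) (λ x → ∑ (finM n ℓ) (λ M → f ((g x ⊕ l ⊙ v) ∷ lift ls M)))))
        ≡⟨ ∑-cong finK (λ l → ∑-cong (finV ℓ) (λ ls → sym (∑-∷ (finV n) ℓ (λ M → f (lift (l ∷ ls) M))))) ⟩
      ∑ finK (λ l → ∑ (finV ℓ) (λ ls → ∑ (finM n (suc ℓ)) (λ M → f (lift (l ∷ ls) M))))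
        ≡⟨ sym (∑-∷ finK ℓ _) ⟩
      ∑ (finV (suc ℓ)) (λ l → ∑ (finM n (suc ℓ)) (λ M → f (lift l M))) ∎
      where open ≡-Reasoning

    card-lift : ∀ {ℓ b} → b ≤ a → (l : V ℓ) (M : Vec (V n) ℓ) → card b (lift l M) ≡ cardPerp l M b
    card-lift {ℓ} {b} b≤a l M = #-cong (finV ℓ) _ _ to from
      where
      point : ∀ c → c ∙ lift l M ≡ g (c ∙ M) ⊕ (c ∙ l) ⊙ v
      point c = trans (∙-shear c v l (map g M)) (cong (_⊕ (c ∙ l) ⊙ v) (sym (∙-map lin-g c M)))
      to : ∀ c → Low b (c ∙ lift l M) → (c ∙ l ≡ 0#) × Low b (c ∙ M)
      to c p = let p′ = subst (Low b) (point c) p in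
        trans (sym (h-point (c ∙ M) (c ∙ l))) (low-h b≤a _ p′) ,
        subst (Low b) (ρ-point (c ∙ M) (c ∙ l)) (low-ρ b≤a _ p′)
      from : ∀ c → (c ∙ l ≡ 0#) × Low b (c ∙ M) → Low b (c ∙ lift l M)
      from c (e , p) = subst (Low b) (sym (trans (point c) (trans (cong (λ z → g (c ∙ M) ⊕ z ⊙ v) e)
        (trans (cong (g (c ∙ M) ⊕_) (⊙-zeroˡ v)) (⊕-identityʳ _))))) (low-g b≤a _ p)

  cardPerp-𝟘 : ∀ {n ℓ} (M : Vec (V n) ℓ) b → cardPerp 𝟘 M b ≡ card b M
  cardPerp-𝟘 {ℓ = ℓ} M b = #-cong (finV ℓ) _ _ (λ c → proj₂) (λ c p → zero-map (lin-∙ʳ c) , p)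

  card-map-g : ∀ {n a} (s : Split n a) {ℓ b} → b ≤ a → (M : Vec (V n) ℓ) → card b (map (Split.g s) M) ≡ card b M
  card-map-g s b≤a M = trans (cong (card _) (sym (Split.lift-𝟘 s M))) (trans (Split.card-lift s b≤a 𝟘 M) (cardPerp-𝟘 M _))

  card-∷ : ∀ {n ℓ} b y (X : Vec (V n) ℓ) → card b X ≤ card b (y ∷ X)
  card-∷ {ℓ = ℓ} b y X = begin
    card b X
      ≡⟨ ∑-cong (finV ℓ) (λ c → cong (λ z → 𝟙 (low? b z)) (sym (trans (cong (_⊕ c ∙ X) (⊙-zeroˡ y)) (⊕-identityˡ _)))) ⟩
    ∑ (finV ℓ) (λ c → 𝟙 (low? b ((0# ∷ c) ∙ (y ∷ X))))
      ≤⟨ ∑-≥ finK 0# (λ a → ∑ (finV ℓ) (λ c → 𝟙 (low? b ((a ∷ c) ∙ (y ∷ X))))) ⟩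
    ∑ finK (λ a → ∑ (finV ℓ) (λ c → 𝟙 (low? b ((a ∷ c) ∙ (y ∷ X)))))
      ≡⟨ sym (∑-∷ finK ℓ _) ⟩
    card b (y ∷ X) ∎
    where open ≤-Reasoning

  -- Row reduction along an entry u ≠ 0 of the column l: the remaining rows X are freed of y.
  module Pivot {n ℓ : ℕ} (l : V ℓ) (i : Fin (suc ℓ)) (u : Carrier) (u≢0 : u ≢ 0#) where

    u⁻¹ : Carrier
    u⁻¹ = proj₁ (inverse u u≢0)

    u*u⁻¹ : u *ᶠ u⁻¹ ≡ 1#
    u*u⁻¹ = proj₂ (inverse u u≢0)

    cs : V ℓ
    cs = u⁻¹ ⊙ l

    reduced : V n → Vec (V n) ℓ → Vec (V n) (suc ℓ)
    reduced y X = insertAt (shear y cs X) i y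

    ∑-reduced : ∀ f → ∑ (finM n (suc ℓ)) f ≡ ∑ (finV n) (λ y → ∑ (finM n ℓ) (λ X → f (reduced y X)))
    ∑-reduced f = trans (∑-insertAt (finV n) ℓ i f) (∑-cong (finV n) (λ y →
      sym (∑-bij (finM n ℓ) (finM n ℓ) (shear y cs) (shear y (⊖ cs))
        (λ X → trans (shear-⊕ y cs (⊖ cs) X) (trans (cong (λ z → shear y z X) (⊖-inverse cs)) (shear-𝟘ʳ y X)))
        (λ X → trans (shear-⊕ y (⊖ cs) cs X) (trans (cong (λ z → shear y z X) (trans (⊕-comm (⊖ cs) cs) (⊖-inverse cs))) (shear-𝟘ʳ y X)))
        (λ Z → f (insertAt Z i y)))))

    -- Orthogonality to the column determines the coefficient of the pivot row from the others, and
    -- with that coefficient `y` cancels from the combination, which leaves `c ∙ X`.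
    cardPerp-reduced : ∀ y X b → cardPerp (insertAt l i u) (reduced y X) b ≡ card b X
    cardPerp-reduced y X b = begin
      cardPerp (insertAt l i u) (reduced y X) b
        ≡⟨ ∑-insertAt finK ℓ i _ ⟩
      ∑ finK (λ t → ∑ (finV ℓ) (λ c → 𝟙 ((insertAt c i t ∙ insertAt l i u ≟ 0#) ×-dec low? b (insertAt c i t ∙ reduced y X))))
        ≡⟨ ∑-swap finK (finV ℓ) _ ⟩
      ∑ (finV ℓ) (λ c → ∑ finK (λ t → 𝟙 ((insertAt c i t ∙ insertAt l i u ≟ 0#) ×-dec low? b (insertAt c i t ∙ reduced y X))))
        ≡⟨ ∑-cong (finV ℓ) (λ c → trans (∑-cong finK (λ t → trans
             (𝟙-cong _ ((t ≟ root c) ×-dec low? b (c ∙ X)) (to c t) (from c t)) (𝟙-× (t ≟ root c) _)))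
             (∑-δ finK (root c) (λ _ → 𝟙 (low? b (c ∙ X))))) ⟩
      card b X ∎
      where
      open ≡-Reasoning
      root : V ℓ → Carrier
      root c = -ᶠ (u⁻¹ *ᶠ (c ∙ l))
      expand : ∀ c t → insertAt c i t ∙ reduced y X ≡ c ∙ X ⊕ (t +ᶠ u⁻¹ *ᶠ (c ∙ l)) ⊙ y
      expand c t = begin
        insertAt c i t ∙ reduced y X
          ≡⟨ ∙-insertAt c (shear y cs X) i t y ⟩
        t ⊙ y ⊕ c ∙ shear y cs X
          ≡⟨ cong (t ⊙ y ⊕_) (trans (∙-shear c y cs X) (cong (λ z → c ∙ X ⊕ z ⊙ y) (scale (lin-∙ʳ c) u⁻¹ l))) ⟩
        t ⊙ y ⊕ (c ∙ X ⊕ (u⁻¹ *ᶠ (c ∙ l)) ⊙ y)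
          ≡⟨ trans (sym (⊕-assoc _ _ _)) (trans (cong (_⊕ (u⁻¹ *ᶠ (c ∙ l)) ⊙ y) (⊕-comm _ _)) (⊕-assoc _ _ _)) ⟩
        c ∙ X ⊕ (t ⊙ y ⊕ (u⁻¹ *ᶠ (c ∙ l)) ⊙ y)
          ≡⟨ cong (c ∙ X ⊕_) (sym (⊙-distribʳ _ _ y)) ⟩
        c ∙ X ⊕ (t +ᶠ u⁻¹ *ᶠ (c ∙ l)) ⊙ y ∎
      at-root : ∀ c → insertAt c i (root c) ∙ reduced y X ≡ c ∙ X
      at-root c = begin
        insertAt c i (root c) ∙ reduced y X                       ≡⟨ expand c (root c) ⟩
        c ∙ X ⊕ (root c +ᶠ u⁻¹ *ᶠ (c ∙ l)) ⊙ y                    ≡⟨ cong (λ z → c ∙ X ⊕ z ⊙ y) (R.-‿inverseˡ _) ⟩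
        c ∙ X ⊕ 0# ⊙ y                                            ≡⟨ trans (cong (c ∙ X ⊕_) (⊙-zeroˡ y)) (⊕-identityʳ _) ⟩
        c ∙ X                                                     ∎
      solve-root : ∀ c t → insertAt c i t ∙ insertAt l i u ≡ 0# → t ≡ root c
      solve-root c t e = R.inverseˡ-unique t _ (begin
        t +ᶠ u⁻¹ *ᶠ (c ∙ l)                    ≡⟨ cong (_+ᶠ u⁻¹ *ᶠ (c ∙ l)) (sym (trans (R.*-comm _ _) (trans (R.*-assoc t u u⁻¹) (trans (cong (t *ᶠ_) u*u⁻¹) (R.*-identityʳ t))))) ⟩
        u⁻¹ *ᶠ (t *ᶠ u) +ᶠ u⁻¹ *ᶠ (c ∙ l)      ≡⟨ sym (R.distribˡ _ _ _) ⟩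
        u⁻¹ *ᶠ (t *ᶠ u +ᶠ c ∙ l)               ≡⟨ cong (u⁻¹ *ᶠ_) (trans (sym (∙-insertAt c l i t u)) e) ⟩
        u⁻¹ *ᶠ 0#                              ≡⟨ R.zeroʳ _ ⟩
        0#                                     ∎)
      is-root : ∀ c → insertAt c i (root c) ∙ insertAt l i u ≡ 0#
      is-root c = begin
        insertAt c i (root c) ∙ insertAt l i u   ≡⟨ ∙-insertAt c l i (root c) u ⟩
        root c *ᶠ u +ᶠ c ∙ l                     ≡⟨ cong (_+ᶠ c ∙ l) (trans (sym (R.-‿distribˡ-* _ u)) (cong -ᶠ_
                                                      (trans (R.*-comm _ u) (trans (sym (R.*-assoc u u⁻¹ _)) (trans (cong (_*ᶠ (c ∙ l)) u*u⁻¹) (R.*-identityˡ _)))))) ⟩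
        -ᶠ (c ∙ l) +ᶠ c ∙ l                      ≡⟨ R.-‿inverseˡ _ ⟩
        0#                                       ∎
      to : ∀ c t → (insertAt c i t ∙ insertAt l i u ≡ 0#) × Low b (insertAt c i t ∙ reduced y X) → (t ≡ root c) × Low b (c ∙ X)
      to c t (e , p) with solve-root c t e
      ... | refl = refl , subst (Low b) (at-root c) p
      from : ∀ c t → (t ≡ root c) × Low b (c ∙ X) → (insertAt c i t ∙ insertAt l i u ≡ 0#) × Low b (insertAt c i t ∙ reduced y X)
      from c t (refl , p) = is-root c , subst (Low b) (sym (at-root c)) p

    -- Since `l` is `u ⊙ cs`, what the other rows receive from `y` and from `w` together is a
    -- multiple of the full pivot row `g y ⊕ u ⊙ w`, and `alt-shear` removes it.
    form-reduced : ∀ {F : Vec (V (suc n)) (suc ℓ) → Carrier} → Alt (suc ℓ) F → {g : V n → V (suc n)} → Lin g → ∀ w y X →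
                   F (shear w (insertAt l i u) (map g (reduced y X))) ≡ signed (toℕ i) (F ((g y ⊕ u ⊙ w) ∷ map g X))
    form-reduced {F} aF {g} lg w y X = begin
      F (shear w (insertAt l i u) (map g (insertAt (shear y cs X) i y)))
        ≡⟨ cong (λ z → F (shear w (insertAt l i u) z)) (trans (Vecₚ.map-insertAt g y (shear y cs X) i)
             (cong (λ z → insertAt z i (g y)) (map-shear lg y cs X))) ⟩
      F (shear w (insertAt l i u) (insertAt (shear (g y) cs (map g X)) i (g y)))
        ≡⟨ cong F (shear-insertAt w l i u _ (g y)) ⟩
      F (insertAt (shear w l (shear (g y) cs (map g X))) i (g y ⊕ u ⊙ w))
        ≡⟨ cong (λ z → F (insertAt z i (g y ⊕ u ⊙ w))) (trans
             (cong (λ z → shear w z (shear (g y) cs (map g X))) (sym (⊙-inverse l u*u⁻¹)))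
             (shear-shear u w (g y) cs (map g X))) ⟩
      F (insertAt (shear (g y ⊕ u ⊙ w) cs (map g X)) i (g y ⊕ u ⊙ w))
        ≡⟨ alt-insertAt aF _ i _ ⟩
      signed (toℕ i) (F ((g y ⊕ u ⊙ w) ∷ shear (g y ⊕ u ⊙ w) cs (map g X)))
        ≡⟨ cong (signed (toℕ i)) (alt-shear aF _ cs (map g X)) ⟩
      signed (toℕ i) (F ((g y ⊕ u ⊙ w) ∷ map g X)) ∎
      where open ≡-Reasoning

  nonzero-entry : ∀ {n} (l : V n) → l ≢ 𝟘 → ∃ λ i → lookup l i ≢ 0#
  nonzero-entry []       h = contradiction refl h
  nonzero-entry (x ∷ l) h with x ≟ 0#
  ... | no x≢0 = Fin.zero , x≢0
  ... | yes refl = let i , p = nonzero-entry l (λ e → h (cong (0# ∷_) e)) in Fin.suc i , p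

  nonzero? : ∀ x → Dec (x ≢ 0#)
  nonzero? x = ¬? (x ≟ 0#)

  nz : ℕ → ℕ
  nz ℓ = # (finV ℓ) (λ l → ¬? (l ≟ᵛ 𝟘 {V ℓ}))

  1+nz : ∀ ℓ → 1 + nz ℓ ≡ q ^ ℓ
  1+nz ℓ = begin
    1 + nz ℓ                                              ≡⟨ cong (_+ nz ℓ) (sym (Finite.once (finV ℓ) (𝟘 {V ℓ}))) ⟩
    # (finV ℓ) (_≟ᵛ 𝟘 {V ℓ}) + nz ℓ                             ≡⟨ sym (∑-+ (finV ℓ) _ _) ⟩
    ∑ (finV ℓ) (λ l → 𝟙 (l ≟ᵛ 𝟘 {V ℓ}) + 𝟙 (¬? (l ≟ᵛ 𝟘 {V ℓ})))      ≡⟨ ∑-cong (finV ℓ) (λ l → 𝟙-¬ (l ≟ᵛ 𝟘 {V ℓ})) ⟩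
    size (finV ℓ)                                         ≡⟨ size-V ℓ ⟩
    q ^ ℓ                                                 ∎
    where open ≡-Reasoning

  low-insertAt : ∀ {n b} (x : V n) p w → b ≤ toℕ p → Low b x → w ≡ 0# → Low b (insertAt x p w)
  low-insertAt {b = zero}  x       Fin.zero    w h l e = e , l
  low-insertAt {b = zero}  (y ∷ x) (Fin.suc p) w h (z , l) e = z , low-insertAt x p w z≤n l e
  low-insertAt {b = suc b} (y ∷ x) (Fin.suc p) w (s≤s h) l e = low-insertAt x p w h l e

  low-insertAt⁻ : ∀ {n b} (x : V n) p w → b ≤ toℕ p → Low b (insertAt x p w) → Low b x
  low-insertAt⁻ {b = zero}  x       Fin.zero    w h (_ , l) = l
  low-insertAt⁻ {b = zero}  (y ∷ x) (Fin.suc p) w h (z , l) = z , low-insertAt⁻ x p w z≤n l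
  low-insertAt⁻ {b = suc b} (y ∷ x) (Fin.suc p) w (s≤s h) l = low-insertAt⁻ x p w h l

  high-insertAt⁻ : ∀ {n a} (x : V n) p w → a ≤ toℕ p → High a (insertAt x p w) → High a x
  high-insertAt⁻ {a = zero}  []      p           w h l = tt
  high-insertAt⁻ {a = zero}  (y ∷ x) p           w h l = tt
  high-insertAt⁻ {a = suc a} (y ∷ x) (Fin.suc p) w (s≤s h) (e , l) = e , high-insertAt⁻ x p w h l

  high-lookup : ∀ {n a} (x : V n) p → High a x → lookup x p ≢ 0# → a ≤ toℕ p
  high-lookup {a = zero}  x       p           h ne = z≤n
  high-lookup {a = suc a} (y ∷ x) Fin.zero    (e , _) ne = contradiction e ne
  high-lookup {a = suc a} (y ∷ x) (Fin.suc p) (_ , h) ne = s≤s (high-lookup x p h ne)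

  unit : ∀ {n} → Fin n → V n
  unit Fin.zero    = 1# ∷ 𝟘
  unit (Fin.suc i) = 0# ∷ unit i

  insertAt-split : ∀ {n} (x : V n) p w → insertAt x p w ≡ insertAt x p 0# ⊕ w ⊙ unit p
  insertAt-split x       Fin.zero    w = cong₂ _∷_ (sym (trans (R.+-identityˡ _) (R.*-identityʳ w)))
    (sym (trans (cong (x ⊕_) (⊙-zeroʳ w)) (⊕-identityʳ x)))
  insertAt-split (y ∷ x) (Fin.suc p) w = cong₂ _∷_ (sym (trans (cong (y +ᶠ_) (R.zeroʳ w)) (R.+-identityʳ y))) (insertAt-split x p w)

  lin-insertAt : ∀ {n} p → Lin (λ (x : V n) → insertAt x p 0#)
  lin-insertAt Fin.zero = record
    { add = λ x y → cong (_∷ (x ⊕ y)) (sym (R.+-identityˡ 0#)) ; scale = λ c x → cong (_∷ (c ⊙ x)) (sym (R.zeroʳ c)) }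
  lin-insertAt (Fin.suc p) = record
    { add   = λ { (x ∷ xs) (y ∷ ys) → cong (_ ∷_) (add (lin-insertAt p) xs ys) }
    ; scale = λ { c (x ∷ xs) → cong (_ ∷_) (scale (lin-insertAt p) c xs) } }

  lin-removeAt : ∀ {n} p → Lin (λ (x : V (suc n)) → removeAt x p)
  lin-removeAt {n} Fin.zero = record { add = λ { (_ ∷ _) (_ ∷ _) → refl } ; scale = λ { c (_ ∷ _) → refl } }
  lin-removeAt {suc n} (Fin.suc p) = record
    { add   = λ { (x ∷ x′ ∷ xs) (y ∷ y′ ∷ ys) → cong (_ ∷_) (add (lin-removeAt p) (x′ ∷ xs) (y′ ∷ ys)) }
    ; scale = λ { c (x ∷ x′ ∷ xs) → cong (_ ∷_) (scale (lin-removeAt p) c (x′ ∷ xs)) } }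

  removeAt-unit : ∀ {n} p → removeAt (unit {suc n} p) p ≡ 𝟘
  removeAt-unit Fin.zero = refl
  removeAt-unit {suc n} (Fin.suc Fin.zero)    = refl
  removeAt-unit {suc n} (Fin.suc (Fin.suc p)) = cong (0# ∷_) (removeAt-unit (Fin.suc p))

  ∙-unit : ∀ {n} (x : V n) p → x ∙ unit p ≡ lookup x p
  ∙-unit (x ∷ xs) Fin.zero    = trans (cong₂ _+ᶠ_ (R.*-identityʳ x) (zero-map (lin-∙ʳ xs))) (R.+-identityʳ x)
  ∙-unit (x ∷ xs) (Fin.suc p) = trans (cong₂ _+ᶠ_ (R.zeroʳ x) (∙-unit xs p)) (R.+-identityˡ _)

  -- At a position `p` with nonzero coefficient, a vector of the kernel of `H` is determined by its
  -- other coordinates, and a multiple of `unit p` is complementary. The last component serves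
  -- coordinate hyperplanes, where unit vectors must be followed through `g` and `v`.
  hyperplane : ∀ {n a} (H : V (suc n)) → High a H → ∀ p → lookup H p ≢ 0# →
               ∃ λ (s : Split n a) → (∀ x → Split.h s x ≡ H ∙ x) ×
                 (removeAt H p ≡ 𝟘 → (∀ x → Split.g s x ≡ insertAt x p 0#) × (lookup H p ≡ 1# → Split.v s ≡ unit p))
  hyperplane {n} {a} H hH p u≢0 = record
    { g = g ; v = v ; h = H ∙_ ; ρ = λ x → removeAt x p
    ; lin-g = lin-⊕ (lin-insertAt p) (lin-*ʳ v (lin-⊙ (-ᶠ 1#) (lin-∙ʳ H′)))
    ; lin-h = lin-∙ʳ H ; lin-ρ = lin-removeAt p
    ; h-g = λ x → begin
        H ∙ g x                                      ≡⟨ axpy (lin-∙ʳ H) _ _ v ⟩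
        H ∙ insertAt x p 0# +ᶠ ⊖ (H′ ∙ x) *ᶠ (H ∙ v) ≡⟨ cong₂ (λ s t → s +ᶠ ⊖ (H′ ∙ x) *ᶠ t) (H∙insert x 0#) H∙v ⟩
        (u *ᶠ 0# +ᶠ H′ ∙ x) +ᶠ ⊖ (H′ ∙ x) *ᶠ 1#      ≡⟨ cong₂ _+ᶠ_ (trans (cong (_+ᶠ H′ ∙ x) (R.zeroʳ u)) (R.+-identityˡ _)) (R.*-identityʳ _) ⟩
        H′ ∙ x +ᶠ ⊖ (H′ ∙ x)                         ≡⟨ ⊖-inverse (H′ ∙ x) ⟩
        0#                                           ∎
    ; h-v = H∙v
    ; ρ-g = λ x → begin
        removeAt (g x) p                                      ≡⟨ axpy (lin-removeAt p) (insertAt x p 0#) (⊖ (H′ ∙ x)) v ⟩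
        removeAt (insertAt x p 0#) p ⊕ ⊖ (H′ ∙ x) ⊙ removeAt v p ≡⟨ cong₂ (λ s t → s ⊕ ⊖ (H′ ∙ x) ⊙ t) (Vecₚ.removeAt-insertAt x p 0#) ρv ⟩
        x ⊕ ⊖ (H′ ∙ x) ⊙ 𝟘                                    ≡⟨ trans (cong (x ⊕_) (⊙-zeroʳ _)) (⊕-identityʳ x) ⟩
        x                                                     ∎
    ; ρ-v = ρv
    ; decompose = dec
    ; low-g = λ {b} b≤a x lx → has-⊕ (low-sub b) {insertAt x p 0#} {⊖ (H′ ∙ x) ⊙ v} (low-insertAt x p 0# (≤-trans b≤a a≤p) lx refl)
        (subst (λ z → Low b (z ⊙ v)) (sym (trans (cong ⊖_ (high-low a H′ x hH′ (low-mono b≤a x lx))) (⊙-zeroʳ _)))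
          (subst (Low b) (sym (⊙-zeroˡ v)) (has-0 (low-sub {suc n} b))))
    ; low-h = λ b≤a x lx → high-low a H x hH (low-mono b≤a x lx)
    ; low-ρ = λ {b} b≤a x lx → low-insertAt⁻ (removeAt x p) p (lookup x p) (≤-trans b≤a a≤p)
        (subst (Low b) (sym (Vecₚ.insertAt-removeAt x p)) lx) }
    , (λ x → refl)
    , λ e → (λ x → trans (cong (λ z → insertAt x p 0# ⊕ ⊖ z ⊙ v) (trans (cong (_∙ x) e) (zero-map (lin-∙ˡ x))))
              (trans (cong (λ z → insertAt x p 0# ⊕ z ⊙ v) (⊙-zeroʳ (-ᶠ 1#))) (trans (cong (insertAt x p 0# ⊕_) (⊙-zeroˡ v)) (⊕-identityʳ _))))
          , (λ u≡1 → trans (cong (_⊙ unit p) (trans (sym (R.*-identityˡ _)) (trans (cong (_*ᶠ u⁻¹) (sym u≡1)) u*u⁻¹))) (⊙-identity _))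
    where
    open ≡-Reasoning
    u = lookup H p
    u⁻¹ = proj₁ (inverse u u≢0)
    u*u⁻¹ = proj₂ (inverse u u≢0)
    H′ = removeAt H p
    a≤p = high-lookup H p hH u≢0
    hH′ : High a H′
    hH′ = high-insertAt⁻ H′ p u a≤p (subst (High a) (sym (Vecₚ.insertAt-removeAt H p)) hH)
    v = u⁻¹ ⊙ unit p
    g : V n → V (suc n)
    g x = insertAt x p 0# ⊕ ⊖ (H′ ∙ x) ⊙ v
    H∙insert : ∀ x w → H ∙ insertAt x p w ≡ u *ᶠ w +ᶠ H′ ∙ x
    H∙insert x w = trans (cong (_∙ insertAt x p w) (sym (Vecₚ.insertAt-removeAt H p))) (∙-insertAt H′ x p u w)
    H∙v : H ∙ v ≡ 1#
    H∙v = trans (scale (lin-∙ʳ H) u⁻¹ (unit p)) (trans (cong (u⁻¹ *ᶠ_) (∙-unit H p)) (trans (R.*-comm _ _) u*u⁻¹))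
    ρv : removeAt v p ≡ 𝟘
    ρv = trans (scale (lin-removeAt p) u⁻¹ (unit p)) (trans (cong (u⁻¹ ⊙_) (removeAt-unit p)) (⊙-zeroʳ u⁻¹))
    dec : ∀ x → g (removeAt x p) ⊕ (H ∙ x) ⊙ v ≡ x
    dec x = begin
      (insertAt x′ p 0# ⊕ ⊖ (H′ ∙ x′) ⊙ v) ⊕ (H ∙ x) ⊙ v
        ≡⟨ ⊕-assoc _ _ _ ⟩
      insertAt x′ p 0# ⊕ (⊖ (H′ ∙ x′) ⊙ v ⊕ (H ∙ x) ⊙ v)
        ≡⟨ cong (insertAt x′ p 0# ⊕_) (trans (sym (⊙-distribʳ _ _ v)) (cong (_⊙ v) coefficient)) ⟩
      insertAt x′ p 0# ⊕ (w *ᶠ u) ⊙ u⁻¹ ⊙ unit p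
        ≡⟨ cong (insertAt x′ p 0# ⊕_) (trans (⊙-assoc w u _) (cong (w ⊙_) (⊙-inverse _ u*u⁻¹))) ⟩
      insertAt x′ p 0# ⊕ w ⊙ unit p
        ≡⟨ sym (insertAt-split x′ p w) ⟩
      insertAt x′ p w
        ≡⟨ Vecₚ.insertAt-removeAt x p ⟩
      x ∎
      where
      x′ = removeAt x p
      w = lookup x p
      coefficient : ⊖ (H′ ∙ x′) +ᶠ H ∙ x ≡ w *ᶠ u
      coefficient = begin
        ⊖ (H′ ∙ x′) +ᶠ H ∙ x                    ≡⟨ cong (λ z → ⊖ (H′ ∙ x′) +ᶠ H ∙ z) (sym (Vecₚ.insertAt-removeAt x p)) ⟩
        ⊖ (H′ ∙ x′) +ᶠ H ∙ insertAt x′ p w      ≡⟨ cong (⊖ (H′ ∙ x′) +ᶠ_) (trans (H∙insert x′ w) (cong (_+ᶠ H′ ∙ x′) (R.*-comm u w))) ⟩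
        ⊖ (H′ ∙ x′) +ᶠ (w *ᶠ u +ᶠ H′ ∙ x′)      ≡⟨ R.+-comm _ _ ⟩
        (w *ᶠ u +ᶠ H′ ∙ x′) +ᶠ ⊖ (H′ ∙ x′)      ≡⟨ ⊕-⊖ _ _ ⟩
        w *ᶠ u                                  ∎

  split-of : ∀ {n a} (H : V (suc n)) → High a H → H ≢ 𝟘 → ∃ λ (s : Split n a) → ∀ x → Split.h s x ≡ H ∙ x
  split-of H hH H≢𝟘 = let p , u≢0 = nonzero-entry H H≢𝟘 ; s , e , _ = hyperplane H hH p u≢0 in s , e

  lookup-unit : ∀ {n} (p : Fin n) → lookup (unit p) p ≡ 1#
  lookup-unit Fin.zero    = refl
  lookup-unit (Fin.suc p) = lookup-unit p

  1≢0 : 1# ≢ 0#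
  1≢0 e = 0≢1 (sym e)

  high-unit : ∀ {n} a (p : Fin n) → a ≤ toℕ p → High a (unit p)
  high-unit zero    Fin.zero    h = tt
  high-unit zero    (Fin.suc p) h = tt
  high-unit (suc a) (Fin.suc p) (s≤s h) = refl , high-unit a p h

  lastSplit : ∀ n a → a ≤ n → ∃ λ (s : Split n a) →
    (∀ x → Split.g s x ≡ insertAt x (Fin.fromℕ n) 0#) × Split.v s ≡ unit (Fin.fromℕ n)
  lastSplit n a a≤n =
    let p = Fin.fromℕ n
        s , _ , k = hyperplane (unit p) (high-unit a p (subst (a ≤_) (sym (Finₚ.toℕ-fromℕ n)) a≤n)) p
                      (λ e → 1≢0 (trans (sym (lookup-unit p)) e))
        g≡ , v≡ = k (removeAt-unit p)
    in s , g≡ , v≡ (lookup-unit p)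

  injective-rows : ∀ {n ℓ} {F : Vec (V n) ℓ → Carrier} → Alt ℓ F → ∀ M → F M ≢ 0# → ∀ c → c ∙ M ≡ 𝟘 → c ≡ 𝟘
  injective-rows aF M ne c e = alt-indep aF M ne c e _≟_

  card-0 : ∀ {n ℓ} (M : Vec (V n) ℓ) → (∀ c → c ∙ M ≡ 𝟘 → c ≡ 𝟘) → card 0 M ≡ 1
  card-0 {n} {ℓ} M inj = #-single (finV ℓ) _ 𝟘
    (subst (Low 0) (sym (zero-map (lin-∙ˡ M))) (has-0 (low-sub {n} 0))) (λ c p → inj c (low-0 _ p))

  -- Conditions of codimension at most the corank are automatic.
  card-codim : ∀ {n ℓ} b j (M : Vec (V n) ℓ) → n ∸ b ≤ ℓ ∸ j → j ≤ ℓ → q ^ j ≤ card b M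
  card-codim {n} {ℓ} b j M h j≤ℓ = *-cancelʳ-≤ (q ^ j) (card b M) (q ^ (ℓ ∸ j)) {{q^-nonZero (ℓ ∸ j)}} (begin
    q ^ j * q ^ (ℓ ∸ j)                                    ≡⟨ sym (^-distribˡ-+-* q j (ℓ ∸ j)) ⟩
    q ^ (j + (ℓ ∸ j))                                      ≡⟨ cong (q ^_) (m+[n∸m]≡n j≤ℓ) ⟩
    q ^ ℓ                                                  ≡⟨ sym (*-identityˡ _) ⟩
    1 * q ^ ℓ                                              ≤⟨ *-monoˡ-≤ (q ^ ℓ) (n≢0⇒n>0 (#-≢0 (finV n) (λ h → high? b h ×-dec perp? M h)
                                                                {𝟘} (has-0 (high-sub {n} b) , 𝟘-perp))) ⟩
    # (finV n) (λ h → high? b h ×-dec perp? M h) * q ^ ℓ   ≡⟨ sym (rank-count b M) ⟩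
    card b M * q ^ (n ∸ b)                                 ≤⟨ *-monoʳ-≤ (card b M) (q^-mono h) ⟩
    card b M * q ^ (ℓ ∸ j)                                 ∎)
    where
    open ≤-Reasoning
    𝟘-perp : map (𝟘 ∙_) M ≡ 𝟘
    𝟘-perp = nondegenerate _ (λ c → trans (sym (∙-map (lin-∙ʳ 𝟘) c M)) (zero-map (lin-∙ˡ (c ∙ M))))

  -- More than `n` rows satisfy a nontrivial relation, by `card-codim` at step zero, whereas
  -- `F M ≢ 0#` would make them independent.
  alt-overflow : ∀ {n ℓ} {F : Vec (V n) ℓ → Carrier} → Alt ℓ F → n < ℓ → ∀ M → F M ≡ 0#
  alt-overflow {F = F} aF (s≤s n≤ℓ) M with F M ≟ 0#
  ... | yes e = e
  ... | no ne = contradiction (≤-trans (card-codim 0 1 M n≤ℓ (s≤s z≤n)) (≤-reflexive (card-0 M (injective-rows aF M ne))))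
    (<⇒≱ (≤-trans 2≤q (≤-reflexive (sym (*-identityʳ q)))))

  sub-card : ∀ {n ℓ} b (M : Vec (V n) ℓ) → Subspace (λ c → Low b (c ∙ M))
  sub-card {n} b M = record
    { has-0 = subst (Low b) (sym (zero-map (lin-∙ˡ M))) (has-0 (low-sub {n} b))
    ; has-⊕ = λ {x} {y} p r → subst (Low b) (sym (add (lin-∙ˡ M) x y)) (has-⊕ (low-sub b) {x ∙ M} {y ∙ M} p r)
    ; has-⊙ = λ c {x} p → subst (Low b) (sym (scale (lin-∙ˡ M) c x)) (has-⊙ (low-sub b) c {x ∙ M} p) }

  card-drop : ∀ {n ℓ} b l (M : Vec (V n) ℓ) → card b M ≤ q * cardPerp l M b
  card-drop {ℓ = ℓ} b l M = ≤-trans (#-drop (finV ℓ) (λ c → low? b (c ∙ M)) (sub-card b M) (lin-∙ˡ l))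
    (*-monoʳ-≤ q (#-mono (finV ℓ) _ _ (λ c (p , r) → r , p)))

  open Over K public using (det; sumF; sumL; minor; formVal)

  -- Determinants

  sg : ℕ → Carrier
  sg i = signed i 1#

  signed-sg : ∀ i x → signed i x ≡ sg i *ᶠ x
  signed-sg zero    x = sym (R.*-identityˡ x)
  signed-sg (suc i) x = trans (cong -ᶠ_ (signed-sg i x)) (R.-‿distribˡ-* _ _)

  sg-suc : ∀ i → sg (suc i) ≡ (-ᶠ 1#) *ᶠ sg i
  sg-suc i = sym (R.-1*x≈-x (sg i))

  sg-square : ∀ i → sg i *ᶠ sg i ≡ 1#
  sg-square i = trans (sym (signed-sg i (sg i))) (signed-involutive i 1#)

  neg-square : (-ᶠ 1#) *ᶠ (-ᶠ 1#) ≡ 1#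
  neg-square = sg-square 1

  sumF-cong : ∀ {n} {f g : Fin n → Carrier} → (∀ i → f i ≡ g i) → sumF f ≡ sumF g
  sumF-cong {zero}  h = refl
  sumF-cong {suc n} h = cong₂ _+ᶠ_ (h Fin.zero) (sumF-cong (λ i → h (Fin.suc i)))

  sumF-0 : ∀ n → sumF {n} (λ _ → 0#) ≡ 0#
  sumF-0 zero    = refl
  sumF-0 (suc n) = trans (R.+-identityˡ _) (sumF-0 n)

  sumF-zero : ∀ {n} {f : Fin n → Carrier} → (∀ i → f i ≡ 0#) → sumF f ≡ 0#
  sumF-zero {n} h = trans (sumF-cong h) (sumF-0 n)

  sumF-axpy : ∀ {n} (f : Fin n → Carrier) c g → sumF (λ i → f i +ᶠ c *ᶠ g i) ≡ sumF f +ᶠ c *ᶠ sumF g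
  sumF-axpy {zero}  f c g = sym (trans (cong (0# +ᶠ_) (R.zeroʳ c)) (R.+-identityˡ 0#))
  sumF-axpy {suc n} f c g = trans (cong (f Fin.zero +ᶠ c *ᶠ g Fin.zero +ᶠ_) (sumF-axpy (λ i → f (Fin.suc i)) c (λ i → g (Fin.suc i))))
    (trans (⊕-interchange _ _ _ _) (cong (f Fin.zero +ᶠ sumF (λ i → f (Fin.suc i)) +ᶠ_) (sym (R.distribˡ c _ _))))

  sumF-scale : ∀ {n} c (g : Fin n → Carrier) → sumF (λ i → c *ᶠ g i) ≡ c *ᶠ sumF g
  sumF-scale {n} c g = trans (sumF-cong {n} {λ i → c *ᶠ g i} {λ i → 0# +ᶠ c *ᶠ g i} (λ i → sym (R.+-identityˡ _))) (trans (sumF-axpy (λ _ → 0#) c g)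
    (trans (cong (_+ᶠ c *ᶠ sumF g) (sumF-0 n)) (R.+-identityˡ _)))

  alt-sumF : ∀ {A : Set} {{_ : Space A}} {ℓ} n {F : Fin n → Vec A ℓ → Carrier} → (∀ j → Alt ℓ (F j)) → Alt ℓ (λ xs → sumF (λ j → F j xs))
  alt-sumF zero    h = alt-0 _
  alt-sumF (suc n) h = alt-⊕ (h Fin.zero) (alt-sumF n (λ j → h (Fin.suc j)))

  lin-sumF : ∀ {A : Set} {{_ : Space A}} n {F : Fin n → A → Carrier} → (∀ j → Lin (F j)) → Lin (λ x → sumF (λ j → F j x))
  lin-sumF zero    h = lin-𝟘
  lin-sumF (suc n) h = lin-⊕ (h Fin.zero) (lin-sumF n (λ j → h (Fin.suc j)))

  det-cong : ∀ n {M N : Fin n → Fin n → Carrier} → (∀ i k → M i k ≡ N i k) → det n M ≡ det n N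
  det-cong zero    h = refl
  det-cong (suc n) h = sumF-cong (λ j → cong (signed (toℕ j)) (cong₂ _*ᶠ_ (h Fin.zero j) (det-cong n (λ i k → h (Fin.suc i) (punchIn j k)))))

  -- Expansion along two equal rows y: the terms for a pair of columns in either order cancel.
  twoRows : ∀ n (y : Fin (suc (suc n)) → Carrier) (D : (Fin n → Fin (suc (suc n))) → Carrier) →
            (∀ f g → (∀ i → f i ≡ g i) → D f ≡ D g) →
            sumF (λ j → sg (toℕ j) *ᶠ (y j *ᶠ sumF (λ k → sg (toℕ k) *ᶠ (y (punchIn j k) *ᶠ D (λ l → punchIn j (punchIn k l)))))) ≡ 0#
  twoRows n y D ext = begin
    1# *ᶠ (y₀ *ᶠ sumF A) +ᶠ
      sumF (λ j → sg (suc (toℕ j)) *ᶠ (y (Fin.suc j) *ᶠ (1# *ᶠ (y₀ *ᶠ E j) +ᶠ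
        sumF (λ k → sg (suc (toℕ k)) *ᶠ (y (Fin.suc (punchIn j k)) *ᶠ D (λ l → punchIn (Fin.suc j) (punchIn (Fin.suc k) l)))))))
      ≡⟨ cong₂ _+ᶠ_ (R.*-identityˡ _) (sumF-cong split) ⟩
    y₀ *ᶠ sumF A +ᶠ sumF (λ j → (-ᶠ 1# *ᶠ y₀) *ᶠ A j +ᶠ 1# *ᶠ B n y D j)
      ≡⟨ cong (y₀ *ᶠ sumF A +ᶠ_) (trans (sumF-axpy (λ j → (-ᶠ 1# *ᶠ y₀) *ᶠ A j) 1# (B n y D)) (cong₂ _+ᶠ_ (sumF-scale (-ᶠ 1# *ᶠ y₀) A) (trans (R.*-identityˡ _) (rest n y D ext)))) ⟩
    y₀ *ᶠ sumF A +ᶠ ((-ᶠ 1# *ᶠ y₀) *ᶠ sumF A +ᶠ 0#)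
      ≡⟨ cong (y₀ *ᶠ sumF A +ᶠ_) (trans (R.+-identityʳ _) (R.*-assoc _ _ _)) ⟩
    y₀ *ᶠ sumF A +ᶠ -ᶠ 1# *ᶠ (y₀ *ᶠ sumF A)
      ≡⟨ ⊖-inverse _ ⟩
    0# ∎
    where
    open ≡-Reasoning
    y₀ = y Fin.zero
    E : Fin (suc n) → Carrier
    E j = D (λ l → Fin.suc (punchIn j l))
    A : Fin (suc n) → Carrier
    A j = sg (toℕ j) *ᶠ (y (Fin.suc j) *ᶠ E j)
    B : ∀ n (y : Fin (suc (suc n)) → Carrier) (D : (Fin n → Fin (suc (suc n))) → Carrier) → Fin (suc n) → Carrier
    B n y D j = sg (toℕ j) *ᶠ (y (Fin.suc j) *ᶠ sumF (λ k → sg (toℕ k) *ᶠ (y (Fin.suc (punchIn j k)) *ᶠ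
                    D (λ l → punchIn (Fin.suc j) (punchIn (Fin.suc k) l)))))
    -- Pairs of columns avoiding column zero give the same double sum with one column fewer; `up`
    -- keeps column zero among the surviving columns.
    rest : ∀ n y (D : (Fin n → Fin (suc (suc n))) → Carrier) → (∀ f g → (∀ i → f i ≡ g i) → D f ≡ D g) → sumF (B n y D) ≡ 0#
    rest zero    y D ext = sumF-zero {f = B zero y D} (λ j → trans (cong (sg (toℕ j) *ᶠ_) (R.zeroʳ _)) (R.zeroʳ _))
    rest (suc n) y D ext = trans
      (sumF-cong (λ j → cong (λ z → sg (toℕ j) *ᶠ (y (Fin.suc j) *ᶠ z)) (sumF-cong (λ k →
        cong (λ z → sg (toℕ k) *ᶠ (y (Fin.suc (punchIn j k)) *ᶠ z)) (ext (λ l → punchIn (Fin.suc j) (punchIn (Fin.suc k) l)) (up (λ l → punchIn j (punchIn k l))) (λ { Fin.zero → refl ; (Fin.suc l) → refl }))))))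
      (twoRows n (λ j → y (Fin.suc j)) (λ f → D (up f)) (λ f g h → ext (up f) (up g) (λ { Fin.zero → refl ; (Fin.suc l) → cong Fin.suc (h l) })))
      where
      up : (Fin n → Fin (suc (suc n))) → Fin (suc n) → Fin (suc (suc (suc n)))
      up f Fin.zero    = Fin.zero
      up f (Fin.suc l) = Fin.suc (f l)
    split : ∀ j → sg (suc (toℕ j)) *ᶠ (y (Fin.suc j) *ᶠ (1# *ᶠ (y₀ *ᶠ E j) +ᶠ
        sumF (λ k → sg (suc (toℕ k)) *ᶠ (y (Fin.suc (punchIn j k)) *ᶠ D (λ l → punchIn (Fin.suc j) (punchIn (Fin.suc k) l))))))
        ≡ (-ᶠ 1# *ᶠ y₀) *ᶠ A j +ᶠ 1# *ᶠ B n y D j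
    split j = begin
      sg (suc (toℕ j)) *ᶠ (Y *ᶠ (1# *ᶠ (y₀ *ᶠ E j) +ᶠ sumF (λ k → sg (suc (toℕ k)) *ᶠ Z k)))
        ≡⟨ cong₂ (λ a b → a *ᶠ (Y *ᶠ b)) (sg-suc (toℕ j)) (cong₂ _+ᶠ_ (R.*-identityˡ (y₀ *ᶠ E j))
             (trans (sumF-cong (λ k → trans (cong (_*ᶠ Z k) (sg-suc (toℕ k))) (R.*-assoc _ _ _))) (sumF-scale (-ᶠ 1#) Z′))) ⟩
      (-ᶠ 1# *ᶠ sg (toℕ j)) *ᶠ (Y *ᶠ (y₀ *ᶠ E j +ᶠ -ᶠ 1# *ᶠ C))
        ≡⟨ lem (-ᶠ 1#) (sg (toℕ j)) Y y₀ (E j) C ⟩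
      (-ᶠ 1# *ᶠ y₀) *ᶠ A j +ᶠ (-ᶠ 1# *ᶠ -ᶠ 1#) *ᶠ (sg (toℕ j) *ᶠ (Y *ᶠ C))
        ≡⟨ cong (λ z → (-ᶠ 1# *ᶠ y₀) *ᶠ A j +ᶠ z *ᶠ (sg (toℕ j) *ᶠ (Y *ᶠ C))) neg-square ⟩
      (-ᶠ 1# *ᶠ y₀) *ᶠ A j +ᶠ 1# *ᶠ B n y D j ∎
      where
      Y = y (Fin.suc j)
      Z : Fin n → Carrier
      Z k = y (Fin.suc (punchIn j k)) *ᶠ D (λ l → punchIn (Fin.suc j) (punchIn (Fin.suc k) l))
      Z′ : Fin n → Carrier
      Z′ k = sg (toℕ k) *ᶠ Z k
      C = sumF Z′
      open Solver
      lem : ∀ n s Y y E C → (n *ᶠ s) *ᶠ (Y *ᶠ (y *ᶠ E +ᶠ n *ᶠ C)) ≡ (n *ᶠ y) *ᶠ (s *ᶠ (Y *ᶠ E)) +ᶠ (n *ᶠ n) *ᶠ (s *ᶠ (Y *ᶠ C))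
      lem = solve 6 (λ n s Y y E C → ((n ⊗ s) ⊗ (Y ⊗ (y ⊗ E Solver.⊕ n ⊗ C)))
                                   ⊜ ((n ⊗ y) ⊗ (s ⊗ (Y ⊗ E)) Solver.⊕ (n ⊗ n) ⊗ (s ⊗ (Y ⊗ C)))) refl

  minorOn : ∀ {m} ℓ → (Fin ℓ → Fin m) → Vec (V m) ℓ → Carrier
  minorOn ℓ f N = det ℓ (λ i k → lookup (lookup N i) (f k))

  minorOn-cong : ∀ {m} ℓ {f g : Fin ℓ → Fin m} N → (∀ k → f k ≡ g k) → minorOn ℓ f N ≡ minorOn ℓ g N
  minorOn-cong ℓ N h = det-cong ℓ (λ i k → cong (lookup (lookup N i)) (h k))

  minorOn-∷ : ∀ {m} ℓ (f : Fin (suc ℓ) → Fin m) x N → minorOn (suc ℓ) f (x ∷ N) ≡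
              sumF (λ j → sg (toℕ j) *ᶠ (lookup x (f j) *ᶠ minorOn ℓ (λ k → f (punchIn j k)) N))
  minorOn-∷ ℓ f x N = sumF-cong {suc ℓ} {λ j → signed (toℕ j) (lookup x (f j) *ᶠ minorOn ℓ (λ k → f (punchIn j k)) N)}
    {λ j → sg (toℕ j) *ᶠ (lookup x (f j) *ᶠ minorOn ℓ (λ k → f (punchIn j k)) N)} (λ j → signed-sg (toℕ j) _)

  alt-minorOn : ∀ {m} ℓ (f : Fin ℓ → Fin m) → Alt ℓ (minorOn ℓ f)
  alt-minorOn zero    f = altZ
  alt-minorOn (suc ℓ) f = altS
    (λ x → alt-ext (minorOn-∷ ℓ f x) (alt-sumF (suc ℓ) (λ j → alt-⊙ (sg (toℕ j)) (alt-⊙ (lookup x (f j)) (alt-minorOn ℓ (λ k → f (punchIn j k)))))))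
    (λ N → lin-ext (λ x → minorOn-∷ ℓ f x N) (lin-sumF (suc ℓ) (λ j → lin-⊙ (sg (toℕ j)) (lin-*ʳ (minorOn ℓ (λ k → f (punchIn j k)) N) (lin-lookup (f j))))))
    (adjacent ℓ f)
    where
    adjacent : ∀ {m} ℓ (f : Fin (suc ℓ) → Fin m) → Adj ℓ (minorOn (suc ℓ) f)
    adjacent zero    f = tt
    adjacent (suc ℓ) f x N = trans
      (trans (minorOn-∷ (suc ℓ) f x (x ∷ N)) (sumF-cong (λ j → cong (λ z → sg (toℕ j) *ᶠ (lookup x (f j) *ᶠ z)) (minorOn-∷ ℓ (λ k → f (punchIn j k)) x N))))
      (twoRows ℓ (λ j → lookup x (f j)) (λ g → minorOn ℓ (λ l → f (g l)) N) (λ g g′ h → minorOn-cong ℓ N (λ l → cong f (h l))))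

  det′ : ∀ {n} → Vec (V n) n → Carrier
  det′ {n} = minorOn n id

  sumL-cong : ∀ {A : Set} (xs : List A) {f g : A → Carrier} → (∀ x → f x ≡ g x) → sumL xs f ≡ sumL xs g
  sumL-cong []       h = refl
  sumL-cong (x ∷ xs) h = cong₂ _+ᶠ_ (h x) (sumL-cong xs h)

  alt-sumL : ∀ {A B : Set} {{_ : Space A}} {ℓ} (ys : List B) {F : B → Vec A ℓ → Carrier} → (∀ y → Alt ℓ (F y)) → Alt ℓ (λ xs → sumL ys (λ y → F y xs))
  alt-sumL []       h = alt-0 _
  alt-sumL (y ∷ ys) h = alt-⊕ (h y) (alt-sumL ys h)

  sumL-single : ∀ {A : Set} (_≟ᴬ_ : DecidableEquality A) (xs : List A) a {f : A → Carrier} →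
                (∀ x → x ≢ a → f x ≡ 0#) → ∑ˡ xs (λ x → 𝟙 (x ≟ᴬ a)) ≡ 1 → sumL xs f ≡ f a
  sumL-single _≟ᴬ_ (x ∷ xs) a {f} h e with x ≟ᴬ a
  ... | no ne = trans (cong (_+ᶠ sumL xs f) (h x ne)) (trans (R.+-identityˡ _) (sumL-single _≟ᴬ_ xs a h e))
  ... | yes refl = trans (cong (f x +ᶠ_) (none xs (suc-injective e))) (R.+-identityʳ _)
    where
    none : ∀ xs → ∑ˡ xs (λ y → 𝟙 (y ≟ᴬ x)) ≡ 0 → sumL xs f ≡ 0#
    none []       e = refl
    none (y ∷ ys) e with y ≟ᴬ x
    ... | no ne = trans (cong₂ _+ᶠ_ (h y ne) (none ys e)) (R.+-identityˡ 0#)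

  allVecs-elems : ∀ m ℓ → allVecs m ℓ ≡ Finite.elems (finVec (finFin m) ℓ)
  allVecs-elems m zero    = refl
  allVecs-elems m (suc ℓ) = cong (λ zs → List.concatMap (λ i → List.map (i ∷_) zs) (List.allFin m)) (allVecs-elems m ℓ)

  -- The linear form Σ c_β X_β on tuples of rows.
  form : ∀ {ℓ m} → (Vec (Fin m) ℓ → Carrier) → Vec (V m) ℓ → Carrier
  form c N = formVal c (λ i k → lookup (lookup N i) k)

  alt-form : ∀ {ℓ m} (c : Vec (Fin m) ℓ → Carrier) → Alt ℓ (form c)
  alt-form {ℓ} {m} c = alt-sumL (allVecs m ℓ) (λ β → alt-⊙ (c β) (alt-minorOn ℓ (lookup β)))

  lookup-unit-≢ : ∀ {n} {i j : Fin n} → i ≢ j → lookup (unit i) j ≡ 0#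
  lookup-unit-≢ {i = Fin.zero}  {Fin.zero}  ne = contradiction refl ne
  lookup-unit-≢ {i = Fin.zero}  {Fin.suc j} ne = Vecₚ.lookup-replicate j 0#
  lookup-unit-≢ {i = Fin.suc i} {Fin.zero}  ne = refl
  lookup-unit-≢ {i = Fin.suc i} {Fin.suc j} ne = lookup-unit-≢ (λ e → ne (cong Fin.suc e))

  inc-tail : ∀ {m ℓ b} {β : Vec (Fin m) ℓ} → Inc (b ∷ β) → Inc β
  inc-tail h i j i<j = h (Fin.suc i) (Fin.suc j) (s≤s i<j)

  inc-head : ∀ {m ℓ b} {β : Vec (Fin m) ℓ} → Inc (b ∷ β) → ∀ i → toℕ b < toℕ (lookup β i)
  inc-head h i = h Fin.zero (Fin.suc i) (s≤s z≤n)

  inc-∷ : ∀ {m ℓ b} {β : Vec (Fin m) ℓ} → (∀ i → toℕ b < toℕ (lookup β i)) → Inc β → Inc (b ∷ β)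
  inc-∷ h inc Fin.zero    (Fin.suc j) _         = h j
  inc-∷ h inc (Fin.suc i) (Fin.suc j) (s≤s i<j) = inc i j i<j

  det-column0 : ∀ n (M : Fin (suc n) → Fin (suc n) → Carrier) → (∀ i → M i Fin.zero ≡ 0#) → det (suc n) M ≡ 0#
  det-column0 n M h = sumF-zero {f = λ j → signed (toℕ j) (M Fin.zero j *ᶠ det n (λ i k → M (Fin.suc i) (punchIn j k)))} (at n M h)
    where
    at : ∀ n (M : Fin (suc n) → Fin (suc n) → Carrier) → (∀ i → M i Fin.zero ≡ 0#) → ∀ j → signed (toℕ j) (M Fin.zero j *ᶠ det n (λ i k → M (Fin.suc i) (punchIn j k))) ≡ 0#
    at n       M h Fin.zero    = trans (cong (_*ᶠ det n (λ i k → M (Fin.suc i) (Fin.suc k))) (h Fin.zero)) (R.zeroˡ _)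
    at (suc n) M h (Fin.suc j) = trans (cong (signed (suc (toℕ j))) (trans (cong (M Fin.zero (Fin.suc j) *ᶠ_)
      (det-column0 n (λ i k → M (Fin.suc i) (punchIn (Fin.suc j) k)) (λ i → h (Fin.suc i)))) (R.zeroʳ _))) (signed-0 (suc (toℕ j)))

  <⇒≢ᶠ : ∀ {n} {i j : Fin n} → toℕ i < toℕ j → i ≢ j
  <⇒≢ᶠ h refl = <-irrefl refl h

  -- Compare the first entries. If `b` is smaller, the first row vanishes on all columns of the
  -- minor; if larger, the first column vanishes; if they agree, the expansion has one term and the
  -- tails are compared.
  minor-unit : ∀ {m ℓ} (β β′ : Vec (Fin m) ℓ) → Inc β → Inc β′ →
               (β ≡ β′ → minorOn ℓ (lookup β′) (map unit β) ≡ 1#) × (β ≢ β′ → minorOn ℓ (lookup β′) (map unit β) ≡ 0#)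
  minor-unit [] [] _ _ = (λ _ → refl) , λ ne → contradiction refl ne
  minor-unit {ℓ = suc ℓ} (b ∷ β) (b′ ∷ β′) inc inc′ with <-cmp (toℕ b) (toℕ b′)
  ... | tri< b<b′ b≢b′ _ = (λ { refl → contradiction refl b≢b′ }) ,
    λ _ → sumF-zero (λ j → trans (cong (signed (toℕ j)) (trans (cong (_*ᶠ det ℓ (λ i k → lookup (lookup (map unit β) i) (lookup (b′ ∷ β′) (punchIn j k))))
      (lookup-unit-≢ (away j))) (R.zeroˡ _))) (signed-0 (toℕ j)))
    where
    away : ∀ j → b ≢ lookup (b′ ∷ β′) j
    away Fin.zero    = <⇒≢ᶠ b<b′
    away (Fin.suc j) = <⇒≢ᶠ (<-trans b<b′ (inc-head inc′ j))
  ... | tri> _ b≢b′ b′<b = (λ { refl → contradiction refl b≢b′ }) ,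
    λ _ → det-column0 ℓ (λ i k → lookup (lookup (map unit (b ∷ β)) i) (lookup (b′ ∷ β′) k)) (λ i → trans (cong (λ z → lookup z b′) (Vecₚ.lookup-map i unit (b ∷ β))) (lookup-unit-≢ (λ e → away i (sym e))))
    where
    away : ∀ i → b′ ≢ lookup (b ∷ β) i
    away Fin.zero    = <⇒≢ᶠ b′<b
    away (Fin.suc i) = <⇒≢ᶠ (<-trans b′<b (inc-head inc i))
  ... | tri≈ _ b≡b′ _ with Finₚ.toℕ-injective b≡b′
  ... | refl = (λ { refl → trans reduce (proj₁ (minor-unit β β′ (inc-tail inc) (inc-tail inc′)) refl) }) ,
    λ ne → trans reduce (proj₂ (minor-unit β β′ (inc-tail inc) (inc-tail inc′)) (λ e → ne (cong (b ∷_) e)))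
    where
    reduce : minorOn (suc ℓ) (lookup (b ∷ β′)) (unit b ∷ map unit β) ≡ minorOn ℓ (lookup β′) (map unit β)
    reduce = trans (cong₂ _+ᶠ_ (trans (cong (_*ᶠ minorOn ℓ (lookup β′) (map unit β)) (lookup-unit b)) (R.*-identityˡ _))
      (sumF-zero (λ j → trans (cong (signed (suc (toℕ j))) (trans (cong (_*ᶠ det ℓ (λ i k → lookup (lookup (map unit β) i) (lookup (b ∷ β′) (punchIn (Fin.suc j) k))))
        (lookup-unit-≢ (<⇒≢ᶠ (inc-head inc′ j)))) (R.zeroˡ _))) (signed-0 (suc (toℕ j))))))
      (R.+-identityʳ _)

  form-unit : ∀ {ℓ m} (c : Vec (Fin m) ℓ → Carrier) → (∀ β → ¬ Inc β → c β ≡ 0#) → (∀ (β : Vec (Fin m) ℓ) → Dec (Inc β)) →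
              ∀ β → Inc β → form c (map unit β) ≡ c β
  form-unit {ℓ} {m} c c0 inc? β inc = trans
    (sumL-single (Finite._≟_ (finVec (finFin m) ℓ)) (allVecs m ℓ) β {λ β′ → c β′ *ᶠ minorOn ℓ (lookup β′) (map unit β)} off
      (trans (cong (λ z → ∑ˡ z (λ x → 𝟙 (Finite._≟_ (finVec (finFin m) ℓ) x β))) (allVecs-elems m ℓ)) (Finite.once (finVec (finFin m) ℓ) β)))
    (trans (cong (c β *ᶠ_) (proj₁ (minor-unit β β inc inc) refl)) (R.*-identityʳ _))
    where
    off : ∀ β′ → β′ ≢ β → c β′ *ᶠ minorOn ℓ (lookup β′) (map unit β) ≡ 0#
    off β′ ne with inc? β′
    ... | no ¬inc = trans (cong (_*ᶠ minorOn ℓ (lookup β′) (map unit β)) (c0 β′ ¬inc)) (R.zeroˡ _)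
    ... | yes inc′ = trans (cong (c β′ *ᶠ_) (proj₂ (minor-unit β β′ inc inc′) (λ e → ne (sym e)))) (R.zeroʳ _)

  idM : ∀ n → Vec (V n) n
  idM zero    = []
  idM (suc n) = unit Fin.zero ∷ map (0# ∷_) (idM n)

  ∙-idM : ∀ {n} (x : V n) → x ∙ idM n ≡ x
  ∙-idM []       = refl
  ∙-idM {suc n} (x ∷ xs) = begin
    x ⊙ (1# ∷ 𝟘) ⊕ xs ∙ map (0# ∷_) (idM n)
      ≡⟨ cong (x ⊙ (1# ∷ 𝟘) ⊕_) (sym (∙-map lin-0∷ xs (idM n))) ⟩
    x ⊙ (1# ∷ 𝟘) ⊕ (0# ∷ xs ∙ idM n)
      ≡⟨ cong₂ _∷_ (trans (R.+-identityʳ _) (R.*-identityʳ x)) (trans (cong (_⊕ xs ∙ idM n) (⊙-zeroʳ x)) (trans (⊕-identityˡ _) (∙-idM xs))) ⟩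
    x ∷ xs ∎
    where
    open ≡-Reasoning
    lin-0∷ : Lin (λ (x : V n) → 0# ∷ x)
    lin-0∷ = record { add = λ x y → cong (_∷ (x ⊕ y)) (sym (R.+-identityˡ 0#)) ; scale = λ c x → cong (_∷ (c ⊙ x)) (sym (R.zeroʳ c)) }

  map-∙-idM : ∀ {n m} (N : Vec (V n) m) → map (_∙ idM n) N ≡ N
  map-∙-idM N = trans (Vecₚ.map-cong ∙-idM N) (Vecₚ.map-id N)

  det-idM : ∀ n → det′ (idM n) ≡ 1#
  det-idM zero    = refl
  det-idM (suc n) = trans (cong₂ _+ᶠ_
      (trans (R.*-identityˡ _) (trans (det-cong n (λ i k → cong (λ z → lookup z (Fin.suc k)) (Vecₚ.lookup-map i (0# ∷_) (idM n)))) (det-idM n)))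
      (sumF-zero (λ j → trans (cong (signed (suc (toℕ j))) (trans (cong (_*ᶠ det n (λ i k → lookup (lookup (idM (suc n)) (Fin.suc i)) (punchIn (Fin.suc j) k)))
        (Vecₚ.lookup-replicate j 0#)) (R.zeroˡ _))) (signed-0 (suc (toℕ j))))))
    (R.+-identityʳ 1#)

  -- The difference of the two sides is alternating and zero at the standard basis, hence zero
  -- everywhere by `alt-span`.
  topForm : ∀ {n} {τ : Vec (V n) n → Carrier} → Alt n τ → ∀ N → τ N ≡ τ (idM n) *ᶠ det′ N
  topForm {n} {τ} aτ N = ⊖-≡ _ _ (subst (λ z → τ z +ᶠ ⊖ (τ (idM n) *ᶠ det′ z) ≡ 0#) (map-∙-idM N)
    (alt-span {F = λ z → τ z +ᶠ ⊖ (τ (idM n) *ᶠ det′ z)} (alt-⊕ aτ (alt-⊙ (-ᶠ 1#) (alt-⊙ (τ (idM n)) (alt-minorOn n id)))) (idM n)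
      (trans (cong (λ z → τ (idM n) +ᶠ ⊖ z) (trans (cong (τ (idM n) *ᶠ_) (det-idM n)) (R.*-identityʳ _))) (⊖-inverse _)) N))

  -- Laplace expansion

  sumF-single : ∀ {n} (f : Fin n → Carrier) i → (∀ j → j ≢ i → f j ≡ 0#) → sumF f ≡ f i
  sumF-single {suc n} f Fin.zero    h = trans (cong (f Fin.zero +ᶠ_) (sumF-zero {n} {λ j → f (Fin.suc j)} (λ j → h (Fin.suc j) λ ()))) (R.+-identityʳ _)
  sumF-single {suc n} f (Fin.suc i) h = trans (cong₂ _+ᶠ_ (h Fin.zero λ ()) (sumF-single (λ j → f (Fin.suc j)) i (λ j ne → h (Fin.suc j) (λ e → ne (Finₚ.suc-injective e)))))
    (R.+-identityˡ _)

  removeAt-∷ : ∀ {n} x (xs : V (suc n)) i → removeAt (x ∷ xs) (Fin.suc i) ≡ x ∷ removeAt xs i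
  removeAt-∷ x (_ ∷ _) i = refl

  lookup-removeAt : ∀ {A : Set} {n} (x : Vec A (suc n)) b k → lookup (removeAt x b) k ≡ lookup x (punchIn b k)
  lookup-removeAt (x ∷ xs)      Fin.zero    k           = refl
  lookup-removeAt (x ∷ y ∷ xs) (Fin.suc b) Fin.zero    = refl
  lookup-removeAt (x ∷ y ∷ xs) (Fin.suc b) (Fin.suc k) = lookup-removeAt (y ∷ xs) b k

  removeAt-unit-punchIn : ∀ {n} b (c : Fin n) → removeAt (unit (punchIn b c)) b ≡ unit c
  removeAt-unit-punchIn Fin.zero    c           = refl
  removeAt-unit-punchIn (Fin.suc b) Fin.zero    = trans (removeAt-∷ 1# 𝟘 b) (cong (1# ∷_) (zero-map (lin-removeAt b)))
  removeAt-unit-punchIn (Fin.suc b) (Fin.suc c) = trans (removeAt-∷ 0# (unit (punchIn b c)) b) (cong (0# ∷_) (removeAt-unit-punchIn b c))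

  det-unit-∷ : ∀ {n} b (N : Vec (V (suc n)) n) → det′ (unit b ∷ N) ≡ sg (toℕ b) *ᶠ det′ (map (λ x → removeAt x b) N)
  det-unit-∷ {n} b N = trans (minorOn-∷ n id (unit b) N) (trans (sumF-single _ b off)
    (cong (sg (toℕ b) *ᶠ_) (trans (cong (_*ᶠ minorOn n (punchIn b) N) (lookup-unit b)) (trans (R.*-identityˡ _)
      (det-cong n (λ i k → trans (sym (lookup-removeAt (lookup N i) b k)) (cong (λ z → lookup z k) (sym (Vecₚ.lookup-map i (λ x → removeAt x b) N)))))))))
    where
    off : ∀ j → j ≢ b → sg (toℕ j) *ᶠ (lookup (unit b) j *ᶠ minorOn n (punchIn j) N) ≡ 0#
    off j ne = trans (cong (sg (toℕ j) *ᶠ_) (trans (cong (_*ᶠ minorOn n (punchIn j) N) (lookup-unit-≢ (λ e → ne (sym e)))) (R.zeroˡ _))) (R.zeroʳ _)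

  unpunch : ∀ {n ℓ} b (β : Vec (Fin (suc n)) ℓ) → (∀ i → b ≢ lookup β i) → ∃ λ β′ → β ≡ map (punchIn b) β′
  unpunch b []      h = [] , refl
  unpunch b (c ∷ β) h with unpunch b β (λ i → h (Fin.suc i))
  ... | β′ , refl = punchOut (h Fin.zero) ∷ β′ , cong (_∷ map (punchIn b) β′) (sym (Finₚ.punchIn-punchOut (h Fin.zero)))

  punchIn-strict : ∀ {n} b (x y : Fin n) → toℕ x < toℕ y → toℕ (punchIn b x) < toℕ (punchIn b y)
  punchIn-strict b x y h = ≰⇒> (λ le → <⇒≱ h (Finₚ.punchIn-cancel-≤ b y x le))

  punchIn-strict⁻ : ∀ {n} b (x y : Fin n) → toℕ (punchIn b x) < toℕ (punchIn b y) → toℕ x < toℕ y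
  punchIn-strict⁻ b x y h = ≰⇒> (λ le → <⇒≱ h (Finₚ.punchIn-mono-≤ b y x le))

  inc-map-punchIn : ∀ {n ℓ} b (β : Vec (Fin n) ℓ) → Inc β → Inc (map (punchIn b) β)
  inc-map-punchIn b β inc i j h rewrite Vecₚ.lookup-map i (punchIn b) β | Vecₚ.lookup-map j (punchIn b) β =
    punchIn-strict b _ _ (inc i j h)

  inc-map-punchIn⁻ : ∀ {n ℓ} b (β : Vec (Fin n) ℓ) → Inc (map (punchIn b) β) → Inc β
  inc-map-punchIn⁻ b β inc i j h = punchIn-strict⁻ b _ _
    (subst₂ (λ x y → toℕ x < toℕ y) (Vecₚ.lookup-map i (punchIn b) β) (Vecₚ.lookup-map j (punchIn b) β) (inc i j h))

  inc-≥ : ∀ {m r} lo (γ : Vec (Fin m) r) → Inc γ → (∀ i → lo ≤ toℕ (lookup γ i)) → ∀ k → lo + toℕ k ≤ toℕ (lookup γ k)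
  inc-≥ lo (g ∷ γ) inc h Fin.zero    = ≤-trans (≤-reflexive (+-identityʳ lo)) (h Fin.zero)
  inc-≥ lo (g ∷ γ) inc h (Fin.suc k) = ≤-trans (≤-reflexive (+-suc lo (toℕ k)))
    (inc-≥ (suc lo) γ (inc-tail inc) (λ i → ≤-<-trans (h Fin.zero) (inc-head inc i)) k)

  inc-≤ : ∀ {m r} (γ : Vec (Fin m) r) → Inc γ → ∀ k → toℕ (lookup γ k) + r ≤ m + toℕ k
  inc-≤ {m} (g ∷ [])     inc Fin.zero = ≤-trans (≤-reflexive (+-comm (toℕ g) 1)) (≤-trans (Finₚ.toℕ<n g) (≤-reflexive (sym (+-identityʳ m))))
  inc-≤ {m} {suc (suc r)} (g ∷ g′ ∷ γ) inc Fin.zero = ≤-trans (≤-reflexive (+-suc (toℕ g) (suc r)))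
    (≤-trans (+-monoˡ-≤ (suc r) (inc-head inc Fin.zero)) (inc-≤ (g′ ∷ γ) (inc-tail inc) Fin.zero))
  inc-≤ {m} {suc r} (g ∷ γ) inc (Fin.suc k) = ≤-trans (≤-reflexive (+-suc _ r))
    (≤-trans (s≤s (inc-≤ γ (inc-tail inc) k)) (≤-reflexive (sym (+-suc m (toℕ k)))))

  inc-full : ∀ {m} (γ : Vec (Fin m) m) → Inc γ → ∀ k → lookup γ k ≡ k
  inc-full {m} γ inc k = Finₚ.toℕ-injective (≤-antisym
    (+-cancelˡ-≤ m _ _ (≤-trans (≤-reflexive (+-comm m _)) (inc-≤ γ inc k)))
    (inc-≥ 0 γ inc (λ _ → z≤n) k))

  sgΣ : ∀ {n ℓ} → Vec (Fin n) ℓ → Carrier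
  sgΣ []      = 1#
  sgΣ (b ∷ β) = sg (toℕ b) *ᶠ sgΣ β

  -- The sign (-1)^(ℓ(ℓ-1)/2).
  cst : ℕ → Carrier
  cst zero    = 1#
  cst (suc ℓ) = sg ℓ *ᶠ cst ℓ

  *-swap : ∀ a b c → a *ᶠ (b *ᶠ c) ≡ b *ᶠ (a *ᶠ c)
  *-swap a b c = trans (sym (R.*-assoc a b c)) (trans (cong (_*ᶠ c) (R.*-comm a b)) (R.*-assoc b a c))

  *-square : ∀ {x y} → x *ᶠ x ≡ 1# → y *ᶠ y ≡ 1# → (x *ᶠ y) *ᶠ (x *ᶠ y) ≡ 1#
  *-square {x} {y} hx hy = trans (lem x y) (trans (cong₂ _*ᶠ_ hx hy) (R.*-identityˡ 1#))
    where
    open Solver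
    lem : ∀ x y → (x *ᶠ y) *ᶠ (x *ᶠ y) ≡ (x *ᶠ x) *ᶠ (y *ᶠ y)
    lem = solve 2 (λ x y → ((x ⊗ y) ⊗ (x ⊗ y)) ⊜ ((x ⊗ x) ⊗ (y ⊗ y))) refl

  cst-square : ∀ ℓ → cst ℓ *ᶠ cst ℓ ≡ 1#
  cst-square zero    = R.*-identityˡ 1#
  cst-square (suc ℓ) = *-square (sg-square ℓ) (cst-square ℓ)

  sgΣ-square : ∀ {n ℓ} (β : Vec (Fin n) ℓ) → sgΣ β *ᶠ sgΣ β ≡ 1#
  sgΣ-square []      = R.*-identityˡ 1#
  sgΣ-square (b ∷ β) = *-square (sg-square (toℕ b)) (sgΣ-square β)

  square-flip : ∀ {s x y} → s *ᶠ s ≡ 1# → x ≡ s *ᶠ y → y ≡ s *ᶠ x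
  square-flip {s} {x} {y} h e = trans (sym (⊙-inverse y h)) (cong (s *ᶠ_) (sym e))

  toℕ-punchIn : ∀ {n} b (c : Fin n) → toℕ b < toℕ (punchIn b c) → toℕ (punchIn b c) ≡ suc (toℕ c)
  toℕ-punchIn Fin.zero    c           h       = refl
  toℕ-punchIn (Fin.suc b) (Fin.suc c) (s≤s h) = cong suc (toℕ-punchIn b c h)

  -- Deleting column `b` shifts each of the ℓ larger entries down by one. Over the recursion of
  -- `laplace` these signs accumulate to `cst`.
  sgΣ-punchIn : ∀ {n ℓ} b (β : Vec (Fin n) ℓ) → (∀ i → toℕ b < toℕ (lookup (map (punchIn b) β) i)) →
                sgΣ (map (punchIn b) β) ≡ sg ℓ *ᶠ sgΣ β
  sgΣ-punchIn b []      h = sym (R.*-identityˡ 1#)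
  sgΣ-punchIn {ℓ = suc ℓ} b (c ∷ β) h = begin
    sg (toℕ (punchIn b c)) *ᶠ sgΣ (map (punchIn b) β)
      ≡⟨ cong₂ _*ᶠ_ (trans (cong sg (toℕ-punchIn b c (h Fin.zero))) (sg-suc (toℕ c))) (sgΣ-punchIn b β (λ i → h (Fin.suc i))) ⟩
    (-ᶠ 1# *ᶠ sg (toℕ c)) *ᶠ (sg ℓ *ᶠ sgΣ β)
      ≡⟨ lem (-ᶠ 1#) (sg (toℕ c)) (sg ℓ) (sgΣ β) ⟩
    (-ᶠ 1# *ᶠ sg ℓ) *ᶠ (sg (toℕ c) *ᶠ sgΣ β)
      ≡⟨ cong (_*ᶠ (sg (toℕ c) *ᶠ sgΣ β)) (sym (sg-suc ℓ)) ⟩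
    sg (suc ℓ) *ᶠ (sg (toℕ c) *ᶠ sgΣ β) ∎
    where
    open ≡-Reasoning
    open Solver
    lem : ∀ n s t x → (n *ᶠ s) *ᶠ (t *ᶠ x) ≡ (n *ᶠ t) *ᶠ (s *ᶠ x)
    lem = solve 4 (λ n s t x → ((n ⊗ s) ⊗ (t ⊗ x)) ⊜ ((n ⊗ t) ⊗ (s ⊗ x))) refl

  -- Expansion along the first row, a unit vector, deletes the first column of `β` and leaves the
  -- same statement for the remaining rows and columns.
  laplace : ∀ ℓ {k} (β : Vec (Fin (ℓ + k)) ℓ) (γ : Vec (Fin (ℓ + k)) k) → Inc β → Inc γ → Disjoint β γ →
            ∀ W → det′ (map unit β ++ W) ≡ cst ℓ *ᶠ (sgΣ β *ᶠ minorOn k (lookup γ) W)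
  laplace zero {k} [] γ _ inc _ W = sym (trans (R.*-identityˡ _) (trans (R.*-identityˡ _) (minorOn-cong k W (inc-full γ inc))))
  laplace (suc ℓ) {k} (b ∷ β₁) γ₁ incβ incγ disj W
    with unpunch b β₁ (λ i → <⇒≢ᶠ (inc-head incβ i)) | unpunch b γ₁ (disj Fin.zero)
  ... | β , refl | γ , refl = begin
    det′ (unit b ∷ (map unit (map (punchIn b) β) ++ W))
      ≡⟨ det-unit-∷ b (map unit (map (punchIn b) β) ++ W) ⟩
    sg (toℕ b) *ᶠ det′ (map rem (map unit (map (punchIn b) β) ++ W))
      ≡⟨ cong (λ z → sg (toℕ b) *ᶠ det′ z) (trans (Vecₚ.map-++ rem (map unit (map (punchIn b) β)) W) (cong (_++ map rem W) (units β))) ⟩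
    sg (toℕ b) *ᶠ det′ (map unit β ++ map rem W)
      ≡⟨ cong (sg (toℕ b) *ᶠ_) (laplace ℓ β γ (inc-map-punchIn⁻ b β (inc-tail incβ)) (inc-map-punchIn⁻ b γ incγ) disj′ (map rem W)) ⟩
    sg (toℕ b) *ᶠ (cst ℓ *ᶠ (sgΣ β *ᶠ minorOn k (lookup γ) (map rem W)))
      ≡⟨ cong₂ (λ x y → sg (toℕ b) *ᶠ (cst ℓ *ᶠ (x *ᶠ y))) (square-flip (sg-square ℓ) (sgΣ-punchIn b β (inc-head incβ)))
           (det-cong k (λ i j → trans (cong (λ z → lookup z (lookup γ j)) (Vecₚ.lookup-map i rem W))
             (trans (lookup-removeAt (lookup W i) b (lookup γ j)) (cong (lookup (lookup W i)) (sym (Vecₚ.lookup-map j (punchIn b) γ)))))) ⟩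
    sg (toℕ b) *ᶠ (cst ℓ *ᶠ ((sg ℓ *ᶠ sgΣ (map (punchIn b) β)) *ᶠ minorOn k (lookup (map (punchIn b) γ)) W))
      ≡⟨ lem (sg (toℕ b)) (cst ℓ) (sg ℓ) (sgΣ (map (punchIn b) β)) _ ⟩
    (sg ℓ *ᶠ cst ℓ) *ᶠ ((sg (toℕ b) *ᶠ sgΣ (map (punchIn b) β)) *ᶠ minorOn k (lookup (map (punchIn b) γ)) W) ∎
    where
    open ≡-Reasoning
    rem : V (suc (ℓ + k)) → V (ℓ + k)
    rem x = removeAt x b
    units : ∀ {r} (β : Vec (Fin (ℓ + k)) r) → map rem (map unit (map (punchIn b) β)) ≡ map unit β
    units []      = refl
    units (c ∷ β) = cong₂ _∷_ (removeAt-unit-punchIn b c) (units β)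
    disj′ : Disjoint β γ
    disj′ i j e = disj (Fin.suc i) j (trans (Vecₚ.lookup-map i (punchIn b) β) (trans (cong (punchIn b) e) (sym (Vecₚ.lookup-map j (punchIn b) γ))))
    lem : ∀ s c t x μ → s *ᶠ (c *ᶠ ((t *ᶠ x) *ᶠ μ)) ≡ (t *ᶠ c) *ᶠ ((s *ᶠ x) *ᶠ μ)
    lem s c t x μ = begin
      s *ᶠ (c *ᶠ ((t *ᶠ x) *ᶠ μ))    ≡⟨ cong (λ z → s *ᶠ (c *ᶠ z)) (R.*-assoc t x μ) ⟩
      s *ᶠ (c *ᶠ (t *ᶠ (x *ᶠ μ)))    ≡⟨ cong (s *ᶠ_) (*-swap c t _) ⟩
      s *ᶠ (t *ᶠ (c *ᶠ (x *ᶠ μ)))    ≡⟨ *-swap s t _ ⟩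
      t *ᶠ (s *ᶠ (c *ᶠ (x *ᶠ μ)))    ≡⟨ cong (t *ᶠ_) (*-swap s c _) ⟩
      t *ᶠ (c *ᶠ (s *ᶠ (x *ᶠ μ)))    ≡⟨ sym (R.*-assoc t c _) ⟩
      (t *ᶠ c) *ᶠ (s *ᶠ (x *ᶠ μ))    ≡⟨ cong ((t *ᶠ c) *ᶠ_) (sym (R.*-assoc s x μ)) ⟩
      (t *ᶠ c) *ᶠ ((s *ᶠ x) *ᶠ μ)    ∎

  complement : ∀ ℓ {k} (β : Vec (Fin (ℓ + k)) ℓ) → Inc β → ∃ λ (γ : Vec (Fin (ℓ + k)) k) → Inc γ × Disjoint β γ
  complement zero    {k} [] _ = Vec.allFin k ,
    (λ i j h → subst₂ (λ x y → toℕ x < toℕ y) (sym (Vecₚ.lookup-allFin i)) (sym (Vecₚ.lookup-allFin j)) h) , λ ()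
  complement (suc ℓ) (b ∷ β₁) inc with unpunch b β₁ (λ i → <⇒≢ᶠ (inc-head inc i))
  ... | β , refl with complement ℓ β (inc-map-punchIn⁻ b β (inc-tail inc))
  ...   | γ , incγ , disj = map (punchIn b) γ , inc-map-punchIn b γ incγ , disj′
    where
    disj′ : Disjoint (b ∷ map (punchIn b) β) (map (punchIn b) γ)
    disj′ Fin.zero    k e = Finₚ.punchInᵢ≢i b (lookup γ k) (trans (sym (Vecₚ.lookup-map k (punchIn b) γ)) (sym e))
    disj′ (Fin.suc i) k e = disj i k (Finₚ.punchIn-injective b _ _
      (trans (sym (Vecₚ.lookup-map i (punchIn b) β)) (trans e (Vecₚ.lookup-map k (punchIn b) γ))))

  -- Changing the sign of every other coordinate turns the signed complementary minors of
  -- the Laplace expansion into the unsigned coordinates of the wedge product.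
  twist : ∀ {n} → V n → V n
  twist []       = []
  twist (x ∷ xs) = x ∷ ⊖ twist xs

  lin-twist : ∀ {n} → Lin (twist {n})
  lin-twist {zero} = record { add = λ { [] [] → refl } ; scale = λ { c [] → refl } }
  lin-twist {suc n} = record
    { add   = λ { (x ∷ xs) (y ∷ ys) → cong (_ ∷_) (add (lin-⊙ (-ᶠ 1#) lin-twist) xs ys) }
    ; scale = λ { c (x ∷ xs) → cong (_ ∷_) (scale (lin-⊙ (-ᶠ 1#) lin-twist) c xs) } }

  twist-involutive : ∀ {n} (x : V n) → twist (twist x) ≡ x
  twist-involutive []       = refl
  twist-involutive (x ∷ xs) = cong (x ∷_) (trans (cong ⊖_ (scale lin-twist (-ᶠ 1#) (twist xs)))
    (trans (⊙-inverse (twist (twist xs)) neg-square) (twist-involutive xs)))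

  twist-unit : ∀ {n} (p : Fin n) → twist (unit p) ≡ sg (toℕ p) ⊙ unit p
  twist-unit Fin.zero    = cong₂ _∷_ (sym (R.*-identityˡ 1#)) (trans (cong ⊖_ (zero-map lin-twist)) (trans (⊙-zeroʳ _) (sym (⊙-zeroʳ 1#))))
  twist-unit (Fin.suc p) = cong₂ _∷_ (sym (R.zeroʳ _)) (trans (cong ⊖_ (twist-unit p))
    (trans (sym (⊙-assoc _ _ (unit p))) (cong (_⊙ unit p) (sym (sg-suc (toℕ p))))))

  low-twist : ∀ {n} b (x : V n) → Low b x → Low b (twist x)
  low-twist b       []       h = tt
  low-twist {suc n} zero (x ∷ xs) (e , h) = e , has-⊙ (low-sub 0) (-ᶠ 1#) {twist xs} (low-twist 0 xs h)
  low-twist (suc b) (x ∷ xs) h = has-⊙ (low-sub b) (-ᶠ 1#) {twist xs} (low-twist b xs h)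

  twistDet : ℕ → Carrier
  twistDet n = det′ (map twist (idM n))

  det-twist : ∀ {n} (N : Vec (V n) n) → det′ (map twist N) ≡ twistDet n *ᶠ det′ N
  det-twist N = topForm {τ = λ N → det′ (map twist N)} (alt-map lin-twist (alt-minorOn _ id)) N

  map-twist-involutive : ∀ {n m} (N : Vec (V n) m) → map twist (map twist N) ≡ N
  map-twist-involutive N = trans (sym (Vecₚ.map-∘ twist twist N)) (trans (Vecₚ.map-cong twist-involutive N) (Vecₚ.map-id N))

  twistDet-square : ∀ n → twistDet n *ᶠ twistDet n ≡ 1#
  twistDet-square n = trans (sym (det-twist (map twist (idM n)))) (trans (cong det′ (map-twist-involutive (idM n))) (det-idM n))

  pull-signs : ∀ {n} ℓ {k F} (W : Vec (V n) k) → Alt (ℓ + k) F → (β : Vec (Fin n) ℓ) →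
               F (map twist (map unit β) ++ W) ≡ sgΣ β *ᶠ F (map unit β ++ W)
  pull-signs zero    W aF [] = sym (R.*-identityˡ _)
  pull-signs (suc ℓ) {F = F} W aF (b ∷ β) = begin
    F (twist (unit b) ∷ (map twist (map unit β) ++ W))
      ≡⟨ cong (λ z → F (z ∷ (map twist (map unit β) ++ W))) (twist-unit b) ⟩
    F (sg (toℕ b) ⊙ unit b ∷ (map twist (map unit β) ++ W))
      ≡⟨ scale (alt-lin aF _) (sg (toℕ b)) (unit b) ⟩
    sg (toℕ b) *ᶠ F (unit b ∷ (map twist (map unit β) ++ W))
      ≡⟨ cong (sg (toℕ b) *ᶠ_) (pull-signs ℓ W (alt-tail aF (unit b)) β) ⟩
    sg (toℕ b) *ᶠ (sgΣ β *ᶠ F (unit b ∷ (map unit β ++ W)))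
      ≡⟨ sym (R.*-assoc _ _ _) ⟩
    (sg (toℕ b) *ᶠ sgΣ β) *ᶠ F (unit b ∷ (map unit β ++ W)) ∎
    where open ≡-Reasoning

  twistCst : ℕ → ℕ → Carrier
  twistCst ℓ k = cst ℓ *ᶠ twistDet (ℓ + k)

  twistCst-square : ∀ ℓ k → twistCst ℓ k *ᶠ twistCst ℓ k ≡ 1#
  twistCst-square ℓ k = *-square (cst-square ℓ) (twistDet-square (ℓ + k))

  -- Twisting all rows multiplies the determinant by a constant, while twisting the unit vectors
  -- alone contributes `sgΣ β`, exactly the sign in `laplace` that depends on `β`.
  laplace-twist : ∀ ℓ {k} (β : Vec (Fin (ℓ + k)) ℓ) (γ : Vec (Fin (ℓ + k)) k) → Inc β → Inc γ → Disjoint β γ →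
                  ∀ W → minorOn k (lookup γ) (map twist W) ≡ twistCst ℓ k *ᶠ det′ (map unit β ++ W)
  laplace-twist ℓ {k} β γ incβ incγ disj W = begin
    minorOn k (lookup γ) (map twist W)
      ≡⟨ square-flip (sgΣ-square β) (sym (square-flip (cst-square ℓ) (laplace ℓ β γ incβ incγ disj (map twist W)))) ⟩
    sgΣ β *ᶠ (cst ℓ *ᶠ det′ (map unit β ++ map twist W))
      ≡⟨ *-swap (sgΣ β) (cst ℓ) _ ⟩
    cst ℓ *ᶠ (sgΣ β *ᶠ det′ (map unit β ++ map twist W))
      ≡⟨ cong (cst ℓ *ᶠ_) (trans (sym (pull-signs ℓ {F = det′} (map twist W) (alt-minorOn (ℓ + k) id) β))
           (trans (cong det′ (sym (Vecₚ.map-++ twist (map unit β) W))) (det-twist (map unit β ++ W)))) ⟩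
    cst ℓ *ᶠ (twistDet (ℓ + k) *ᶠ det′ (map unit β ++ W))
      ≡⟨ sym (R.*-assoc _ _ _) ⟩
    twistCst ℓ k *ᶠ det′ (map unit β ++ W) ∎
    where open ≡-Reasoning

  open Over K public using (Vector; Matrix; Subset; lincomb; LinIndep; HasIndep; InSpan; InV; SameSpace)

  -- Spans and linear independence

  lookup-∙ : ∀ {n m} (c : V n) (M : Vec (V m) n) k → lookup (c ∙ M) k ≡ sumF (λ i → lookup c i *ᶠ lookup (lookup M i) k)
  lookup-∙ []       []      k = Vecₚ.lookup-replicate k 0#
  lookup-∙ (c ∷ cs) (x ∷ M) k = trans (Vecₚ.lookup-zipWith _+ᶠ_ k (c ⊙ x) (cs ∙ M))
    (cong₂ _+ᶠ_ (Vecₚ.lookup-map k (c *ᶠ_) x) (lookup-∙ cs M k))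

  toVec : ∀ {r m} → Matrix r m → Vec (V m) r
  toVec M = tabulate (λ i → tabulate (M i))

  fromVec : ∀ {r m} → Vec (V m) r → Matrix r m
  fromVec N i k = lookup (lookup N i) k

  lookup-toVec : ∀ {r m} (M : Matrix r m) i k → lookup (lookup (toVec M) i) k ≡ M i k
  lookup-toVec M i k = trans (cong (λ z → lookup z k) (Vecₚ.lookup∘tabulate (λ i → tabulate (M i)) i)) (Vecₚ.lookup∘tabulate (M i) k)

  toVec-fromVec : ∀ {r m} (N : Vec (V m) r) → toVec (fromVec N) ≡ N
  toVec-fromVec N = trans (Vecₚ.tabulate-cong (λ i → Vecₚ.tabulate∘lookup (lookup N i))) (Vecₚ.tabulate∘lookup N)

  lookup-ext : ∀ {A : Set} {n} {x y : Vec A n} → (∀ k → lookup x k ≡ lookup y k) → x ≡ y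
  lookup-ext {x = x} {y} h = trans (sym (Vecₚ.tabulate∘lookup x)) (trans (Vecₚ.tabulate-cong h) (Vecₚ.tabulate∘lookup y))

  lincomb-∙ : ∀ {r m} c (M : Matrix r m) k → lincomb c M k ≡ lookup (tabulate c ∙ toVec M) k
  lincomb-∙ c M k = trans (sumF-cong (λ i → sym (cong₂ _*ᶠ_ (Vecₚ.lookup∘tabulate c i) (lookup-toVec M i k))))
    (sym (lookup-∙ (tabulate c) (toVec M) k))

  Span : ∀ {n r} → Vec (V n) r → V n → Set
  Span M x = ∃ λ c → c ∙ M ≡ x

  span? : ∀ {n r} (M : Vec (V n) r) x → Dec (Span M x)
  span? {r = r} M x = ∃? (finV r) (λ c → c ∙ M ≟ᵛ x)

  span-sub : ∀ {n r} (M : Vec (V n) r) → Subspace (Span M)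
  span-sub M = record
    { has-0 = 𝟘 , zero-map (lin-∙ˡ M)
    ; has-⊕ = λ { (c , refl) (d , refl) → c ⊕ d , add (lin-∙ˡ M) c d }
    ; has-⊙ = λ { s (c , refl) → s ⊙ c , scale (lin-∙ˡ M) s c } }

  span-row : ∀ {n r} (M : Vec (V n) r) i → Span M (lookup M i)
  span-row (x ∷ M) Fin.zero    = 1# ∷ 𝟘 , trans (cong₂ _⊕_ (⊙-identity x) (zero-map (lin-∙ˡ M))) (⊕-identityʳ x)
  span-row (x ∷ M) (Fin.suc i) = let c , e = span-row M i in
    0# ∷ c , trans (cong₂ _⊕_ (⊙-zeroˡ x) e) (⊕-identityˡ _)

  span-rows : ∀ {n r s} (M : Vec (V n) r) (N : Vec (V n) s) → (∀ i → Span M (lookup N i)) → ∃ λ P → map (_∙ M) P ≡ N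
  span-rows M []      h = [] , refl
  span-rows M (x ∷ N) h = let c , e = h Fin.zero ; P , e′ = span-rows M N (λ i → h (Fin.suc i)) in c ∷ P , cong₂ _∷_ e e′

  Indep : ∀ {n r} → Vec (V n) r → Set
  Indep M = ∀ c → c ∙ M ≡ 𝟘 → c ≡ 𝟘

  indep-injective : ∀ {n r} (M : Vec (V n) r) → Indep M → ∀ c d → c ∙ M ≡ d ∙ M → c ≡ d
  indep-injective M ind c d e = ⊖-≡ c d (ind (c ⊕ ⊖ d) (trans (axpy (lin-∙ˡ M) c (-ᶠ 1#) d) (trans (cong (_⊕ ⊖ (d ∙ M)) e) (⊖-inverse (d ∙ M)))))

  linIndep⇒indep : ∀ {r m} (M : Matrix r m) → LinIndep M → Indep (toVec M)
  linIndep⇒indep M li c e = lookup-ext (λ i → trans (li (lookup c)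
    (λ k → trans (lincomb-∙ (lookup c) M k) (trans (cong (λ z → lookup (z ∙ toVec M) k) (Vecₚ.tabulate∘lookup c))
      (trans (cong (λ z → lookup z k) e) (Vecₚ.lookup-replicate k 0#)))) i) (sym (Vecₚ.lookup-replicate i 0#)))

  indep⇒linIndep : ∀ {r m} (M : Matrix r m) → Indep (toVec M) → LinIndep M
  indep⇒linIndep M ind c h i = trans (sym (Vecₚ.lookup∘tabulate c i)) (trans (cong (λ z → lookup z i) (ind (tabulate c)
    (lookup-ext (λ k → trans (sym (lincomb-∙ c M k)) (trans (h k) (sym (Vecₚ.lookup-replicate k 0#))))))) (Vecₚ.lookup-replicate i 0#))

  inSpan⇒span : ∀ {r m} (M : Matrix r m) x → InSpan M x → Span (toVec M) (tabulate x)
  inSpan⇒span M x (c , h) = tabulate c , lookup-ext (λ k → trans (sym (lincomb-∙ c M k)) (trans (h k) (sym (Vecₚ.lookup∘tabulate x k))))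

  span⇒inSpan : ∀ {r m} (M : Matrix r m) x → Span (toVec M) (tabulate x) → InSpan M x
  span⇒inSpan M x (c , e) = lookup c , λ k → trans (lincomb-∙ (lookup c) M k)
    (trans (cong (λ z → lookup (z ∙ toVec M) k) (Vecₚ.tabulate∘lookup c)) (trans (cong (λ z → lookup z k) e) (Vecₚ.lookup∘tabulate x k)))

  low⇒lookup : ∀ {n} b (x : V n) → Low b x → ∀ k → b ≤ toℕ k → lookup x k ≡ 0#
  low⇒lookup zero    (x ∷ xs) (p , _) Fin.zero    h = p
  low⇒lookup zero    (x ∷ xs) (_ , p) (Fin.suc k) h = low⇒lookup zero xs p k z≤n
  low⇒lookup (suc b) (x ∷ xs) p       (Fin.suc k) (s≤s h) = low⇒lookup b xs p k h

  lookup⇒low : ∀ {n} b (x : V n) → (∀ k → b ≤ toℕ k → lookup x k ≡ 0#) → Low b x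
  lookup⇒low b       []       h = tt
  lookup⇒low zero    (x ∷ xs) h = h Fin.zero z≤n , lookup⇒low zero xs (λ k _ → h (Fin.suc k) z≤n)
  lookup⇒low (suc b) (x ∷ xs) h = lookup⇒low b xs (λ k p → h (Fin.suc k) (s≤s p))

  inV⇒low : ∀ {m} b (x : Vector m) → InV b x → Low b (tabulate x)
  inV⇒low b x h = lookup⇒low b (tabulate x) (λ k p → trans (Vecₚ.lookup∘tabulate x k) (h k p))

  -- Turns "dimension at least d" into "size at least q^d", the only form in which the counting
  -- arguments see dimensions; `#⇒hasIndep` is the way back.
  hasIndep⇒# : ∀ {m d} {S : Subset m} {P : V m → Set} (P? : ∀ x → Dec (P x)) → Subspace P → (∀ x → S x → P (tabulate x)) →
               HasIndep S d → q ^ d ≤ # (finV m) P?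
  hasIndep⇒# {m} {d} {S} {P} P? sub S⇒P (v , sv , li) = ≤-trans (≤-reflexive (sym (#⊤ d)))
    (#-injection (finV d) (finV m) (λ _ → yes tt) P? (_∙ toVec v)
      (λ c _ → sub-∙ sub c (toVec v) (λ i → subst P (sym (Vecₚ.lookup∘tabulate (λ i → tabulate (v i)) i)) (S⇒P (v i) (sv i))))
      (λ c c′ _ _ → indep-injective (toVec v) (linIndep⇒indep v li) c c′))

  #span≤ : ∀ {n r} (M : Vec (V n) r) → # (finV n) (span? M) ≤ q ^ r
  #span≤ {n} {r} M = begin
    # (finV n) (span? M)
      ≤⟨ ∑-mono (finV n) at ⟩
    ∑ (finV n) (λ x → # (finV r) (λ c → c ∙ M ≟ᵛ x))
      ≡⟨ ∑-swap (finV n) (finV r) _ ⟩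
    ∑ (finV r) (λ c → # (finV n) (λ x → c ∙ M ≟ᵛ x))
      ≡⟨ ∑-cong (finV r) (λ c → #-single (finV n) (λ x → c ∙ M ≟ᵛ x) (c ∙ M) refl (λ x → sym)) ⟩
    size (finV r)
      ≡⟨ size-V r ⟩
    q ^ r ∎
    where
    open ≤-Reasoning
    at : ∀ x → 𝟙 (span? M x) ≤ # (finV r) (λ c → c ∙ M ≟ᵛ x)
    at x with span? M x
    ... | no _ = z≤n
    ... | yes (c , e) = n≢0⇒n>0 (#-≢0 (finV r) (λ c → c ∙ M ≟ᵛ x) {c} e)

  indep-∷ : ∀ {n r} x (M : Vec (V n) r) → Indep M → ¬ Span M x → Indep (x ∷ M)
  indep-∷ x M ind ¬span (c ∷ cs) e with c ≟ 0#
  ... | yes refl = cong (0# ∷_) (ind cs (trans (sym (trans (cong (_⊕ cs ∙ M) (⊙-zeroˡ x)) (⊕-identityˡ _))) e))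
  ... | no c≢0 = contradiction (⊖ (c⁻¹ ⊙ cs) , (begin
    ⊖ (c⁻¹ ⊙ cs) ∙ M       ≡⟨ trans (scale (lin-∙ˡ M) (-ᶠ 1#) (c⁻¹ ⊙ cs)) (cong ⊖_ (scale (lin-∙ˡ M) c⁻¹ cs)) ⟩
    ⊖ (c⁻¹ ⊙ cs ∙ M)       ≡⟨ cong (λ z → ⊖ (c⁻¹ ⊙ z)) (⊖-≡ (cs ∙ M) (⊖ (c ⊙ x)) cancel) ⟩
    ⊖ (c⁻¹ ⊙ ⊖ (c ⊙ x))    ≡⟨ negate ⟩
    x                      ∎)) ¬span
    where
    open ≡-Reasoning
    c⁻¹ = proj₁ (inverse c c≢0)
    c⁻¹*c : c⁻¹ *ᶠ c ≡ 1#
    c⁻¹*c = trans (R.*-comm _ _) (proj₂ (inverse c c≢0))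
    cancel : cs ∙ M ⊕ ⊖ ⊖ (c ⊙ x) ≡ 𝟘
    cancel = trans (cong (cs ∙ M ⊕_) (⊙-inverse (c ⊙ x) neg-square)) (trans (⊕-comm _ _) e)
    negate : ⊖ (c⁻¹ ⊙ ⊖ (c ⊙ x)) ≡ x
    negate = trans (cong ⊖_ (trans (sym (⊙-assoc c⁻¹ (-ᶠ 1#) (c ⊙ x))) (trans (cong (_⊙ (c ⊙ x)) (R.*-comm c⁻¹ (-ᶠ 1#)))
      (trans (⊙-assoc (-ᶠ 1#) c⁻¹ (c ⊙ x)) (cong ⊖_ (⊙-inverse x c⁻¹*c)))))) (⊙-inverse x neg-square)

  -- Greedy extension: `d` vectors span at most q^d points, so a set with q^(d+1) elements contains
  -- a vector outside their span.
  basisIn : ∀ {m} {P : V m → Set} (P? : ∀ x → Dec (P x)) → ∀ d → q ^ d ≤ # (finV m) P? →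
            ∃ λ (X : Vec (V m) d) → Indep X × (∀ i → P (lookup X i))
  basisIn P? zero    h = [] , (λ { [] _ → refl }) , λ ()
  basisIn {m} {P} P? (suc d) h with basisIn {m} {P} P? d (≤-trans (q^-mono (n≤1+n d)) h)
  ... | X , ind , inP with ∃? (finV m) (λ x → P? x ×-dec ¬? (span? X x))
  ...   | yes (x , px , ¬span) = x ∷ X , indep-∷ x X ind ¬span , λ { Fin.zero → px ; (Fin.suc i) → inP i }
  ...   | no none = contradiction (≤-trans h (≤-trans (#-mono (finV m) P? (span? X) inSpan) (#span≤ X))) (<⇒≱ (q^-strict (n<1+n d)))
    where
    inSpan : ∀ x → P x → Span X x
    inSpan x px with span? X x
    ... | yes s = s
    ... | no ¬s = contradiction (x , px , ¬s) none

  #⇒hasIndep : ∀ {m d} {S : Subset m} {P : V m → Set} (P? : ∀ x → Dec (P x)) → (∀ x → P x → S (lookup x)) →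
               q ^ d ≤ # (finV m) P? → HasIndep S d
  #⇒hasIndep {d = d} {S} {P} P? P⇒S h with basisIn {P = P} P? d h
  ... | X , ind , inP = (λ i → lookup (lookup X i)) , (λ i → P⇒S _ (inP i)) ,
    indep⇒linIndep (fromVec X) (subst Indep (sym (toVec-fromVec X)) ind)

  spanLow? : ∀ {n r} (M : Vec (V n) r) b x → Dec (Span M x × Low b x)
  spanLow? M b x = span? M x ×-dec low? b x

  spanLow-sub : ∀ {n r} (M : Vec (V n) r) b → Subspace (λ x → Span M x × Low b x)
  spanLow-sub M b = sub-× (span-sub M) (low-sub b)

  #spanLow : ∀ {n r} (M : Vec (V n) r) → Indep M → ∀ b → # (finV n) (spanLow? M b) ≡ card b M
  #spanLow {n} {r} M ind b = #-image (finV r) (finV n) (_∙ M) (indep-injective M ind) (low? b)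

  map-∙-∙ : ∀ {n r s} (c : V s) (P : Vec (V r) s) (M : Vec (V n) r) → c ∙ map (_∙ M) P ≡ (c ∙ P) ∙ M
  map-∙-∙ c P M = sym (∙-map (lin-∙ˡ M) c P)

  -- An injective square matrix `P` is surjective by counting, so `r` independent vectors in the
  -- span of the `r` rows of `R` span all of it.
  exchange : ∀ {n r} (R : Vec (V n) r) (P : Vec (V r) r) → Indep (map (_∙ R) P) → ∀ c → Span (map (_∙ R) P) (c ∙ R)
  exchange {n} {r} R P ind c =
    let d , _ , e = #-surjection (finV r) (finV r) {P = λ _ → ⊤} {Q = λ _ → ⊤} (λ _ → yes tt) (λ _ → yes tt) (_∙ P) (λ _ _ → tt)
          (λ a b _ _ eq → indep-injective P indP a b eq) ≤-refl c tt
    in d , trans (map-∙-∙ d P R) (cong (_∙ R) e)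
    where
    indP : Indep P
    indP d e = ind d (trans (map-∙-∙ d P R) (trans (cong (_∙ R) e) (zero-map (lin-∙ˡ R))))

  ∙-++ : ∀ {A : Set} {{_ : Space A}} {m n} (c : V m) (d : V n) (M : Vec A m) (N : Vec A n) → (c ++ d) ∙ (M ++ N) ≡ c ∙ M ⊕ d ∙ N
  ∙-++ []       d []      N = sym (⊕-identityˡ _)
  ∙-++ (c ∷ cs) d (x ∷ M) N = trans (cong (c ⊙ x ⊕_) (∙-++ cs d M N)) (sym (⊕-assoc _ _ _))

  ++-𝟘 : ∀ {m n} (c : V m) (d : V n) → c ++ d ≡ 𝟘 → c ≡ 𝟘 × d ≡ 𝟘
  ++-𝟘 []       d e = refl , e
  ++-𝟘 (c ∷ cs) d e = let p , r = ++-𝟘 cs d (Vecₚ.∷-injectiveʳ e) in cong₂ _∷_ (Vecₚ.∷-injectiveˡ e) p , r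

  -- Sums of an element of the span of `M` and one of the span of `W` are unique. Hence the sizes of
  -- the two intersections with V_b multiply to at most q^b, and when they reach it, every vector of
  -- V_b splits inside V_b.
  module Complementary {n ℓ k} (M : Vec (V n) ℓ) (W : Vec (V n) k) (ind : Indep (M ++ W)) where

    pairs-injective : ∀ c c′ d d′ → c ∙ M ⊕ d ∙ W ≡ c′ ∙ M ⊕ d′ ∙ W → c ≡ c′ × d ≡ d′
    pairs-injective c c′ d d′ e = Vecₚ.++-injective c c′ (indep-injective (M ++ W) ind (c ++ d) (c′ ++ d′)
      (trans (∙-++ c d M W) (trans e (sym (∙-++ c′ d′ M W)))))

    indepʳ : Indep W
    indepʳ d e = proj₂ (++-𝟘 (𝟘 {V ℓ}) d (ind (𝟘 ++ d) (trans (∙-++ 𝟘 d M W) (trans (cong₂ _⊕_ (zero-map (lin-∙ˡ M)) e) (⊕-identityˡ 𝟘)))))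

    sum-low : ∀ b (p : V ℓ × V k) → Low b (proj₁ p ∙ M) × Low b (proj₂ p ∙ W) → Low b (proj₁ p ∙ M ⊕ proj₂ p ∙ W)
    sum-low b (c , d) (lc , ld) = has-⊕ (low-sub b) {c ∙ M} {d ∙ W} lc ld

    lowPair? : ∀ b (p : V ℓ × V k) → Dec (Low b (proj₁ p ∙ M) × Low b (proj₂ p ∙ W))
    lowPair? b (c , d) = low? b (c ∙ M) ×-dec low? b (d ∙ W)

    card-*-≤ : ∀ b → b ≤ n → card b M * card b W ≤ q ^ b
    card-*-≤ b b≤n = ≤-trans (≤-reflexive (sym (#-pair (finV ℓ) (finV k) (λ c → low? b (c ∙ M)) (λ d → low? b (d ∙ W)))))
      (≤-trans (#-injection (finPair (finV ℓ) (finV k)) (finV n) (lowPair? b) (low? b) (λ (c , d) → c ∙ M ⊕ d ∙ W) (sum-low b)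
        (λ (c , d) (c′ , d′) _ _ e → let p , r = pairs-injective c c′ d d′ e in cong₂ _,_ p r))
      (≤-reflexive (#Low b≤n)))

    low-sum : ∀ b → b ≤ n → q ^ b ≤ card b M * card b W → ∀ x → Low b x →
              ∃₂ λ c d → Low b (d ∙ W) × c ∙ M ⊕ d ∙ W ≡ x
    low-sum b b≤n le x lx =
      let (c , d) , (_ , ld) , e = #-surjection (finPair (finV ℓ) (finV k)) (finV n) (lowPair? b) (low? b) (λ (c , d) → c ∙ M ⊕ d ∙ W) (sum-low b)
            (λ (c , d) (c′ , d′) _ _ e → let p , r = pairs-injective c c′ d d′ e in cong₂ _,_ p r)
            (≤-trans (≤-reflexive (#Low b≤n)) (≤-trans le (≤-reflexive (sym (#-pair (finV ℓ) (finV k) (λ c → low? b (c ∙ M)) (λ d → low? b (d ∙ W)))))))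
            x lx
      in c , d , ld , e

  -- Decompositions acquire their new vector between the rows of `M` and the old vectors, whereas
  -- `wedge` is evaluated with it in front; the sign is that of moving it past ℓ arguments.
  cast-insert : ∀ {A : Set} {{_ : Space A}} ℓ {k} {G : Vec A (suc (ℓ + k)) → Carrier} → Alt (suc (ℓ + k)) G →
                ∀ .(eq : ℓ + suc k ≡ suc (ℓ + k)) (xs : Vec A ℓ) y (ys : Vec A k) →
                G (Vec.cast eq (xs ++ y ∷ ys)) ≡ signed ℓ (G (y ∷ xs ++ ys))
  cast-insert zero {G = G} aG eq [] y ys = cong (λ z → G (y ∷ z)) (Vecₚ.cast-is-id _ ys)
  cast-insert (suc ℓ) {G = G} aG eq (x ∷ xs) y ys = begin
    G (x ∷ Vec.cast _ (xs ++ y ∷ ys))    ≡⟨ cast-insert ℓ (alt-tail aG x) _ xs y ys ⟩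
    signed ℓ (G (x ∷ y ∷ xs ++ ys))           ≡⟨ cong (signed ℓ) (swap-neg aG x y _) ⟩
    signed ℓ (-ᶠ G (y ∷ x ∷ xs ++ ys))        ≡⟨ signed-neg ℓ _ ⟩
    -ᶠ signed ℓ (G (y ∷ x ∷ xs ++ ys))        ∎
    where open ≡-Reasoning

  alt-cast : ∀ {A : Set} {{_ : Space A}} {m m′} (eq : m ≡ m′) {G : Vec A m′ → Carrier} → Alt m′ G → Alt m (λ xs → G (Vec.cast eq xs))
  alt-cast refl {G} aG = alt-ext (λ xs → cong G (Vecₚ.cast-is-id refl xs)) aG

  signed-* : ∀ i x → signed i 1# *ᶠ signed i x ≡ x
  signed-* zero    x = R.*-identityˡ x
  signed-* (suc i) x = trans (trans (sym (R.-‿distribˡ-* _ _)) (trans (cong -ᶠ_ (sym (R.-‿distribʳ-* _ _))) (R.⁻¹-involutive _))) (signed-* i x)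

  formVal-toVec : ∀ {ℓ m} (c : Vec (Fin m) ℓ → Carrier) (M : Matrix ℓ m) → formVal c M ≡ form c (toVec M)
  formVal-toVec {ℓ} {m} c M = sumL-cong (allVecs m ℓ) (λ β → cong (c β *ᶠ_) (det-cong ℓ (λ i k → sym (lookup-toVec M i (lookup β k)))))

  open Over K public using (appendRow; Inᵥ)

  laplace-cast : ∀ {n} ℓ k (eq : ℓ + k ≡ n) (β : Vec (Fin n) ℓ) (γ : Vec (Fin n) k) → Inc β → Inc γ → Disjoint β γ →
                 ∀ W → minorOn k (lookup γ) (map twist W) ≡ twistCst ℓ k *ᶠ det′ (Vec.cast eq (map unit β ++ W))
  laplace-cast ℓ k refl β γ incβ incγ disj W = trans (laplace-twist ℓ β γ incβ incγ disj W)
    (cong (λ z → twistCst ℓ k *ᶠ det′ z) (sym (Vecₚ.cast-is-id refl (map unit β ++ W))))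

  complement-cast : ∀ {n} ℓ k → ℓ + k ≡ n → (β : Vec (Fin n) ℓ) → Inc β → ∃ λ (γ : Vec (Fin n) k) → Inc γ × Disjoint β γ
  complement-cast ℓ k refl β inc = complement ℓ β inc

  twistCst-≢0 : ∀ ℓ k {x} → twistCst ℓ k *ᶠ x ≡ 0# → x ≡ 0#
  twistCst-≢0 ℓ k {x} z = trans (sym (⊙-inverse x (twistCst-square ℓ k))) (trans (cong (twistCst ℓ k *ᶠ_) z) (R.zeroʳ _))

  appendRow-snoc : ∀ {k m} (W : Matrix k m) x i j → appendRow W x i j ≡ lookup (lookup (insertAt (toVec W) (Fin.fromℕ k) (tabulate x)) i) j
  appendRow-snoc {zero}  W x Fin.zero    j = sym (Vecₚ.lookup∘tabulate x j)
  appendRow-snoc {suc k} W x Fin.zero    j = sym (Vecₚ.lookup∘tabulate (W Fin.zero) j)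
  appendRow-snoc {suc k} W x (Fin.suc i) j = appendRow-snoc (λ i → W (Fin.suc i)) x i j

  minor-append : ∀ {k m} (W : Matrix k m) x γ → minor (appendRow W x) γ ≡ signed (toℕ (Fin.fromℕ k)) (minorOn (suc k) (lookup γ) (tabulate x ∷ toVec W))
  minor-append {k} W x γ = trans (det-cong (suc k) (λ i j → appendRow-snoc W x i (lookup γ j)))
    (alt-insertAt (alt-minorOn (suc k) (lookup γ)) (toVec W) (Fin.fromℕ k) (tabulate x))

  span⇒Inᵥ : ∀ {k m} (W : Matrix k m) x → Span (toVec W) (tabulate x) → Inᵥ W x
  span⇒Inᵥ {k} W x (c , e) γ _ = trans (minor-append W x γ) (trans (cong (signed (toℕ (Fin.fromℕ k)))
    (trans (cong (λ z → minorOn (suc k) (lookup γ) (z ∷ toVec W)) (sym e))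
      (lin-vanish (alt-lin (alt-minorOn (suc k) (lookup γ)) (toVec W)) c (toVec W) (alt-repeat (alt-minorOn (suc k) (lookup γ)) (toVec W)))))
    (signed-0 (toℕ (Fin.fromℕ k))))

  inc-removeAt : ∀ {n ℓ} (β : Vec (Fin n) (suc ℓ)) i → Inc β → Inc (removeAt β i)
  inc-removeAt β i inc a b h = subst₂ (λ x y → toℕ x < toℕ y) (sym (lookup-removeAt β i a)) (sym (lookup-removeAt β i b))
    (inc _ _ (punchIn-strict i a b h))

  -- Expand x in the basis e_β, W; its coefficient at e_{β_i} is, up to a nonzero factor, the
  -- coordinate of W ∧ x complementary to β without β_i.
  Inᵥ-coefficient : ∀ ℓ {k} (β : Vec (Fin (ℓ + k)) ℓ) → Inc β → (W̃ : Matrix k (ℓ + k)) → det′ (map unit β ++ map twist (toVec W̃)) ≢ 0# →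
    ∀ x → Inᵥ W̃ x → ∀ c d → c ∙ map unit β ⊕ d ∙ map twist (toVec W̃) ≡ twist (tabulate x) → ∀ i → lookup c i ≡ 0#
  Inᵥ-coefficient (suc ℓ) {k} β inc W̃ ne x annihilates c d e i = fromZero (det-zero (complement-cast ℓ (suc k) (+-suc ℓ k) β′ (inc-removeAt β i inc)))
    where
    open ≡-Reasoning
    Ŵ = toVec W̃
    W = map twist Ŵ
    y = twist (tabulate x)
    β′ = removeAt β i
    b = lookup β i
    c′ = removeAt c i
    u = lookup c i
    D : Vec (V (suc ℓ + k)) (suc ℓ) → Carrier
    D X = det′ (X ++ W)
    aD : Alt (suc ℓ) D
    aD = alt-++ (suc ℓ) {F = det′} W (alt-minorOn (suc ℓ + k) id)
    units : map unit β ≡ insertAt (map unit β′) i (unit b)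
    units = trans (cong (map unit) (sym (Vecₚ.insertAt-removeAt β i))) (Vecₚ.map-insertAt unit b β′ i)
    nonzero : D (unit b ∷ map unit β′) ≢ 0#
    nonzero z = ne (trans (cong D units) (trans (alt-insertAt aD (map unit β′) i (unit b)) (trans (cong (signed (toℕ i)) z) (signed-0 (toℕ i)))))
    y≡ : u ⊙ unit b ⊕ (c′ ++ d) ∙ (map unit β′ ++ W) ≡ y
    y≡ = begin
      u ⊙ unit b ⊕ (c′ ++ d) ∙ (map unit β′ ++ W)
        ≡⟨ cong (u ⊙ unit b ⊕_) (∙-++ c′ d (map unit β′) W) ⟩
      u ⊙ unit b ⊕ (c′ ∙ map unit β′ ⊕ d ∙ W)
        ≡⟨ sym (⊕-assoc _ _ _) ⟩
      (u ⊙ unit b ⊕ c′ ∙ map unit β′) ⊕ d ∙ W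
        ≡⟨ cong (_⊕ d ∙ W) (sym (trans (cong₂ _∙_ (sym (Vecₚ.insertAt-removeAt c i)) units) (∙-insertAt c′ (map unit β′) i u (unit b)))) ⟩
      c ∙ map unit β ⊕ d ∙ W
        ≡⟨ e ⟩
      y ∎
    det-zero : ∃ (λ (γ : Vec (Fin (suc ℓ + k)) (suc k)) → Inc γ × Disjoint β′ γ) → det′ (y ∷ (map unit β′ ++ W)) ≡ 0#
    det-zero (γ , incγ , disj) = signed-≡0 ℓ (trans (sym (cast-insert ℓ {G = det′} (alt-minorOn (suc ℓ + k) id) (+-suc ℓ k) (map unit β′) y W))
      (twistCst-≢0 ℓ (suc k) (trans (sym (laplace-cast ℓ (suc k) (+-suc ℓ k) β′ γ (inc-removeAt β i inc) incγ disj (y ∷ W)))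
        (trans (cong (minorOn (suc k) (lookup γ)) (cong₂ _∷_ (twist-involutive (tabulate x)) (map-twist-involutive Ŵ)))
          (signed-≡0 (toℕ (Fin.fromℕ k)) (trans (sym (minor-append W̃ x γ)) (annihilates γ incγ)))))))
    fromZero : det′ (y ∷ (map unit β′ ++ W)) ≡ 0# → u ≡ 0#
    fromZero z with u ≟ 0#
    ... | yes p = p
    ... | no u≢0 = contradiction (x*y≡0 u≢0 (begin
      u *ᶠ D (unit b ∷ map unit β′)
        ≡⟨ sym (R.+-identityʳ _) ⟩
      u *ᶠ D (unit b ∷ map unit β′) +ᶠ 0#
        ≡⟨ cong₂ _+ᶠ_ (sym (scale linD u (unit b))) (sym (lin-vanish linD (c′ ++ d) (map unit β′ ++ W) (alt-repeat (alt-minorOn (suc ℓ + k) id) (map unit β′ ++ W)))) ⟩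
      det′ (u ⊙ unit b ∷ (map unit β′ ++ W)) +ᶠ det′ ((c′ ++ d) ∙ (map unit β′ ++ W) ∷ (map unit β′ ++ W))
        ≡⟨ sym (add linD (u ⊙ unit b) ((c′ ++ d) ∙ (map unit β′ ++ W))) ⟩
      det′ ((u ⊙ unit b ⊕ (c′ ++ d) ∙ (map unit β′ ++ W)) ∷ (map unit β′ ++ W))
        ≡⟨ cong (λ v → det′ (v ∷ (map unit β′ ++ W))) y≡ ⟩
      det′ (y ∷ (map unit β′ ++ W))
        ≡⟨ z ⟩
      0# ∎)) nonzero
      where
      linD : Lin (λ v → det′ (v ∷ (map unit β′ ++ W)))
      linD = alt-lin (alt-minorOn (suc ℓ + k) id) (map unit β′ ++ W)

  -- The vectors `unit` of `β` and the twisted rows form a basis, and by `Inᵥ-coefficient` the twist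
  -- of `x` has no part along the former; undoing the twist gives a combination of the rows.
  Inᵥ⇒span : ∀ ℓ {k} (β : Vec (Fin (ℓ + k)) ℓ) → Inc β → (W̃ : Matrix k (ℓ + k)) → det′ (map unit β ++ map twist (toVec W̃)) ≢ 0# →
             ∀ x → Inᵥ W̃ x → Span (toVec W̃) (tabulate x)
  Inᵥ⇒span ℓ {k} β inc W̃ ne x annihilates = fromCoordinates
    (exchange (idM (ℓ + k)) B (subst Indep (sym (map-∙-idM B)) (injective-rows (alt-minorOn (ℓ + k) id) B ne)) (twist (tabulate x)))
    where
    open ≡-Reasoning
    Ŵ = toVec W̃
    B = map unit β ++ map twist Ŵ
    fromCoordinates : Span (map (_∙ idM (ℓ + k)) B) (twist (tabulate x) ∙ idM (ℓ + k)) → Span Ŵ (tabulate x)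
    fromCoordinates (a , e) with Vec.splitAt ℓ a
    ... | c , d , refl = d , (begin
      d ∙ Ŵ                      ≡⟨ cong (d ∙_) (sym (map-twist-involutive Ŵ)) ⟩
      d ∙ map twist (map twist Ŵ) ≡⟨ sym (∙-map lin-twist d (map twist Ŵ)) ⟩
      twist (d ∙ map twist Ŵ)    ≡⟨ cong twist (trans (sym (⊕-identityˡ _)) (cong (_⊕ d ∙ map twist Ŵ) (sym (trans (cong (_∙ map unit β) c≡𝟘) (zero-map (lin-∙ˡ (map unit β))))))) ⟩
      twist (c ∙ map unit β ⊕ d ∙ map twist Ŵ) ≡⟨ cong twist coords ⟩
      twist (twist (tabulate x)) ≡⟨ twist-involutive _ ⟩
      tabulate x                 ∎)
      where
      coords : c ∙ map unit β ⊕ d ∙ map twist Ŵ ≡ twist (tabulate x)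
      coords = trans (sym (∙-++ c d (map unit β) (map twist Ŵ))) (trans (cong ((c ++ d) ∙_) (sym (map-∙-idM B))) (trans e (∙-idM _)))
      c≡𝟘 : c ≡ 𝟘
      c≡𝟘 = lookup-ext (λ i → trans (Inᵥ-coefficient ℓ β inc W̃ ne x annihilates c d coords i) (sym (Vecₚ.lookup-replicate i 0#)))

  card-twist : ∀ {n r} b (M : Vec (V n) r) → card b M ≤ card b (map twist M)
  card-twist {r = r} b M = #-mono (finV r) _ _ (λ c l → subst (Low b) (∙-map lin-twist c M) (low-twist b (c ∙ M) l))

  high-combination : ∀ {n r} {P : V n → Set} → Subspace P → ∀ a (c : V r) (M : Vec (V n) r) → High a c →
                     (∀ i → a ≤ toℕ i → P (lookup M i)) → P (c ∙ M)
  high-combination s a       []       []      h p = has-0 s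
  high-combination s zero    (c ∷ cs) (x ∷ M) h p = sub-∙ s (c ∷ cs) (x ∷ M) (λ i → p i z≤n)
  high-combination {P = P} s (suc a) (c ∷ cs) (x ∷ M) (refl , h) p = subst P (sym (trans (cong (_⊕ cs ∙ M) (⊙-zeroˡ x)) (⊕-identityˡ _)))
    (high-combination s a cs M h (λ i q → p (Fin.suc i) (s≤s q)))

  -- Schubert conditions for an excess sequence

  module Flag (e : ℕ → ℕ) (e0 : e 0 ≡ 0) (e-mono : ∀ {i j} → i ≤ j → e i ≤ e j) where

    -- Conditions dim (L ∩ V_{j + e j}) ≥ j, imposed only for those j ≤ ℓ with e j < k: the
    -- others hold for every ℓ-dimensional L in dimension ℓ + k.
    Cond : ℕ → ℕ → (ℕ → ℕ) → Set
    Cond ℓ k N = ∀ j → j ≤ ℓ → e j < k → q ^ j ≤ N (j + e j)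

    abstract
      cond? : ∀ ℓ k N → Dec (Cond ℓ k N)
      cond? ℓ k N = map′ (λ f j j≤ℓ → f (s≤s j≤ℓ)) (λ f {j} j<1+ℓ → f j (≤-pred j<1+ℓ))
        (allUpTo? (λ j → (e j <? k) →-dec (q ^ j ≤? N (j + e j))) (suc ℓ))

    cond-map : ∀ {ℓ k} N N′ → (∀ j → j ≤ ℓ → e j < k → N (j + e j) ≤ N′ (j + e j)) → Cond ℓ k N → Cond ℓ k N′
    cond-map N N′ f c j p r = ≤-trans (c j p r) (f j p r)

    Ω : ∀ ℓ k {n} → Vec (V n) ℓ → Set
    Ω ℓ k M = Cond ℓ k (cards M)

    Ω? : ∀ ℓ k {n} (M : Vec (V n) ℓ) → Dec (Ω ℓ k M)
    Ω? ℓ k M = cond? ℓ k (cards M)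

    -- Independence of the rows is not demanded because a nonzero value of an alternating form
    -- implies it (`injective-rows`).
    T : ∀ ℓ k {n} → (Vec (V n) ℓ → Carrier) → ℕ
    T ℓ k {n} F = ∑ (finM n ℓ) (λ M → 𝟙 (Ω? ℓ k M) * 𝟙 (nonzero? (F M)))

    T-vanish : ∀ {ℓ k n} {F : Vec (V n) ℓ → Carrier} → T ℓ k F ≡ 0 → ∀ M → Ω ℓ k M → F M ≡ 0#
    T-vanish {ℓ} {k} {n} {F} e M ω with F M ≟ 0# | ∑-≡0 (finM n ℓ) _ e M
    ... | yes p | _ = p
    ... | no ¬p | z = contradiction (trans (sym (cong₂ _*_ (𝟙-yes (Ω? ℓ k M) ω) (𝟙-yes (nonzero? (F M)) ¬p)))
                        (trans (cong (λ d → 𝟙 (Ω? ℓ k M) * d) (𝟙-cong (nonzero? (F M)) (yes ¬p) (λ x → x) (λ _ → ¬p))) z)) λ ()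

    T-≡0 : ∀ {ℓ k n} {F : Vec (V n) ℓ → Carrier} → (∀ M → Ω ℓ k M → F M ≡ 0#) → T ℓ k F ≡ 0
    T-≡0 {ℓ} {k} {n} {F} h = ∑-zero (finM n ℓ) _ at
      where
      at : ∀ M → 𝟙 (Ω? ℓ k M) * 𝟙 (nonzero? (F M)) ≡ 0
      at M with Ω? ℓ k M
      ... | no _  = refl
      ... | yes ω = cong (_+ 0) (𝟙-no (nonzero? (F M)) (λ ne → ne (h M ω)))

    T-witness : ∀ {ℓ k n} {F : Vec (V n) ℓ → Carrier} → T ℓ k F ≢ 0 → ∃ λ M → Ω ℓ k M × F M ≢ 0#
    T-witness {ℓ} {k} {n} {F} h with ∑-pos (finM n ℓ) _ h
    ... | M , p with Ω? ℓ k M | nonzero? (F M)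
    ... | yes ω | yes ne = M , ω , ne
    ... | yes ω | no _   = contradiction refl p
    ... | no _  | _      = contradiction refl p

    T-≢0 : ∀ {ℓ k n} {F : Vec (V n) ℓ → Carrier} M → Ω ℓ k M → F M ≢ 0# → T ℓ k F ≢ 0
    T-≢0 M ω ne e = ne (T-vanish e M ω)

    module Step {n a : ℕ} (s : Split n a) (ℓ k : ℕ) (fits : ∀ j → j ≤ ℓ → e j < k → j + e j ≤ a) where
      open Split s

      Allowed? : ∀ (l : V ℓ) (M : Vec (V n) ℓ) → Dec (Cond ℓ k (cardPerp l M))
      Allowed? l M = cond? ℓ k (cardPerp l M)

      -- The vector `w` is free for the sake of comparison: `w = v` gives the tuples with h-values
      -- `l`, and `w = 𝟘` evaluates `F` inside the hyperplane under the conditions belonging to the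
      -- column `l`.
      slice : (Vec (V (suc n)) ℓ → Carrier) → V ℓ → V (suc n) → ℕ
      slice F l w = ∑ (finM n ℓ) (λ M → 𝟙 (Allowed? l M) * 𝟙 (nonzero? (F (shear w l (map g M)))))

      T-slices : ∀ F → T ℓ k F ≡ ∑ (finV ℓ) (λ l → slice F l v)
      T-slices F = trans (∑-lift ℓ _) (∑-cong (finV ℓ) (λ l → ∑-cong (finM n ℓ) (λ M →
        cong (_* 𝟙 (nonzero? (F (lift l M)))) (𝟙-cong (Ω? ℓ k (lift l M)) (Allowed? l M)
          (cond-map (cards (lift l M)) (cardPerp l M) (λ j p r → ≤-reflexive (card-lift (fits j p r) l M)))
          (cond-map (cardPerp l M) (cards (lift l M)) (λ j p r → ≤-reflexive (sym (card-lift (fits j p r) l M))))))))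

      Ω-map-g : ∀ M → Ω ℓ k M → Ω ℓ k (map g M)
      Ω-map-g M = cond-map (cards M) (cards (map g M)) (λ j p r → ≤-reflexive (sym (card-map-g s (fits j p r) M)))

      Ω-map-g⁻ : ∀ M → Ω ℓ k (map g M) → Ω ℓ k M
      Ω-map-g⁻ M = cond-map (cards (map g M)) (cards M) (λ j p r → ≤-reflexive (card-map-g s (fits j p r) M))

      slice-𝟘 : ∀ F w → slice F 𝟘 w ≡ T ℓ k (λ M → F (map g M))
      slice-𝟘 F w = ∑-cong (finM n ℓ) (λ M → cong₂ _*_
        (𝟙-cong (Allowed? 𝟘 M) (Ω? ℓ k M) (cond-map (cardPerp 𝟘 M) (cards M) (λ j _ _ → ≤-reflexive (cardPerp-𝟘 M (j + e j))))
          (cond-map (cards M) (cardPerp 𝟘 M) (λ j _ _ → ≤-reflexive (sym (cardPerp-𝟘 M (j + e j))))))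
        (cong (λ z → 𝟙 (nonzero? (F z))) (shear-𝟘ʳ w (map g M))))

    module Step⁺ {n a : ℕ} (s : Split n a) (ℓ k : ℕ) (fits : ∀ j → j ≤ suc ℓ → e j < k → j + e j ≤ a)
                 (k≤e : k ≤ e (suc ℓ)) {F : Vec (V (suc n)) (suc ℓ) → Carrier} (aF : Alt (suc ℓ) F) where
      open Split s
      open Step s (suc ℓ) k fits

      -- Row reduction at a nonzero entry `u` of `l` moves all conditions onto `X` and confines `y`
      -- and `w` to the first argument of `F`. As `u` does not depend on `w`, slices with different
      -- `w` can be compared summand by summand.
      slice-pivot : ∀ l → l ≢ 𝟘 → ∃ λ u → u ≢ 0# × ∀ w → slice F l w ≡
        ∑ (finM n ℓ) (λ X → 𝟙 (Ω? ℓ k X) * # (finV n) (λ y → nonzero? (F ((g y ⊕ u ⊙ w) ∷ map g X))))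
      slice-pivot l l≢𝟘 with nonzero-entry l l≢𝟘
      ... | i , u≢0 with insertAt-view l i
      ... | l′ , u′ , refl = u , u≢0 , λ w → begin
        slice F (insertAt l′ i u′) w
          ≡⟨ cong (λ z → slice F (insertAt l′ i z) w) (sym (Vecₚ.insertAt-lookup l′ i u′)) ⟩
        slice F (insertAt l′ i u) w
          ≡⟨ P.∑-reduced _ ⟩
        ∑ (finV n) (λ y → ∑ (finM n ℓ) (λ X → 𝟙 (Allowed? (insertAt l′ i u) (P.reduced y X))
          * 𝟙 (nonzero? (F (shear w (insertAt l′ i u) (map g (P.reduced y X)))))))
          ≡⟨ ∑-cong (finV n) (λ y → ∑-cong (finM n ℓ) (λ X → cong₂ _*_
               (𝟙-cong (Allowed? (insertAt l′ i u) (P.reduced y X)) (Ω? ℓ k X)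
                 (λ c j p r → subst (q ^ j ≤_) (P.cardPerp-reduced y X _) (c j (m≤n⇒m≤1+n p) r))
                 (λ c j p r → subst (q ^ j ≤_) (sym (P.cardPerp-reduced y X _)) (c j (below j p r) r)))
               (𝟙-cong (nonzero? _) (nonzero? _)
                 (λ ne z → ne (trans (P.form-reduced aF lin-g w y X) (trans (cong (signed (toℕ i)) z) (signed-0 (toℕ i)))))
                 (λ ne z → ne (signed-≡0 (toℕ i) (trans (sym (P.form-reduced aF lin-g w y X)) z)))))) ⟩
        ∑ (finV n) (λ y → ∑ (finM n ℓ) (λ X → 𝟙 (Ω? ℓ k X) * 𝟙 (nonzero? (F ((g y ⊕ u ⊙ w) ∷ map g X)))))
          ≡⟨ ∑-swap (finV n) (finM n ℓ) _ ⟩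
        ∑ (finM n ℓ) (λ X → ∑ (finV n) (λ y → 𝟙 (Ω? ℓ k X) * 𝟙 (nonzero? (F ((g y ⊕ u ⊙ w) ∷ map g X)))))
          ≡⟨ ∑-cong (finM n ℓ) (λ X → ∑-*ˡ (finV n) (𝟙 (Ω? ℓ k X)) _) ⟩
        ∑ (finM n ℓ) (λ X → 𝟙 (Ω? ℓ k X) * # (finV n) (λ y → nonzero? (F ((g y ⊕ u ⊙ w) ∷ map g X)))) ∎
        where
        open ≡-Reasoning
        u = lookup (insertAt l′ i u′) i
        module P = Pivot {n} l′ i u u≢0
        -- The condition at `suc ℓ` would need `e (suc ℓ) < k`, so no imposed condition is lost with
        -- the pivot row.
        below : ∀ j → j ≤ suc ℓ → e j < k → j ≤ ℓ
        below j p r with j ≟ⁿ suc ℓ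
        ... | yes refl = contradiction r (≤⇒≯ k≤e)
        ... | no j≢ = ≤-pred (≤∧≢⇒< p j≢)

      -- A form vanishing on the members of Ω inside the hyperplane only sees the intersection with it.
      T-contract : T (suc ℓ) k (λ M → F (map g M)) ≡ 0 →
                   T (suc ℓ) k F ≡ nz (suc ℓ) * (q ^ n * T ℓ k (λ X → F (v ∷ map g X)))
      T-contract vanish = begin
        T (suc ℓ) k F                                      ≡⟨ T-slices F ⟩
        ∑ (finV (suc ℓ)) (λ l → slice F l v)               ≡⟨ ∑-cong (finV (suc ℓ)) (λ l → at l (l ≟ᵛ 𝟘)) ⟩
        ∑ (finV (suc ℓ)) (λ l → 𝟙 (¬? (l ≟ᵛ 𝟘)) * (q ^ n * T′))  ≡⟨ ∑-*ʳ (finV (suc ℓ)) (q ^ n * T′) _ ⟩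
        nz (suc ℓ) * (q ^ n * T′)                          ∎
        where
        open ≡-Reasoning
        G : Vec (V n) ℓ → Carrier
        G X = F (v ∷ map g X)
        T′ = T ℓ k G
        -- `y ∷ X` still belongs to Ω, so `F` is zero on its image in the hyperplane and only the
        -- multiple of `v` remains. The value is the same for every `y`, whence the factor `q ^ n`.
        head : ∀ u X → Ω ℓ k X → ∀ y → F ((g y ⊕ u ⊙ v) ∷ map g X) ≡ u *ᶠ G X
        head u X ω y = begin
          F ((g y ⊕ u ⊙ v) ∷ map g X)         ≡⟨ axpy (alt-lin aF (map g X)) (g y) u v ⟩
          F (map g (y ∷ X)) +ᶠ u *ᶠ G X       ≡⟨ cong (_+ᶠ u *ᶠ G X) (T-vanish {F = λ M → F (map g M)} vanish (y ∷ X) ω⁺) ⟩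
          0# +ᶠ u *ᶠ G X                      ≡⟨ R.+-identityˡ _ ⟩
          u *ᶠ G X                            ∎
          where
          ω⁺ : Ω (suc ℓ) k (y ∷ X)
          ω⁺ j p r with j ≟ⁿ suc ℓ
          ... | yes refl = contradiction r (≤⇒≯ k≤e)
          ... | no j≢ = ≤-trans (ω j (≤-pred (≤∧≢⇒< p j≢)) r) (card-∷ (j + e j) y X)
        column : ∀ u → u ≢ 0# → ∀ X → 𝟙 (Ω? ℓ k X) * # (finV n) (λ y → nonzero? (F ((g y ⊕ u ⊙ v) ∷ map g X)))
                 ≡ q ^ n * (𝟙 (Ω? ℓ k X) * 𝟙 (nonzero? (G X)))
        column u u≢0 X with Ω? ℓ k X
        ... | no _  = sym (*-zeroʳ (q ^ n))
        ... | yes ω = begin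
          1 * # (finV n) (λ y → nonzero? (F ((g y ⊕ u ⊙ v) ∷ map g X)))
            ≡⟨ *-identityˡ _ ⟩
          # (finV n) (λ y → nonzero? (F ((g y ⊕ u ⊙ v) ∷ map g X)))
            ≡⟨ ∑-cong (finV n) (λ y → 𝟙-cong (nonzero? _) (nonzero? (G X))
                 (λ ne z → ne (trans (head u X ω y) (trans (cong (u *ᶠ_) z) (R.zeroʳ u))))
                 (λ ne z → ne (x*y≡0 u≢0 (trans (sym (head u X ω y)) z)))) ⟩
          ∑ (finV n) (λ y → 𝟙 (nonzero? (G X)))
            ≡⟨ ∑-const (finV n) _ ⟩
          size (finV n) * 𝟙 (nonzero? (G X))
            ≡⟨ cong₂ _*_ (size-V n) (sym (*-identityˡ _)) ⟩
          q ^ n * (1 * 𝟙 (nonzero? (G X))) ∎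
        at : ∀ l (d : Dec (l ≡ 𝟘)) → slice F l v ≡ 𝟙 (¬? d) * (q ^ n * T′)
        at l (yes refl) = trans (slice-𝟘 F v) vanish
        at l (no l≢𝟘) with slice-pivot l l≢𝟘
        ... | u , u≢0 , formula = begin
          slice F l v
            ≡⟨ formula v ⟩
          ∑ (finM n ℓ) (λ X → 𝟙 (Ω? ℓ k X) * # (finV n) (λ y → nonzero? (F ((g y ⊕ u ⊙ v) ∷ map g X))))
            ≡⟨ ∑-cong (finM n ℓ) (column u u≢0) ⟩
          ∑ (finM n ℓ) (λ X → q ^ n * (𝟙 (Ω? ℓ k X) * 𝟙 (nonzero? (G X))))
            ≡⟨ ∑-*ˡ (finM n ℓ) (q ^ n) _ ⟩
          q ^ n * T′
            ≡⟨ sym (*-identityˡ _) ⟩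
          1 * (q ^ n * T′) ∎

      -- For a fixed column l, replacing the hyperplane vectors by those with h-values l can
      -- only increase the number of tuples at which F does not vanish.
      T-≥ : ∑ (finM n (suc ℓ)) (λ M → 𝟙 (nonzero? (F (map g M))) * # (finV (suc ℓ)) (λ l → Allowed? l M)) ≤ T (suc ℓ) k F
      T-≥ = begin
        ∑ (finM n (suc ℓ)) (λ M → 𝟙 (nonzero? (F (map g M))) * # (finV (suc ℓ)) (λ l → Allowed? l M))
          ≡⟨ ∑-cong (finM n (suc ℓ)) (λ M → sym (∑-*ˡ (finV (suc ℓ)) (𝟙 (nonzero? (F (map g M)))) _)) ⟩
        ∑ (finM n (suc ℓ)) (λ M → ∑ (finV (suc ℓ)) (λ l → 𝟙 (nonzero? (F (map g M))) * 𝟙 (Allowed? l M)))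
          ≡⟨ ∑-swap (finM n (suc ℓ)) (finV (suc ℓ)) _ ⟩
        ∑ (finV (suc ℓ)) (λ l → ∑ (finM n (suc ℓ)) (λ M → 𝟙 (nonzero? (F (map g M))) * 𝟙 (Allowed? l M)))
          ≡⟨ ∑-cong (finV (suc ℓ)) (λ l → ∑-cong (finM n (suc ℓ)) (λ M → trans (*-comm (𝟙 (nonzero? (F (map g M)))) _)
               (cong (λ z → 𝟙 (Allowed? l M) * 𝟙 (nonzero? (F z))) (sym (shear-𝟘ˡ l (map g M)))))) ⟩
        ∑ (finV (suc ℓ)) (λ l → slice F l 𝟘)
          ≤⟨ ∑-mono (finV (suc ℓ)) (λ l → at l (l ≟ᵛ 𝟘)) ⟩
        ∑ (finV (suc ℓ)) (λ l → slice F l v)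
          ≡⟨ sym (T-slices F) ⟩
        T (suc ℓ) k F ∎
        where
        open ≤-Reasoning
        at : ∀ l → Dec (l ≡ 𝟘) → slice F l 𝟘 ≤ slice F l v
        at l (yes refl) = ≤-reflexive (trans (slice-𝟘 F 𝟘) (sym (slice-𝟘 F v)))
        at l (no l≢𝟘) with slice-pivot l l≢𝟘
        ... | u , u≢0 , formula = begin
          slice F l 𝟘
            ≡⟨ formula 𝟘 ⟩
          ∑ (finM n ℓ) (λ X → 𝟙 (Ω? ℓ k X) * # (finV n) (λ y → nonzero? (F ((g y ⊕ u ⊙ 𝟘) ∷ map g X))))
            ≤⟨ ∑-mono (finM n ℓ) (λ X → *-monoʳ-≤ (𝟙 (Ω? ℓ k X)) (begin
                 # (finV n) (λ y → nonzero? (F ((g y ⊕ u ⊙ 𝟘) ∷ map g X)))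
                   ≡⟨ ∑-cong (finV n) (λ y → cong (λ z → 𝟙 (nonzero? (F (z ∷ map g X)))) (trans (cong (g y ⊕_) (⊙-zeroʳ u)) (⊕-identityʳ _))) ⟩
                 # (finV n) (λ y → nonzero? (F (g y ∷ map g X)))
                   ≤⟨ #-≢0-shift (finV n) (lin-∘ (alt-lin aF (map g X)) lin-g) (u *ᶠ F (v ∷ map g X)) ⟩
                 # (finV n) (λ y → nonzero? (F (g y ∷ map g X) +ᶠ u *ᶠ F (v ∷ map g X)))
                   ≡⟨ ∑-cong (finV n) (λ y → cong (λ z → 𝟙 (nonzero? z)) (sym (axpy (alt-lin aF (map g X)) (g y) u v))) ⟩
                 # (finV n) (λ y → nonzero? (F ((g y ⊕ u ⊙ v) ∷ map g X))) ∎)) ⟩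
          ∑ (finM n ℓ) (λ X → 𝟙 (Ω? ℓ k X) * # (finV n) (λ y → nonzero? (F ((g y ⊕ u ⊙ v) ∷ map g X))))
            ≡⟨ sym (formula v) ⟩
          slice F l v ∎

    flag-mono : ∀ {i j} → i ≤ j → i + e i ≤ j + e j
    flag-mono h = +-mono-≤ h (e-mono h)

    Ω-weaken : ∀ ℓ k′ {n} (M : Vec (V n) ℓ) → Ω ℓ (suc k′) M → Ω ℓ k′ M
    Ω-weaken ℓ k′ M ω j p r = ω j p (m≤n⇒m≤1+n r)

    -- The only new condition has `e j ≡ k′`. In dimension ℓ + k′ its flag step has codimension ℓ -
    -- j, which is the automatic case of `card-codim`.
    Ω-strengthen : ∀ ℓ k′ {n} → n ≡ ℓ + k′ → (M : Vec (V n) ℓ) → Ω ℓ k′ M → Ω ℓ (suc k′) M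
    Ω-strengthen ℓ k′ refl M ω j p r with e j ≟ⁿ k′
    ... | no ne = ω j p (≤∧≢⇒< (≤-pred r) ne)
    ... | yes refl = card-codim (j + e j) j M
      (≤-reflexive (trans (cong₂ _∸_ (+-comm ℓ (e j)) (+-comm j (e j))) ([m+n]∸[m+o]≡n∸o (e j) ℓ j))) p

    T-suc : ∀ ℓ k′ {n} → n ≡ ℓ + k′ → (F : Vec (V n) ℓ → Carrier) → T ℓ (suc k′) F ≡ T ℓ k′ F
    T-suc ℓ k′ {n} h F = ∑-cong (finM n ℓ) (λ M → cong (_* 𝟙 (nonzero? (F M)))
      (𝟙-cong (Ω? ℓ (suc k′) M) (Ω? ℓ k′ M) (Ω-weaken ℓ k′ M) (Ω-strengthen ℓ k′ h M)))

    -- Columns compatible with a tuple in the hyperplane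

    module Allowed {n ℓ : ℕ} (k t : ℕ) (M : Vec (V n) ℓ) (t≤ℓ : t ≤ ℓ) (last : ∀ j → j ≤ ℓ → e j < k → j ≤ t)
                   (inj : ∀ c → c ∙ M ≡ 𝟘 → c ≡ 𝟘) (dims : ∀ j → j ≤ t → q ^ j ≤ card (j + e j) M) where

      #allowed : ℕ
      #allowed = # (finV ℓ) (λ l → cond? ℓ k (cardPerp l M))

      -- Functionals killing the j₀-th step of the flag are allowed when the dimension
      -- exceeds the required one at all later steps.
      fromTight : ∀ j₀ → j₀ ≤ t → card (j₀ + e j₀) M ≡ q ^ j₀ →
                  (∀ i → j₀ < i → i ≤ t → q ^ suc i ≤ card (i + e i) M) → q ^ (ℓ ∸ j₀) ≤ #allowed
      fromTight j₀ j₀≤t tight slack = begin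
        q ^ (ℓ ∸ j₀)
          ≡⟨ *-cancelʳ-≡ _ _ (q ^ j₀) {{q^-nonZero j₀}} (trans (trans (sym (^-distribˡ-+-* q (ℓ ∸ j₀) j₀)) (cong (q ^_) (m∸n+n≡m (≤-trans j₀≤t t≤ℓ))))
               (trans (sym (annihilator-count (λ c → low? (j₀ + e j₀) (c ∙ M)) (sub-card (j₀ + e j₀) M)))
                      (cong (# (finV ℓ) (λ l → annihilates? l) *_) tight))) ⟩
        # (finV ℓ) (λ l → annihilates? l)
          ≤⟨ #-mono (finV ℓ) _ _ allowed ⟩
        #allowed ∎
        where
        open ≤-Reasoning
        annihilates? : ∀ l → Dec (∀ c → Low (j₀ + e j₀) (c ∙ M) → c ∙ l ≡ 0#)
        annihilates? l = ∀? (finV ℓ) (λ c → low? (j₀ + e j₀) (c ∙ M) →-dec (c ∙ l ≟ 0#))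
        allowed : ∀ l → (∀ c → Low (j₀ + e j₀) (c ∙ M) → c ∙ l ≡ 0#) → Cond ℓ k (cardPerp l M)
        allowed l ann j p r with j ≤? j₀
        ... | yes j≤j₀ = ≤-trans (dims j (≤-trans j≤j₀ j₀≤t))
          (#-mono (finV ℓ) _ _ (λ c lc → ann c (low-mono (flag-mono j≤j₀) (c ∙ M) lc) , lc))
        ... | no j≰j₀ = *-cancelˡ-≤ q {{ℕ.>-nonZero (≤-trans (n≤1+n 1) 2≤q)}}
          (≤-trans (slack j (≰⇒> j≰j₀) (last j p r)) (card-drop (j + e j) l M))

      -- Downward search for the last tight step, where `card` equals the required power; step zero
      -- is tight because the rows are independent. At a step that is not tight `card`, being a
      -- power of q, is at least q times what is required, and this is the slack that `fromTight`
      -- needs at later steps.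
      find : ∀ r → r ≤ t → (∀ i → r < i → i ≤ t → q ^ suc i ≤ card (i + e i) M) →
             ∃ λ j₀ → j₀ ≤ r × q ^ (ℓ ∸ j₀) ≤ #allowed
      find zero h slack = 0 , ≤-refl , fromTight 0 h (trans (cong (λ z → card z M) e0) (card-0 M inj)) slack
      find (suc r) h slack with card (suc r + e (suc r)) M ≟ⁿ q ^ suc r
      ... | yes tight = suc r , ≤-refl , fromTight (suc r) h tight slack
      ... | no loose = let j₀ , p , b = find r (≤-trans (n≤1+n r) h) slack′ in j₀ , m≤n⇒m≤1+n p , b
        where
        step : q ^ suc (suc r) ≤ card (suc r + e (suc r)) M
        step with card-power (λ c → low? (suc r + e (suc r)) (c ∙ M)) (sub-card (suc r + e (suc r)) M)
        ... | d , eq = subst (q ^ suc (suc r) ≤_) (sym eq) (q^-mono {suc (suc r)} {d} (≤∧≢⇒<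
          (q^-cancel-≤ {suc r} {d} (≤-trans (dims (suc r) h) (≤-reflexive eq))) (λ z → loose (trans eq (cong (q ^_) (sym z))))))
        slack′ : ∀ i → r < i → i ≤ t → q ^ suc i ≤ card (i + e i) M
        slack′ i r<i i≤t with i ≟ⁿ suc r
        ... | yes refl = step
        ... | no i≢ = slack i (≤∧≢⇒< r<i (λ z → i≢ (sym z))) i≤t

      allowed-≥ : q ^ (ℓ ∸ t) ≤ #allowed
      allowed-≥ = let j₀ , p , b = find t ≤-refl (λ i t<i i≤t → contradiction i≤t (<⇒≱ t<i)) in
        ≤-trans (q^-mono (∸-monoʳ-≤ ℓ p)) b

      -- With step `t` loose the search already starts below `t`, and the tight step found there has
      -- a strictly larger annihilator.
      allowed-> : card (t + e t) M ≢ q ^ t → q ^ (ℓ ∸ t) < #allowed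
      allowed-> loose = strict t refl
        where
        strict : ∀ r → r ≡ t → q ^ (ℓ ∸ t) < #allowed
        strict zero refl = contradiction (trans (cong (λ z → card z M) e0) (card-0 M inj)) loose
        strict (suc r) refl with card-power (λ c → low? (t + e t) (c ∙ M)) (sub-card (t + e t) M)
        ... | d , eq = let j₀ , p , b = find r (n≤1+n r) slack in
              <-≤-trans (q^-strict (≤-<-trans ≤-refl (∸-monoʳ-< (s≤s p) t≤ℓ))) b
          where
          slack : ∀ i → r < i → i ≤ t → q ^ suc i ≤ card (i + e i) M
          slack i r<i i≤t with ≤-antisym i≤t r<i
          ... | refl = subst (q ^ suc t ≤_) (sym eq) (q^-mono {suc t} {d} (≤∧≢⇒<
            (q^-cancel-≤ {t} {d} (≤-trans (dims t ≤-refl) (≤-reflexive eq))) (λ z → loose (trans eq (cong (q ^_) (sym z))))))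

    -- The lower bound and its equality case

    -- The order of GL_ℓ, in the form |GL_(ℓ+1)| = (q^(ℓ+1) - 1) q^ℓ |GL_ℓ| that `T-contract`
    -- produces in dimension ℓ + 1.
    gl : ℕ → ℕ
    gl zero    = 1
    gl (suc ℓ) = nz (suc ℓ) * (q ^ ℓ * gl ℓ)

    -- The exponent δ as seen in dimension ℓ + k, where an excess above `k` imposes no condition and
    -- counts as `k`.
    Δ : ℕ → ℕ → ℕ
    Δ zero    k = 0
    Δ (suc ℓ) k = Δ ℓ k + e (suc ℓ) ⊓ k

    nz-pos : ∀ ℓ → nz (suc ℓ) ≢ 0
    nz-pos ℓ z = contradiction (≤-trans 2≤q (≤-trans (≤-reflexive (sym (*-identityʳ q))) (≤-trans (*-monoʳ-≤ q (1≤q^ ℓ))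
      (≤-reflexive (trans (sym (1+nz (suc ℓ))) (cong (1 +_) z)))))) λ { (s≤s ()) }

    gl-pos : ∀ ℓ → gl ℓ ≢ 0
    gl-pos zero    ()
    gl-pos (suc ℓ) z with m*n≡0⇒m≡0∨n≡0 (nz (suc ℓ)) z
    ... | inj₁ z₁ = nz-pos ℓ z₁
    ... | inj₂ z₂ with m*n≡0⇒m≡0∨n≡0 (q ^ ℓ) z₂
    ...   | inj₁ z₃ = q^≢0 ℓ z₃
    ...   | inj₂ z₄ = gl-pos ℓ z₄

    -- The indices at which a block of consecutive entries of α ends, `ℓ` ending the last block.
    Corner : ℕ → ℕ → Set
    Corner ℓ j = j ≡ ℓ ⊎ e j < e (suc j)

    -- F agrees on Ω with the contraction of a top form τ by vectors W adapted to the corners of the flag.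
    Decomposable : ∀ ℓ k {n} → (Vec (V n) ℓ → Carrier) → Set
    Decomposable ℓ k {n} F = ∃ λ (W : Vec (V n) k) → ∃ λ (τ : Vec (V n) (ℓ + k) → Carrier) →
      Alt (ℓ + k) τ × (∀ M → Ω ℓ k M → F M ≡ τ (M ++ W)) ×
      (∀ j → j ≤ ℓ → e j < k → Corner ℓ j → ∀ (i : Fin k) → k ≤ toℕ i + e j → Low (j + e j) (lookup W i))

    -- Both statements go through one induction: equality for `F` combined with the bound for a
    -- smaller form forces equality there, and the decomposition of the smaller form is then
    -- extended to `F`.
    Bounded : ∀ ℓ k {n} → (Vec (V n) ℓ → Carrier) → Set
    Bounded ℓ k F = (gl ℓ * q ^ Δ ℓ k ≤ T ℓ k F) × (T ℓ k F ≡ gl ℓ * q ^ Δ ℓ k → Decomposable ℓ k F)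

    map-ρ-g : ∀ {n a} (s : Split n a) {m} (X : Vec (V n) m) → map (Split.ρ s) (map (Split.g s) X) ≡ X
    map-ρ-g s X = trans (sym (Vecₚ.map-∘ (Split.ρ s) (Split.g s) X)) (trans (Vecₚ.map-cong (Split.ρ-g s) X) (Vecₚ.map-id X))

    h-map-g : ∀ {n a} (s : Split n a) {m} (X : Vec (V n) m) i → Split.h s (lookup (map (Split.g s) X) i) ≡ 0#
    h-map-g s X i = trans (cong (Split.h s) (Vecₚ.lookup-map i (Split.g s) X)) (Split.h-g s _)

    lift-map-ρ : ∀ {n a} (s : Split n a) {m} (M : Vec (V (suc n)) m) → map (Split.h s) M ≡ 𝟘 → map (Split.g s) (map (Split.ρ s) M) ≡ M
    lift-map-ρ s []      z = refl
    lift-map-ρ s (x ∷ M) z = cong₂ _∷_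
      (trans (sym (trans (cong (Split.g s (Split.ρ s x) ⊕_) (trans (cong (_⊙ Split.v s) (Vecₚ.∷-injectiveˡ z)) (⊙-zeroˡ _))) (⊕-identityʳ _))) (Split.decompose s x))
      (lift-map-ρ s M (Vecₚ.∷-injectiveʳ z))

    alt-sub : ∀ {n ℓ} {F G : Vec (V n) ℓ → Carrier} → Alt ℓ F → Alt ℓ G → Alt ℓ (λ M → F M +ᶠ ⊖ G M)
    alt-sub aF aG = alt-⊕ aF (alt-⊙ (-ᶠ 1#) aG)

    -- Since `F` vanishes on Ω inside the hyperplane, it is governed on Ω by its contraction by `v`,
    -- a form with one argument less in one dimension less and with the same `k`.
    module Contract {n a} (s : Split n a) (ℓ k : ℕ) (n≡ : n ≡ ℓ + k) (fits : ∀ j → j ≤ suc ℓ → e j < k → j + e j ≤ a)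
                    (k≤e : k ≤ e (suc ℓ)) {F : Vec (V (suc n)) (suc ℓ) → Carrier} (aF : Alt (suc ℓ) F)
                    (vanish : T (suc ℓ) k (λ M → F (map (Split.g s) M)) ≡ 0) (F≢0 : T (suc ℓ) k F ≢ 0)
                    (ih : ∀ {G : Vec (V n) ℓ → Carrier} → Alt ℓ G → T ℓ k G ≢ 0 → Bounded ℓ k G) where
      open Split s
      open Step s (suc ℓ) k fits

      G : Vec (V n) ℓ → Carrier
      G X = F (v ∷ map g X)

      aG : Alt ℓ G
      aG = alt-map lin-g (alt-tail aF v)

      T-G : T (suc ℓ) k F ≡ nz (suc ℓ) * (q ^ n * T ℓ k G)
      T-G = Step⁺.T-contract s ℓ k fits k≤e aF vanish

      G≢0 : T ℓ k G ≢ 0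
      G≢0 z = F≢0 (trans T-G (trans (cong (λ w → nz (suc ℓ) * (q ^ n * w)) z)
        (trans (cong (nz (suc ℓ) *_) (*-zeroʳ (q ^ n))) (*-zeroʳ (nz (suc ℓ))))))

      goal-count : gl (suc ℓ) * q ^ Δ (suc ℓ) k ≡ nz (suc ℓ) * (q ^ n * (gl ℓ * q ^ Δ ℓ k))
      goal-count = begin
        nz (suc ℓ) * (q ^ ℓ * gl ℓ) * q ^ (Δ ℓ k + e (suc ℓ) ⊓ k)
          ≡⟨ cong (λ z → nz (suc ℓ) * (q ^ ℓ * gl ℓ) * q ^ (Δ ℓ k + z)) (m≥n⇒m⊓n≡n k≤e) ⟩
        nz (suc ℓ) * (q ^ ℓ * gl ℓ) * q ^ (Δ ℓ k + k)
          ≡⟨ cong (nz (suc ℓ) * (q ^ ℓ * gl ℓ) *_) (^-distribˡ-+-* q (Δ ℓ k) k) ⟩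
        nz (suc ℓ) * (q ^ ℓ * gl ℓ) * (q ^ Δ ℓ k * q ^ k)
          ≡⟨ lem (nz (suc ℓ)) (q ^ ℓ) (gl ℓ) (q ^ Δ ℓ k) (q ^ k) ⟩
        nz (suc ℓ) * (q ^ ℓ * q ^ k * (gl ℓ * q ^ Δ ℓ k))
          ≡⟨ cong (λ z → nz (suc ℓ) * (z * (gl ℓ * q ^ Δ ℓ k))) (trans (sym (^-distribˡ-+-* q ℓ k)) (cong (q ^_) (sym n≡))) ⟩
        nz (suc ℓ) * (q ^ n * (gl ℓ * q ^ Δ ℓ k)) ∎
        where
        open ≡-Reasoning
        lem : ∀ a b c d f → a * (b * c) * (d * f) ≡ a * (b * f * (c * d))
        lem = ℕ-solve

      decomposable : Decomposable ℓ k G → Decomposable (suc ℓ) k F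
      decomposable (W , τ , aτ , agree , corners) = map g W , wedge lin-h lin-ρ τ , alt-wedge lin-h lin-ρ aτ ,
        (λ M ω → ⊖-≡ _ _ (T-vanish {F = D} D-vanishes M ω)) , corners′
        where
        open ≡-Reasoning
        aD : Alt (suc ℓ) (λ M → F M +ᶠ ⊖ wedge lin-h lin-ρ τ (M ++ map g W))
        aD = alt-sub aF (alt-++ (suc ℓ) (map g W) (alt-wedge lin-h lin-ρ aτ))
        D : Vec (V (suc n)) (suc ℓ) → Carrier
        D M = F M +ᶠ ⊖ wedge lin-h lin-ρ τ (M ++ map g W)
        inside : ∀ M → Ω (suc ℓ) k M → D (map g M) ≡ 0#
        inside M ω = begin
          F (map g M) +ᶠ ⊖ wedge lin-h lin-ρ τ (map g M ++ map g W)
            ≡⟨ cong₂ (λ x y → x +ᶠ ⊖ y) (T-vanish {F = λ M → F (map g M)} vanish M ω)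
                 (trans (cong (wedge lin-h lin-ρ τ) (sym (Vecₚ.map-++ g M W))) (wedge-kernel lin-h lin-ρ τ (map g (M ++ W)) (h-map-g s (M ++ W)))) ⟩
          0# +ᶠ ⊖ 0# ≡⟨ ⊖-inverse 0# ⟩
          0# ∎
        contracted : ∀ X → Ω ℓ k X → D (v ∷ map g X) ≡ 0#
        contracted X ω = begin
          G X +ᶠ ⊖ wedge lin-h lin-ρ τ (v ∷ (map g X ++ map g W))
            ≡⟨ cong (λ y → G X +ᶠ ⊖ y) (trans (cong (λ z → wedge lin-h lin-ρ τ (v ∷ z)) (sym (Vecₚ.map-++ g X W)))
                 (trans (wedge-head lin-h lin-ρ τ v (map g (X ++ W)) (h-map-g s (X ++ W)))
                 (trans (cong₂ (λ x y → x *ᶠ τ y) h-v (map-ρ-g s (X ++ W))) (R.*-identityˡ _)))) ⟩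
          G X +ᶠ ⊖ τ (X ++ W)
            ≡⟨ cong (_+ᶠ ⊖ τ (X ++ W)) (agree X ω) ⟩
          τ (X ++ W) +ᶠ ⊖ τ (X ++ W)
            ≡⟨ ⊖-inverse _ ⟩
          0# ∎
        -- The difference again vanishes on Ω inside the hyperplane, so `T-contract` applies to it
        -- too, and its contraction by `v` is zero on Ω.
        D-vanishes : T (suc ℓ) k D ≡ 0
        D-vanishes = trans (Step⁺.T-contract s ℓ k fits k≤e aD (T-≡0 inside))
          (trans (cong (λ w → nz (suc ℓ) * (q ^ n * w)) (T-≡0 contracted))
            (trans (cong (nz (suc ℓ) *_) (*-zeroʳ (q ^ n))) (*-zeroʳ (nz (suc ℓ)))))
        corners′ : ∀ j → j ≤ suc ℓ → e j < k → Corner (suc ℓ) j → ∀ i → k ≤ toℕ i + e j → Low (j + e j) (lookup (map g W) i)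
        corners′ j p r c i h with j ≟ⁿ suc ℓ
        ... | yes refl = contradiction r (≤⇒≯ k≤e)
        ... | no j≢ = subst (Low (j + e j)) (sym (Vecₚ.lookup-map i g W))
          (low-g (fits j p r) _ (corners j (≤-pred (≤∧≢⇒< p j≢)) r (shift c) i h))
          where
          shift : Corner (suc ℓ) j → Corner ℓ j
          shift (inj₁ z) = contradiction z j≢
          shift (inj₂ z) = inj₂ z

      bounded : Bounded (suc ℓ) k F
      bounded = let lower , equality = ih aG G≢0 in
        (begin
          gl (suc ℓ) * q ^ Δ (suc ℓ) k                      ≡⟨ goal-count ⟩
          nz (suc ℓ) * (q ^ n * (gl ℓ * q ^ Δ ℓ k))         ≤⟨ *-monoʳ-≤ (nz (suc ℓ)) (*-monoʳ-≤ (q ^ n) lower) ⟩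
          nz (suc ℓ) * (q ^ n * T ℓ k G)                    ≡⟨ sym T-G ⟩
          T (suc ℓ) k F                                     ∎) ,
        λ eq → decomposable (equality (*-cancelˡ-≡ (T ℓ k G) _ (q ^ n) {{q^-nonZero n}}
          (*-cancelˡ-≡ _ _ (nz (suc ℓ)) {{ℕ.≢-nonZero (nz-pos ℓ)}} (trans (sym T-G) (trans eq goal-count)))))
        where open ≤-Reasoning

    -- Ω lies in the hyperplane when its last condition does.
    module Restrict {n} (s : Split n n) (ℓ k : ℕ) (n≡ : n ≡ ℓ + k) (e≤k : e ℓ ≤ k) where
      open Split s

      fits : ∀ j → j ≤ ℓ → e j < suc k → j + e j ≤ n
      fits j p r = ≤-trans (+-mono-≤ p (≤-pred r)) (≤-reflexive (sym n≡))

      open Step s ℓ (suc k) fits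

      T-restrict : ∀ F → T ℓ (suc k) F ≡ T ℓ k (λ M → F (map g M))
      T-restrict F = begin
        T ℓ (suc k) F                                       ≡⟨ T-slices F ⟩
        ∑ (finV ℓ) (λ l → slice F l v)                      ≡⟨ ∑-cong (finV ℓ) (λ l → at l (l ≟ᵛ 𝟘)) ⟩
        ∑ (finV ℓ) (λ l → 𝟙 (l ≟ᵛ 𝟘) * T ℓ (suc k) (λ M → F (map g M)))  ≡⟨ ∑-δ (finV ℓ) 𝟘 _ ⟩
        T ℓ (suc k) (λ M → F (map g M))                     ≡⟨ T-suc ℓ k n≡ _ ⟩
        T ℓ k (λ M → F (map g M))                           ∎
        where
        open ≡-Reasoning
        -- The condition at ℓ asks all q^ℓ coefficient vectors to be orthogonal to `l`, so no row of
        -- a member of Ω leaves the hyperplane.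
        kills : ∀ l M → Cond ℓ (suc k) (cardPerp l M) → l ≡ 𝟘
        kills l M c = nondegenerate l all
          where
          full : q ^ ℓ ≤ # (finV ℓ) (λ c → c ∙ l ≟ 0#)
          full = ≤-trans (c ℓ ≤-refl (s≤s e≤k)) (#-mono (finV ℓ) _ _ (λ c → proj₁))
          all : ∀ c → c ∙ l ≡ 0#
          all c with c ∙ l ≟ 0#
          ... | yes p = p
          ... | no ¬p = contradiction full (<⇒≱ (subst (# (finV ℓ) (λ c → c ∙ l ≟ 0#) <_) (size-V ℓ)
            (∑-strict (finV ℓ) (λ c → ≤1 (c ∙ l ≟ 0#)) c (subst (_< 1) (sym (𝟙-no (c ∙ l ≟ 0#) ¬p)) ≤-refl))))
            where
            ≤1 : ∀ {P : Set} (d : Dec P) → 𝟙 d ≤ 1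
            ≤1 d = 𝟙-mono d (yes tt) (λ _ → tt)
        at : ∀ l (d : Dec (l ≡ 𝟘)) → slice F l v ≡ 𝟙 d * T ℓ (suc k) (λ M → F (map g M))
        at l (yes refl) = trans (slice-𝟘 F v) (sym (*-identityˡ _))
        at l (no l≢𝟘) = ∑-zero (finM n ℓ) _ (λ M → cong (_* 𝟙 (nonzero? (F (lift l M)))) (𝟙-no (Allowed? l M) (λ c → l≢𝟘 (kills l M c))))

      Δ-restrict : ∀ i → i ≤ ℓ → Δ i (suc k) ≡ Δ i k
      Δ-restrict zero    h = refl
      Δ-restrict (suc i) h = cong₂ _+_ (Δ-restrict i (≤-trans (n≤1+n i) h))
        (trans (m≤n⇒m⊓n≡m (m≤n⇒m≤1+n small)) (sym (m≤n⇒m⊓n≡m small)))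
        where
        small : e (suc i) ≤ k
        small = ≤-trans (e-mono h) e≤k

      decomposable : ∀ {F : Vec (V (suc n)) ℓ → Carrier} → Alt ℓ F → Decomposable ℓ k (λ M → F (map g M)) → Decomposable ℓ (suc k) F
      decomposable {F} aF (W , τ , aτ , agree , corners) = v ∷ map g W , σ , aσ ,
        (λ M ω → ⊖-≡ _ _ (T-vanish {F = D} (trans (T-restrict D) (T-≡0 inside)) M ω)) , corners′
        where
        open ≡-Reasoning
        -- `v` is the additional vector of the decomposition: contracting the wedge product by it
        -- returns `τ` inside the hyperplane. The sign undoes moving `v` past the ℓ rows of `M`.
        σ : Vec (V (suc n)) (ℓ + suc k) → Carrier
        σ N = signed ℓ 1# *ᶠ wedge lin-h lin-ρ τ (Vec.cast (+-suc ℓ k) N)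
        aσ : Alt (ℓ + suc k) σ
        aσ = alt-⊙ (signed ℓ 1#) (alt-cast (+-suc ℓ k) (alt-wedge lin-h lin-ρ aτ))
        D : Vec (V (suc n)) ℓ → Carrier
        D M = F M +ᶠ ⊖ σ (M ++ v ∷ map g W)
        inside : ∀ M → Ω ℓ k M → D (map g M) ≡ 0#
        inside M ω = begin
          F (map g M) +ᶠ ⊖ σ (map g M ++ v ∷ map g W)
            ≡⟨ cong (λ z → F (map g M) +ᶠ ⊖ z) (trans (cong (signed ℓ 1# *ᶠ_)
                 (cast-insert ℓ (alt-wedge lin-h lin-ρ aτ) (+-suc ℓ k) (map g M) v (map g W))) (signed-* ℓ _)) ⟩
          F (map g M) +ᶠ ⊖ wedge lin-h lin-ρ τ (v ∷ map g M ++ map g W)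
            ≡⟨ cong (λ z → F (map g M) +ᶠ ⊖ z) (trans (cong (λ z → wedge lin-h lin-ρ τ (v ∷ z)) (sym (Vecₚ.map-++ g M W)))
                 (trans (wedge-head lin-h lin-ρ τ v (map g (M ++ W)) (h-map-g s (M ++ W)))
                 (trans (cong₂ (λ x y → x *ᶠ τ y) h-v (map-ρ-g s (M ++ W))) (R.*-identityˡ _)))) ⟩
          F (map g M) +ᶠ ⊖ τ (M ++ W)
            ≡⟨ cong (_+ᶠ ⊖ τ (M ++ W)) (agree M ω) ⟩
          τ (M ++ W) +ᶠ ⊖ τ (M ++ W)
            ≡⟨ ⊖-inverse _ ⟩
          0# ∎
        corners′ : ∀ j → j ≤ ℓ → e j < suc k → Corner ℓ j → ∀ i → suc k ≤ toℕ i + e j → Low (j + e j) (lookup (v ∷ map g W) i)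
        -- Only the last `e j` vectors are constrained, and `e j < suc k` keeps the new first vector
        -- out of them.
        corners′ j p r c Fin.zero    h = contradiction h (<⇒≱ r)
        corners′ j p r c (Fin.suc i) h with e j <? k
        ... | yes r′ = subst (Low (j + e j)) (sym (Vecₚ.lookup-map i g W)) (low-g (fits j p r) _ (corners j p r′ c i (≤-pred h)))
        -- Here `e j` equals `k`. Because `e ℓ ≤ k`, a corner with this value must be `ℓ`, and then
        -- the flag step is the whole hyperplane.
        ... | no ¬r′ with ≤-antisym (≤-pred r) (≮⇒≥ ¬r′)
        ...   | refl = subst (Low (j + e j)) (sym (Vecₚ.lookup-map i g W)) (low-g (fits j p r) _
          (low-full (≤-reflexive (trans n≡ (cong (_+ e j) (top c)))) (lookup W i)))
          where
          top : Corner ℓ j → ℓ ≡ j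
          top (inj₁ z) = sym z
          top (inj₂ z) with j ≟ⁿ ℓ
          ... | yes eq = sym eq
          ... | no ne = contradiction (≤-trans (e-mono (≤∧≢⇒< p ne)) e≤k) (<⇒≱ z)

    -- The case where the condition at `suc ℓ` is not imposed. `t` is the last index whose condition
    -- is, so all imposed conditions concern subspaces of V_a with `a = t + e t`, and any hyperplane
    -- through V_a may be used.
    module Shrink {n} (ℓ k t : ℕ) (n≡ : n ≡ suc ℓ + k) (t≤ℓ : t ≤ ℓ) (et≤k : e t ≤ k) (k<e : suc k ≤ e (suc ℓ))
                  (last : ∀ j → j ≤ suc ℓ → e j < suc k → j ≤ t)
                  {F : Vec (V (suc n)) (suc ℓ) → Carrier} (aF : Alt (suc ℓ) F) where

      a : ℕ
      a = t + e t

      a≤n : a ≤ n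
      a≤n = ≤-trans (+-mono-≤ (m≤n⇒m≤1+n t≤ℓ) et≤k) (≤-reflexive (sym n≡))

      fits : ∀ j → j ≤ suc ℓ → e j < suc k → j + e j ≤ a
      fits j p r = flag-mono (last j p r)

      s : ℕ
      s = suc ℓ ∸ t

      -- Exactly the `s` indices after `t` have excess above `k`, and each of them contributes one
      -- less when `suc k` drops to `k`.
      Δ-shrink : Δ (suc ℓ) (suc k) ≡ Δ (suc ℓ) k + s
      Δ-shrink = trans (go (suc ℓ) ≤-refl) refl
        where
        go : ∀ i → i ≤ suc ℓ → Δ i (suc k) ≡ Δ i k + (i ∸ t)
        go zero h = sym (0∸n≡0 t)
        go (suc i) h with suc i ≤? t
        ... | yes i<t = begin
          Δ i (suc k) + e (suc i) ⊓ suc k   ≡⟨ cong₂ _+_ (go i (≤-trans (n≤1+n i) h)) (trans (m≤n⇒m⊓n≡m (m≤n⇒m≤1+n small)) (sym (m≤n⇒m⊓n≡m small))) ⟩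
          Δ i k + (i ∸ t) + e (suc i) ⊓ k   ≡⟨ cong (λ z → Δ i k + z + e (suc i) ⊓ k) (m≤n⇒m∸n≡0 (≤-trans (n≤1+n i) i<t)) ⟩
          Δ i k + 0 + e (suc i) ⊓ k         ≡⟨ cong (_+ e (suc i) ⊓ k) (+-identityʳ _) ⟩
          Δ i k + e (suc i) ⊓ k             ≡⟨ sym (+-identityʳ _) ⟩
          Δ i k + e (suc i) ⊓ k + 0         ≡⟨ cong (Δ i k + e (suc i) ⊓ k +_) (sym (m≤n⇒m∸n≡0 i<t)) ⟩
          Δ i k + e (suc i) ⊓ k + (suc i ∸ t) ∎
          where
          open ≡-Reasoning
          small : e (suc i) ≤ k
          small = ≤-trans (e-mono i<t) et≤k
        ... | no i≮t = begin
          Δ i (suc k) + e (suc i) ⊓ suc k   ≡⟨ cong₂ _+_ (go i (≤-trans (n≤1+n i) h)) (trans (m≥n⇒m⊓n≡n big) (cong suc (sym (m≥n⇒m⊓n≡n (≤-trans (n≤1+n k) big))))) ⟩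
          Δ i k + (i ∸ t) + suc (e (suc i) ⊓ k)   ≡⟨ lem (Δ i k) (i ∸ t) (e (suc i) ⊓ k) ⟩
          Δ i k + e (suc i) ⊓ k + suc (i ∸ t)     ≡⟨ cong (Δ i k + e (suc i) ⊓ k +_) (sym (+-∸-assoc 1 (≤-pred (≰⇒> i≮t)))) ⟩
          Δ i k + e (suc i) ⊓ k + (suc i ∸ t) ∎
          where
          open ≡-Reasoning
          big : suc k ≤ e (suc i)
          big with e (suc i) <? suc k
          ... | yes r = contradiction (last (suc i) h r) i≮t
          ... | no ¬r = ≮⇒≥ ¬r
          lem : ∀ a b c → a + b + suc c ≡ a + c + suc b
          lem = ℕ-solve

      module At (sp : Split n a) where
        open Split sp
        open Step sp (suc ℓ) (suc k) fits

        F′ : Vec (V n) (suc ℓ) → Carrier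
        F′ M = F (map g M)

        aF′ : Alt (suc ℓ) F′
        aF′ = alt-map lin-g aF

        T′ : ℕ
        T′ = T (suc ℓ) (suc k) F′

        module A (M : Vec (V n) (suc ℓ)) (ω : Ω (suc ℓ) (suc k) M) (ne : F′ M ≢ 0#) =
          Allowed (suc k) t M (m≤n⇒m≤1+n t≤ℓ) last (injective-rows aF′ M ne)
            (λ j j≤t → ω j (≤-trans j≤t (m≤n⇒m≤1+n t≤ℓ)) (s≤s (≤-trans (e-mono j≤t) et≤k)))

        pointwise : ∀ M → 𝟙 (Ω? (suc ℓ) (suc k) M) * 𝟙 (nonzero? (F′ M)) * q ^ s ≤ 𝟙 (nonzero? (F′ M)) * # (finV (suc ℓ)) (λ l → Allowed? l M)
        pointwise M with Ω? (suc ℓ) (suc k) M | nonzero? (F′ M)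
        ... | no _  | _      = z≤n
        ... | yes _ | no _   = z≤n
        ... | yes ω | yes ne = *-monoʳ-≤ 1 (A.allowed-≥ M ω ne)

        T-≥-shrink : T′ * q ^ s ≤ T (suc ℓ) (suc k) F
        T-≥-shrink = ≤-trans (≤-reflexive (sym (∑-*ʳ (finM n (suc ℓ)) (q ^ s) _)))
          (≤-trans (∑-mono (finM n (suc ℓ)) pointwise) (Step⁺.T-≥ sp ℓ (suc k) fits k<e aF))

        T->-shrink : ∀ M → Ω (suc ℓ) (suc k) M → F′ M ≢ 0# → card a M ≢ q ^ t → T′ * q ^ s < T (suc ℓ) (suc k) F
        T->-shrink M ω ne loose = <-≤-trans (≤-<-trans (≤-reflexive (sym (∑-*ʳ (finM n (suc ℓ)) (q ^ s) _)))
          (∑-strict (finM n (suc ℓ)) pointwise M strict)) (Step⁺.T-≥ sp ℓ (suc k) fits k<e aF)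
          where
          strict : 𝟙 (Ω? (suc ℓ) (suc k) M) * 𝟙 (nonzero? (F′ M)) * q ^ s < 𝟙 (nonzero? (F′ M)) * # (finV (suc ℓ)) (λ l → Allowed? l M)
          strict = begin-strict
            𝟙 (Ω? (suc ℓ) (suc k) M) * 𝟙 (nonzero? (F′ M)) * q ^ s
              ≡⟨ trans (cong₂ (λ x y → x * y * q ^ s) (𝟙-yes (Ω? (suc ℓ) (suc k) M) ω) (𝟙-yes (nonzero? (F′ M)) ne)) (*-identityˡ _) ⟩
            q ^ s
              <⟨ A.allowed-> M ω ne loose ⟩
            # (finV (suc ℓ)) (λ l → Allowed? l M)
              ≡⟨ sym (trans (cong (_* # (finV (suc ℓ)) (λ l → Allowed? l M)) (𝟙-yes (nonzero? (F′ M)) ne)) (*-identityˡ _)) ⟩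
            𝟙 (nonzero? (F′ M)) * # (finV (suc ℓ)) (λ l → Allowed? l M) ∎
            where open ≤-Reasoning

        lower : (∀ {G : Vec (V n) (suc ℓ) → Carrier} → Alt (suc ℓ) G → T (suc ℓ) k G ≢ 0 → Bounded (suc ℓ) k G) →
                T′ ≢ 0 → gl (suc ℓ) * q ^ Δ (suc ℓ) (suc k) ≤ T′ * q ^ s
        lower ih ne = begin
          gl (suc ℓ) * q ^ Δ (suc ℓ) (suc k)          ≡⟨ cong (λ z → gl (suc ℓ) * q ^ z) Δ-shrink ⟩
          gl (suc ℓ) * q ^ (Δ (suc ℓ) k + s)          ≡⟨ cong (gl (suc ℓ) *_) (^-distribˡ-+-* q (Δ (suc ℓ) k) s) ⟩
          gl (suc ℓ) * (q ^ Δ (suc ℓ) k * q ^ s)      ≡⟨ sym (*-assoc (gl (suc ℓ)) _ _) ⟩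
          gl (suc ℓ) * q ^ Δ (suc ℓ) k * q ^ s        ≤⟨ *-monoˡ-≤ (q ^ s) (proj₁ (ih aF′ (λ z → ne (trans (T-suc (suc ℓ) k n≡ F′) z)))) ⟩
          T (suc ℓ) k F′ * q ^ s                      ≡⟨ cong (_* q ^ s) (sym (T-suc (suc ℓ) k n≡ F′)) ⟩
          T′ * q ^ s                                  ∎
          where open ≤-Reasoning

      N : ℕ
      N = suc n

      X : Vec (V N) (suc ℓ) → ℕ
      X M = 𝟙 (Ω? (suc ℓ) (suc k) M) * 𝟙 (nonzero? (F M))

      -- The bases counted by `T` that lie in the kernel of `H`. Indexing by functionals, zero
      -- included, lets the double count run over the full space of functionals vanishing on V_a,
      -- whose relevant subspaces have sizes given by `rank-count`.
      U : V N → ℕ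
      U H = ∑ (finM N (suc ℓ)) (λ M → X M * 𝟙 (perp? M H))

      U-split : ∀ H (sp : Split n a) → (∀ x → Split.h sp x ≡ H ∙ x) → U H ≡ At.T′ sp
      U-split H sp h≡ = begin
        U H
          ≡⟨ ∑-lift (suc ℓ) _ ⟩
        ∑ (finV (suc ℓ)) (λ l → ∑ (finM n (suc ℓ)) (λ M → X (lift l M) * 𝟙 (perp? (lift l M) H)))
          ≡⟨ ∑-cong (finV (suc ℓ)) (λ l → trans (∑-cong (finM n (suc ℓ)) (λ M → trans (*-comm (X (lift l M)) _)
               (cong (_* X (lift l M)) (𝟙-cong (perp? (lift l M) H) (l ≟ᵛ 𝟘)
                 (λ z → trans (sym (H-lift l M)) z) (λ z → trans (H-lift l M) z)))))
               (∑-*ˡ (finM n (suc ℓ)) (𝟙 (l ≟ᵛ 𝟘)) _)) ⟩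
        ∑ (finV (suc ℓ)) (λ l → 𝟙 (l ≟ᵛ 𝟘) * ∑ (finM n (suc ℓ)) (λ M → X (lift l M)))
          ≡⟨ ∑-δ (finV (suc ℓ)) 𝟘 _ ⟩
        ∑ (finM n (suc ℓ)) (λ M → X (lift 𝟘 M))
          ≡⟨ ∑-cong (finM n (suc ℓ)) (λ M → trans (cong X (lift-𝟘 M)) (cong (_* 𝟙 (nonzero? (F (map g M))))
               (𝟙-cong (Ω? (suc ℓ) (suc k) (map g M)) (Ω? (suc ℓ) (suc k) M) (Ω-map-g⁻ M) (Ω-map-g M)))) ⟩
        At.T′ sp ∎
        where
        open ≡-Reasoning
        open Split sp
        open Step sp (suc ℓ) (suc k) fits
        H-lift : ∀ l M → map (H ∙_) (lift l M) ≡ l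
        H-lift l M = trans (Vecₚ.map-cong (λ x → sym (h≡ x)) (lift l M)) (map-h-lift l M)

      U-𝟘 : U 𝟘 ≡ T (suc ℓ) (suc k) F
      U-𝟘 = ∑-cong (finM N (suc ℓ)) (λ M → trans (cong (X M *_) (𝟙-yes (perp? M 𝟘) (nondegenerate _ (λ c →
        trans (sym (∙-map (lin-∙ʳ 𝟘) c M)) (zero-map (lin-∙ˡ (c ∙ M))))))) (*-identityʳ _))

      -- If F attains the bound but vanishes on Ω ∩ H for no hyperplane H ⊇ V_a, then T = q^s · T_H for
      -- each of them, and every L with F(L) ≠ 0 meets V_a in dimension exactly t; so L lies in
      -- q^(r-s) of the q^r functionals on K^N / V_a, and summing T_H over all functionals gives T = q^s · T.
      module Contradiction
        (ih : ∀ {G : Vec (V n) (suc ℓ) → Carrier} → Alt (suc ℓ) G → T (suc ℓ) k G ≢ 0 → Bounded (suc ℓ) k G)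
        (attained : T (suc ℓ) (suc k) F ≡ gl (suc ℓ) * q ^ Δ (suc ℓ) (suc k))
        (survives : ∀ H → High a H → H ≢ 𝟘 → U H ≢ 0) where

        T₀ : ℕ
        T₀ = T (suc ℓ) (suc k) F

        r : ℕ
        r = N ∸ a

        t+r≡ : t + r ≡ suc ℓ + (suc k ∸ e t)
        t+r≡ = begin
          t + (N ∸ (t + e t))              ≡⟨ sym (+-∸-assoc t (≤-trans a≤n (n≤1+n n))) ⟩
          (t + N) ∸ (t + e t)              ≡⟨ [m+n]∸[m+o]≡n∸o t N (e t) ⟩
          N ∸ e t                          ≡⟨ cong (_∸ e t) (trans (cong suc n≡) (sym (+-suc (suc ℓ) k))) ⟩
          (suc ℓ + suc k) ∸ e t            ≡⟨ +-∸-assoc (suc ℓ) (m≤n⇒m≤1+n et≤k) ⟩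
          suc ℓ + (suc k ∸ e t)            ∎
          where open ≡-Reasoning

        exact : ∀ H → High a H → H ≢ 𝟘 → U H * q ^ s ≡ T₀
        exact H hH ne with split-of H hH ne
        ... | sp , h≡ = ≤-antisym
          (subst (λ z → z * q ^ s ≤ T₀) (sym (U-split H sp h≡)) (At.T-≥-shrink sp))
          (≤-trans (≤-reflexive attained) (subst (λ z → _ ≤ z * q ^ s) (sym (U-split H sp h≡))
            (At.lower sp ih (λ z → survives H hH ne (trans (U-split H sp h≡) z)))))

        tight : ∀ M → Ω (suc ℓ) (suc k) M → F M ≢ 0# → card a M ≡ q ^ t
        tight M ω ne with card a M ≟ⁿ q ^ t
        ... | yes p = p
        ... | no loose = contradiction (∃? (finV N) (λ H → (high? a H ×-dec perp? M H) ×-dec ¬? (H ≟ᵛ 𝟘))) impossible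
          where
          -- A loose `M` spans an L meeting V_a in dimension at least t + 1. Then L and V_a together
          -- do not fill the space, and `rank-count` leaves nonzero functionals vanishing on both.
          q≤ : q ≤ # (finV N) (λ H → high? a H ×-dec perp? M H)
          q≤ with card-power (λ c → low? a (c ∙ M)) (sub-card a M)
          ... | d , eq = *-cancelʳ-≤ q _ (q ^ suc ℓ) {{q^-nonZero (suc ℓ)}} (begin
            q * q ^ suc ℓ            ≤⟨ q^-mono {suc (suc ℓ)} {d + r} (≤-trans (s≤s (m≤m+n (suc ℓ) (suc k ∸ e t)))
                                          (≤-trans (≤-reflexive (cong suc (sym t+r≡))) (+-monoˡ-≤ r t<d))) ⟩
            q ^ (d + r)              ≡⟨ ^-distribˡ-+-* q d r ⟩
            q ^ d * q ^ r            ≡⟨ cong (_* q ^ r) (sym eq) ⟩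
            card a M * q ^ r         ≡⟨ rank-count a M ⟩
            # (finV N) (λ H → high? a H ×-dec perp? M H) * q ^ suc ℓ ∎)
            where
            open ≤-Reasoning
            t<d : t < d
            t<d = ≤∧≢⇒< (q^-cancel-≤ {t} {d} (≤-trans (ω t (m≤n⇒m≤1+n t≤ℓ) (s≤s et≤k)) (≤-reflexive eq)))
                        (λ z → loose (trans eq (cong (q ^_) (sym z))))
          impossible : ¬ Dec (∃ λ H → (High a H × map (H ∙_) M ≡ 𝟘) × H ≢ 𝟘)
          impossible (no none) = contradiction (≤-trans 2≤q (≤-trans q≤ (≤-trans
            (#-mono (finV N) _ (_≟ᵛ 𝟘) (λ H p → only H p))
            (≤-reflexive (Finite.once (finV N) 𝟘))))) λ { (s≤s ()) }
            where
            only : ∀ H → High a H × map (H ∙_) M ≡ 𝟘 → H ≡ 𝟘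
            only H p with H ≟ᵛ 𝟘
            ... | yes z = z
            ... | no nz = contradiction (H , p , nz) none
          -- All of L lies in the kernel of `H`, and there a loose tuple makes the inequality behind
          -- `exact` strict.
          impossible (yes (H , (hH , perp) , H≢𝟘)) with split-of H hH H≢𝟘
          ... | sp , h≡ = <-irrefl (trans (cong (_* q ^ s) (sym (U-split H sp h≡))) (exact H hH H≢𝟘))
              (At.T->-shrink sp M′ ω′ (λ z → ne (trans (cong F (sym back)) z)) (λ z → loose (trans (cong (card a) (sym back)) (trans (card-map-g sp ≤-refl M′) z))))
            where
            open Split sp
            M′ : Vec (V n) (suc ℓ)
            M′ = map ρ M
            back : map g M′ ≡ M
            back = lift-map-ρ sp M (trans (Vecₚ.map-cong h≡ M) perp)
            ω′ : Ω (suc ℓ) (suc k) M′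
            ω′ = Step.Ω-map-g⁻ sp (suc ℓ) (suc k) fits M′ (subst (Ω (suc ℓ) (suc k)) (sym back) ω)

        incidences : ∑ (finV N) (λ H → 𝟙 (high? a H) * U H) * q ^ s ≡ T₀ * q ^ r
        incidences = begin
          ∑ (finV N) (λ H → 𝟙 (high? a H) * U H) * q ^ s
            ≡⟨ cong (_* q ^ s) (trans (∑-cong (finV N) (λ H → trans (sym (∑-*ˡ (finM N (suc ℓ)) (𝟙 (high? a H)) _))
                 (∑-cong (finM N (suc ℓ)) (λ M → trans (swap* (𝟙 (high? a H)) (X M) _) (cong (X M *_) (sym (𝟙-× (high? a H) (perp? M H))))))))
                 (trans (∑-swap (finV N) (finM N (suc ℓ)) _) (∑-cong (finM N (suc ℓ)) (λ M → ∑-*ˡ (finV N) (X M) _)))) ⟩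
          ∑ (finM N (suc ℓ)) (λ M → X M * # (finV N) (λ H → high? a H ×-dec perp? M H)) * q ^ s
            ≡⟨ sym (∑-*ʳ (finM N (suc ℓ)) (q ^ s) _) ⟩
          ∑ (finM N (suc ℓ)) (λ M → X M * # (finV N) (λ H → high? a H ×-dec perp? M H) * q ^ s)
            ≡⟨ ∑-cong (finM N (suc ℓ)) at ⟩
          ∑ (finM N (suc ℓ)) (λ M → X M * q ^ r)
            ≡⟨ ∑-*ʳ (finM N (suc ℓ)) (q ^ r) _ ⟩
          T₀ * q ^ r ∎
          where
          open ≡-Reasoning
          swap* : ∀ a b c → a * (b * c) ≡ b * (a * c)
          swap* = ℕ-solve
          at : ∀ M → X M * # (finV N) (λ H → high? a H ×-dec perp? M H) * q ^ s ≡ X M * q ^ r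
          at M with Ω? (suc ℓ) (suc k) M | nonzero? (F M)
          ... | no _  | _      = refl
          ... | yes _ | no _   = refl
          ... | yes ω | yes ne = trans (cong (_* q ^ s) (*-identityˡ h)) (trans (*-cancelˡ-≡ _ _ (q ^ t) {{q^-nonZero t}} (begin
            q ^ t * (h * q ^ s)       ≡⟨ trans (swap* (q ^ t) h (q ^ s)) (cong (h *_) (trans (sym (^-distribˡ-+-* q t s)) (cong (q ^_) (m+[n∸m]≡n (m≤n⇒m≤1+n t≤ℓ))))) ⟩
            h * q ^ suc ℓ             ≡⟨ sym (rank-count a M) ⟩
            card a M * q ^ r          ≡⟨ cong (_* q ^ r) (tight M ω ne) ⟩
            q ^ t * q ^ r             ∎)) (sym (*-identityˡ _)))
            where
            h : ℕ
            h = # (finV N) (λ H → high? a H ×-dec perp? M H)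

        -- This is `exact` summed over all functionals. The functional zero is no hyperplane and has
        -- `U 𝟘 ≡ T₀`, hence the correction terms on both sides.
        summed : ∑ (finV N) (λ H → 𝟙 (high? a H) * U H) * q ^ s + T₀ ≡ T₀ * q ^ r + T₀ * q ^ s
        summed = begin
          ∑ (finV N) (λ H → 𝟙 (high? a H) * U H) * q ^ s + T₀
            ≡⟨ cong₂ _+_ (sym (∑-*ʳ (finV N) (q ^ s) _)) (sym (∑-δ (finV N) 𝟘 (λ _ → T₀))) ⟩
          ∑ (finV N) (λ H → 𝟙 (high? a H) * U H * q ^ s) + ∑ (finV N) (λ H → 𝟙 (H ≟ᵛ 𝟘) * T₀)
            ≡⟨ sym (∑-+ (finV N) _ _) ⟩
          ∑ (finV N) (λ H → 𝟙 (high? a H) * U H * q ^ s + 𝟙 (H ≟ᵛ 𝟘) * T₀)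
            ≡⟨ ∑-cong (finV N) (λ H → at H (high? a H) (H ≟ᵛ 𝟘)) ⟩
          ∑ (finV N) (λ H → 𝟙 (high? a H) * T₀ + 𝟙 (H ≟ᵛ 𝟘) * (T₀ * q ^ s))
            ≡⟨ ∑-+ (finV N) _ _ ⟩
          ∑ (finV N) (λ H → 𝟙 (high? a H) * T₀) + ∑ (finV N) (λ H → 𝟙 (H ≟ᵛ 𝟘) * (T₀ * q ^ s))
            ≡⟨ cong₂ _+_ (trans (∑-*ʳ (finV N) T₀ _) (trans (cong (_* T₀) (#High a)) (*-comm (q ^ r) T₀))) (∑-δ (finV N) 𝟘 (λ _ → T₀ * q ^ s)) ⟩
          T₀ * q ^ r + T₀ * q ^ s ∎
          where
          open ≡-Reasoning
          at : ∀ H (d : Dec (High a H)) (d′ : Dec (H ≡ 𝟘)) → 𝟙 d * U H * q ^ s + 𝟙 d′ * T₀ ≡ 𝟙 d * T₀ + 𝟙 d′ * (T₀ * q ^ s)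
          at H (yes hH) (yes refl) = trans (cong (λ z → 1 * z * q ^ s + 1 * T₀) U-𝟘) (lem T₀ (q ^ s))
            where
            lem : ∀ a b → 1 * a * b + 1 * a ≡ 1 * a + 1 * (a * b)
            lem = ℕ-solve
          at H (yes hH) (no ne)    = cong (_+ 0) (trans (cong (_* q ^ s) (*-identityˡ (U H))) (trans (exact H hH ne) (sym (*-identityˡ T₀))))
          at H (no ¬hH) (yes refl) = contradiction (has-0 (high-sub {N} a)) ¬hH
          at H (no _)   (no _)     = refl

        absurd : T₀ ≢ 0 → ⊥
        absurd ne = <-irrefl eq (<-≤-trans (m<m*n T₀ (q ^ 1) {{ℕ.≢-nonZero ne}} (≤-trans 2≤q (≤-reflexive (sym (*-identityʳ q)))))
          (*-monoʳ-≤ T₀ (q^-mono {1} {s} 1≤s)))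
          where
          eq : T₀ ≡ T₀ * q ^ s
          eq = +-cancelˡ-≡ (T₀ * q ^ r) _ _ (trans (cong (_+ T₀) (sym incidences)) summed)
          1≤s : 1 ≤ s
          1≤s = ≤-trans (≤-reflexive (sym (m+n∸n≡m 1 t))) (∸-monoˡ-≤ t (s≤s t≤ℓ))

    restrict-bounded : ∀ {n} ℓ k → n ≡ ℓ + k → e ℓ ≤ k →
      (∀ {G : Vec (V n) ℓ → Carrier} → Alt ℓ G → T ℓ k G ≢ 0 → Bounded ℓ k G) →
      ∀ {F : Vec (V (suc n)) ℓ → Carrier} → Alt ℓ F → T ℓ (suc k) F ≢ 0 → Bounded ℓ (suc k) F
    restrict-bounded {n} ℓ k n≡ e≤k ih {F} aF ne with lastSplit n n ≤-refl
    ... | s , _ with ih (alt-map (Split.lin-g s) aF) (λ z → ne (trans (Restrict.T-restrict s ℓ k n≡ e≤k F) z))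
    ...   | lower , equality =
      subst₂ (λ x y → gl ℓ * q ^ x ≤ y) (sym (Δ-restrict ℓ ≤-refl)) (sym (T-restrict F)) lower ,
      λ eq → decomposable aF (equality (trans (sym (T-restrict F)) (trans eq (cong (λ z → gl ℓ * q ^ z) (Δ-restrict ℓ ≤-refl)))))
      where open Restrict s ℓ k n≡ e≤k

    findLast : ∀ ℓ k r → (∀ j → j ≤ ℓ → e j < suc k → j ≤ r) →
               ∃ λ t → t ≤ r × e t ≤ k × (∀ j → j ≤ ℓ → e j < suc k → j ≤ t)
    findLast ℓ k zero h = 0 , ≤-refl , subst (_≤ k) (sym e0) z≤n , h
    findLast ℓ k (suc r) h with e (suc r) ≤? k
    ... | yes p = suc r , ≤-refl , p , h
    ... | no ¬p with findLast ℓ k r (λ j j≤ℓ ej → ≤-pred (≤∧≢⇒< (h j j≤ℓ ej) (λ { refl → ¬p (≤-pred ej) })))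
    ...   | t , t≤r , et , l = t , m≤n⇒m≤1+n t≤r , et , l

    shrink-bounded : ∀ {n} ℓ k → n ≡ suc ℓ + k → suc k ≤ e (suc ℓ) →
      (∀ ℓ′ k′ → n ≡ ℓ′ + k′ → ∀ {G : Vec (V n) ℓ′ → Carrier} → Alt ℓ′ G → T ℓ′ k′ G ≢ 0 → Bounded ℓ′ k′ G) →
      ∀ {F : Vec (V (suc n)) (suc ℓ) → Carrier} → Alt (suc ℓ) F → T (suc ℓ) (suc k) F ≢ 0 → Bounded (suc ℓ) (suc k) F
    shrink-bounded {n} ℓ k n≡ k<e ih {F} aF ne
      with findLast (suc ℓ) k ℓ (λ j p r → ≤-pred (≤∧≢⇒< p (λ { refl → <⇒≱ r k<e })))
    ... | t , t≤ℓ , et≤k , last = lower , equality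
      where
      open Shrink ℓ k t n≡ t≤ℓ et≤k k<e last aF
      contract : ∀ (s : Split n a) → T (suc ℓ) (suc k) (λ M → F (map (Split.g s) M)) ≡ 0 → Bounded (suc ℓ) (suc k) F
      contract s vanish = Contract.bounded s ℓ (suc k) n≡′ fits k<e aF vanish ne (ih ℓ (suc k) n≡′)
        where
        n≡′ : n ≡ ℓ + suc k
        n≡′ = trans n≡ (sym (+-suc ℓ k))
      lower : gl (suc ℓ) * q ^ Δ (suc ℓ) (suc k) ≤ T (suc ℓ) (suc k) F
      lower with lastSplit n a a≤n
      ... | s , _ with At.T′ s ≟ⁿ 0
      ...   | yes z = proj₁ (contract s z)
      ...   | no nz = ≤-trans (At.lower s (ih (suc ℓ) k n≡) nz) (At.T-≥-shrink s)
      equality : T (suc ℓ) (suc k) F ≡ gl (suc ℓ) * q ^ Δ (suc ℓ) (suc k) → Decomposable (suc ℓ) (suc k) F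
      -- The bound came from one arbitrary hyperplane; equality needs one on which `F` vanishes
      -- within Ω. It is found by searching all functionals that vanish on V_a, and `Contradiction`
      -- excludes failure.
      equality eq with ∃? (finV (suc n)) (λ H → (high? a H ×-dec ¬? (H ≟ᵛ 𝟘)) ×-dec (U H ≟ⁿ 0))
      ... | no none = contradiction ne (Contradiction.absurd (ih (suc ℓ) k n≡) eq (λ H hH H≢𝟘 z → none (H , (hH , H≢𝟘) , z)))
      ... | yes (H , (hH , H≢𝟘) , z) with split-of H hH H≢𝟘
      ...   | s , h≡ = proj₂ (contract s (trans (sym (U-split H s h≡)) z)) eq

    -- A hyperplane of K^(ℓ+1) cannot hold ℓ + 1 independent rows, so `F` vanishes inside it and
    -- contraction applies.
    square-bounded : ∀ {n} ℓ → n ≡ ℓ + 0 →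
      (∀ {G : Vec (V n) ℓ → Carrier} → Alt ℓ G → T ℓ 0 G ≢ 0 → Bounded ℓ 0 G) →
      ∀ {F : Vec (V (suc n)) (suc ℓ) → Carrier} → Alt (suc ℓ) F → T (suc ℓ) 0 F ≢ 0 → Bounded (suc ℓ) 0 F
    square-bounded {n} ℓ n≡ ih aF ne with lastSplit n 0 z≤n
    ... | s , _ = Contract.bounded s ℓ 0 n≡ (λ j p ()) z≤n aF
      (T-≡0 {suc ℓ} {0} (λ M _ → alt-overflow (alt-map (Split.lin-g s) aF) (≤-reflexive (cong suc (trans n≡ (+-identityʳ ℓ)))) M)) ne ih

    -- In codimension `suc k` the test `e ℓ ≤ k` asks whether the last condition is imposed. If so,
    -- Ω lies in a hyperplane and `k` drops; if not, a hyperplane through the last imposed step is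
    -- compared with the whole space.
    bounded : ∀ n ℓ k → n ≡ ℓ + k → ∀ {F : Vec (V n) ℓ → Carrier} → Alt ℓ F → T ℓ k F ≢ 0 → Bounded ℓ k F
    bounded zero zero zero refl {F} aF ne =
      n≢0⇒n>0 ne , λ _ → [] , F , altZ , (λ { [] _ → refl }) , λ j p r c ()
    bounded (suc n) ℓ (suc k) n≡ aF ne with e ℓ ≤? k
    ... | yes e≤k = restrict-bounded ℓ k n≡′ e≤k (bounded n ℓ k n≡′) aF ne
      where
      n≡′ : n ≡ ℓ + k
      n≡′ = suc-injective (trans n≡ (+-suc ℓ k))
    bounded (suc n) zero    (suc k) n≡ aF ne | no e≰k = contradiction (subst (_≤ k) (sym e0) z≤n) e≰k
    bounded (suc n) (suc ℓ) (suc k) n≡ aF ne | no e≰k =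
      shrink-bounded ℓ k (trans (suc-injective n≡) (+-suc ℓ k)) (≰⇒> e≰k) (bounded n) aF ne
    bounded (suc n) (suc ℓ) zero n≡ aF ne = square-bounded ℓ (suc-injective n≡) (bounded n ℓ 0 (suc-injective n≡)) aF ne

    -- In dimension ℓ every nonzero form is a multiple of the determinant, so T counts GL_ℓ.
    T-square : ∀ ℓ {n} → n ≡ ℓ → ∀ {F : Vec (V n) ℓ → Carrier} → Alt ℓ F → T ℓ 0 F ≢ 0 → T ℓ 0 F ≡ gl ℓ
    T-square zero refl {F} aF ne = trans (+-identityʳ _) (trans (cong₂ _*_ (𝟙-yes (Ω? 0 0 {0} []) (λ _ _ ()))
      (𝟙-yes (nonzero? (F [])) (λ z → ne (T-≡0 {0} {0} {F = F} (λ { [] _ → z }))))) refl)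
    T-square (suc ℓ) refl {F} aF ne with lastSplit ℓ 0 z≤n
    ... | s , _ = begin
      T (suc ℓ) 0 F                        ≡⟨ T-G ⟩
      nz (suc ℓ) * (q ^ ℓ * T ℓ 0 G)       ≡⟨ cong (λ z → nz (suc ℓ) * (q ^ ℓ * z)) (T-square ℓ refl aG G≢0) ⟩
      nz (suc ℓ) * (q ^ ℓ * gl ℓ)          ∎
      where
      open ≡-Reasoning
      open Contract s ℓ 0 (sym (+-identityʳ ℓ)) (λ j p ()) z≤n aF
        (T-≡0 {suc ℓ} {0} (λ M _ → alt-overflow (alt-map (Split.lin-g s) aF) ≤-refl M)) ne (bounded ℓ ℓ 0 (sym (+-identityʳ ℓ)))

    -- The i-th entry of β (counted from o + 1) is at most the i-th step of the flag; entries are 0-based.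
    Adm : ∀ {n r} → ℕ → Vec (Fin n) r → Set
    Adm o []      = ⊤
    Adm o (b ∷ β) = toℕ b < suc o + e (suc o) × Adm (suc o) β

    low-unit : ∀ {n b} (p : Fin n) → toℕ p < b → Low b (unit p)
    low-unit {suc n} {suc b} Fin.zero    h       = has-0 (low-sub {n} b)
    low-unit {suc n} {suc b} (Fin.suc p) (s≤s h) = low-unit p h

    low-units : ∀ {n r} o (β : Vec (Fin n) r) → Adm o β → ∀ j c → Low j c → Low (o + j + e (o + j)) (c ∙ map unit β)
    low-units {n} o []      _        j       []       h = has-0 (low-sub {n} (o + j + e (o + j)))
    low-units {n} o (b ∷ β) _        zero    (c ∷ cs) h =
      subst (Low (o + 0 + e (o + 0))) (sym (trans (cong (_∙ map unit (b ∷ β)) (low-0 (c ∷ cs) h)) (zero-map (lin-∙ˡ (map unit (b ∷ β))))))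
        (has-0 (low-sub {n} (o + 0 + e (o + 0))))
    low-units o (b ∷ β) (b< , adm) (suc j) (c ∷ cs) h = subst (λ z → Low (z + e z) ((c ∷ cs) ∙ map unit (b ∷ β))) (sym (+-suc o j))
      (has-⊕ (low-sub (suc o + j + e (suc o + j))) {c ⊙ unit b} {cs ∙ map unit β}
        (has-⊙ (low-sub (suc o + j + e (suc o + j))) c {unit b}
          (low-mono (flag-mono (m≤m+n (suc o) j)) (unit b) (low-unit b b<)))
        (low-units (suc o) β adm j cs h))

    Ω-units : ∀ {n ℓ} k (β : Vec (Fin n) ℓ) → Adm 0 β → Ω ℓ k (map unit β)
    Ω-units {ℓ = ℓ} k β adm j j≤ℓ _ = ≤-trans (≤-reflexive (sym (#Low j≤ℓ))) (#-mono (finV ℓ) _ _ (low-units 0 β adm j))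

    lookup-snoc : ∀ {A : Set} {P : A → Set} {r} (β : Vec A r) x → (∀ i → P (lookup β i)) → P x →
                  ∀ i → P (lookup (insertAt β (Fin.fromℕ r) x) i)
    lookup-snoc []      x h p Fin.zero    = p
    lookup-snoc (b ∷ β) x h p Fin.zero    = h Fin.zero
    lookup-snoc (b ∷ β) x h p (Fin.suc i) = lookup-snoc β x (λ i → h (Fin.suc i)) p i

    inc-snoc : ∀ {n r} (β : Vec (Fin n) r) x → Inc β → (∀ i → toℕ (lookup β i) < toℕ x) → Inc (insertAt β (Fin.fromℕ r) x)
    inc-snoc []      x inc h Fin.zero Fin.zero ()
    inc-snoc (b ∷ β) x inc h = inc-∷ {b = b} {β = insertAt β (Fin.fromℕ _) x}
      (lookup-snoc {P = λ c → toℕ b < toℕ c} β x (inc-head inc) (h Fin.zero)) (inc-snoc β x (inc-tail inc) (λ i → h (Fin.suc i)))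

    adm-snoc : ∀ {n r} o (β : Vec (Fin n) r) x → Adm o β → toℕ x < suc (o + r) + e (suc (o + r)) → Adm o (insertAt β (Fin.fromℕ r) x)
    adm-snoc o []      x _         h rewrite +-identityʳ o = h , tt
    adm-snoc {r = suc r} o (b ∷ β) x (p , adm) h = p , adm-snoc (suc o) β x adm (subst (λ z → toℕ x < suc z + e (suc z)) (+-suc o r) h)

    adm-inject : ∀ {n r} o (β : Vec (Fin n) r) → Adm o β → Adm o (map Fin.inject₁ β)
    adm-inject o []      _         = tt
    adm-inject o (b ∷ β) (p , adm) = subst (_< suc o + e (suc o)) (sym (Finₚ.toℕ-inject₁ b)) p , adm-inject (suc o) β adm

    lookup-inject : ∀ {n r} (β : Vec (Fin n) r) i → toℕ (lookup (map Fin.inject₁ β) i) ≡ toℕ (lookup β i)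
    lookup-inject β i = trans (cong toℕ (Vecₚ.lookup-map i Fin.inject₁ β)) (Finₚ.toℕ-inject₁ _)

    inc-inject : ∀ {n r} (β : Vec (Fin n) r) → Inc β → Inc (map Fin.inject₁ β)
    inc-inject β inc i j h = subst₂ _<_ (sym (lookup-inject β i)) (sym (lookup-inject β j)) (inc i j h)

    unit-inject : ∀ {n} (i : Fin n) → insertAt (unit i) (Fin.fromℕ n) 0# ≡ unit (Fin.inject₁ i)
    unit-inject {suc n} Fin.zero    = cong (1# ∷_) (go n)
      where
      go : ∀ n → insertAt (𝟘 {V n}) (Fin.fromℕ n) 0# ≡ 𝟘
      go zero    = refl
      go (suc n) = cong (0# ∷_) (go n)
    unit-inject {suc n} (Fin.suc i) = cong (0# ∷_) (unit-inject i)

    Witness : ∀ {n ℓ} → (Vec (V n) ℓ → Carrier) → Set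
    Witness {n} {ℓ} D = ∃ λ (β : Vec (Fin n) ℓ) → Inc β × Adm 0 β × D (map unit β) ≢ 0#

    -- A form is determined on Ω by its values at the coordinate subspaces belonging to Ω.
    unit-witness : ∀ n ℓ k → n ≡ ℓ + k → ∀ {D : Vec (V n) ℓ → Carrier} → Alt ℓ D → T ℓ k D ≢ 0 → Witness D
    unit-witness n zero k n≡ {D} aD ne with T-witness {F = D} ne
    ... | [] , _ , nz = [] , (λ ()) , tt , nz
    unit-witness (suc n) (suc ℓ) k n≡ {D} aD ne = cases k n≡ ne
      where
      p = Fin.fromℕ n
      units-g : ∀ (g : V n → V (suc n)) → (∀ x → g x ≡ insertAt x p 0#) → ∀ {r} (β : Vec (Fin n) r) → map g (map unit β) ≡ map unit (map Fin.inject₁ β)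
      units-g g g≡ []      = refl
      units-g g g≡ (b ∷ β) = cong₂ _∷_ (trans (g≡ (unit b)) (unit-inject b)) (units-g g g≡ β)
      inside : ∀ (g : V n → V (suc n)) → (∀ x → g x ≡ insertAt x p 0#) → Witness (λ M → D (map g M)) → Witness D
      inside g g≡ (β , inc , adm , nz) = map Fin.inject₁ β , inc-inject β inc , adm-inject 0 β adm ,
        λ z → nz (trans (cong D (units-g g g≡ β)) z)
      contracted : ∀ k → suc n ≡ suc ℓ + k → k ≤ e (suc ℓ) → ∀ a (s : Split n a) → (∀ x → Split.g s x ≡ insertAt x p 0#) → Split.v s ≡ unit p →
                   (∀ j → j ≤ suc ℓ → e j < k → j + e j ≤ a) → T (suc ℓ) k D ≢ 0 → T (suc ℓ) k (λ M → D (map (Split.g s) M)) ≡ 0 → Witness D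
      contracted k n≡ k≤e a s g≡ v≡ fits ne vanish
        with unit-witness n ℓ k (suc-injective n≡) (alt-map (Split.lin-g s) (alt-tail aD (Split.v s))) G≢0
        where
        G≢0 : T ℓ k (λ X → D (Split.v s ∷ map (Split.g s) X)) ≢ 0
        G≢0 z = ne (trans (Step⁺.T-contract s ℓ k fits k≤e aD vanish) (trans (cong (λ w → nz (suc ℓ) * (q ^ n * w)) z)
          (trans (cong (nz (suc ℓ) *_) (*-zeroʳ (q ^ n))) (*-zeroʳ (nz (suc ℓ))))))
      -- The vector split off is the last unit vector, so its index is appended at the end of `β`;
      -- `k ≤ e (suc ℓ)` makes it admissible there.
      ... | β , inc , adm , nz = insertAt (map Fin.inject₁ β) (Fin.fromℕ ℓ) p ,
        inc-snoc (map Fin.inject₁ β) p (inc-inject β inc) (λ i → ≤-trans (s≤s (≤-reflexive (lookup-inject β i))) (≤-trans (Finₚ.toℕ<n (lookup β i)) (≤-reflexive (sym (Finₚ.toℕ-fromℕ n))))) ,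
        adm-snoc 0 (map Fin.inject₁ β) p (adm-inject 0 β adm)
          (s≤s (≤-trans (≤-reflexive (trans (Finₚ.toℕ-fromℕ n) (suc-injective n≡))) (+-monoʳ-≤ ℓ k≤e))) ,
        λ z → nz (begin
          D (Split.v s ∷ map (Split.g s) (map unit β))
            ≡⟨ cong₂ (λ x X → D (x ∷ X)) v≡ (units-g (Split.g s) g≡ β) ⟩
          D (unit p ∷ map unit (map Fin.inject₁ β))
            ≡⟨ signed-≡0 (toℕ (Fin.fromℕ ℓ)) (trans (sym (alt-insertAt aD _ (Fin.fromℕ ℓ) (unit p)))
                 (trans (cong D (sym (Vecₚ.map-insertAt unit p (map Fin.inject₁ β) (Fin.fromℕ ℓ)))) z)) ⟩
          0# ∎)
        where open ≡-Reasoning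
      cases : ∀ k → suc n ≡ suc ℓ + k → T (suc ℓ) k D ≢ 0 → Witness D
      cases zero n≡ ne with lastSplit n 0 z≤n
      ... | s , g≡ , v≡ = contracted 0 n≡ z≤n 0 s g≡ v≡ (λ j p ()) ne
        (T-≡0 {suc ℓ} {0} (λ M _ → alt-overflow (alt-map (Split.lin-g s) aD) (≤-reflexive (trans n≡ (cong suc (+-identityʳ ℓ)))) M))
      cases (suc k) n≡ ne with lastSplit n n ≤-refl | e (suc ℓ) ≤? k
      ... | s , g≡ , v≡ | yes e≤k = inside (Split.g s) g≡ (unit-witness n (suc ℓ) k n≡′ (alt-map (Split.lin-g s) aD)
        (λ z → ne (trans (Restrict.T-restrict s (suc ℓ) k n≡′ e≤k D) z)))
        where
        n≡′ : n ≡ suc ℓ + k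
        n≡′ = suc-injective (trans n≡ (+-suc (suc ℓ) k))
      ... | s , g≡ , v≡ | no e≰k with T (suc ℓ) (suc k) (λ M → D (map (Split.g s) M)) ≟ⁿ 0
      ...   | yes z = contracted (suc k) n≡ (≰⇒> e≰k) n s g≡ v≡ fits ne z
        where
        fits : ∀ j → j ≤ suc ℓ → e j < suc k → j + e j ≤ n
        fits j p r with j ≟ⁿ suc ℓ
        ... | yes refl = contradiction (≤-pred r) e≰k
        ... | no ne = ≤-trans (+-mono-≤ (≤-pred (≤∧≢⇒< p ne)) (≤-trans (≤-pred r) (n≤1+n k))) (≤-reflexive (sym (suc-injective n≡)))
      ...   | no nz = inside (Split.g s) g≡ (unit-witness n (suc ℓ) k n≡′ (alt-map (Split.lin-g s) aD)
        (λ z → nz (trans (T-suc (suc ℓ) k n≡′ _) z)))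
        where
        n≡′ : n ≡ suc ℓ + k
        n≡′ = suc-injective (trans n≡ (+-suc (suc ℓ) k))

  -- The Schubert variety of α and its points

  module Schubert (ℓ k : ℕ) (α : Vec (Fin (ℓ + k)) ℓ) (incα : Inc α) where
    open Profile

    m : ℕ
    m = ℓ + k

    α-lower : ∀ i → toℕ i ≤ toℕ (lookup α i)
    α-lower = inc-≥ 0 α incα (λ _ → z≤n)

    α-upper : ∀ i → toℕ (lookup α i) ≤ toℕ i + k
    α-upper i = +-cancelʳ-≤ ℓ _ _ (≤-trans (inc-≤ α incα i) (≤-reflexive (lem ℓ k (toℕ i))))
      where
      lem : ∀ a b c → a + b + c ≡ c + b + a
      lem = ℕ-solve

    -- The shift makes the argument a 1-based index: `e j` is α_j - j. The value at zero belongs to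
    -- the zero subspace of the flag.
    e : ℕ → ℕ
    e zero    = 0
    e (suc j) = excess k α 0 j

    e-step : ∀ j → e j ≤ e (suc j)
    e-step zero    = z≤n
    e-step (suc j) = excess-step k α 0 α-upper incα j

    e≤k : ∀ j → e j ≤ k
    e≤k zero    = z≤n
    e≤k (suc j) = excess-≤ k α 0 α-upper j

    e-mono : ∀ {i j} → i ≤ j → e i ≤ e j
    e-mono = monotone e e-step

    open Flag e refl e-mono

    open Over K public using (InΩ; OnΠ)

    flag-α : ∀ i → suc (toℕ i) + e (suc (toℕ i)) ≡ suc (toℕ (lookup α i))
    flag-α i = cong suc (trans (cong (toℕ i +_) (excess-lookup k α 0 i)) (m+[n∸m]≡n (α-lower i)))

    ≼⇒adm : ∀ (β : Vec (Fin m) ℓ) → β ≼ α → Adm 0 β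
    ≼⇒adm β h = go 0 β (λ i → subst (toℕ (lookup β i) <_) (sym (flag-α i)) (s≤s (h i)))
      where
      go : ∀ {r} o (β : Vec (Fin m) r) → (∀ i → toℕ (lookup β i) < suc (o + toℕ i) + e (suc (o + toℕ i))) → Adm o β
      go o []      h = tt
      go o (b ∷ β) h = subst (λ z → toℕ b < suc z + e (suc z)) (+-identityʳ o) (h Fin.zero) ,
        go (suc o) β (λ i → subst (λ z → toℕ (lookup β i) < suc z + e (suc z)) (+-suc o (toℕ i)) (h (Fin.suc i)))

    adm⇒≼ : ∀ (β : Vec (Fin m) ℓ) → Adm 0 β → β ≼ α
    adm⇒≼ β h i = ≤-pred (subst (toℕ (lookup β i) <_) (flag-α i) (go 0 β h i))
      where
      go : ∀ {r} o (β : Vec (Fin m) r) → Adm o β → ∀ i → toℕ (lookup β i) < suc (o + toℕ i) + e (suc (o + toℕ i))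
      go o (b ∷ β) (h , _)   Fin.zero    = subst (λ z → toℕ b < suc z + e (suc z)) (sym (+-identityʳ o)) h
      go o (b ∷ β) (_ , adm) (Fin.suc i) = subst (λ z → toℕ (lookup β i) < suc z + e (suc z)) (sym (+-suc o (toℕ i))) (go (suc o) β adm i)

    card≥1 : ∀ {r} b (M : Vec (V m) r) → 1 ≤ card b M
    card≥1 {r} b M = n≢0⇒n>0 (#-≢0 (finV r) (λ c → low? b (c ∙ M)) {𝟘} (subst (Low b) (sym (zero-map (lin-∙ˡ M))) (has-0 (low-sub {m} b))))

    -- A condition that `Ω` leaves out has `e j` equal to `k`, since no excess is larger, and is
    -- then automatic by codimension.
    Ω-dims : ∀ (N : Vec (V m) ℓ) → Ω ℓ k N → ∀ j → j ≤ ℓ → q ^ j ≤ card (j + e j) N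
    Ω-dims N ω j j≤ℓ with e j <? k
    ... | yes r = ω j j≤ℓ r
    ... | no ¬r = card-codim (j + e j) j N (≤-reflexive (trans (cong (λ z → ℓ + k ∸ (j + z)) (≤-antisym (e≤k j) (≮⇒≥ ¬r)))
      (trans (cong₂ _∸_ (+-comm ℓ k) (+-comm j k)) ([m+n]∸[m+o]≡n∸o k ℓ j)))) j≤ℓ

    inΩ⇒Ω : ∀ M → InΩ α M → Ω ℓ k (toVec M)
    inΩ⇒Ω M (li , dims) zero    _ _ = card≥1 0 (toVec M)
    inΩ⇒Ω M (li , dims) (suc j) j<ℓ _ = subst₂ (λ x y → q ^ x ≤ card y (toVec M)) (cong suc toℕ-i) (trans (sym (flag-α i)) (cong (λ z → suc z + e (suc z)) toℕ-i))
      (≤-trans (hasIndep⇒# {S = λ x → InSpan M x × InV b x} (spanLow? (toVec M) b) (spanLow-sub (toVec M) b) (λ x (s , v) → inSpan⇒span M x s , inV⇒low b x v) (dims i))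
        (≤-reflexive (#spanLow (toVec M) (linIndep⇒indep M li) b)))
      where
      i = Fin.fromℕ< j<ℓ
      b = suc (toℕ (lookup α i))
      toℕ-i : toℕ i ≡ j
      toℕ-i = Finₚ.toℕ-fromℕ< j<ℓ

    Ω⇒inΩ : ∀ N → Indep N → Ω ℓ k N → InΩ α (fromVec N)
    Ω⇒inΩ N ind ω = indep⇒linIndep (fromVec N) (subst Indep (sym (toVec-fromVec N)) ind) , λ j →
      #⇒hasIndep {S = λ x → InSpan (fromVec N) x × InV (suc (toℕ (lookup α j))) x} (spanLow? N (suc (toℕ (lookup α j))))
        (λ x (s , l) → span⇒inSpan (fromVec N) (lookup x) (subst₂ Span (sym (toVec-fromVec N)) (sym (Vecₚ.tabulate∘lookup x)) s) , low⇒lookup _ x l)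
        (≤-trans (Ω-dims N ω (suc (toℕ j)) (Finₚ.toℕ<n j)) (≤-reflexive (trans (cong (λ z → card z N) (flag-α j)) (sym (#spanLow N ind _)))))

    rowsIn? : ∀ {r} (R M : Vec (V m) r) → Dec (∃ λ P → map (_∙ R) P ≡ M)
    rowsIn? {r} R M = ∃? (finM r r) (λ P → Finite._≟_ (finM m r) (map (_∙ R) P) M)

    map-∙-injective : ∀ {r s} (R : Vec (V m) r) → Indep R → ∀ (P Q : Vec (V r) s) → map (_∙ R) P ≡ map (_∙ R) Q → P ≡ Q
    map-∙-injective R ind []      []      eq = refl
    map-∙-injective R ind (c ∷ P) (d ∷ Q) eq = cong₂ _∷_ (indep-injective R ind c d (Vecₚ.∷-injectiveˡ eq)) (map-∙-injective R ind P Q (Vecₚ.∷-injectiveʳ eq))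

    alt-nonzero : ∀ {F : Vec (V m) ℓ → Carrier} → Alt ℓ F → ∀ R P → F (map (_∙ R) P) ≢ 0# → F R ≢ 0#
    alt-nonzero aF R P ne z = ne (alt-span aF R z P)

    -- Coefficient matrices `P` parametrize the tuples in the row span of `R`. Pulled back along
    -- them, `F` is a nonzero form in ℓ arguments on K^ℓ, which `T-square` counts.
    #bases : ∀ {F : Vec (V m) ℓ → Carrier} → Alt ℓ F → ∀ R → F R ≢ 0# → # (finM m ℓ) (λ M → rowsIn? R M ×-dec nonzero? (F M)) ≡ gl ℓ
    #bases {F} aF R ne = begin
      # (finM m ℓ) (λ M → rowsIn? R M ×-dec nonzero? (F M))
        ≡⟨ #-image (finM ℓ ℓ) (finM m ℓ) (map (_∙ R)) (map-∙-injective R (injective-rows aF R ne)) (λ M → nonzero? (F M)) ⟩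
      # (finM ℓ ℓ) (λ P → nonzero? (F (map (_∙ R) P)))
        ≡⟨ ∑-cong (finM ℓ ℓ) (λ P → sym (trans (cong (_* 𝟙 (nonzero? (F (map (_∙ R) P)))) (𝟙-yes (Ω? ℓ 0 P) (λ _ _ ()))) (*-identityˡ _))) ⟩
      T ℓ 0 (λ P → F (map (_∙ R) P))
        ≡⟨ T-square ℓ refl (alt-map (lin-∙ˡ R) aF) (T-≢0 {F = λ P → F (map (_∙ R) P)} (idM ℓ) (λ _ _ ()) (λ z → ne (trans (cong F (sym identity)) z))) ⟩
      gl ℓ ∎
      where
      open ≡-Reasoning
      rows : ∀ {n} (R : Vec (V m) n) → map (_∙ R) (idM n) ≡ R
      rows {zero}  [] = refl
      rows {suc n} (x ∷ R) = cong₂ _∷_ (trans (cong₂ _⊕_ (⊙-identity x) (zero-map (lin-∙ˡ R))) (⊕-identityʳ x))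
        (trans (sym (Vecₚ.map-∘ (_∙ (x ∷ R)) (0# ∷_) (idM n))) (trans (Vecₚ.map-cong (λ c → trans (cong (_⊕ c ∙ R) (⊙-zeroˡ x)) (⊕-identityˡ _)) (idM n)) (rows R)))
      identity : map (_∙ R) (idM ℓ) ≡ R
      identity = rows R

    span-rowsIn : ∀ {r} (R : Vec (V m) r) P → Indep (map (_∙ R) P) → ∀ x → Span R x → Span (map (_∙ R) P) x
    span-rowsIn R P ind x (c , refl) = exchange R P ind c

    span-rowsIn⁻ : ∀ {r} (R : Vec (V m) r) (P : Vec (V r) r) x → Span (map (_∙ R) P) x → Span R x
    span-rowsIn⁻ R P x (c , refl) = c ∙ P , sym (map-∙-∙ c P R)

    Ω-rowsIn : ∀ R P → Indep R → Indep (map (_∙ R) P) → Ω ℓ k R → Ω ℓ k (map (_∙ R) P)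
    Ω-rowsIn R P indR ind = cond-map (cards R) (cards (map (_∙ R) P)) (λ j p r → ≤-trans (≤-reflexive (sym (#spanLow R indR (j + e j))))
      (≤-trans (#-mono (finV m) (spanLow? R (j + e j)) (spanLow? (map (_∙ R) P) (j + e j)) (λ x (s , l) → span-rowsIn R P ind x s , l)) (≤-reflexive (#spanLow (map (_∙ R) P) ind (j + e j)))))

    module Classes {F : Vec (V m) ℓ → Carrier} (aF : Alt ℓ F) (NΩ : ℕ) (reps : Fin NΩ → Matrix ℓ m)
                   (reps-in : ∀ i → InΩ α (reps i)) (reps-distinct : ∀ i j → SameSpace (reps i) (reps j) → i ≡ j)
                   (reps-complete : ∀ M → InΩ α M → ∃ λ i → SameSpace M (reps i)) where

      R : Fin NΩ → Vec (V m) ℓ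
      R i = toVec (reps i)

      N : ℕ
      N = # (finFin NΩ) (λ i → nonzero? (F (R i)))

      sameSpace : ∀ (M M′ : Matrix ℓ m) → (∀ i → Span (toVec M) (lookup (toVec M′) i)) → (∀ i → Span (toVec M′) (lookup (toVec M) i)) → SameSpace M M′
      sameSpace M M′ h h′ = (λ i → span⇒inSpan M (M′ i) (subst (Span (toVec M)) (Vecₚ.lookup∘tabulate (λ i → tabulate (M′ i)) i) (h i))) ,
        (λ i → span⇒inSpan M′ (M i) (subst (Span (toVec M′)) (Vecₚ.lookup∘tabulate (λ i → tabulate (M i)) i) (h′ i)))

      spanned : ∀ (M M′ : Matrix ℓ m) → (∀ i → InSpan M (M′ i)) → ∃ λ P → map (_∙ toVec M) P ≡ toVec M′
      spanned M M′ h = span-rows (toVec M) (toVec M′) (λ i → subst (Span (toVec M)) (sym (Vecₚ.lookup∘tabulate (λ i → tabulate (M′ i)) i)) (inSpan⇒span M (M′ i) (h i)))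

      -- A tuple of Ω with `F M ≢ 0#` lies in the row span of exactly one representative, and each
      -- representative off the hyperplane carries `gl ℓ` such tuples.
      T-classes : T ℓ k F ≡ gl ℓ * N
      T-classes = begin
        T ℓ k F
          ≡⟨ ∑-cong (finM m ℓ) pointwise ⟩
        ∑ (finM m ℓ) (λ M → ∑ (finFin NΩ) (λ i → 𝟙 (nonzero? (F (R i))) * 𝟙 (rowsIn? (R i) M ×-dec nonzero? (F M))))
          ≡⟨ ∑-swap (finM m ℓ) (finFin NΩ) _ ⟩
        ∑ (finFin NΩ) (λ i → ∑ (finM m ℓ) (λ M → 𝟙 (nonzero? (F (R i))) * 𝟙 (rowsIn? (R i) M ×-dec nonzero? (F M))))
          ≡⟨ ∑-cong (finFin NΩ) (λ i → trans (∑-*ˡ (finM m ℓ) (𝟙 (nonzero? (F (R i)))) _) (bases i)) ⟩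
        ∑ (finFin NΩ) (λ i → gl ℓ * 𝟙 (nonzero? (F (R i))))
          ≡⟨ ∑-*ˡ (finFin NΩ) (gl ℓ) _ ⟩
        gl ℓ * N ∎
        where
        open ≡-Reasoning
        bases : ∀ i → 𝟙 (nonzero? (F (R i))) * # (finM m ℓ) (λ M → rowsIn? (R i) M ×-dec nonzero? (F M)) ≡ gl ℓ * 𝟙 (nonzero? (F (R i)))
        bases i = at (nonzero? (F (R i)))
          where
          at : (d : Dec (F (R i) ≢ 0#)) → 𝟙 d * # (finM m ℓ) (λ M → rowsIn? (R i) M ×-dec nonzero? (F M)) ≡ gl ℓ * 𝟙 d
          at (no _)   = sym (*-zeroʳ (gl ℓ))
          at (yes ne) = trans (*-identityˡ _) (trans (#bases aF (R i) ne) (sym (*-identityʳ _)))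
        unique : ∀ M → F M ≢ 0# → ∀ i j → ∃ (λ P → map (_∙ R i) P ≡ M) → ∃ (λ P → map (_∙ R j) P ≡ M) → i ≡ j
        unique M ne i j (P , eP) (Q , eQ) = reps-distinct i j (sameSpace (reps i) (reps j)
          (λ r → span-rowsIn⁻ (R i) P _ (subst (λ z → Span z (lookup (R j) r)) (trans eQ (sym eP)) (span-rowsIn (R j) Q (ind Q eQ) _ (span-row (R j) r))))
          (λ r → span-rowsIn⁻ (R j) Q _ (subst (λ z → Span z (lookup (R i) r)) (trans eP (sym eQ)) (span-rowsIn (R i) P (ind P eP) _ (span-row (R i) r)))))
          where
          ind : ∀ {i} P → map (_∙ R i) P ≡ M → Indep (map (_∙ R i) P)
          ind P refl = injective-rows aF M ne
        term? : ∀ i M → Dec (F (R i) ≢ 0# × (∃ (λ P → map (_∙ R i) P ≡ M) × F M ≢ 0#))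
        term? i M = nonzero? (F (R i)) ×-dec (rowsIn? (R i) M ×-dec nonzero? (F M))
        pointwise : ∀ M → 𝟙 (Ω? ℓ k M) * 𝟙 (nonzero? (F M)) ≡ ∑ (finFin NΩ) (λ i → 𝟙 (nonzero? (F (R i))) * 𝟙 (rowsIn? (R i) M ×-dec nonzero? (F M)))
        pointwise M = trans (sym (𝟙-× (Ω? ℓ k M) (nonzero? (F M)))) (trans (at (Ω? ℓ k M ×-dec nonzero? (F M)))
          (∑-cong (finFin NΩ) (λ i → 𝟙-× (nonzero? (F (R i))) (rowsIn? (R i) M ×-dec nonzero? (F M)))))
          where
          at : (d : Dec (Ω ℓ k M × F M ≢ 0#)) → 𝟙 d ≡ # (finFin NΩ) (λ i → term? i M)
          at (yes (ω , ne)) = sym (#-single (finFin NΩ) (λ i → term? i M) i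
            (alt-nonzero aF (R i) P (λ z → ne (trans (cong F (sym eP)) z)) , (P , eP) , ne)
            (λ j (_ , rows , _) → unique M ne j i rows (P , eP)))
            where
            found : ∃ λ i → SameSpace (fromVec M) (reps i)
            found = reps-complete (fromVec M) (Ω⇒inΩ M (injective-rows aF M ne) ω)
            i = proj₁ found
            rows : ∃ λ P → map (_∙ R i) P ≡ toVec (fromVec M)
            rows = spanned (reps i) (fromVec M) (proj₂ (proj₂ found))
            P = proj₁ rows
            eP : map (_∙ R i) P ≡ M
            eP = trans (proj₂ rows) (toVec-fromVec M)
          at (no ¬p) = sym (∑-zero (finFin NΩ) _ (λ i → 𝟙-no (term? i M) (bad i)))
            where
            bad : ∀ i → ¬ (F (R i) ≢ 0# × (∃ (λ P → map (_∙ R i) P ≡ M) × F M ≢ 0#))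
            bad i (neR , (P , refl) , ne) = ¬p (Ω-rowsIn (R i) P (injective-rows aF (R i) neR) (injective-rows aF M ne) (inΩ⇒Ω (reps i) (reps-in i)) , ne)

      module _ (c : Vec (Fin m) ℓ → Carrier) (F≡ : ∀ M → formVal c M ≡ F (toVec M)) (NΠ : ℕ)
               (countΠ : CountClasses (λ M → InΩ α M × OnΠ c M) SameSpace NΠ) where

        -- The two lists of representatives are chosen independently. Sending a class on Π to the
        -- representative of Ω with the same span matches them with those where `F` vanishes,
        -- because by `alt-span` vanishing depends on the span only.
        NΩ-split : NΠ + N ≡ NΩ
        NΩ-split = trans (cong (_+ N) NΠ≡) (trans (sym (∑-+ (finFin NΩ) _ _))
          (trans (∑-cong (finFin NΩ) (λ i → 𝟙-¬ (F (R i) ≟ 0#))) (size-fin NΩ)))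
          where
          open ≤-Reasoning
          repsΠ = proj₁ countΠ
          Π-in = proj₁ (proj₂ countΠ)
          Π-distinct = proj₁ (proj₂ (proj₂ countΠ))
          Π-complete = proj₂ (proj₂ (proj₂ countΠ))
          trans-span : ∀ (A B C : Matrix ℓ m) → (∀ i → InSpan A (B i)) → (∀ i → InSpan B (C i)) → ∀ i → Span (toVec A) (lookup (toVec C) i)
          trans-span A B C h h′ i with spanned A B h | spanned B C h′
          ... | P , eP | Q , eQ = subst (Span (toVec A)) (cong (λ z → lookup z i) eQ)
            (subst (Span (toVec A)) (sym (Vecₚ.lookup-map i (_∙ toVec B) Q))
              (span-rowsIn⁻ (toVec A) P _ (subst (λ z → Span z (lookup Q i ∙ toVec B)) (sym eP) (lookup Q i , refl))))
          same-trans : ∀ A B C → SameSpace A B → SameSpace B C → SameSpace A C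
          same-trans A B C (ab , ba) (bc , cb) = sameSpace A C (trans-span A B C ab bc) (trans-span C B A cb ba)
          same-sym : ∀ {A B : Matrix ℓ m} → SameSpace A B → SameSpace B A
          same-sym (ab , ba) = ba , ab
          vanish : ∀ A B → SameSpace A B → F (toVec A) ≡ 0# → F (toVec B) ≡ 0#
          vanish A B (ab , _) z with spanned A B ab
          ... | P , eP = trans (cong F (sym eP)) (alt-span aF (toVec A) z P)
          class : ∀ j → ∃ λ i → SameSpace (repsΠ j) (reps i)
          class j = reps-complete (repsΠ j) (proj₁ (Π-in j))
          class-vanish : ∀ j → F (R (proj₁ (class j))) ≡ 0#
          class-vanish j = vanish (repsΠ j) _ (proj₂ (class j)) (trans (sym (F≡ (repsΠ j))) (proj₂ (Π-in j)))
          zero? : ∀ i → Dec (F (R i) ≡ 0#)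
          zero? i = F (R i) ≟ 0#
          NΠ≡ : NΠ ≡ # (finFin NΩ) zero?
          NΠ≡ = ≤-antisym
            (≤-trans (≤-reflexive (sym (size-fin NΠ)))
              (#-injection (finFin NΠ) (finFin NΩ) (λ _ → yes tt) zero? (λ j → proj₁ (class j)) (λ j _ → class-vanish j)
                (λ j j′ _ _ eq → Π-distinct j j′ (same-trans _ _ _ (proj₂ (class j)) (same-sym (subst (λ i → SameSpace (repsΠ j′) (reps i)) (sym eq) (proj₂ (class j′))))))))
            (begin
              # (finFin NΩ) zero?
                ≤⟨ ∑-mono (finFin NΩ) hit ⟩
              ∑ (finFin NΩ) (λ i → # (finFin NΠ) (λ j → proj₁ (class j) Finₚ.≟ i))
                ≡⟨ ∑-swap (finFin NΩ) (finFin NΠ) _ ⟩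
              ∑ (finFin NΠ) (λ j → # (finFin NΩ) (λ i → proj₁ (class j) Finₚ.≟ i))
                ≡⟨ ∑-cong (finFin NΠ) (λ j → #-single (finFin NΩ) (λ i → proj₁ (class j) Finₚ.≟ i) (proj₁ (class j)) refl (λ i → sym)) ⟩
              size (finFin NΠ)
                ≡⟨ size-fin NΠ ⟩
              NΠ ∎)
            where
            hit : ∀ i → 𝟙 (zero? i) ≤ # (finFin NΠ) (λ j → proj₁ (class j) Finₚ.≟ i)
            hit i = at (zero? i)
              where
              at : (d : Dec (F (R i) ≡ 0#)) → 𝟙 d ≤ # (finFin NΠ) (λ j → proj₁ (class j) Finₚ.≟ i)
              at (no _)  = z≤n
              at (yes z) = let j , same = Π-complete (reps i) (reps-in i , trans (F≡ (reps i)) z) in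
                n≢0⇒n>0 (#-≢0 (finFin NΠ) (λ j → proj₁ (class j) Finₚ.≟ i) {j}
                  (sym (reps-distinct i (proj₁ (class j)) (same-trans _ _ _ same (proj₂ (class j))))))

    -- The exponent, and the upper bound for decomposable forms

    Δ-sum : Δ ℓ k ≡ sumTo ℓ (λ j → e (suc j))
    Δ-sum = go ℓ
      where
      go : ∀ i → Δ i k ≡ sumTo i (λ j → e (suc j))
      go zero    = refl
      go (suc i) = cong₂ _+_ (go i) (m≤n⇒m⊓n≡m (e≤k (suc i)))

    δ≡Δ : δ α ≡ Δ ℓ k
    δ≡Δ = begin
      Vec.sum (map (λ a → suc (toℕ a)) α) ∸ ((ℓ * suc ℓ) / 2)
        ≡⟨ cong₂ _∸_ (trans (sum-excess k α 0 α-lower) (sumTo-+ ℓ (excess k α 0) suc)) (half-triangle ℓ) ⟩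
      sumTo ℓ (excess k α 0) + sumTo ℓ suc ∸ sumTo ℓ suc
        ≡⟨ m+n∸n≡m _ (sumTo ℓ suc) ⟩
      sumTo ℓ (excess k α 0)
        ≡⟨ sym Δ-sum ⟩
      Δ ℓ k ∎
      where open ≡-Reasoning

    #choices : ∀ r {Q : Fin r → V m → Set} (Q? : ∀ i x → Dec (Q i x)) (f : ℕ → ℕ) → (∀ i → # (finV m) (Q? i) ≤ q ^ f (toℕ i)) →
               # (finM m r) (λ w → Finₚ.all? (λ i → Q? i (lookup w i))) ≤ q ^ sumTo r f
    #choices zero    Q? f h = ≤-trans (∑-mono (finM m 0) (λ w → 𝟙-mono (Finₚ.all? (λ i → Q? i (lookup w i))) (yes tt) (λ _ → tt))) ≤-refl
    #choices (suc r) {Q} Q? f h = begin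
      # (finM m (suc r)) (λ w → Finₚ.all? (λ i → Q? i (lookup w i)))
        ≡⟨ ∑-∷ (finV m) r _ ⟩
      ∑ (finV m) (λ x → ∑ (finM m r) (λ w → 𝟙 (Finₚ.all? (λ i → Q? i (lookup (x ∷ w) i)))))
        ≤⟨ ∑-mono (finV m) (λ x → ∑-mono (finM m r) (λ w → ≤-trans
             (𝟙-mono (Finₚ.all? (λ i → Q? i (lookup (x ∷ w) i))) (Q? Fin.zero x ×-dec Finₚ.all? (λ i → Q? (Fin.suc i) (lookup w i)))
               (λ p → p Fin.zero , λ i → p (Fin.suc i)))
             (≤-reflexive (𝟙-× (Q? Fin.zero x) (Finₚ.all? (λ i → Q? (Fin.suc i) (lookup w i))))))) ⟩
      ∑ (finV m) (λ x → ∑ (finM m r) (λ w → 𝟙 (Q? Fin.zero x) * 𝟙 (Finₚ.all? (λ i → Q? (Fin.suc i) (lookup w i)))))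
        ≡⟨ trans (∑-cong (finV m) (λ x → ∑-*ˡ (finM m r) (𝟙 (Q? Fin.zero x)) _)) (∑-*ʳ (finV m) _ _) ⟩
      # (finV m) (Q? Fin.zero) * # (finM m r) (λ w → Finₚ.all? (λ i → Q? (Fin.suc i) (lookup w i)))
        ≤⟨ *-mono-≤ (h Fin.zero) (#choices r (λ i → Q? (Fin.suc i)) (λ j → f (suc j)) (λ i → h (Fin.suc i))) ⟩
      q ^ f 0 * q ^ sumTo r (λ j → f (suc j))
        ≡⟨ trans (sym (^-distribˡ-+-* q (f 0) _)) (cong (q ^_) (sym (sumTo-front r f))) ⟩
      q ^ sumTo (suc r) f ∎
      where open ≤-Reasoning

    -- The size of the intersection of `W` with the flag is prescribed at corners only, so every
    -- index is referred to the end of its block, where the excess is the same.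
    cornerAbove : ∀ d j → d + j ≡ ℓ → ∃ λ c → j ≤ c × c ≤ ℓ × e c ≡ e j × Corner ℓ c
    cornerAbove zero    j eq = j , ≤-refl , ≤-reflexive eq , refl , inj₁ eq
    cornerAbove (suc d) j eq with e j <? e (suc j)
    ... | yes r = j , ≤-refl , ≤-trans (m≤n+m j (suc d)) (≤-reflexive eq) , refl , inj₂ r
    ... | no ¬r with cornerAbove d (suc j) (trans (+-suc d j) eq)
    ...   | c , j<c , c≤ℓ , ec , corner = c , ≤-trans (n≤1+n j) j<c , c≤ℓ , trans ec (≤-antisym (≮⇒≥ ¬r) (e-step j)) , corner

    flag-≤m : ∀ c → c ≤ ℓ → c + e c ≤ m
    flag-≤m c h = +-mono-≤ h (e≤k c)

    -- The coordinate subspace of `β`, at which `F` is nonzero, serves as origin: the other members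
    -- with F ≠ 0 are described as graphs over it with values in `W`.
    module Upper {F : Vec (V m) ℓ → Carrier} (aF : Alt ℓ F) (W : Vec (V m) k) (κ : Carrier)
                 (agree : ∀ M → Ω ℓ k M → F M ≡ κ *ᶠ det′ (M ++ W))
                 (β : Vec (Fin m) ℓ) (admβ : Adm 0 β) (Fβ : F (map unit β) ≢ 0#)
                 (large : ∀ c → c ≤ ℓ → Corner ℓ c → q ^ e c ≤ card (c + e c) W) where

      complementary : ∀ M → Ω ℓ k M → F M ≢ 0# → Indep (M ++ W)
      complementary M ω ne = injective-rows (alt-minorOn (ℓ + k) id) (M ++ W)
        (λ z → ne (trans (agree M ω) (trans (cong (κ *ᶠ_) z) (R.zeroʳ κ))))

      us : Vec (V m) ℓ
      us = map unit β

      Ω-us : Ω ℓ k us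
      Ω-us = Ω-units k β admβ

      module C₀ = Complementary us W (complementary us Ω-us Fβ)

      -- The subspace spanned by `us` is independent of `W` and already takes up a factor q^c of the
      -- flag step, so at most q^(e c) is left for `W`.
      small : ∀ c → c ≤ ℓ → card (c + e c) W ≤ q ^ e c
      small c c≤ℓ = *-cancelˡ-≤ (q ^ c) {{q^-nonZero c}} (begin
        q ^ c * card (c + e c) W             ≤⟨ *-monoˡ-≤ (card (c + e c) W) (Ω-dims us Ω-us c c≤ℓ) ⟩
        card (c + e c) us * card (c + e c) W ≤⟨ C₀.card-*-≤ (c + e c) (flag-≤m c c≤ℓ) ⟩
        q ^ (c + e c)                        ≡⟨ ^-distribˡ-+-* q c (e c) ⟩
        q ^ c * q ^ e c                      ∎)
        where open ≤-Reasoning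

      corner : ∀ (r : Fin ℓ) → ∃ λ c → suc (toℕ r) ≤ c × c ≤ ℓ × e c ≡ e (suc (toℕ r)) × Corner ℓ c
      corner r = cornerAbove (ℓ ∸ suc (toℕ r)) (suc (toℕ r)) (m∸n+n≡m (Finₚ.toℕ<n r))

      bound : Fin ℓ → ℕ
      bound r = proj₁ (corner r) + e (proj₁ (corner r))

      Fits : Vec (V m) ℓ → Set
      Fits w = ∀ r → Span W (lookup w r) × Low (bound r) (lookup w r)

      fits? : ∀ w → Dec (Fits w)
      fits? w = Finₚ.all? (λ r → spanLow? W (bound r) (lookup w r))

      #fits : # (finM m ℓ) fits? ≤ q ^ Δ ℓ k
      #fits = ≤-trans (#choices ℓ (λ r → spanLow? W (bound r)) (λ j → e (suc j)) (λ r →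
          ≤-trans (≤-reflexive (#spanLow W C₀.indepʳ (bound r))) (≤-trans (small (proj₁ (corner r)) (proj₁ (proj₂ (proj₂ (corner r)))))
            (≤-reflexive (cong (q ^_) (proj₁ (proj₂ (proj₂ (proj₂ (corner r)))))))))) (≤-reflexive (cong (q ^_) (sym Δ-sum)))

      low-β : ∀ r → Low (suc (toℕ r) + e (suc (toℕ r))) (lookup us r)
      low-β r = subst (Low _) (sym (Vecₚ.lookup-map r unit β)) (low-unit (lookup β r)
        (≤-trans (s≤s (adm⇒≼ β admβ r)) (≤-reflexive (sym (flag-α r)))))

      -- Every L with F(L) ≠ 0 is a complement of W, hence contains a unique vector of e_{β_r} + W
      -- for each r, and that vector differs from e_{β_r} by an element of the flag.
      module Graph (M : Vec (V m) ℓ) (ω : Ω ℓ k M) (ne : F M ≢ 0#) where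
        module C = Complementary M W (complementary M ω ne)

        piece : ∀ r → ∃ λ w → (Span W w × Low (bound r) w) × Span M (lookup us r ⊕ w)
        piece r = let c , r<c , c≤ℓ , ec , cc = corner r
                      -- L fills at least q^c and W at least q^(e c) of this flag step, which has
                      -- q^(c + e c) elements. So the unit vector of β_r, lying in the step, splits
                      -- with its component in W still in the step.
                      a , d , ld , eq = C.low-sum (c + e c) (flag-≤m c c≤ℓ)
                        (≤-trans (≤-reflexive (^-distribˡ-+-* q c (e c))) (*-mono-≤ (Ω-dims M ω c c≤ℓ) (large c c≤ℓ cc)))
                        (lookup us r) (low-mono (flag-mono r<c) (lookup us r) (low-β r))
                  in ⊖ (d ∙ W) , ((⊖ d , scale (lin-∙ˡ W) (-ᶠ 1#) d) , has-⊙ (low-sub (c + e c)) (-ᶠ 1#) {d ∙ W} ld) ,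
                     (a , sym (trans (cong (_⊕ ⊖ (d ∙ W)) (sym eq)) (⊕-⊖ (a ∙ M) (d ∙ W))))

        w : Vec (V m) ℓ
        w = tabulate (λ r → proj₁ (piece r))

        w-fits : Fits w
        w-fits r = subst (λ z → Span W z × Low (bound r) z) (sym (Vecₚ.lookup∘tabulate _ r)) (proj₁ (proj₂ (piece r)))

        graph : Vec (V m) ℓ
        graph = us ⊕ w

        graph-in-M : ∀ r → Span M (lookup graph r)
        graph-in-M r = subst (Span M) (sym (trans (Vecₚ.lookup-zipWith _⊕_ r us w) (cong (lookup us r ⊕_) (Vecₚ.lookup∘tabulate _ r))))
          (proj₂ (proj₂ (piece r)))

        graph-indep : Indep graph
        graph-indep c e₀ = let d , eq = sub-∙ (span-sub W) c w (λ r → proj₁ (w-fits r)) in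
          proj₁ (++-𝟘 c d (complementary us Ω-us Fβ (c ++ d) (trans (∙-++ c d us W) (trans (cong (c ∙ us ⊕_) eq) (trans (sym (add (lin-∙ʳ c) us w)) e₀)))))

        M-rowsIn : ∃ λ P → map (_∙ graph) P ≡ M
        M-rowsIn = let A , eq = span-rows M graph graph-in-M in
          span-rows graph M (λ r → subst (λ z → Span z (lookup M r)) eq (span-rowsIn M A (subst Indep (sym eq) graph-indep) (lookup M r) (span-row M r)))

      #bases-≤ : ∀ R → # (finM m ℓ) (λ M → rowsIn? R M ×-dec nonzero? (F M)) ≤ gl ℓ
      #bases-≤ R = at (nonzero? (F R))
        where
        at : Dec (F R ≢ 0#) → # (finM m ℓ) (λ M → rowsIn? R M ×-dec nonzero? (F M)) ≤ gl ℓ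
        at (yes ne) = ≤-reflexive (#bases aF R ne)
        at (no ¬ne) = ≤-trans (≤-reflexive (∑-zero (finM m ℓ) _ (λ M → 𝟙-no (rowsIn? R M ×-dec nonzero? (F M))
          (λ { ((P , refl) , ne) → ¬ne (alt-nonzero aF R P ne) })))) z≤n

      T-≤ : T ℓ k F ≤ gl ℓ * q ^ Δ ℓ k
      T-≤ = begin
        T ℓ k F
          ≤⟨ ∑-mono (finM m ℓ) (λ M → ≤-trans (≤-reflexive (sym (𝟙-× (Ω? ℓ k M) (nonzero? (F M))))) (at M (Ω? ℓ k M ×-dec nonzero? (F M)))) ⟩
        ∑ (finM m ℓ) (λ M → ∑ (finM m ℓ) (λ w → 𝟙 (fits? w) * 𝟙 (rowsIn? (us ⊕ w) M ×-dec nonzero? (F M))))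
          ≡⟨ ∑-swap (finM m ℓ) (finM m ℓ) _ ⟩
        ∑ (finM m ℓ) (λ w → ∑ (finM m ℓ) (λ M → 𝟙 (fits? w) * 𝟙 (rowsIn? (us ⊕ w) M ×-dec nonzero? (F M))))
          ≡⟨ ∑-cong (finM m ℓ) (λ w → ∑-*ˡ (finM m ℓ) (𝟙 (fits? w)) _) ⟩
        ∑ (finM m ℓ) (λ w → 𝟙 (fits? w) * # (finM m ℓ) (λ M → rowsIn? (us ⊕ w) M ×-dec nonzero? (F M)))
          ≤⟨ ∑-mono (finM m ℓ) (λ w → *-monoʳ-≤ (𝟙 (fits? w)) (#bases-≤ (us ⊕ w))) ⟩
        ∑ (finM m ℓ) (λ w → 𝟙 (fits? w) * gl ℓ)
          ≡⟨ ∑-*ʳ (finM m ℓ) (gl ℓ) _ ⟩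
        # (finM m ℓ) fits? * gl ℓ
          ≤⟨ *-monoˡ-≤ (gl ℓ) #fits ⟩
        q ^ Δ ℓ k * gl ℓ
          ≡⟨ *-comm (q ^ Δ ℓ k) (gl ℓ) ⟩
        gl ℓ * q ^ Δ ℓ k ∎
        where
        open ≤-Reasoning
        at : ∀ M → (d : Dec (Ω ℓ k M × F M ≢ 0#)) → 𝟙 d ≤ ∑ (finM m ℓ) (λ w → 𝟙 (fits? w) * 𝟙 (rowsIn? (us ⊕ w) M ×-dec nonzero? (F M)))
        at M (no _)         = z≤n
        at M (yes (ω , ne)) = ≤-trans
          (≤-reflexive (sym (cong₂ _*_ (𝟙-yes (fits? G.w) G.w-fits) (𝟙-yes (rowsIn? G.graph M ×-dec nonzero? (F M)) (G.M-rowsIn , ne)))))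
          (∑-≥ (finM m ℓ) G.w (λ w → 𝟙 (fits? w) * 𝟙 (rowsIn? (us ⊕ w) M ×-dec nonzero? (F M))))
          where module G = Graph M ω ne

    -- Schubert decomposability in coordinates

    open Over K public using (Dim; SchubertDecomposable; HyperplaneSchubertDecomposable)

    corner-gap : ∀ (j j′ : Fin ℓ) → toℕ j′ ≡ suc (toℕ j) → 2 + toℕ (lookup α j) ≤ toℕ (lookup α j′) → e (suc (toℕ j)) < e (suc (suc (toℕ j)))
    corner-gap j j′ eq gap = +-cancelˡ-≤ (suc (suc (toℕ j))) _ _ (begin
      suc (suc (toℕ j)) + suc (e (suc (toℕ j)))   ≡⟨ cong suc (+-suc (suc (toℕ j)) _) ⟩
      suc (suc (suc (toℕ j) + e (suc (toℕ j))))   ≡⟨ cong (λ z → suc (suc z)) (flag-α j) ⟩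
      suc (suc (suc (toℕ (lookup α j))))          ≤⟨ s≤s gap ⟩
      suc (toℕ (lookup α j′))                     ≡⟨ trans (sym (flag-α j′)) (cong (λ z → suc z + e (suc z)) eq) ⟩
      suc (suc (toℕ j)) + e (suc (suc (toℕ j)))   ∎)
      where open ≤-Reasoning

    gap-corner : ∀ (j j′ : Fin ℓ) → toℕ j′ ≡ suc (toℕ j) → e (suc (toℕ j)) < e (suc (suc (toℕ j))) → 2 + toℕ (lookup α j) ≤ toℕ (lookup α j′)
    gap-corner j j′ eq lt = ≤-pred (begin
      suc (suc (suc (toℕ (lookup α j))))          ≡⟨ cong (λ z → suc (suc z)) (sym (flag-α j)) ⟩
      suc (suc (suc (toℕ j) + e (suc (toℕ j))))   ≡⟨ cong suc (sym (+-suc (suc (toℕ j)) _)) ⟩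
      suc (suc (toℕ j)) + suc (e (suc (toℕ j)))   ≤⟨ +-monoʳ-≤ (suc (suc (toℕ j))) lt ⟩
      suc (suc (toℕ j)) + e (suc (suc (toℕ j)))   ≡⟨ trans (sym (cong (λ z → suc z + e (suc z)) eq)) (flag-α j′) ⟩
      suc (toℕ (lookup α j′))                     ∎)
      where open ≤-Reasoning

    excess-gap : ∀ (j : Fin ℓ) → suc (toℕ (lookup α j)) ∸ suc (toℕ j) ≡ e (suc (toℕ j))
    excess-gap j = trans (cong (_∸ suc (toℕ j)) (sym (flag-α j))) (m+n∸m≡n (suc (toℕ j)) _)

    -- Decomposability with the number of vectors as a parameter κ, to be compared at κ = k and κ = m ∸ ℓ.
    Represented : ℕ → (Vec (Fin m) ℓ → Carrier) → Set
    Represented κ c′ = ∃ λ (W : Matrix κ m) →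
      (∀ (β : Vec (Fin m) ℓ) (γ : Vec (Fin m) κ) → Inc β → Inc γ → Disjoint β γ → c′ β ≡ minor W γ) ×
      (∀ (j j′ : Fin ℓ) → toℕ j′ ≡ suc (toℕ j) → 2 + toℕ (lookup α j) ≤ toℕ (lookup α j′) →
        Dim (λ x → Inᵥ W x × InV (suc (toℕ (lookup α j))) x) (suc (toℕ (lookup α j)) ∸ suc (toℕ j)))

    module Linear-form (c : Vec (Fin m) ℓ → Carrier) (c0 : ∀ β → ¬ (β ∈∇ α) → c β ≡ 0#)
                       (β₀ : Vec (Fin m) ℓ) (cβ₀ : c β₀ ≢ 0#) where

      inc? : ∀ (β : Vec (Fin m) ℓ) → Dec (Inc β)
      inc? β = Finₚ.all? (λ i → Finₚ.all? (λ j → (toℕ i <? toℕ j) →-dec (toℕ (lookup β i) <? toℕ (lookup β j))))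

      ∈∇? : ∀ β → Dec (β ∈∇ α)
      ∈∇? β = inc? β ×-dec Finₚ.all? (λ i → toℕ (lookup β i) ≤? toℕ (lookup α i))

      β₀∈∇ : β₀ ∈∇ α
      β₀∈∇ = decidable-stable (∈∇? β₀) (λ ¬p → cβ₀ (c0 β₀ ¬p))

      F : Vec (V m) ℓ → Carrier
      F = form c

      aF : Alt ℓ F
      aF = alt-form c

      F-unit : ∀ β → Inc β → F (map unit β) ≡ c β
      F-unit β = form-unit c (λ β ¬inc → c0 β (λ p → ¬inc (proj₁ p))) inc? β

      Fβ₀ : F (map unit β₀) ≢ 0#
      Fβ₀ z = cβ₀ (trans (sym (F-unit β₀ (proj₁ β₀∈∇))) z)

      admβ₀ : Adm 0 β₀
      admβ₀ = ≼⇒adm β₀ (proj₂ β₀∈∇)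

      T≢0 : T ℓ k F ≢ 0
      T≢0 = T-≢0 {F = F} (map unit β₀) (Ω-units k β₀ admβ₀) Fβ₀

      minor-toVec : ∀ {κ} (W : Matrix κ m) γ → minor W γ ≡ minorOn κ (lookup γ) (toVec W)
      minor-toVec {κ} W γ = det-cong κ (λ i j → sym (lookup-toVec W i (lookup γ j)))

      twisted : ∀ (c′ : Vec (Fin m) ℓ → Carrier) (W̃ : Matrix k m) → (∀ (β : Vec (Fin m) ℓ) (γ : Vec (Fin m) k) → Inc β → Inc γ → Disjoint β γ → c′ β ≡ minor W̃ γ) →
                ∀ β → Inc β → c′ β ≡ twistCst ℓ k *ᶠ det′ (map unit β ++ map twist (toVec W̃))
      twisted c′ W̃ rep β inc = let γ , incγ , disj = complement ℓ β inc in
        trans (rep β γ inc incγ disj) (trans (minor-toVec W̃ γ) (trans (cong (minorOn k (lookup γ)) (sym (map-twist-involutive (toVec W̃))))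
          (laplace-twist ℓ β γ inc incγ disj (map twist (toVec W̃)))))

      det≢0 : ∀ {x y} → x ≢ 0# → x ≡ twistCst ℓ k *ᶠ y → y ≢ 0#
      det≢0 ne eq z = ne (trans eq (trans (cong (twistCst ℓ k *ᶠ_) z) (R.zeroʳ _)))

      -- The coefficients `c′` agree with `c` on ∇(α) only. The difference `D` of the two forms thus
      -- vanishes at the coordinate members of Ω, and `unit-witness` extends this to all of Ω, where
      -- `Upper` applies.
      attained : e ℓ ≡ k → ∀ c′ → (∀ β → β ∈∇ α → c′ β ≡ c β) → (∃ λ β → Inc β × c′ β ≢ 0#) → Represented k c′ → T ℓ k F ≤ gl ℓ * q ^ Δ ℓ k
      attained eℓ c′ c′≡c (β₁ , inc₁ , c′β₁) (W̃ , rep , dims) = Upper.T-≤ aF W (twistCst ℓ k) agree β₀ admβ₀ Fβ₀ large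
        where
        Ŵ = toVec W̃
        W = map twist Ŵ
        basis : det′ (map unit β₁ ++ W) ≢ 0#
        basis = det≢0 c′β₁ (twisted c′ W̃ rep β₁ inc₁)
        indepW : Indep W
        indepW = Complementary.indepʳ (map unit β₁) W (injective-rows (alt-minorOn (ℓ + k) id) (map unit β₁ ++ W) basis)
        indepŴ : Indep Ŵ
        indepŴ d eq = indepW d (trans (sym (∙-map lin-twist d Ŵ)) (trans (cong twist eq) (zero-map lin-twist)))
        D : Vec (V m) ℓ → Carrier
        D M = F M +ᶠ ⊖ (twistCst ℓ k *ᶠ det′ (M ++ W))
        aD : Alt ℓ D
        aD = alt-sub aF (alt-⊙ (twistCst ℓ k) (alt-++ ℓ {F = det′} W (alt-minorOn (ℓ + k) id)))
        T-D : T ℓ k D ≡ 0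
        T-D with T ℓ k D ≟ⁿ 0
        ... | yes z = z
        ... | no nz = let β , inc , adm , ne = unit-witness m ℓ k refl aD nz in
          contradiction (trans (cong (_+ᶠ ⊖ (twistCst ℓ k *ᶠ det′ (map unit β ++ W)))
            (trans (F-unit β inc) (trans (sym (c′≡c β (inc , adm⇒≼ β adm))) (twisted c′ W̃ rep β inc)))) (⊖-inverse _)) ne
        agree : ∀ M → Ω ℓ k M → F M ≡ twistCst ℓ k *ᶠ det′ (M ++ W)
        agree M ω = ⊖-≡ _ _ (T-vanish {F = D} T-D M ω)
        full : ∀ b → m ≤ b → q ^ k ≤ card b W
        full b h = ≤-reflexive (sym (trans (#-all (finV k) (λ c → low? b (c ∙ W)) (λ c → low-full h (c ∙ W))) (size-V k)))
        large : ∀ c → c ≤ ℓ → Corner ℓ c → q ^ e c ≤ card (c + e c) W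
        large c c≤ℓ (inj₁ refl) = subst (λ z → q ^ z ≤ card (c + e c) W) (sym eℓ) (full (c + e c) (≤-reflexive (cong (c +_) (sym eℓ))))
        large zero    c≤ℓ (inj₂ _) = card≥1 0 W
        -- At an inner corner α has a gap, which is where decomposability prescribes a dimension.
        -- The count is made for `Ŵ` and carried to its twist by `card-twist`.
        large (suc c) c<ℓ (inj₂ step) with suc c ≟ⁿ ℓ
        ... | yes refl = large (suc c) c<ℓ (inj₁ refl)
        ... | no c≢ℓ = ≤-trans (subst₂ (λ x y → q ^ x ≤ card y Ŵ) (trans (excess-gap j) (cong (λ z → e (suc z)) toℕ-j))
                          (trans (sym (flag-α j)) (cong (λ z → suc z + e (suc z)) toℕ-j))
                          (≤-trans (hasIndep⇒# {S = λ x → Inᵥ W̃ x × InV b x} (spanLow? Ŵ b) (spanLow-sub Ŵ b)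
                            (λ x (v , l) → Inᵥ⇒span ℓ β₁ inc₁ W̃ basis x v , inV⇒low b x l)
                            (proj₁ (dims j j′ (trans toℕ-j′ (cong suc (sym toℕ-j)))
                              (gap-corner j j′ (trans toℕ-j′ (cong suc (sym toℕ-j))) (subst (λ z → e (suc z) < e (suc (suc z))) (sym toℕ-j) step)))))
                            (≤-reflexive (#spanLow Ŵ indepŴ b))))
                        (card-twist _ Ŵ)
          where
          j = Fin.fromℕ< c<ℓ
          j′ = Fin.fromℕ< (≤∧≢⇒< c<ℓ c≢ℓ)
          toℕ-j : toℕ j ≡ c
          toℕ-j = Finₚ.toℕ-fromℕ< c<ℓ
          toℕ-j′ : toℕ j′ ≡ suc c
          toℕ-j′ = Finₚ.toℕ-fromℕ< (≤∧≢⇒< c<ℓ c≢ℓ)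
          b = suc (toℕ (lookup α j))

      -- `c′` takes the values of the contraction at all coordinate subspaces, also those outside Ω;
      -- on ∇(α) these are the given coefficients. Twisting `W` makes these values the coordinates
      -- of a wedge product.
      represented : ∀ {k′} → k ≡ suc k′ → Decomposable ℓ k F →
                    ∃ λ c′ → (∀ β → β ∈∇ α → c′ β ≡ c β) × (∃ λ β → Inc β × c′ β ≢ 0#) × Represented k c′
      represented k≡ (W , τ , aτ , agree , corners) = c′ , c′≡c , (β₀ , proj₁ β₀∈∇ , c′β₀) , W̃ , rep , dims
        where
        -- The scalar relating `τ` to the determinant times the constant of `laplace-twist`. It is
        -- absorbed by rescaling the first vector, which exists because `k≡` makes `k` positive.
        s = τ (idM (ℓ + k)) *ᶠ twistCst ℓ k
        scaleHead : ∀ {κ} → Carrier → Vec (V m) κ → Vec (V m) κ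
        scaleHead s []       = []
        scaleHead s (x ∷ xs) = s ⊙ x ∷ xs
        minor-scaleHead : ∀ {κ} → κ ≢ 0 → ∀ s (f : Fin κ → Fin m) N → minorOn κ f (scaleHead s N) ≡ s *ᶠ minorOn κ f N
        minor-scaleHead ne s f []       = contradiction refl ne
        minor-scaleHead ne s f (x ∷ xs) = scale (alt-lin (alt-minorOn _ f) xs) s x
        low-scaleHead : ∀ {κ} b s (N : Vec (V m) κ) i → Low b (lookup N i) → Low b (lookup (scaleHead s N) i)
        low-scaleHead b s (x ∷ xs) Fin.zero    l = has-⊙ (low-sub b) s {x} l
        low-scaleHead b s (x ∷ xs) (Fin.suc i) l = l
        Ŵ = scaleHead s (map twist W)
        W̃ : Matrix k m
        W̃ = fromVec Ŵ
        c′ : Vec (Fin m) ℓ → Carrier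
        c′ β = τ (map unit β ++ W)
        c′≡c : ∀ β → β ∈∇ α → c′ β ≡ c β
        c′≡c β (inc , le) = trans (sym (agree (map unit β) (Ω-units k β (≼⇒adm β le)))) (F-unit β inc)
        c′β₀ : c′ β₀ ≢ 0#
        c′β₀ z = cβ₀ (trans (sym (c′≡c β₀ β₀∈∇)) z)
        rep : ∀ (β : Vec (Fin m) ℓ) (γ : Vec (Fin m) k) → Inc β → Inc γ → Disjoint β γ → c′ β ≡ minor W̃ γ
        rep β γ incβ incγ disj = sym (begin
          minorOn k (lookup γ) Ŵ
            ≡⟨ minor-scaleHead (λ z → contradiction (trans (sym k≡) z) λ ()) s (lookup γ) (map twist W) ⟩
          s *ᶠ minorOn k (lookup γ) (map twist W)
            ≡⟨ cong (s *ᶠ_) (laplace-twist ℓ β γ incβ incγ disj W) ⟩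
          (τ (idM (ℓ + k)) *ᶠ twistCst ℓ k) *ᶠ (twistCst ℓ k *ᶠ det′ (map unit β ++ W))
            ≡⟨ trans (R.*-assoc _ _ _) (cong (τ (idM (ℓ + k)) *ᶠ_) (⊙-inverse _ (twistCst-square ℓ k))) ⟩
          τ (idM (ℓ + k)) *ᶠ det′ (map unit β ++ W)
            ≡⟨ sym (topForm aτ (map unit β ++ W)) ⟩
          c′ β ∎)
          where open ≡-Reasoning
        basis : det′ (map unit β₀ ++ map twist (toVec W̃)) ≢ 0#
        basis = det≢0 c′β₀ (twisted c′ W̃ rep β₀ (proj₁ β₀∈∇))
        module C = Complementary (map unit β₀) (map twist (toVec W̃)) (injective-rows (alt-minorOn (ℓ + k) id) (map unit β₀ ++ map twist (toVec W̃)) basis)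
        indepŴ : Indep (toVec W̃)
        indepŴ d eq = C.indepʳ d (trans (sym (∙-map lin-twist d (toVec W̃))) (trans (cong twist eq) (zero-map lin-twist)))
        dims : ∀ (j j′ : Fin ℓ) → toℕ j′ ≡ suc (toℕ j) → 2 + toℕ (lookup α j) ≤ toℕ (lookup α j′) →
          Dim (λ x → Inᵥ W̃ x × InV (suc (toℕ (lookup α j))) x) (suc (toℕ (lookup α j)) ∸ suc (toℕ j))
        dims j j′ eq gap = subst (Dim (λ x → Inᵥ W̃ x × InV b x)) (sym (excess-gap j)) (lower , upper)
          where
          open ≤-Reasoning
          j⁺ = suc (toℕ j)
          b = suc (toℕ (lookup α j))
          ej<k : e j⁺ < k
          ej<k = <-≤-trans (corner-gap j j′ eq gap) (e≤k (suc j⁺))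
          -- `Decomposable` constrains the last `e j⁺` of the `k` vectors, those of index at least
          -- `k ∸ e j⁺`. Neither the twist nor the rescaling moves a vector out of a flag step.
          row-low : ∀ i → k ∸ e j⁺ ≤ toℕ i → Low b (lookup (toVec W̃) i)
          row-low i h = subst (λ z → Low b (lookup z i)) (sym (toVec-fromVec Ŵ)) (low-scaleHead b s (map twist W) i
            (subst (Low b) (sym (Vecₚ.lookup-map i twist W)) (low-twist b (lookup W i)
              (subst (λ z → Low z (lookup W i)) (flag-α j) (corners j⁺ (Finₚ.toℕ<n j) ej<k (inj₂ (corner-gap j j′ eq gap)) i
                (≤-trans (≤-reflexive (sym (m∸n+n≡m (e≤k j⁺)))) (+-monoˡ-≤ (e j⁺) h)))))))
          lower : HasIndep (λ x → Inᵥ W̃ x × InV b x) (e j⁺)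
          lower = #⇒hasIndep {S = λ x → Inᵥ W̃ x × InV b x} (spanLow? (toVec W̃) b)
            (λ x (sp , l) → span⇒Inᵥ W̃ (lookup x) (subst (Span (toVec W̃)) (sym (Vecₚ.tabulate∘lookup x)) sp) , low⇒lookup b x l) (begin
            q ^ e j⁺                              ≡⟨ cong (q ^_) (sym (m∸[m∸n]≡n (e≤k j⁺))) ⟩
            q ^ (k ∸ (k ∸ e j⁺))                  ≡⟨ sym (#High {k} (k ∸ e j⁺)) ⟩
            # (finV k) (high? (k ∸ e j⁺))         ≤⟨ #-mono (finV k) _ _ (λ d hd → high-combination (low-sub b) (k ∸ e j⁺) d (toVec W̃) hd row-low) ⟩
            card b (toVec W̃)                     ≡⟨ sym (#spanLow (toVec W̃) indepŴ b) ⟩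
            # (finV m) (spanLow? (toVec W̃) b)    ∎)
          -- `map unit β₀` spans a complement of the twisted rows and takes up at least q^(j⁺) of
          -- the flag step of dimension j⁺ + e j⁺; one dimension more for the rows would exceed the
          -- product bound `C.card-*-≤`.
          upper : ¬ HasIndep (λ x → Inᵥ W̃ x × InV b x) (suc (e j⁺))
          upper hi = contradiction (q^-strict (n<1+n (e j⁺))) (≤⇒≯ (*-cancelˡ-≤ (q ^ j⁺) {{q^-nonZero j⁺}} (begin
            q ^ j⁺ * q ^ suc (e j⁺)
              ≤⟨ *-mono-≤ (Ω-dims (map unit β₀) (Ω-units k β₀ admβ₀) j⁺ (Finₚ.toℕ<n j))
                   (≤-trans (hasIndep⇒# {S = λ x → Inᵥ W̃ x × InV b x} (spanLow? (toVec W̃) b) (spanLow-sub (toVec W̃) b)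
                     (λ x (v , l) → Inᵥ⇒span ℓ β₀ (proj₁ β₀∈∇) W̃ basis x v , inV⇒low b x l) hi)
                   (≤-trans (≤-reflexive (trans (#spanLow (toVec W̃) indepŴ b) (cong (λ z → card z (toVec W̃)) (sym (flag-α j))))) (card-twist (j⁺ + e j⁺) (toVec W̃)))) ⟩
            card (j⁺ + e j⁺) (map unit β₀) * card (j⁺ + e j⁺) (map twist (toVec W̃))
              ≤⟨ C.card-*-≤ (j⁺ + e j⁺) (flag-≤m j⁺ (Finₚ.toℕ<n j)) ⟩
            q ^ (j⁺ + e j⁺)
              ≡⟨ ^-distribˡ-+-* q j⁺ (e j⁺) ⟩
            q ^ j⁺ * q ^ e j⁺ ∎)))

      Represented-∸ : ∀ c′ → Represented k c′ ⇔ Represented (m ∸ ℓ) c′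
      Represented-∸ c′ = mk⇔ (subst (λ κ → Represented κ c′) (sym (m+n∸m≡n ℓ k))) (subst (λ κ → Represented κ c′) (m+n∸m≡n ℓ k))

      module _ {k′} (k≡ : k ≡ suc k′) (eℓ : e ℓ ≡ k) (NΩ NΠ : ℕ)
               (countΩ : CountClasses (InΩ α) SameSpace NΩ) (countΠ : CountClasses (λ M → InΩ α M × OnΠ c M) SameSpace NΠ) where

        open Classes aF NΩ (proj₁ countΩ) (proj₁ (proj₂ countΩ)) (proj₁ (proj₂ (proj₂ countΩ))) (proj₂ (proj₂ (proj₂ countΩ))) using (N; T-classes; NΩ-split)

        split : NΠ + N ≡ NΩ
        split = NΩ-split c (formVal-toVec c) NΠ countΠ

        gl-nonZero : ℕ.NonZero (gl ℓ)
        gl-nonZero = ℕ.≢-nonZero (gl-pos ℓ)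

        bound : Bounded ℓ k F
        bound = bounded m ℓ k refl aF T≢0

        N-≥ : q ^ Δ ℓ k ≤ N
        N-≥ = *-cancelˡ-≤ (gl ℓ) {{gl-nonZero}} (≤-trans (proj₁ bound) (≤-reflexive T-classes))

        result : (NΠ + q ^ δ α ≤ NΩ) × ((NΠ + q ^ δ α ≡ NΩ) ⇔ HyperplaneSchubertDecomposable α c)
        result = subst (λ d → (NΠ + q ^ d ≤ NΩ) × ((NΠ + q ^ d ≡ NΩ) ⇔ HyperplaneSchubertDecomposable α c)) (sym δ≡Δ)
          ( ≤-trans (+-monoʳ-≤ NΠ N-≥) (≤-reflexive split)
          , mk⇔ to from )
          where
          to : NΠ + q ^ Δ ℓ k ≡ NΩ → HyperplaneSchubertDecomposable α c
          to eq = let c′ , c′≡c , nz , rep = represented k≡ (proj₂ bound (trans T-classes (cong (gl ℓ *_) (+-cancelˡ-≡ NΠ _ _ (trans split (sym eq))))))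
                  in c′ , c′≡c , nz , Equivalence.to (Represented-∸ c′) rep
          from : HyperplaneSchubertDecomposable α c → NΠ + q ^ Δ ℓ k ≡ NΩ
          from (c′ , c′≡c , nz , rep) = trans (cong (NΠ +_) (≤-antisym N-≥
            (*-cancelˡ-≤ (gl ℓ) {{gl-nonZero}} (≤-trans (≤-reflexive (sym T-classes)) (attained eℓ c′ c′≡c nz (Equivalence.from (Represented-∸ c′) rep)))))) split

-- Specialisation to a field in bijection with `Fin q`

theorem4p7 : (q ℓ m : ℕ) → IsPrimePower q → AboveQ₀ ℓ q → 2 ≤ ℓ → ℓ < m →
    (K : Field) → Fin q ↔ Field.Carrier K →
    (α : Vec (Fin m) ℓ) → Inc α →
    (∀ (i : Fin ℓ) → toℕ i ≡ ℓ ∸ 1 → suc (toℕ (lookup α i)) ≡ m) →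
    (c : Vec (Fin m) ℓ → Field.Carrier K) →
    (∀ β → ¬ (β ∈∇ α) → c β ≡ Field.0# K) →
    (∃ λ β → c β ≢ Field.0# K) →
    (NΩ NΠ : ℕ) →
    CountClasses (Over.InΩ K α) (Over.SameSpace K) NΩ →
    CountClasses (λ M → Over.InΩ K α M × Over.OnΠ K c M) (Over.SameSpace K) NΠ →
    (NΠ + q ^ δ α ≤ NΩ) × ((NΠ + q ^ δ α ≡ NΩ) ⇔ Over.HyperplaneSchubertDecomposable K α c)
-- Writing `m` as `suc ℓ + k` makes the codimension available for pattern matching, and `ℓ < m`
-- excludes codimension zero.
theorem4p7 q (suc ℓ) m _ _ _ ℓ<m K iso α incα last c c0 (β₀ , cβ₀) NΩ NΠ countΩ countΠ = go (m ∸ suc ℓ) (m+[n∸m]≡n (<⇒≤ ℓ<m)) α incα last c c0 β₀ cβ₀ countΩ countΠ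
  where
  open Inverse iso
  finK : Finite (Field.Carrier K)
  finK = fin↔ (finFin q) to from strictlyInverseˡ strictlyInverseʳ
  size-K : size finK ≡ q
  size-K = trans (∑ˡ-map to (Finite.elems (finFin q)) (λ _ → 1)) (size-fin q)
  go : ∀ k → suc ℓ + k ≡ m → (α : Vec (Fin m) (suc ℓ)) → Inc α →
       (∀ i → toℕ i ≡ ℓ → suc (toℕ (lookup α i)) ≡ m) →
       (c : Vec (Fin m) (suc ℓ) → Field.Carrier K) → (∀ β → ¬ (β ∈∇ α) → c β ≡ Field.0# K) → ∀ β₀ → c β₀ ≢ Field.0# K →
       CountClasses (Over.InΩ K α) (Over.SameSpace K) NΩ →
       CountClasses (λ M → Over.InΩ K α M × Over.OnΠ K c M) (Over.SameSpace K) NΠ →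
       (NΠ + q ^ δ α ≤ NΩ) × ((NΠ + q ^ δ α ≡ NΩ) ⇔ Over.HyperplaneSchubertDecomposable K α c)
  go zero    refl = contradiction (≤-reflexive (cong suc (+-identityʳ ℓ))) (<⇒≱ ℓ<m)
  go (suc k) refl α incα last c c0 β₀ cβ₀ countΩ countΠ =
    subst (λ z → (NΠ + z ^ δ α ≤ NΩ) × ((NΠ + z ^ δ α ≡ NΩ) ⇔ Over.HyperplaneSchubertDecomposable K α c)) size-K
      (result refl e-last NΩ NΠ countΩ countΠ)
    where
    open FiniteField K finK
    open Schubert (suc ℓ) (suc k) α incα
    open Linear-form c c0 β₀ cβ₀
    -- In terms of excesses the hypothesis on the last entry of α says that the last excess is the
    -- full codimension; `attained` uses this at the corner that ends the last block.
    e-last : e (suc ℓ) ≡ suc k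
    e-last = +-cancelˡ-≡ (suc ℓ) _ _ (trans (cong (λ z → suc z + e (suc z)) (sym (Finₚ.toℕ-fromℕ ℓ)))
      (trans (flag-α (Fin.fromℕ ℓ)) (last (Fin.fromℕ ℓ) (Finₚ.toℕ-fromℕ ℓ))))
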